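{- Assume the explicit abc conjecture. Let $s,t$ be integers with $2<s<t$ and let $c>0$ be a fixed positive integer. Then for every set $\{i_2,\dots,i_s\}$ of $s-1$ distinct elements of $\{2,\dots,t\}$, the set $\mathcal{N}(c)_{\{i_2,\dots,i_s\}}$ is finite. Consequently the set $\mathcal{N}(c)=\bigcup_{\{i_2,\dots,i_s\}}\mathcal{N}(c)_{\{i_2,\dots,i_s\}}$ (union over all $(s-1)$-element subsets of $\{2,\dots,t\}$) is finite, i.e. the equation $\prod_{i=1}^t a_i!=\prod_{j=1}^s n_j!$ has only finitely many solutions $(a_1,\dots,a_t,n_1,\dots,n_s)\in\mathcal{N}(c)$.
   Context: Explicit abc conjecture: whenever $x,y,z$ are coprime nonzero integers with $x+y=z$, one has $z<N(xyz)^{7/4}$, where for a nonzero integer $a$, $N(a)=\prod_{p\mid a}p$ is the product of the distinct primes dividing $a$. Setting: consider integer tuples $(a_1,\dots,a_t,n_1,\dots,n_s)$ with $a_1\geq\cdots\geq a_t\geq 2$, $n_1\geq\cdots\geq n_s\geq 2$, $a_i\neq n_j$ for all $i,j$, satisfying $\prod_{i=1}^t a_i!=\prod_{j=1}^s n_j!$. Such a solution is trivial if there is a pair $(i,j)$ with $|a_i-n_j|=1$, and nontrivial otherwise. For an $(s-1)$-element subset $\{i_2,\dots,i_s\}\subset\{2,\dots,t\}$, put $k_1=n_1-a_1$, $k_j=n_j-a_{i_j}$ for $j=2,\dots,s$, and $k=\max\{k_2,\dots,k_s\}$. Define $\mathcal{N}(c)_{\{i_2,\dots,i_s\}}$ to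 be the set of nontrivial solutions with $n_1>a_1$, $n_j>a_{i_j}$ for $j=2,\dots,s$, and $k/k_1\leq c$. -}

module Defs where

open import Data.Nat using (ℕ; zero; suc; _+_; _*_; _^_; _≤_; _<_; _!)
open import Data.Nat.Primality using (Prime; prime?)
open import Data.Nat.Divisibility using (_∣_; _∣?_)
open import Data.Integer as ℤ using (ℤ; ∣_∣)
open import Data.Integer.Coprimality using (Coprime)
open import Data.Fin using (Fin; zero; suc; toℕ)
open import Data.Vec using (Vec; lookup; foldr; map)
open import Data.List using (List; filter; upTo)
open import Data.Nat.ListAction using (product)
open import Data.List.Membership.Propositional using (_∈_)
open import Data.Product using (Σ; ∃; _×_; _,_)
open import Relation.Nullary using (¬_)
open import Relation.Nullary.Decidable using (_×-dec_)
open import Relation.Binary.PropositionalEquality using (_≡_; _≢_)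
open import Function.Definitions using (Injective)

-- Radical of a natural number m ≥ 1: product of the distinct primes
-- dividing m (all such primes are ≤ m, so we filter [0 .. m]).
rad : ℕ → ℕ
rad m = product (filter (λ p → prime? p ×-dec p ∣? m) (upTo (suc m)))

N : ℤ → ℕ
N a = rad ∣ a ∣

-- Explicit abc conjecture: for coprime nonzero integers x, y, z with
-- x + y = z, one has z < N(xyz)^(7/4).  Since N(xyz) ≥ 1, for z > 0 this
-- is z^4 < N(xyz)^7, and for z ≤ 0 it holds trivially.
ExplicitABC : Set
ExplicitABC =
  (x y z : ℤ) → x ≢ ℤ.0ℤ → y ≢ ℤ.0ℤ → z ≢ ℤ.0ℤ →
  Coprime x y → Coprime y z → Coprime x z →
  x ℤ.+ y ≡ z →
  ℤ.0ℤ ℤ.< z → ∣ z ∣ ^ 4 < N (x ℤ.* y ℤ.* z) ^ 7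

vprod : ∀ {n} → Vec ℕ n → ℕ
vprod = foldr _ _*_ 1

Decreasing : ∀ {n} → Vec ℕ n → Set
Decreasing {n} v = (i j : Fin n) → Data.Fin._≤_ i j → lookup v j ≤ lookup v i

Solution : (t s : ℕ) → Vec ℕ t → Vec ℕ s → Set
Solution t s a n =
  Decreasing a × Decreasing n ×
  ((i : Fin t) → 2 ≤ lookup a i) × ((j : Fin s) → 2 ≤ lookup n j) ×
  ((i : Fin t) (j : Fin s) → lookup a i ≢ lookup n j) ×
  vprod (map _! a) ≡ vprod (map _! n)

Nontrivial : (t s : ℕ) → Vec ℕ t → Vec ℕ s → Set
Nontrivial t s a n =
  (i : Fin t) (j : Fin s) →
  (lookup a i ≢ suc (lookup n j)) × (lookup n j ≢ suc (lookup a i))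

-- A labelled choice of indices i₁ = 1 and distinct i₂,…,i_s ∈ {2,…,t}:
-- an injective map σ : Fin s → Fin t sending index 0 to index 0
-- (index 0 ↔ a₁ / n₁); injectivity forces σ j ≠ 0 for j ≠ 0.
IndexChoice : (t s : ℕ) → Set
IndexChoice t s = Σ (Fin s → Fin t) λ σ →
  Injective _≡_ _≡_ σ × ((j : Fin s) → toℕ j ≡ 0 → toℕ (σ j) ≡ 0)

-- membership in 𝒩(c)_{i₂,…,i_s}: nontrivial solution with nⱼ > a_{iⱼ}
-- (j = 1,…,s, i₁ = 1), and k / k₁ ≤ c, where kⱼ = nⱼ - a_{iⱼ} and
-- k = max{k₂,…,k_s}; since k₁ > 0 the latter says kⱼ ≤ c·k₁ for all j ≥ 2.
InNc : (t s c : ℕ) → IndexChoice t s → Vec ℕ t → Vec ℕ s → Set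
InNc t s c (σ , _) a n =
  Solution t s a n × Nontrivial t s a n ×
  ((j : Fin s) → lookup a (σ j) < lookup n j) ×
  ((j₁ : Fin s) (j : Fin s) → toℕ j₁ ≡ 0 → toℕ j ≢ 0 →
     lookup n j Data.Nat.∸ lookup a (σ j) ≤ c * (lookup n j₁ Data.Nat.∸ lookup a (σ j₁)))

FiniteSet : ∀ {A : Set} → (A → Set) → Set
FiniteSet {A} P = Σ (List A) λ L → (x : A) → P x → x ∈ L

{-# OPTIONS --safe #-}
-- Let a = a₁, n = n₁ and k = n - a. Cancelling the matched factorials, every prime p dividing a
-- number in (a , n] divides an unmatched aᵢ!, and log aᵢ! ≤ s c k log n. Hence (a , n] contains no
-- prime, and its elements are m-smooth for the largest m with log m! ≤ s c k log n;
-- in particular m log m = O(k log n).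
-- By abc, the radical of u (u + 1) exceeds (u + 1)^(4/7) for u in (a , n); comparing the product of these
-- radicals with the product of the primes up to m bounds k log a by O(m + k log k). If log k is much
-- smaller than log a this bounds a. Otherwise Erdős' argument (the part of (a + 1) ⋯ n that is not
-- accounted for by k! consists of one prime power ≤ n for every p ≤ m) gives log a - log k = O(1), so
-- that (a , a + a/D] has no prime for some constant D, and again a is bounded by prime number theory.
--
-- The latter is proved in integers: L is a completely additive function on [1 , X] that is close to
-- K log, where K is a large factorial. With R = ψ - K x one obtains R = O(K x) by Möbius inversion of
-- Σ R(y/d) = O(K √y), then Selberg's formula L R + r ⋆ R = O(K² y). If (x , x′] has no prime, the
-- function Δ(n) = R(x′/n) - R(x/n) is extremal at n = 1; Selberg's formula forces |Δ(n)| to be nearly extremal for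
-- most n, whereas Mertens' theorem and the Lipschitz property of R make Δ small in every long enough window.
module Submission where

open import Data.Nat.Base as ℕ using (ℕ; zero; suc; z≤n; s≤s; _!)
import Data.Nat.Properties as ℕP
import Data.Nat.DivMod as ℕD
import Data.Nat.Divisibility as ∣P
open import Data.Nat.Divisibility using (_∣_; _∣?_; divides)
open import Data.Nat.Divisibility.Core using (hasNonTrivialDivisor)
open import Data.Nat.Primality using (Prime; prime; prime?; prime⇒nonZero; prime⇒nonTrivial; euclidsLemma; prime⇒irreducible)
open import Data.Integer.Base using (ℤ; +_; -[1+_]; +[1+_]; _+_; _*_; _-_; -_; _≤_; _<_; ∣_∣; 0ℤ; 1ℤ; +≤+; -≤+)
import Data.Integer.Properties as ℤP
open import Data.Integer.Tactic.RingSolver using (solve)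
open import Data.List.Base using (List; []; _∷_)
open import Data.Product.Base using (Σ; ∃; _×_; _,_; proj₁; proj₂)
open import Data.Sum.Base using (_⊎_; inj₁; inj₂; [_,_]′)
open import Data.Empty using (⊥; ⊥-elim)
open import Function.Base using (_∘_; id; case_of_)
open import Relation.Nullary using (¬_; Dec; yes; no)
open import Relation.Nullary.Decidable using (_×-dec_)
open import Relation.Binary.PropositionalEquality using (_≡_; refl; sym; trans; cong; cong₂; subst; subst₂; module ≡-Reasoning)
open import Defs using (rad; ExplicitABC; vprod; Decreasing; Nontrivial; IndexChoice; InNc; FiniteSet)
open import Data.Fin.Base as Fin using (Fin)
import Data.Fin.Properties as FinP
open import Data.Vec.Base as Vec using (Vec; lookup)
open import Function.Definitions using (Injective)
open import Data.List.Base using (upTo; filter; _∷ʳ_; _++_; cartesianProductWith; cartesianProduct)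
import Data.List.Properties as ListP
open import Data.Nat.ListAction using (product)
import Data.Nat.ListAction.Properties as ListActionP
open import Data.Nat.Coprimality using (1-coprimeTo)
open import Data.List.Membership.Propositional using (_∈_)
import Data.List.Membership.Propositional.Properties as ∈P
open import Data.List.Relation.Unary.Any using (here)

-- The difficulty is that k may lie anywhere between 2 and a. Where k is a fixed power of a, the
-- comparison of radicals gives nothing, because the primes accounted for by k! may already supply
-- them. Erdős' argument then still leaves a ≤ D k with D growing with s and c, so Bertrand's
-- postulate does not suffice: primes in (a , a + a/D] are needed for every D, which has the
-- strength of the prime number theorem. The logarithm is completely additive by construction, being
-- prescribed at the primes; only its comparison with harmonic sums is approximate and limited to
-- [1 , X]. All thresholds are expressed through ratios to K and so do not depend on X. Therefore X
-- may be chosen after the solution, beyond the seventh power of every radical that occurs. The same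
-- construction with other values at the primes gives the p-adic valuation, so that one identity
-- between factorials serves both for sizes and for divisibility.

-- Integer inequalities from nonnegative certificates

-- Opaque, so that ring-solver proofs are never evaluated by the type checker.
opaque
  lin : ∀ {u v w} → 0ℤ ≤ w → w ≡ v - u → u ≤ v
  lin p refl = ℤP.0≤i-j⇒j≤i p

  by : ∀ {a b : ℤ} → a ≡ b → a ≡ b
  by p = p

sub : ∀ {a b} → a ≤ b → 0ℤ ≤ b - a
sub = ℤP.i≤j⇒0≤j-i

infixl 6 _⊞_
infixl 7 _⊠_ _·_

-- `⊞`, `⊠` and `·` assemble certificates for `lin`: a combination of nonnegative differences which
-- the ring solver identifies with the right side minus the left side of the goal.
_⊞_ : ∀ {a b} → 0ℤ ≤ a → 0ℤ ≤ b → 0ℤ ≤ a + b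
p ⊞ q = ℤP.+-mono-≤ p q

_⊠_ : ∀ {a b} → 0ℤ ≤ a → 0ℤ ≤ b → 0ℤ ≤ a * b
_⊠_ {+ a} {+ b} _ _ = subst (0ℤ ≤_) (ℤP.pos-* a b) (+≤+ z≤n)

_·_ : ∀ n {a} → 0ℤ ≤ a → 0ℤ ≤ + n * a
n · p = +≤+ {0} {n} z≤n ⊠ p

0≤+ : ∀ n → 0ℤ ≤ + n
0≤+ n = +≤+ z≤n

+suc : ∀ n → + suc n ≡ + n + 1ℤ
+suc n = trans (cong +_ (ℕP.+-comm 1 n)) (ℤP.pos-+ n 1)

+∸ : ∀ {m n} → m ℕ.≤ n → + (n ℕ.∸ m) ≡ + n - + m
+∸ {m} {n} m≤n = sym (trans (ℤP.m-n≡m⊖n n m) (ℤP.⊖-≥ m≤n))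

+-interchange : ∀ a b c d → a + b + (c + d) ≡ a + c + (b + d)
+-interchange a b c d = solve (a ∷ b ∷ c ∷ d ∷ [])

*-swapˡ : ∀ a b c → a * (b * c) ≡ b * (a * c)
*-swapˡ a b c = solve (a ∷ b ∷ c ∷ [])

+-swapʳ : ∀ a b c → a + b + c ≡ a + c + b
+-swapʳ a b c = solve (a ∷ b ∷ c ∷ [])

minus-+-swap : ∀ a b c → a - b + c ≡ a + c - b
minus-+-swap a b c = solve (a ∷ b ∷ c ∷ [])

+-minus-cancel : ∀ a b → a + b - a ≡ b
+-minus-cancel a b = solve (a ∷ b ∷ [])

*-distribˡ-minus : ∀ h a b → h * a - h * b ≡ h * (a - b)
*-distribˡ-minus h a b = solve (h ∷ a ∷ b ∷ [])

*-distribʳ-minus : ∀ a b c → a * c - b * c ≡ (a - b) * c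
*-distribʳ-minus a b c = solve (a ∷ b ∷ c ∷ [])

*-monoʳ-nonneg : ∀ a b c → a ≤ b → 0ℤ ≤ c → a * c ≤ b * c
*-monoʳ-nonneg a b c p u = lin (sub p ⊠ u) (solve (a ∷ b ∷ c ∷ []))

below-multiple : ∀ N q B → N ≤ (B + 1ℤ) * q → 1ℤ ≤ B → 0ℤ ≤ q → N ≤ + 2 * q * B
below-multiple N q B p t u = lin (sub p ⊞ u ⊠ sub t) (solve (N ∷ q ∷ B ∷ []))

-- a ⊴ b stands for |a| ≤ b.
infix 4 _⊴_
_⊴_ : ℤ → ℤ → Set
a ⊴ b = (- b ≤ a) × (a ≤ b)

⊴-+ : ∀ {a b c d} → a ⊴ c → b ⊴ d → a + b ⊴ c + d
⊴-+ {a} {b} {c} {d} (p , q) (r , s) =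
  lin (sub p ⊞ sub r) (solve (a ∷ b ∷ c ∷ d ∷ [])) , ℤP.+-mono-≤ q s

⊴-neg : ∀ {a c} → a ⊴ c → - a ⊴ c
⊴-neg {a} {c} (p , q) = ℤP.neg-mono-≤ q , lin (sub p) (solve (a ∷ c ∷ []))

⊴-- : ∀ {a b c d} → a ⊴ c → b ⊴ d → a - b ⊴ c + d
⊴-- p q = ⊴-+ p (⊴-neg q)

⊴-≤ : ∀ {a c d} → a ⊴ c → c ≤ d → a ⊴ d
⊴-≤ (p , q) r = ℤP.≤-trans (ℤP.neg-mono-≤ r) p , ℤP.≤-trans q r

⊴-scale : ∀ {a c} u → 0ℤ ≤ u → a ⊴ c → u * a ⊴ u * c
⊴-scale {a} {c} u 0≤u (p , q) =
  lin (0≤u ⊠ sub p) (solve (a ∷ c ∷ u ∷ [])) , lin (0≤u ⊠ sub q) (solve (a ∷ c ∷ u ∷ []))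

⊴-abs : ∀ a → a ⊴ + ∣ a ∣
⊴-abs (+ n) = ℤP.≤-trans (ℤP.neg-mono-≤ (0≤+ n)) (0≤+ n) , ℤP.≤-refl
⊴-abs -[1+ n ] = ℤP.≤-refl , -≤+

abs-≤-lemma : ∀ c a → a - - c ≡ c - - a
abs-≤-lemma c a = solve (c ∷ a ∷ [])

abs-≤ : ∀ {a c} → a ⊴ c → + ∣ a ∣ ≤ c
abs-≤ {+ n} (_ , q) = q
abs-≤ { -[1+ n ]} {c} (p , _) = lin (sub p) (abs-≤-lemma c (-[1+ n ]))

⊴-nonneg : ∀ {a c} → a ⊴ c → 0ℤ ≤ c
⊴-nonneg {a} p = ℤP.≤-trans (0≤+ ∣ a ∣) (abs-≤ p)

⊴-of-nonneg : ∀ {a c} → 0ℤ ≤ a → a ≤ c → a ⊴ c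
⊴-of-nonneg p q = ℤP.≤-trans (ℤP.neg-mono-≤ (ℤP.≤-trans p q)) p , q

⊴-*-lemma : ∀ x y c d → (c - x) * y + c * (d - y) ≡ c * d - x * y
⊴-*-lemma x y c d = solve (x ∷ y ∷ c ∷ d ∷ [])

⊴-* : ∀ {a b c d} → a ⊴ c → b ⊴ d → a * b ⊴ c * d
⊴-* {a} {b} {c} {d} p q = ⊴-≤ product-bound (lin
    (sub (abs-≤ p) ⊠ 0≤+ ∣ b ∣ ⊞ ⊴-nonneg p ⊠ sub (abs-≤ q)) (⊴-*-lemma (+ ∣ a ∣) (+ ∣ b ∣) c d))
  where
  product-bound : a * b ⊴ + ∣ a ∣ * + ∣ b ∣
  product-bound = subst (a * b ⊴_) (trans (cong +_ (ℤP.abs-* a b)) (ℤP.pos-* ∣ a ∣ ∣ b ∣)) (⊴-abs (a * b))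

-- Finite sums over 1, ..., n

S : (ℕ → ℤ) → ℕ → ℤ
S f zero = 0ℤ
S f (suc n) = S f n + f (suc n)

module _ {f g : ℕ → ℤ} where
  S-cong : ∀ n → (∀ i → 1 ℕ.≤ i → i ℕ.≤ n → f i ≡ g i) → S f n ≡ S g n
  S-cong zero h = refl
  S-cong (suc n) h = cong₂ _+_ (S-cong n (λ i p q → h i p (ℕP.m≤n⇒m≤1+n q))) (h (suc n) (s≤s z≤n) ℕP.≤-refl)

  S-mono : ∀ n → (∀ i → 1 ℕ.≤ i → i ℕ.≤ n → f i ≤ g i) → S f n ≤ S g n
  S-mono zero h = ℤP.≤-refl
  S-mono (suc n) h = ℤP.+-mono-≤ (S-mono n (λ i p q → h i p (ℕP.m≤n⇒m≤1+n q))) (h (suc n) (s≤s z≤n) ℕP.≤-refl)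

  S-⊴ : ∀ n → (∀ i → 1 ℕ.≤ i → i ℕ.≤ n → f i ⊴ g i) → S f n ⊴ S g n
  S-⊴ zero h = ℤP.≤-refl , ℤP.≤-refl
  S-⊴ (suc n) h = ⊴-+ (S-⊴ n (λ i p q → h i p (ℕP.m≤n⇒m≤1+n q))) (h (suc n) (s≤s z≤n) ℕP.≤-refl)

  S-+ : ∀ n → S (λ i → f i + g i) n ≡ S f n + S g n
  S-+ zero = refl
  S-+ (suc n) = trans (cong (_+ (f (suc n) + g (suc n))) (S-+ n)) (+-interchange (S f n) (S g n) (f (suc n)) (g (suc n)))

module _ {f : ℕ → ℤ} where
  S-* : ∀ c n → S (λ i → c * f i) n ≡ c * S f n
  S-* c zero = sym (ℤP.*-zeroʳ c)
  S-* c (suc n) = trans (cong (_+ c * f (suc n)) (S-* c n)) (sym (ℤP.*-distribˡ-+ c (S f n) (f (suc n))))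

  S-zero : ∀ n → (∀ i → 1 ℕ.≤ i → i ℕ.≤ n → f i ≡ 0ℤ) → S f n ≡ 0ℤ
  S-zero zero h = refl
  S-zero (suc n) h = cong₂ _+_ (S-zero n (λ i p q → h i p (ℕP.m≤n⇒m≤1+n q))) (h (suc n) (s≤s z≤n) ℕP.≤-refl)

  S-nonneg : ∀ n → (∀ i → 1 ℕ.≤ i → i ℕ.≤ n → 0ℤ ≤ f i) → 0ℤ ≤ S f n
  S-nonneg zero h = ℤP.≤-refl
  S-nonneg (suc n) h = S-nonneg n (λ i p q → h i p (ℕP.m≤n⇒m≤1+n q)) ⊞ h (suc n) (s≤s z≤n) ℕP.≤-refl

  S-cut : ∀ {m n} → m ℕ.≤ n → (∀ i → m ℕ.< i → i ℕ.≤ n → f i ≡ 0ℤ) → S f n ≡ S f m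
  S-cut {m} {n} m≤n h with ℕP.m≤n⇒m<n∨m≡n m≤n
  ... | inj₂ refl = refl
  S-cut {m} {suc n} m≤n h | inj₁ (s≤s m≤n') =
    trans (cong₂ _+_ (S-cut m≤n' (λ i p q → h i p (ℕP.m≤n⇒m≤1+n q))) (h (suc n) (s≤s m≤n') ℕP.≤-refl)) (ℤP.+-identityʳ _)

S-const-lemma : ∀ c n → n * c + c ≡ (n + 1ℤ) * c
S-const-lemma c n = solve (c ∷ n ∷ [])

S-const : ∀ c n → S (λ _ → c) n ≡ + n * c
S-const c zero = refl
S-const c (suc n) = trans (cong (_+ c) (S-const c n)) (trans (S-const-lemma c (+ n)) (cong (_* c) (sym (+suc n))))

S-neg : ∀ {f} n → S (λ i → - f i) n ≡ - S f n
S-neg zero = refl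
S-neg {f} (suc n) = trans (cong (_+ - f (suc n)) (S-neg n)) (sym (ℤP.neg-distrib-+ (S f n) (f (suc n))))

S-minus : ∀ {f g} n → S (λ i → f i - g i) n ≡ S f n - S g n
S-minus {f} {g} n = trans (S-+ {f} {λ i → - g i} n) (cong (_+_ (S f n)) (S-neg n))

S-*ʳ : ∀ {f} c n → S (λ i → f i * c) n ≡ S f n * c
S-*ʳ {f} c n = trans (S-cong n (λ i _ _ → ℤP.*-comm (f i) c)) (trans (S-* c n) (ℤP.*-comm c (S f n)))

S-swap : ∀ (f : ℕ → ℕ → ℤ) m n → S (λ i → S (f i) m) n ≡ S (λ j → S (λ i → f i j) n) m
S-swap f m zero = sym (S-zero m (λ _ _ _ → refl))
S-swap f m (suc n) = trans (cong (_+ S (f (suc n)) m) (S-swap f m n)) (sym (S-+ {λ j → S (λ i → f i j) n} {f (suc n)} m))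

S-mono-between-step : ∀ a b c d x y → a - b ≤ c - d → x ≤ y → a + x - b ≤ c + y - d
S-mono-between-step a b c d x y p q = lin (sub p ⊞ sub q) (solve (a ∷ b ∷ c ∷ d ∷ x ∷ y ∷ []))

module _ {f g : ℕ → ℤ} where
  S-mono-between : ∀ {m n} → m ℕ.≤ n → (∀ i → m ℕ.< i → i ℕ.≤ n → f i ≤ g i) → S f n - S f m ≤ S g n - S g m
  S-mono-between {m} {n} m≤n h with ℕP.m≤n⇒m<n∨m≡n m≤n
  ... | inj₂ refl = ℤP.≤-reflexive (trans (ℤP.+-inverseʳ (S f m)) (sym (ℤP.+-inverseʳ (S g m))))
  S-mono-between {m} {suc n} m≤n h | inj₁ (s≤s m≤n') =
    S-mono-between-step (S f n) (S f m) (S g n) (S g m) (f (suc n)) (g (suc n))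
      (S-mono-between m≤n' (λ i p q → h i p (ℕP.m≤n⇒m≤1+n q))) (h (suc n) (s≤s m≤n') ℕP.≤-refl)

S-mono-len : ∀ {f m n} → m ℕ.≤ n → (∀ i → m ℕ.< i → i ℕ.≤ n → 0ℤ ≤ f i) → S f m ≤ S f n
S-mono-len {f} {m} {n} m≤n h =
  ℤP.0≤i-j⇒j≤i (subst (_≤ S f n - S f m) zeros (S-mono-between {λ _ → 0ℤ} {f} m≤n h))
  where
  zeros : S (λ _ → 0ℤ) n - S (λ _ → 0ℤ) m ≡ 0ℤ
  zeros = cong₂ _-_ (S-zero n (λ _ _ _ → refl)) (S-zero m (λ _ _ _ → refl))

abel-lemma : ∀ a b → 0ℤ + a * b ≡ a * (0ℤ + b) - 0ℤ
abel-lemma a b = solve (a ∷ b ∷ [])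

abel-lemma2 : ∀ a b c V s → c * V - s + a * b ≡ a * (V + b) - (s + V * (a - c))
abel-lemma2 a b c V s = solve (a ∷ b ∷ c ∷ V ∷ s ∷ [])

-- Always used with u = `L`, whose increments are small: bounds on the partial sums of v pass to the
-- sums weighted by u.
abel : ∀ (u v : ℕ → ℤ) n →
  S (λ i → u i * v i) (suc n) ≡ u (suc n) * S v (suc n) - S (λ i → S v i * (u (suc i) - u i)) n
abel u v zero = by (abel-lemma (u 1) (v 1))
abel u v (suc n) = trans (cong (_+ u (suc (suc n)) * v (suc (suc n))) (abel u v n))
  (abel-lemma2 (u (suc (suc n))) (v (suc (suc n))) (u (suc n)) (S v n + v (suc n)) (S (λ i → S v i * (u (suc i) - u i)) n))

ind : ∀ {P : Set} → Dec P → ℤ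
ind (yes _) = 1ℤ
ind (no _) = 0ℤ

ind-yes : ∀ {P : Set} (d : Dec P) → P → ind d ≡ 1ℤ
ind-yes (yes _) p = refl
ind-yes (no ¬p) p = ⊥-elim (¬p p)

ind-no : ∀ {P : Set} (d : Dec P) → ¬ P → ind d ≡ 0ℤ
ind-no (yes p) ¬p = ⊥-elim (¬p p)
ind-no (no _) ¬p = refl

ind-⇔ : ∀ {P Q : Set} (d : Dec P) (e : Dec Q) → (P → Q) → (Q → P) → ind d ≡ ind e
ind-⇔ (yes p) e f g = sym (ind-yes e (f p))
ind-⇔ (no ¬p) e f g = sym (ind-no e (¬p ∘ g))

ind-nonneg : ∀ {P : Set} (d : Dec P) → 0ℤ ≤ ind d
ind-nonneg (yes _) = 0≤+ 1
ind-nonneg (no _) = 0≤+ 0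

ind-≤1 : ∀ {P : Set} (d : Dec P) → ind d ≤ 1ℤ
ind-≤1 (yes _) = ℤP.≤-refl
ind-≤1 (no _) = 0≤+ 1

-- Dirichlet convolution

infixl 7 _÷_
-- Total, with the default 0 for a zero divisor, so that sums over divisors carry no instance
-- arguments.
_÷_ : ℕ → ℕ → ℕ
x ÷ zero = zero
x ÷ suc n = x ℕ./ suc n

÷-* : ∀ x n → x ÷ n ℕ.* n ℕ.≤ x
÷-* x zero = subst (ℕ._≤ x) (sym (ℕP.*-zeroʳ (x ÷ zero))) z≤n
÷-* x (suc n) = ℕD.m/n*n≤m x (suc n)

÷-lub : ∀ {x n i} → 1 ℕ.≤ n → i ℕ.* n ℕ.≤ x → i ℕ.≤ x ÷ n
÷-lub {x} {suc n} {i} _ p = subst (ℕ._≤ x ℕ./ suc n) (ℕD.m*n/n≡m i (suc n)) (ℕD./-monoˡ-≤ (suc n) p)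

÷-glb : ∀ {x n i} → i ℕ.≤ x ÷ n → i ℕ.* n ℕ.≤ x
÷-glb {x} {n} p = ℕP.≤-trans (ℕP.*-monoˡ-≤ n p) (÷-* x n)

÷-unique : ∀ {x n q} → 1 ℕ.≤ n → q ℕ.* n ℕ.≤ x → x ℕ.< suc q ℕ.* n → x ÷ n ≡ q
÷-unique {x} {n} {q} 1≤n lo hi =
  ℕP.≤-antisym (ℕP.≮⇒≥ λ q< → ℕP.<-irrefl refl (ℕP.<-≤-trans hi (÷-glb {x} {n} q<))) (÷-lub 1≤n lo)

÷-< : ∀ x n → 1 ℕ.≤ n → x ℕ.< suc (x ÷ n) ℕ.* n
÷-< x n 1≤n = ℕP.≰⇒> λ h → ℕP.<-irrefl refl (÷-lub {x} {n} {suc (x ÷ n)} 1≤n h)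

÷-≤ : ∀ x n → x ÷ n ℕ.≤ x
÷-≤ x zero = z≤n
÷-≤ x (suc n) = ℕD.m/n≤m x (suc n)

÷-mono : ∀ {x y} n → x ℕ.≤ y → x ÷ n ℕ.≤ y ÷ n
÷-mono zero p = z≤n
÷-mono (suc n) p = ℕD./-monoˡ-≤ (suc n) p

÷-antimono : ∀ {x m n} → 1 ℕ.≤ m → m ℕ.≤ n → x ÷ n ℕ.≤ x ÷ m
÷-antimono {x} {m} {n} 1≤m m≤n = ÷-lub 1≤m (ℕP.≤-trans (ℕP.*-monoʳ-≤ (x ÷ n) m≤n) (÷-* x n))

÷-zero : ∀ {x n} → x ℕ.< n → x ÷ n ≡ 0
÷-zero {x} {suc n} p = ℕD.m<n⇒m/n≡0 p

÷-1 : ∀ x → x ÷ 1 ≡ x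
÷-1 x = ℕD.n/1≡n x

0÷ : ∀ n → 0 ÷ n ≡ 0
0÷ zero = refl
0÷ (suc n) = ℕD.0/n≡0 (suc n)

÷-pos : ∀ {x n} → 1 ℕ.≤ n → n ℕ.≤ x → 1 ℕ.≤ x ÷ n
÷-pos {x} {n} 1≤n n≤x = ÷-lub 1≤n (subst (ℕ._≤ x) (sym (ℕP.*-identityˡ n)) n≤x)

-- Nested floors collapse into one. This is what lets arithmetic functions act on summatory
-- functions through `⋆`.
÷-÷ : ∀ x m n → 1 ℕ.≤ m → 1 ℕ.≤ n → x ÷ m ÷ n ≡ x ÷ (n ℕ.* m)
÷-÷ x m n 1≤m 1≤n = sym (÷-unique (ℕP.*-mono-≤ 1≤n 1≤m)
    (subst (ℕ._≤ x) (ℕP.*-assoc (x ÷ m ÷ n) n m) (÷-glb {x} {m} (÷-* (x ÷ m) n)))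
    (ℕP.<-≤-trans (÷-< x m 1≤m)
      (subst (suc (x ÷ m) ℕ.* m ℕ.≤_) (ℕP.*-assoc (suc (x ÷ m ÷ n)) n m) (ℕP.*-monoˡ-≤ m (÷-< (x ÷ m) n 1≤n)))))

÷-÷-comm : ∀ x m n → 1 ℕ.≤ m → 1 ℕ.≤ n → x ÷ m ÷ n ≡ x ÷ n ÷ m
÷-÷-comm x m n 1≤m 1≤n = trans (÷-÷ x m n 1≤m 1≤n) (trans (cong (x ÷_) (ℕP.*-comm n m)) (sym (÷-÷ x n m 1≤n 1≤m)))

*÷ : ∀ m n → 1 ℕ.≤ n → (m ℕ.* n) ÷ n ≡ m
*÷ m (suc n) _ = ℕD.m*n/n≡m m (suc n)

÷-∣ : ∀ {p n} → 1 ℕ.≤ p → p ∣ n → n ÷ p ℕ.* p ≡ n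
÷-∣ {p} 1≤p (divides q refl) = cong (ℕ._* p) (*÷ q p 1≤p)

S-multiples : ∀ (F : ℕ → ℤ) d → 1 ℕ.≤ d → ∀ x → S (λ n → ind (d ∣? n) * F n) x ≡ S (λ m → F (m ℕ.* d)) (x ÷ d)
S-multiples F d 1≤d zero = cong (S (λ m → F (m ℕ.* d))) (sym (0÷ d))
S-multiples F d 1≤d (suc x) with d ∣? suc x
... | yes (divides zero ())
... | yes (divides (suc q) eq) =
  trans (cong₂ _+_ (trans (S-multiples F d 1≤d x) (cong (S (λ m → F (m ℕ.* d))) x÷d)) (trans (ℤP.*-identityˡ _) (cong F eq)))
        (cong (S (λ m → F (m ℕ.* d))) (sym (trans (cong (_÷ d) eq) (*÷ (suc q) d 1≤d))))
  where
  x÷d : x ÷ d ≡ q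
  x÷d = ÷-unique 1≤d
    (ℕP.≤-pred (subst (q ℕ.* d ℕ.<_) (sym eq) (ℕP.m<n+m (q ℕ.* d) 1≤d)))
    (subst (x ℕ.<_) eq ℕP.≤-refl)
... | no d∤ = trans (cong₂ _+_ (S-multiples F d 1≤d x) (ℤP.*-zeroˡ (F (suc x))))
   (trans (ℤP.+-identityʳ _) (cong (S (λ m → F (m ℕ.* d))) (sym sx÷d)))
  where
  sx÷d : suc x ÷ d ≡ x ÷ d
  sx÷d = ÷-unique 1≤d (ℕP.m≤n⇒m≤1+n (÷-* x d))
    (ℕP.≤∧≢⇒< (÷-< x d 1≤d) (λ e → d∤ (divides (suc (x ÷ d)) e)))

infixr 7 _⋆_
-- If A is the summatory function of g, then f ⋆ A is the summatory function of the Dirichlet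
-- convolution of f and g.
_⋆_ : (ℕ → ℤ) → (ℕ → ℤ) → ℕ → ℤ
(f ⋆ A) x = S (λ n → f n * A (x ÷ n)) x

𝟙 : ℕ → ℤ
𝟙 _ = 1ℤ

module _ (f A : ℕ → ℤ) (A0 : A 0 ≡ 0ℤ) where
  -- Beyond x the quotient is 0 and `A0` kills the terms; sums of different lengths can thus be
  -- brought to a common range.
  ⋆-extend : ∀ {x X} → x ℕ.≤ X → S (λ n → f n * A (x ÷ n)) X ≡ (f ⋆ A) x
  ⋆-extend x≤X = S-cut x≤X (λ n x<n _ → trans (cong (λ y → f n * A y) (÷-zero x<n)) (trans (cong (f n *_) A0) (ℤP.*-zeroʳ (f n))))

-- Both sides are the sum of f(m) g(n) A(x/(m n)); extending the inner ranges to x makes the domain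
-- a square, on which the summations can be swapped.
⋆-comm : ∀ f g A → A 0 ≡ 0ℤ → ∀ x → (f ⋆ g ⋆ A) x ≡ (g ⋆ f ⋆ A) x
⋆-comm f g A A0 x = begin
    (f ⋆ g ⋆ A) x                                              ≡⟨ expand f g ⟩
    S (λ m → S (λ n → f m * (g n * A (x ÷ m ÷ n))) x) x        ≡⟨ S-swap _ x x ⟩
    S (λ n → S (λ m → f m * (g n * A (x ÷ m ÷ n))) x) x        ≡⟨ S-cong x (λ n 1≤n _ → S-cong x (λ m 1≤m _ → rearrange n m 1≤n 1≤m)) ⟩
    S (λ n → S (λ m → g n * (f m * A (x ÷ n ÷ m))) x) x        ≡⟨ sym (expand g f) ⟩
    (g ⋆ f ⋆ A) x                                              ∎
  where
  open ≡-Reasoning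
  expand : ∀ f g → (f ⋆ g ⋆ A) x ≡ S (λ m → S (λ n → f m * (g n * A (x ÷ m ÷ n))) x) x
  expand f g = S-cong x (λ m _ _ → trans (cong (f m *_) (sym (⋆-extend g A A0 (÷-≤ x m)))) (sym (S-* (f m) x)))
  rearrange : ∀ n m → 1 ℕ.≤ n → 1 ℕ.≤ m → f m * (g n * A (x ÷ m ÷ n)) ≡ g n * (f m * A (x ÷ n ÷ m))
  rearrange n m 1≤n 1≤m = trans (cong (λ y → f m * (g n * A y)) (÷-÷-comm x m n 1≤m 1≤n)) (by (*-swapˡ (f m) (g n) (A (x ÷ n ÷ m))))

dsum : (ℕ → ℤ) → ℕ → ℤ
dsum f N = S (λ d → ind (d ∣? N) * f d) N

dsum-extend : ∀ f {N X} → 1 ℕ.≤ N → N ℕ.≤ X → S (λ d → ind (d ∣? N) * f d) X ≡ dsum f N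
dsum-extend f {suc N} _ N≤X = S-cut N≤X (λ d N<d _ →
  cong (_* f d) (ind-no (d ∣? suc N) (λ d∣N → ℕP.<⇒≱ N<d (∣P.∣⇒≤ d∣N))))

S-dsum-lemma : ∀ a b c → a * b * c ≡ b * (a * c)
S-dsum-lemma a b c = solve (a ∷ b ∷ c ∷ [])

S-dsum : ∀ (f F : ℕ → ℤ) x → S (λ N → dsum f N * F N) x ≡ S (λ d → f d * S (λ m → F (m ℕ.* d)) (x ÷ d)) x
S-dsum f F x = begin
    S (λ N → dsum f N * F N) x
      ≡⟨ S-cong x (λ N 1≤N N≤x → trans (cong (_* F N) (sym (dsum-extend f 1≤N N≤x))) (sym (S-*ʳ (F N) x))) ⟩
    S (λ N → S (λ d → ind (d ∣? N) * f d * F N) x) x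
      ≡⟨ S-swap _ x x ⟩
    S (λ d → S (λ N → ind (d ∣? N) * f d * F N) x) x
      ≡⟨ S-cong x (λ d 1≤d _ → trans (S-cong x (λ N _ _ → by (S-dsum-lemma (ind (d ∣? N)) (f d) (F N)))) (trans (S-* (f d) x) (cong (f d *_) (S-multiples F d 1≤d x)))) ⟩
    S (λ d → f d * S (λ m → F (m ℕ.* d)) (x ÷ d)) x ∎
  where
  open ≡-Reasoning

S-dsum-⋆ : ∀ f x → S (dsum f) x ≡ (f ⋆ +_) x
S-dsum-⋆ f x = trans (S-cong x (λ N _ _ → sym (ℤP.*-identityʳ (dsum f N)))) (trans (S-dsum f 𝟙 x)
  (S-cong x (λ d _ _ → cong (f d *_) (trans (S-const 1ℤ (x ÷ d)) (ℤP.*-identityʳ _)))))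

-- The summatory function of the unit of Dirichlet convolution, so acting on it produces `S f`
-- itself.
sgn : ℕ → ℤ
sgn zero = 0ℤ
sgn (suc _) = 1ℤ

⋆-sgn : ∀ f x → (f ⋆ sgn) x ≡ S f x
⋆-sgn f x = S-cong x (λ n 1≤n n≤x → trans (cong (f n *_) (sgn1 (÷-pos 1≤n n≤x))) (ℤP.*-identityʳ (f n)))
  where
  sgn1 : ∀ {y} → 1 ℕ.≤ y → sgn y ≡ 1ℤ
  sgn1 (s≤s _) = refl

⋆-cong : ∀ {f g A B} → (∀ n → f n ≡ g n) → (∀ n → A n ≡ B n) → ∀ x → (f ⋆ A) x ≡ (g ⋆ B) x
⋆-cong p q x = S-cong x (λ n _ _ → cong₂ _*_ (p n) (q (x ÷ n)))

⋆-S : ∀ f x → (𝟙 ⋆ S f) x ≡ (f ⋆ +_) x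
⋆-S f x = begin
  (𝟙 ⋆ S f) x         ≡⟨ ⋆-cong {𝟙} (λ _ → refl) (λ n → sym (⋆-sgn f n)) x ⟩
  (𝟙 ⋆ f ⋆ sgn) x     ≡⟨ ⋆-comm 𝟙 f sgn refl x ⟩
  (f ⋆ 𝟙 ⋆ sgn) x     ≡⟨ ⋆-cong {f} {f} {𝟙 ⋆ sgn} {+_} (λ _ → refl) (λ n → trans (⋆-sgn 𝟙 n) (trans (S-const 1ℤ n) (ℤP.*-identityʳ _))) x ⟩
  (f ⋆ +_) x          ∎
  where open ≡-Reasoning

-- Collecting the double sum by N = m d leaves the factor `dsum μ N`, which removes everything but N
-- = 1.
⋆-inverse : ∀ μ → dsum μ 1 ≡ 1ℤ → (∀ n → 2 ℕ.≤ n → dsum μ n ≡ 0ℤ) →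
  ∀ A → A 0 ≡ 0ℤ → ∀ x → (μ ⋆ 𝟙 ⋆ A) x ≡ A x
⋆-inverse μ μ1 μ≥2 A A0 zero = sym A0
⋆-inverse μ μ1 μ≥2 A A0 x@(suc _) = begin
    (μ ⋆ 𝟙 ⋆ A) x
      ≡⟨ S-cong x (λ d 1≤d _ → cong (μ d *_) (S-cong (x ÷ d) (λ m 1≤m _ → trans (ℤP.*-identityˡ _) (cong A (÷-÷ x d m 1≤d 1≤m))))) ⟩
    S (λ d → μ d * S (λ m → A (x ÷ (m ℕ.* d))) (x ÷ d)) x
      ≡⟨ sym (S-dsum μ (λ N → A (x ÷ N)) x) ⟩
    S (λ N → dsum μ N * A (x ÷ N)) x
      ≡⟨ S-cut {λ N → dsum μ N * A (x ÷ N)} {1} {x} (s≤s z≤n) (λ N 1<N _ → trans (cong (_* A (x ÷ N)) (μ≥2 N 1<N)) (ℤP.*-zeroˡ (A (x ÷ N)))) ⟩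
    0ℤ + dsum μ 1 * A (x ÷ 1)
      ≡⟨ trans (ℤP.+-identityˡ _) (trans (cong₂ _*_ μ1 (cong A (÷-1 x))) (ℤP.*-identityˡ (A x))) ⟩
    A x ∎
  where open ≡-Reasoning

-- The Möbius and von Mangoldt functions

least : ∀ {P : ℕ → Set} → (∀ n → Dec (P n)) → ∀ n → P n → Σ ℕ λ m → P m × (∀ j → P j → m ℕ.≤ j)
least {P} P? n Pn = search n 0 (ℕP.+-identityʳ n) (λ _ ())
  where
  search : ∀ fuel m → fuel ℕ.+ m ≡ n → (∀ j → j ℕ.< m → ¬ P j) → Σ ℕ λ m → P m × (∀ j → P j → m ℕ.≤ j)
  search fuel m eq below with P? m
  ... | yes Pm = m , Pm , λ j Pj → ℕP.≮⇒≥ λ j<m → below j j<m Pj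
  search zero m refl below | no ¬Pm = ⊥-elim (¬Pm Pn)
  search (suc fuel) m eq below | no ¬Pm = search fuel (suc m) (trans (ℕP.+-suc fuel m) eq) below′
    where
    below′ : ∀ j → j ℕ.< suc m → ¬ P j
    below′ j (s≤s j≤m) with ℕP.m≤n⇒m<n∨m≡n j≤m
    ... | inj₁ j<m = below j j<m
    ... | inj₂ refl = ¬Pm

lpf-spec : ∀ n → 2 ℕ.≤ n → Σ ℕ λ p → (2 ℕ.≤ p × p ∣ n) × (∀ d → 2 ℕ.≤ d × d ∣ n → p ℕ.≤ d)
lpf-spec n 2≤n = least (λ d → (2 ℕP.≤? d) ×-dec (d ∣? n)) n (2≤n , ∣P.∣-refl)

opaque
  -- The value 1 below 2 is a default; everything used later follows from `lpf-properties`.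
  lpf : ℕ → ℕ
  lpf n with 2 ℕP.≤? n
  ... | yes 2≤n = proj₁ (lpf-spec n 2≤n)
  ... | no _ = 1

  lpf-properties : ∀ {n} → 2 ℕ.≤ n → (2 ℕ.≤ lpf n × lpf n ∣ n) × (∀ d → 2 ℕ.≤ d × d ∣ n → lpf n ℕ.≤ d)
  lpf-properties {n} 2≤n with 2 ℕP.≤? n
  ... | yes 2≤n = proj₂ (lpf-spec n 2≤n)
  ... | no 2≰n = ⊥-elim (2≰n 2≤n)

module _ {n} (2≤n : 2 ℕ.≤ n) where
  2≤lpf : 2 ℕ.≤ lpf n
  2≤lpf = proj₁ (proj₁ (lpf-properties 2≤n))

  1≤lpf : 1 ℕ.≤ lpf n
  1≤lpf = ℕP.≤-trans (s≤s z≤n) 2≤lpf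

  lpf∣ : lpf n ∣ n
  lpf∣ = proj₂ (proj₁ (lpf-properties 2≤n))

  lpf-least : ∀ {d} → 2 ℕ.≤ d → d ∣ n → lpf n ℕ.≤ d
  lpf-least 2≤d d∣n = proj₂ (lpf-properties 2≤n) _ (2≤d , d∣n)

  cofactor : n ÷ lpf n ℕ.* lpf n ≡ n
  cofactor = ÷-∣ 1≤lpf lpf∣

  1≤cofactor : 1 ℕ.≤ n ÷ lpf n
  1≤cofactor = ÷-pos 1≤lpf (∣P.∣⇒≤ {{ℕ.>-nonZero (ℕP.≤-trans (s≤s z≤n) 2≤n)}} lpf∣)

  cofactor< : n ÷ lpf n ℕ.< n
  cofactor< = ℕP.<-≤-trans (subst (ℕ._< n ÷ lpf n ℕ.* lpf n) (ℕP.*-identityʳ (n ÷ lpf n))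
      (ℕP.*-monoʳ-< (n ÷ lpf n) {{ℕ.>-nonZero 1≤cofactor}} 2≤lpf)) (ℕP.≤-reflexive cofactor)

  lpf-prime : Prime (lpf n)
  lpf-prime = prime {{ℕ.n>1⇒nonTrivial 2≤lpf}} λ where
    (hasNonTrivialDivisor {divisor = d} d<p d∣p) → ℕP.<⇒≱ d<p
      (lpf-least (ℕ.nonTrivial⇒n>1 d) (∣P.∣-trans d∣p lpf∣))

lpf-of-divisor : ∀ {n d} → 2 ℕ.≤ n → 2 ℕ.≤ d → d ∣ n → lpf n ∣ d → lpf d ≡ lpf n
lpf-of-divisor 2≤n 2≤d d∣n p∣d = ℕP.≤-antisym (lpf-least 2≤d (2≤lpf 2≤n) p∣d) (lpf-least 2≤n (2≤lpf 2≤d) (∣P.∣-trans (lpf∣ 2≤d) d∣n))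

-- Functions computed by splitting off the least prime factor: the value at n = p e is found from p,
-- e and the value at e. The fuel n is enough because e < n.
module Recursion (Φ : ℕ → ℕ → ℤ → ℤ) (z : ℤ) where
  rec : ℕ → ℕ → ℤ
  rec zero n = z
  rec (suc fuel) n with 2 ℕP.≤? n
  ... | yes _ = Φ (lpf n) (n ÷ lpf n) (rec fuel (n ÷ lpf n))
  ... | no _ = z

  fun : ℕ → ℤ
  fun n = rec n n

  rec-fuel : ∀ f g n → n ℕ.≤ f → n ℕ.≤ g → rec f n ≡ rec g n
  rec-fuel zero zero n p q = refl
  rec-fuel zero (suc g) .zero z≤n q = refl
  rec-fuel (suc f) zero .zero p z≤n = refl
  rec-fuel (suc f) (suc g) n p q with 2 ℕP.≤? n
  ... | yes 2≤n = cong (Φ (lpf n) (n ÷ lpf n)) (rec-fuel f g (n ÷ lpf n)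
          (ℕP.≤-pred (ℕP.<-≤-trans (cofactor< 2≤n) p)) (ℕP.≤-pred (ℕP.<-≤-trans (cofactor< 2≤n) q)))
  ... | no _ = refl

  unfold : ∀ {n} → 2 ℕ.≤ n → fun n ≡ Φ (lpf n) (n ÷ lpf n) (fun (n ÷ lpf n))
  unfold {suc n} 2≤n = step {suc n} {n} 2≤n (ℕP.≤-pred (cofactor< 2≤n))
    where
    step : ∀ {n f} → 2 ℕ.≤ n → n ÷ lpf n ℕ.≤ f → rec (suc f) n ≡ Φ (lpf n) (n ÷ lpf n) (fun (n ÷ lpf n))
    step {n} {f} 2≤n le with 2 ℕP.≤? n
    ... | yes _ = cong (Φ (lpf n) (n ÷ lpf n)) (rec-fuel f (n ÷ lpf n) (n ÷ lpf n) le ℕP.≤-refl)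
    ... | no 2≰n = ⊥-elim (2≰n 2≤n)

  module _ {n} (2≤n : 2 ℕ.≤ n) where
    private
      p e : ℕ
      p = lpf n
      e = n ÷ lpf n

    -- As c p divides n, its least prime factor is still p, so the recursion at c p splits off the
    -- same prime.
    at-multiple : ∀ {c} → 1 ℕ.≤ c → c ∣ e → fun (c ℕ.* p) ≡ Φ p c (fun c)
    at-multiple {c} 1≤c c∣e = trans (unfold 2≤cp) (cong₂ (λ q d → Φ q d (fun d)) lpf≡ cofactor≡)
      where
      2≤cp : 2 ℕ.≤ c ℕ.* p
      2≤cp = ℕP.*-mono-≤ 1≤c (2≤lpf 2≤n)
      lpf≡ : lpf (c ℕ.* p) ≡ p
      lpf≡ = lpf-of-divisor 2≤n 2≤cp (subst (c ℕ.* p ∣_) (cofactor 2≤n) (∣P.*-monoˡ-∣ p c∣e)) (divides c refl)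
      cofactor≡ : c ℕ.* p ÷ lpf (c ℕ.* p) ≡ c
      cofactor≡ = trans (cong (c ℕ.* p ÷_) lpf≡) (*÷ c p (1≤lpf 2≤n))

not-ind : ∀ {P : Set} → Dec P → ℤ
not-ind d = 1ℤ - ind d

dsum-lpf-lemma₁ : ∀ a b c → a * b ≡ c * (a * b) + a * ((1ℤ - c) * b)
dsum-lpf-lemma₁ a b c = solve (a ∷ b ∷ c ∷ [])

-- Divisors of n prime to p = lpf n divide n/p; the others are p times a divisor of n/p.
dsum-lpf : ∀ f {n} → 2 ℕ.≤ n → let p = lpf n; e = n ÷ p in
  dsum f n ≡ S (λ c → ind (c ∣? e) * (f (c ℕ.* p) + not-ind (p ∣? c) * f c)) e
dsum-lpf f {n} 2≤n = begin
    dsum f n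
      ≡⟨ S-cong n (λ d _ _ → by (dsum-lpf-lemma₁ (ind (d ∣? n)) (f d) (ind (p ∣? d)))) ⟩
    S (λ d → ind (p ∣? d) * (ind (d ∣? n) * f d) + ind (d ∣? n) * (not-ind (p ∣? d) * f d)) n
      ≡⟨ S-+ n ⟩
    S (λ d → ind (p ∣? d) * (ind (d ∣? n) * f d)) n + S (λ d → ind (d ∣? n) * (not-ind (p ∣? d) * f d)) n
      ≡⟨ cong₂ _+_ (S-multiples (λ d → ind (d ∣? n) * f d) p (1≤lpf 2≤n) n) (S-cong n (λ d _ _ → second d)) ⟩
    S (λ c → ind (c ℕ.* p ∣? n) * f (c ℕ.* p)) e + S (λ d → ind (d ∣? e) * (not-ind (p ∣? d) * f d)) n
      ≡⟨ cong₂ _+_ (S-cong e (λ c _ _ → cong (_* f (c ℕ.* p)) (first c)))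
                   (dsum-extend (λ d → not-ind (p ∣? d) * f d) (1≤cofactor 2≤n) (÷-≤ n p)) ⟩
    S (λ c → ind (c ∣? e) * f (c ℕ.* p)) e + S (λ c → ind (c ∣? e) * (not-ind (p ∣? c) * f c)) e
      ≡⟨ sym (S-+ e) ⟩
    S (λ c → ind (c ∣? e) * f (c ℕ.* p) + ind (c ∣? e) * (not-ind (p ∣? c) * f c)) e
      ≡⟨ S-cong e (λ c _ _ → sym (ℤP.*-distribˡ-+ (ind (c ∣? e)) (f (c ℕ.* p)) (not-ind (p ∣? c) * f c))) ⟩
    S (λ c → ind (c ∣? e) * (f (c ℕ.* p) + not-ind (p ∣? c) * f c)) e ∎
  where
  open ≡-Reasoning
  p e : ℕ
  p = lpf n
  e = n ÷ p
  first : ∀ c → ind (c ℕ.* p ∣? n) ≡ ind (c ∣? e)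
  first c = ind-⇔ (c ℕ.* p ∣? n) (c ∣? e)
    (λ h → ∣P.*-cancelʳ-∣ p {{ℕ.>-nonZero (1≤lpf 2≤n)}} (subst (c ℕ.* p ∣_) (sym (cofactor 2≤n)) h))
    (λ h → subst (c ℕ.* p ∣_) (cofactor 2≤n) (∣P.*-monoˡ-∣ p h))
  second : ∀ d → ind (d ∣? n) * (not-ind (p ∣? d) * f d) ≡ ind (d ∣? e) * (not-ind (p ∣? d) * f d)
  second d with p ∣? d
  ... | yes _ = trans (cong (ind (d ∣? n) *_) (ℤP.*-zeroˡ (f d))) (trans (ℤP.*-zeroʳ (ind (d ∣? n)))
                  (sym (trans (cong (ind (d ∣? e) *_) (ℤP.*-zeroˡ (f d))) (ℤP.*-zeroʳ (ind (d ∣? e))))))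
  ... | no p∤d = cong (_* (1ℤ * f d)) (ind-⇔ (d ∣? n) (d ∣? e) to from)
    where
    from : d ∣ e → d ∣ n
    from h = ∣P.∣-trans h (subst (e ∣_) (cofactor 2≤n) (∣P.m∣m*n p))
    to : d ∣ n → d ∣ e
    to (divides k n≡kd) with euclidsLemma k d (lpf-prime 2≤n) (subst (p ∣_) n≡kd (lpf∣ 2≤n))
    ... | inj₂ p∣d = ⊥-elim (p∤d p∣d)
    ... | inj₁ (divides k′ refl) = divides k′ (ℕP.*-cancelʳ-≡ e (k′ ℕ.* d) p {{ℕ.>-nonZero (1≤lpf 2≤n)}}
        (trans (cofactor 2≤n) (trans n≡kd (trans (ℕP.*-assoc k′ p d) (trans (cong (k′ ℕ.*_) (ℕP.*-comm p d)) (sym (ℕP.*-assoc k′ d p)))))))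

dsum-μ-lemma : ∀ a b → a * - b + a * b ≡ 0ℤ
dsum-μ-lemma a b = solve (a ∷ b ∷ [])

module Möbius where
  open Recursion (λ p e v → not-ind (p ∣? e) * - v) 1ℤ public renaming (fun to μ; unfold to μ-unfold; at-multiple to μ-at-multiple)

  dsum-μ-1 : dsum μ 1 ≡ 1ℤ
  dsum-μ-1 = refl

  -- In `dsum-lpf` the terms at c p and at c cancel when p does not divide c, and both are zero when
  -- it does.
  dsum-μ : ∀ n → 2 ℕ.≤ n → dsum μ n ≡ 0ℤ
  dsum-μ n 2≤n = trans (dsum-lpf μ 2≤n) (S-zero (n ÷ lpf n) (λ c 1≤c _ → vanish c 1≤c))
    where
    vanish : ∀ c → 1 ℕ.≤ c →
      ind (c ∣? n ÷ lpf n) * (μ (c ℕ.* lpf n) + not-ind (lpf n ∣? c) * μ c) ≡ 0ℤ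
    vanish c 1≤c with c ∣? n ÷ lpf n
    ... | no _ = ℤP.*-zeroˡ (μ (c ℕ.* lpf n) + not-ind (lpf n ∣? c) * μ c)
    ... | yes c∣e = trans (ℤP.*-identityˡ _) (trans (cong (_+ not-ind (lpf n ∣? c) * μ c) (μ-at-multiple 2≤n 1≤c c∣e))
        (by (dsum-μ-lemma (not-ind (lpf n ∣? c)) (μ c))))

  μ-⊴1 : ∀ n → μ n ⊴ 1ℤ
  μ-⊴1 n = bound n n
    where
    step : ∀ {P : Set} (d : Dec P) v → v ⊴ 1ℤ → not-ind d * - v ⊴ 1ℤ
    step (yes _) v _ = -≤+ , +≤+ z≤n
    step (no _) v h = subst (_⊴ 1ℤ) (sym (ℤP.*-identityˡ (- v))) (⊴-neg h)
    bound : ∀ f n → rec f n ⊴ 1ℤ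
    bound zero n = -≤+ , ℤP.≤-refl
    bound (suc f) n with 2 ℕP.≤? n
    ... | yes _ = step (lpf n ∣? n ÷ lpf n) (rec f (n ÷ lpf n)) (bound f (n ÷ lpf n))
    ... | no _ = -≤+ , ℤP.≤-refl

lemma-rearrange : ∀ a b i o w → a * b + o * (i * w) + o * b ≡ (a + o) * b + o * i * w
lemma-rearrange a b i o w = solve (a ∷ b ∷ i ∷ o ∷ w ∷ [])

L-lpf-one : ∀ a → a + (1ℤ - a) ≡ 1ℤ
L-lpf-one a = solve (a ∷ [])

-- `Λ` takes the value w p at every power of p and 0 elsewhere: the von Mangoldt function with an
-- arbitrary weight in place of log p. Its divisor sum `L` is the completely additive function with
-- these values at the primes.
module Additive (w : ℕ → ℤ) where
  open Recursion (λ p e v → ind (p ∣? e) * v + not-ind (p ∣? e) * (ind (e ℕP.≟ 1) * w p)) 0ℤ public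
    renaming (fun to Λ; unfold to Λ-unfold; at-multiple to Λ-at-multiple)

  L : ℕ → ℤ
  L = dsum Λ

  ind1-sum : ∀ e (c : ℤ) → 1 ℕ.≤ e → S (λ i → ind (i ℕP.≟ 1) * c) e ≡ c
  ind1-sum e c 1≤e = trans (S-cut {λ i → ind (i ℕP.≟ 1) * c} 1≤e (λ i 1<i _ → trans (cong (_* c) (ind-no (i ℕP.≟ 1) (λ i≡1 → ℕP.<-irrefl (sym i≡1) 1<i))) (ℤP.*-zeroˡ c)))
    (trans (ℤP.+-identityˡ _) (ℤP.*-identityˡ c))

  -- In `dsum-lpf`, Λ(c p) contributes Λ c when p divides c, and the other summand does so when it
  -- does not; together they make L e. Only c = 1 adds the new term w p.
  L-lpf : ∀ {n} → 2 ℕ.≤ n → L n ≡ L (n ÷ lpf n) + w (lpf n)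
  L-lpf {n} 2≤n = trans (dsum-lpf Λ 2≤n) (trans (S-cong e (λ c 1≤c _ → term c 1≤c))
      (trans (S-+ {λ c → ind (c ∣? e) * Λ c} {λ c → ind (c ℕP.≟ 1) * w p} e) (cong (_+_ (L e)) (ind1-sum e (w p) (1≤cofactor 2≤n)))))
    where
    p e : ℕ
    p = lpf n
    e = n ÷ p
    lemma : ∀ a b i o w → o * i ≡ i → a * b + o * (i * w) + o * b ≡ (a + o) * b + i * w
    lemma a b i o w h = trans (lemma-rearrange a b i o w) (cong (λ z → (a + o) * b + z * w) h)
    p∤1 : ∀ c → not-ind (p ∣? c) * ind (c ℕP.≟ 1) ≡ ind (c ℕP.≟ 1)
    p∤1 c with c ℕP.≟ 1
    ... | no _ = ℤP.*-zeroʳ (not-ind (p ∣? c))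
    ... | yes refl = trans (ℤP.*-identityʳ (not-ind (p ∣? 1))) (cong (λ z → 1ℤ - z)
          (ind-no (p ∣? 1) (λ p∣1 → ℕP.<⇒≱ (2≤lpf 2≤n) (∣P.∣⇒≤ p∣1))))
    term : ∀ c → 1 ℕ.≤ c → ind (c ∣? e) * (Λ (c ℕ.* p) + not-ind (p ∣? c) * Λ c) ≡ ind (c ∣? e) * Λ c + ind (c ℕP.≟ 1) * w p
    term c 1≤c with c ∣? e
    ... | yes c∣e = trans (ℤP.*-identityˡ _) (trans (cong (_+ not-ind (p ∣? c) * Λ c) (Λ-at-multiple 2≤n 1≤c c∣e))
          (trans (lemma (ind (p ∣? c)) (Λ c) (ind (c ℕP.≟ 1)) (not-ind (p ∣? c)) (w p) (p∤1 c))
            (cong (λ z → z * Λ c + ind (c ℕP.≟ 1) * w p) (by (L-lpf-one (ind (p ∣? c)))))))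
    ... | no c∤e = trans (ℤP.*-zeroˡ (Λ (c ℕ.* p) + not-ind (p ∣? c) * Λ c)) (sym (cong₂ _+_ (ℤP.*-zeroˡ (Λ c))
          (trans (cong (_* w p) (ind-no (c ℕP.≟ 1) λ { refl → c∤e (∣P.1∣ e) })) (ℤP.*-zeroˡ (w p)))))

-- Completely additive functions and prime powers

<-induction : ∀ {P : ℕ → Set} → (∀ n → (∀ m → m ℕ.< n → P m) → P n) → ∀ n → P n
<-induction {P} step n = below (suc n) n ℕP.≤-refl
  where
  below : ∀ n m → m ℕ.< n → P m
  below (suc n) m (s≤s m≤n) = step m (λ j j<m → below n j (ℕP.<-≤-trans j<m m≤n))

1≤prime : ∀ {p} → Prime p → 1 ℕ.≤ p
1≤prime P = ℕ.>-nonZero⁻¹ _ {{prime⇒nonZero P}}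

2≤prime : ∀ {p} → Prime p → 2 ℕ.≤ p
2≤prime P = ℕ.nonTrivial⇒n>1 _ {{prime⇒nonTrivial P}}

prime∣prime : ∀ {p q} → Prime p → Prime q → p ∣ q → p ≡ q
prime∣prime P Q p∣q with prime⇒irreducible Q p∣q
... | inj₁ refl = ⊥-elim (ℕP.<-irrefl refl (2≤prime P))
... | inj₂ p≡q = p≡q

lpf-of-prime : ∀ {p} → Prime p → lpf p ≡ p
lpf-of-prime P = prime∣prime (lpf-prime (2≤prime P)) P (lpf∣ (2≤prime P))

S-pick : ∀ (f : ℕ → ℤ) {q} → 1 ℕ.≤ q → ∀ m → S (λ p → ind (q ℕP.≟ p) * f p) m ≡ ind (q ℕP.≤? m) * f q
S-pick f {suc q} 1≤q zero = refl
S-pick f {q} 1≤q (suc m) with q ℕP.≟ suc m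
... | yes refl = trans (cong (_+ 1ℤ * f q) (trans (S-pick f 1≤q m) (cong (_* f q) (ind-no (q ℕP.≤? m) (ℕP.<⇒≱ ℕP.≤-refl)))))
      (trans (ℤP.+-identityˡ (1ℤ * f q)) (cong (_* f q) (sym (ind-yes (q ℕP.≤? suc m) ℕP.≤-refl))))
... | no q≢ = trans (cong (_+_ (S (λ p → ind (q ℕP.≟ p) * f p) m)) (ℤP.*-zeroˡ (f (suc m)))) (trans (ℤP.+-identityʳ _)
      (trans (S-pick f 1≤q m) (cong (_* f q) (ind-⇔ (q ℕP.≤? m) (q ℕP.≤? suc m) ℕP.m≤n⇒m≤1+n (λ le → ℕP.≤-pred (ℕP.≤∧≢⇒< le q≢))))))

compare-drop : ∀ l t a → 0ℤ ≤ a → 0ℤ * l + (1ℤ - 0ℤ) * t ≤ t + a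
compare-drop l t a h = lin h (solve (l ∷ t ∷ a ∷ []))

L-^-lemma : ∀ e l → l + e * l ≡ (e + 1ℤ) * l
L-^-lemma e l = solve (e ∷ l ∷ [])

module AdditiveProperties (w : ℕ → ℤ) where
  open Additive w public

  -- `L-lpf` splits off the least prime only. If q = lpf (n p) differs from p, then q divides n, and
  -- the induction hypothesis at n / q allows the two primes to be exchanged.
  L-prime-* : ∀ {p} → Prime p → ∀ n → 1 ℕ.≤ n → L (n ℕ.* p) ≡ L n + w p
  L-prime-* {p} P = <-induction λ n ih 1≤n → step n ih 1≤n
    where
    step : ∀ n → (∀ m → m ℕ.< n → 1 ℕ.≤ m → L (m ℕ.* p) ≡ L m + w p) → 1 ℕ.≤ n → L (n ℕ.* p) ≡ L n + w p
    step n ih 1≤n with lpf (n ℕ.* p) ℕP.≟ p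
    ... | yes q≡p = trans (L-lpf 2≤N) (cong₂ (λ m r → L m + w r) (trans (cong (n ℕ.* p ÷_) q≡p) (*÷ n p (1≤prime P))) q≡p)
      where
      2≤N : 2 ℕ.≤ n ℕ.* p
      2≤N = ℕP.*-mono-≤ 1≤n (2≤prime P)
    ... | no q≢p = begin
        L N                              ≡⟨ L-lpf 2≤N ⟩
        L (N ÷ q) + w q                  ≡⟨ cong (λ m → L m + w q) N÷q ⟩
        L (n ÷ q ℕ.* p) + w q            ≡⟨ cong (_+ w q) (ih (n ÷ q) n÷q<n 1≤n÷q) ⟩
        L (n ÷ q) + w p + w q            ≡⟨ by (+-swapʳ (L (n ÷ q)) (w p) (w q)) ⟩
        L (n ÷ q) + w q + w p            ≡⟨ cong (λ r → L (n ÷ r) + w r + w p) (sym lpf≡) ⟩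
        L (n ÷ lpf n) + w (lpf n) + w p  ≡⟨ cong (_+ w p) (sym (L-lpf 2≤n)) ⟩
        L n + w p                        ∎
      where
      open ≡-Reasoning
      N q : ℕ
      N = n ℕ.* p
      q = lpf N
      2≤N : 2 ℕ.≤ N
      2≤N = ℕP.*-mono-≤ 1≤n (2≤prime P)
      q∣n : q ∣ n
      q∣n with euclidsLemma n p (lpf-prime 2≤N) (lpf∣ 2≤N)
      ... | inj₁ h = h
      ... | inj₂ h = ⊥-elim (q≢p (prime∣prime (lpf-prime 2≤N) P h))
      2≤n : 2 ℕ.≤ n
      2≤n = ℕP.≤-trans (2≤lpf 2≤N) (∣P.∣⇒≤ {{ℕ.>-nonZero 1≤n}} q∣n)
      lpf≡ : lpf n ≡ q
      lpf≡ = lpf-of-divisor 2≤N 2≤n (∣P.m∣m*n p) q∣n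
      1≤n÷q : 1 ℕ.≤ n ÷ q
      1≤n÷q = subst (λ r → 1 ℕ.≤ n ÷ r) lpf≡ (1≤cofactor 2≤n)
      n÷q<n : n ÷ q ℕ.< n
      n÷q<n = subst (λ r → n ÷ r ℕ.< n) lpf≡ (cofactor< 2≤n)
      N÷q : N ÷ q ≡ n ÷ q ℕ.* p
      N÷q = trans (cong (_÷ q) (trans (cong (ℕ._* p) (sym (÷-∣ (1≤lpf 2≤N) q∣n))) (trans (ℕP.*-assoc (n ÷ q) q p)
              (trans (cong (n ÷ q ℕ.*_) (ℕP.*-comm q p)) (sym (ℕP.*-assoc (n ÷ q) p q)))))) (*÷ (n ÷ q ℕ.* p) q (1≤lpf 2≤N))

  L-prime : ∀ {p} → Prime p → L p ≡ w p
  L-prime {p} P = trans (cong L (sym (ℕP.*-identityˡ p))) (trans (L-prime-* P 1 (s≤s z≤n)) (ℤP.+-identityˡ (w p)))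

  L-* : ∀ m n → 1 ℕ.≤ m → 1 ℕ.≤ n → L (m ℕ.* n) ≡ L m + L n
  L-* = <-induction λ m ih n 1≤m 1≤n → step m ih n 1≤m 1≤n
    where
    step : ∀ m → (∀ j → j ℕ.< m → ∀ n → 1 ℕ.≤ j → 1 ℕ.≤ n → L (j ℕ.* n) ≡ L j + L n) →
      ∀ n → 1 ℕ.≤ m → 1 ℕ.≤ n → L (m ℕ.* n) ≡ L m + L n
    step m ih n 1≤m 1≤n with 2 ℕP.≤? m
    ... | no 2≰m = subst (λ m → L (m ℕ.* n) ≡ L m + L n) (ℕP.≤-antisym 1≤m (ℕP.≤-pred (ℕP.≰⇒> 2≰m)))
          (trans (cong L (ℕP.*-identityˡ n)) (sym (ℤP.+-identityˡ (L n))))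
    ... | yes 2≤m = begin
        L (m ℕ.* n)                ≡⟨ cong L (trans (cong (ℕ._* n) (sym (cofactor 2≤m))) (trans (ℕP.*-assoc e q n)
                                       (trans (cong (e ℕ.*_) (ℕP.*-comm q n)) (sym (ℕP.*-assoc e n q))))) ⟩
        L (e ℕ.* n ℕ.* q)          ≡⟨ L-prime-* (lpf-prime 2≤m) (e ℕ.* n) (ℕP.*-mono-≤ (1≤cofactor 2≤m) 1≤n) ⟩
        L (e ℕ.* n) + w q          ≡⟨ cong (_+ w q) (ih e (cofactor< 2≤m) n (1≤cofactor 2≤m) 1≤n) ⟩
        L e + L n + w q            ≡⟨ by (+-swapʳ (L e) (L n) (w q)) ⟩
        L e + w q + L n            ≡⟨ cong (_+ L n) (sym (L-lpf 2≤m)) ⟩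
        L m + L n                  ∎
      where
      open ≡-Reasoning
      q e : ℕ
      q = lpf m
      e = m ÷ q

  L-^ : ∀ m e → 1 ℕ.≤ m → L (m ℕ.^ e) ≡ + e * L m
  L-^ m zero 1≤m = sym (ℤP.*-zeroˡ (L m))
  L-^ m (suc e) 1≤m = trans (L-* m (m ℕ.^ e) 1≤m (ℕP.m^n>0 m {{ℕ.>-nonZero 1≤m}} e))
    (trans (cong (_+_ (L m)) (L-^ m e 1≤m)) (trans (by (L-^-lemma (+ e) (L m))) (cong (_* L m) (sym (+suc e)))))

  ψ : ℕ → ℤ
  ψ = S Λ

  S-L : ∀ x → S L x ≡ (𝟙 ⋆ ψ) x
  S-L x = trans (S-dsum-⋆ Λ x) (sym (⋆-S Λ x))

  Λ-prime : ∀ {p} → Prime p → Λ p ≡ w p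
  Λ-prime {p} P = trans (Λ-unfold (2≤prime P)) (trans (cong₂ (λ q e → ind (q ∣? e) * Λ e + not-ind (q ∣? e) * (ind (e ℕP.≟ 1) * w q)) lpf≡ cof≡)
     (value (ind (p ∣? 1)) (ind-no (p ∣? 1) (λ p∣1 → ℕP.<⇒≱ (2≤prime P) (∣P.∣⇒≤ p∣1)))))
    where
    lpf≡ : lpf p ≡ p
    lpf≡ = lpf-of-prime P
    cof≡ : p ÷ lpf p ≡ 1
    cof≡ = trans (cong₂ _÷_ (sym (ℕP.*-identityˡ p)) lpf≡) (*÷ 1 p (1≤prime P))
    value : ∀ i → i ≡ 0ℤ → i * Λ 1 + (1ℤ - i) * (1ℤ * w p) ≡ w p
    value i refl = trans (ℤP.+-identityˡ _) (trans (ℤP.*-identityˡ _) (ℤP.*-identityˡ _))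

  module _ (w≥0 : ∀ p → 0ℤ ≤ w p) where
    Λ≥0 : ∀ n → 0ℤ ≤ Λ n
    Λ≥0 n = nonneg n n
      where
      0≤not-ind : ∀ {P : Set} (d : Dec P) → 0ℤ ≤ not-ind d
      0≤not-ind (yes _) = 0≤+ 0
      0≤not-ind (no _) = 0≤+ 1
      nonneg : ∀ f n → 0ℤ ≤ rec f n
      nonneg zero n = ℤP.≤-refl
      nonneg (suc f) n with 2 ℕP.≤? n
      ... | yes _ = ind-nonneg (lpf n ∣? (n ÷ lpf n)) ⊠ nonneg f (n ÷ lpf n) ⊞
                    0≤not-ind (lpf n ∣? (n ÷ lpf n)) ⊠ (ind-nonneg ((n ÷ lpf n) ℕP.≟ 1) ⊠ w≥0 (lpf n))
      ... | no _ = ℤP.≤-refl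

    L≥0 : ∀ n → 0ℤ ≤ L n
    L≥0 n = S-nonneg n (λ d _ _ → ind-nonneg (d ∣? n) ⊠ Λ≥0 d)

    -- The restriction of `Λ` to the powers of p, detected by the least prime factor.
    Λ-at : ℕ → ℕ → ℤ
    Λ-at p d = ind (lpf d ℕP.≟ p) * Λ d

    Λ-at≥0 : ∀ p d → 0ℤ ≤ Λ-at p d
    Λ-at≥0 p d = ind-nonneg (lpf d ℕP.≟ p) ⊠ Λ≥0 d

    Λ-at-* : ∀ {p} → Prime p → ∀ c → 1 ℕ.≤ c → Λ-at p (c ℕ.* p) ≤ ind (c ℕP.≟ 1) * w p + Λ-at p c
    Λ-at-* {p} P c 1≤c with lpf (c ℕ.* p) ℕP.≟ p
    ... | no _ = ℤP.≤-trans (ℤP.≤-reflexive (ℤP.*-zeroˡ (Λ (c ℕ.* p)))) (ind-nonneg (c ℕP.≟ 1) ⊠ w≥0 p ⊞ Λ-at≥0 p c)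
    ... | yes q≡p = ℤP.≤-trans (ℤP.≤-reflexive (trans (ℤP.*-identityˡ (Λ (c ℕ.* p))) Λcp)) (compare (p ∣? c))
      where
      2≤cp : 2 ℕ.≤ c ℕ.* p
      2≤cp = ℕP.*-mono-≤ 1≤c (2≤prime P)
      Λcp : Λ (c ℕ.* p) ≡ ind (p ∣? c) * Λ c + not-ind (p ∣? c) * (ind (c ℕP.≟ 1) * w p)
      Λcp = trans (Λ-unfold 2≤cp) (cong₂ (λ q e → ind (q ∣? e) * Λ e + not-ind (q ∣? e) * (ind (e ℕP.≟ 1) * w q)) q≡p
              (trans (cong (c ℕ.* p ÷_) q≡p) (*÷ c p (1≤prime P))))
      compare : (d : Dec (p ∣ c)) → ind d * Λ c + not-ind d * (ind (c ℕP.≟ 1) * w p) ≤ ind (c ℕP.≟ 1) * w p + Λ-at p c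
      compare (yes p∣c) = ℤP.≤-trans (ℤP.≤-reflexive (trans (cong₂ _+_ (cong (_* Λ c) (sym (ind-yes (lpf c ℕP.≟ p) lpf≡))) (ℤP.*-zeroˡ (ind (c ℕP.≟ 1) * w p))) (ℤP.+-identityʳ _)))
          (subst (_≤ ind (c ℕP.≟ 1) * w p + Λ-at p c) (ℤP.+-identityˡ (Λ-at p c)) (ℤP.+-monoˡ-≤ (Λ-at p c) (ind-nonneg (c ℕP.≟ 1) ⊠ w≥0 p)))
        where
        lpf≡ : lpf c ≡ p
        lpf≡ = trans (lpf-of-divisor 2≤cp (ℕP.≤-trans (2≤prime P) (∣P.∣⇒≤ {{ℕ.>-nonZero 1≤c}} p∣c)) (∣P.m∣m*n p) (subst (_∣ c) (sym q≡p) p∣c)) q≡p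
      compare (no _) = compare-drop (Λ c) (ind (c ℕP.≟ 1) * w p) (Λ-at p c) (Λ-at≥0 p c)

    -- The powers of p up to y are p itself and p times the powers of p up to y / p.
    S-Λ-at : ∀ {p} → Prime p → ∀ y → p ℕ.≤ y → S (Λ-at p) y ≤ w p + S (Λ-at p) (y ÷ p)
    S-Λ-at {p} P y p≤y = ℤP.≤-trans (ℤP.≤-reflexive (trans (S-cong y (λ d 1≤d _ → only-multiples d 1≤d)) (S-multiples (Λ-at p) p (1≤prime P) y)))
        (ℤP.≤-trans (S-mono (y ÷ p) (λ c 1≤c _ → Λ-at-* P c 1≤c))
          (ℤP.≤-reflexive (trans (S-+ {λ c → ind (c ℕP.≟ 1) * w p} {Λ-at p} (y ÷ p)) (cong (_+ S (Λ-at p) (y ÷ p)) (ind1-sum (y ÷ p) (w p) (÷-pos (1≤prime P) p≤y))))))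
      where
      only-multiples : ∀ d → 1 ℕ.≤ d → Λ-at p d ≡ ind (p ∣? d) * Λ-at p d
      only-multiples d 1≤d with p ∣? d
      ... | yes _ = sym (ℤP.*-identityˡ (Λ-at p d))
      ... | no p∤d with 2 ℕP.≤? d
      ...   | yes 2≤d = trans (cong (_* Λ d) (ind-no (lpf d ℕP.≟ p) (λ { refl → p∤d (lpf∣ 2≤d) }))) (trans (ℤP.*-zeroˡ (Λ d)) (sym (ℤP.*-zeroˡ (Λ-at p d))))
      ...   | no 2≰d = trans (trans (cong (λ d → ind (lpf d ℕP.≟ p) * Λ d) (sym 1≡d)) (ℤP.*-zeroʳ (ind (lpf 1 ℕP.≟ p)))) (sym (ℤP.*-zeroˡ (Λ-at p d)))
        where
        1≡d : 1 ≡ d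
        1≡d = ℕP.≤-antisym 1≤d (ℕP.≤-pred (ℕP.≰⇒> 2≰d))

-- A discrete logarithm

-- A scaled logarithm on [1 , X]: K plays the role of 1, k n of 1/n and L n of log n.
-- The two bounds say |L (n+1) - L n - k (n+1)| ≤ 2 (k n - k (n+1)) up to a harmless k n - k (n+1).
record Logarithm (X : ℕ) : Set where
  field
    K : ℤ
    k w : ℕ → ℤ
    1≤K : 1ℤ ≤ K
    k-spec : ∀ n → 1 ℕ.≤ n → n ℕ.≤ X → + n * k n ≡ K
    w≥0 : ∀ p → 0ℤ ≤ w p
  open AdditiveProperties w public using (L)
  field
    step-lo : ∀ n → 1 ℕ.≤ n → n ℕ.< X → + 2 * k (suc n) - k n ≤ L (suc n) - L n
    step-hi : ∀ n → 1 ℕ.≤ n → n ℕ.< X → L (suc n) - L n ≤ + 2 * k n - k (suc n)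

*-cancel : ∀ {n} (a b : ℤ) → 1 ℕ.≤ n → + n * a ≡ + n * b → a ≡ b
*-cancel {suc n} a b _ = ℤP.*-cancelˡ-≡ (+ suc n) a b

*-cancel-≤ : ∀ {n} (a b : ℤ) → 1 ℕ.≤ n → + n * a ≤ + n * b → a ≤ b
*-cancel-≤ {suc n} a b _ h = ℤP.*-cancelˡ-≤-pos a b (+ suc n) h

≤-ℤ : ∀ {m n} → m ℕ.≤ n → + m ≤ + n
≤-ℤ p = +≤+ p

w1-zeros : ∀ a → a - a - 0ℤ ≡ 0ℤ
w1-zeros a = solve (a ∷ [])

step-lo2 : ∀ wn we wp Ln Le → 0ℤ ≤ wn - we - wp → 0ℤ ≤ we - Le → Ln ≡ Le + wp → 0ℤ ≤ wn - Ln
step-lo2 wn we wp .(Le + wp) Le p q refl = lin (p ⊞ q) (solve (wn ∷ we ∷ wp ∷ Le ∷ []))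

step-hi2 : ∀ wn we wp Ln Le kM e n → wn - we - wp ≤ kM → we - Le ≤ e * kM → Ln ≡ Le + wp → 0ℤ ≤ kM → e + 1ℤ ≤ n → wn - Ln ≤ n * kM
step-hi2 wn we wp .(Le + wp) Le kM e n p q refl r s = lin (sub p ⊞ sub q ⊞ sub s ⊠ r) (solve (wn ∷ we ∷ wp ∷ Le ∷ kM ∷ e ∷ n ∷ []))

k-*-lemma : ∀ i m c → i * (m * c) ≡ m * i * c
k-*-lemma i m c = solve (i ∷ m ∷ c ∷ [])

const-between-lemma : ∀ c m u → (c + m) * u - c * u ≡ m * u
const-between-lemma c m u = solve (c ∷ m ∷ u ∷ [])

dilate-zeros : ∀ a b → 0ℤ ≡ a - a - (b - b)
dilate-zeros a b = solve (a ∷ b ∷ [])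

dilate-zeros′ : ∀ a b c → a - a - (b - b) ≡ c - c
dilate-zeros′ a b c = solve (a ∷ b ∷ c ∷ [])

dilate-lo : ∀ a b c d e f → 0ℤ ≤ c - a - (d - b) → f ≤ e - c → 0ℤ ≤ e - a - (d + f - b)
dilate-lo a b c d e f p q = lin (p ⊞ sub q) (solve (a ∷ b ∷ c ∷ d ∷ e ∷ f ∷ []))

dilate-hi : ∀ a b c d e f g h → c - a - (d - b) ≤ g - h → e - c ≤ h → e - a - (d + f - b) ≤ g - f
dilate-hi a b c d e f g h p q = lin (sub p ⊞ sub q) (solve (a ∷ b ∷ c ∷ d ∷ e ∷ f ∷ g ∷ h ∷ []))

w-*-drop : ∀ a b → b ≡ a - (a - b)
w-*-drop a b = solve (a ∷ b ∷ [])

w-*-shape : ∀ a b c d → a - d - (b - d) - (c - d) ≡ a - b - (c - d)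
w-*-shape a b c d = solve (a ∷ b ∷ c ∷ d ∷ [])

gap-lemma₁ : ∀ K n → K ≡ (n + 1ℤ) * K - n * K
gap-lemma₁ K n = solve (K ∷ n ∷ [])

gap-lemma₂ : ∀ n a b → (n + 1ℤ) * (n * a) - n * ((n + 1ℤ) * b) ≡ n * (n + 1ℤ) * (a - b)
gap-lemma₂ n a b = solve (n ∷ a ∷ b ∷ [])

w-step-shape : ∀ a b c → a - c - (b - c) ≡ a - b
w-step-shape a b c = solve (a ∷ b ∷ c ∷ [])

step-lo-core : ∀ L' L w' w k k' g → k' ≤ w' - w → 0ℤ ≤ w - L → w' - L' ≤ g → g ≤ k - k' → + 2 * k' - k ≤ L' - L
step-lo-core L' L w' w k k' g p q r s = lin (sub p ⊞ q ⊞ sub r ⊞ sub s) (solve (L' ∷ L ∷ w' ∷ w ∷ k ∷ k' ∷ g ∷ []))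

step-hi-core : ∀ L' L w' w k k' g g' → w' - w ≤ k → 0ℤ ≤ w' - L' → w - L ≤ g → g ≤ g' → g' ≤ k - k' → L' - L ≤ + 2 * k - k'
step-hi-core L' L w' w k k' g g' p q r s t = lin (sub p ⊞ q ⊞ sub r ⊞ sub s ⊞ sub t) (solve (L' ∷ L ∷ w' ∷ w ∷ k ∷ k' ∷ g ∷ g' ∷ []))

-- K log n is approximated by the harmonic sum over (M , n M]. The larger M, the closer this is to
-- being additive: the defect is at most K / M, and M = X³ makes it negligible even after n prime
-- factors. Since N = X M, the choice K = N! keeps all the reciprocals integral.
module LogConstruction (X : ℕ) (1≤X : 1 ℕ.≤ X) where

  M N : ℕ
  M = X ℕ.* X ℕ.* X
  N = X ℕ.* M

  1≤M : 1 ℕ.≤ M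
  1≤M = ℕP.*-mono-≤ (ℕP.*-mono-≤ 1≤X 1≤X) 1≤X

  K : ℤ
  K = + (N !)

  k H : ℕ → ℤ
  k i = + (N ! ÷ i)
  H = S k

  ∣N! : ∀ i → 1 ℕ.≤ i → i ℕ.≤ N → i ∣ N !
  ∣N! (suc i) _ i≤N = ∣P.∣-trans (∣P.m∣m*n (i !)) (∣P.m≤n⇒m!∣n! i≤N)

  k-spec : ∀ i → 1 ℕ.≤ i → i ℕ.≤ N → + i * k i ≡ K
  k-spec i 1≤i i≤N = trans (sym (ℤP.pos-* i (N ! ÷ i))) (cong +_ (trans (ℕP.*-comm i (N ! ÷ i)) (÷-∣ 1≤i (∣N! i 1≤i i≤N))))

  k≥0 : ∀ i → 0ℤ ≤ k i
  k≥0 i = 0≤+ (N ! ÷ i)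

  k-anti : ∀ {a b} → 1 ℕ.≤ a → a ℕ.≤ b → k b ≤ k a
  k-anti 1≤a a≤b = ≤-ℤ (÷-antimono 1≤a a≤b)

  k-* : ∀ m i → 1 ℕ.≤ m → 1 ℕ.≤ i → m ℕ.* i ℕ.≤ N → + m * k (m ℕ.* i) ≡ k i
  k-* m i 1≤m 1≤i mi≤N = *-cancel {i} (+ m * k (m ℕ.* i)) (k i) 1≤i (begin
      + i * (+ m * k (m ℕ.* i))    ≡⟨ by (k-*-lemma (+ i) (+ m) (k (m ℕ.* i))) ⟩
      + m * + i * k (m ℕ.* i)      ≡⟨ cong (_* k (m ℕ.* i)) (sym (ℤP.pos-* m i)) ⟩
      + (m ℕ.* i) * k (m ℕ.* i)    ≡⟨ k-spec (m ℕ.* i) (ℕP.*-mono-≤ 1≤m 1≤i) mi≤N ⟩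
      K                            ≡⟨ sym (k-spec i 1≤i (ℕP.≤-trans (ℕP.≤-trans (ℕP.≤-reflexive (sym (ℕP.*-identityˡ i))) (ℕP.*-monoˡ-≤ i 1≤m)) mi≤N)) ⟩
      + i * k i                    ∎)
    where
    open ≡-Reasoning

  const-between : ∀ c m u → S (λ _ → u) (c ℕ.+ m) - S (λ _ → u) c ≡ + m * u
  const-between c m u = trans (cong₂ _-_ (trans (S-const u (c ℕ.+ m)) (cong (_* u) (ℤP.pos-+ c m))) (S-const u c)) (by (const-between-lemma (+ c) (+ m) u))

  block-lo : ∀ m i → 1 ℕ.≤ m → 1 ℕ.≤ i → m ℕ.* suc i ℕ.≤ N → k (suc i) ≤ H (m ℕ.* suc i) - H (m ℕ.* i)
  block-lo m i 1≤m 1≤i h = subst₂ (λ a b → a ≤ H b - H (m ℕ.* i)) (trans (const-between (m ℕ.* i) m (k (m ℕ.* suc i))) (k-* m (suc i) 1≤m (s≤s z≤n) h)) (sym eq)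
      (S-mono-between {λ _ → k (m ℕ.* suc i)} {k} (ℕP.m≤m+n (m ℕ.* i) m) (λ j lo hi → k-anti (ℕP.≤-trans (s≤s z≤n) lo) (ℕP.≤-trans hi (ℕP.≤-reflexive (sym eq)))))
    where
    eq : m ℕ.* suc i ≡ m ℕ.* i ℕ.+ m
    eq = trans (ℕP.*-suc m i) (ℕP.+-comm m (m ℕ.* i))

  block-hi : ∀ m i → 1 ℕ.≤ m → 1 ℕ.≤ i → m ℕ.* suc i ℕ.≤ N → H (m ℕ.* suc i) - H (m ℕ.* i) ≤ k i
  block-hi m i 1≤m 1≤i h = subst₂ (λ a b → H b - H (m ℕ.* i) ≤ a) (trans (const-between (m ℕ.* i) m (k (m ℕ.* i))) (k-* m i 1≤m 1≤i (ℕP.≤-trans (ℕP.*-monoʳ-≤ m (ℕP.n≤1+n i)) h))) (sym eq)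
      (S-mono-between {k} {λ _ → k (m ℕ.* i)} (ℕP.m≤m+n (m ℕ.* i) m) (λ j lo hi → k-anti (ℕP.*-mono-≤ 1≤m 1≤i) (ℕP.<⇒≤ lo)))
    where
    eq : m ℕ.* suc i ≡ m ℕ.* i ℕ.+ m
    eq = trans (ℕP.*-suc m i) (ℕP.+-comm m (m ℕ.* i))

  -- The m terms of H between m i and m (i + 1) add up to something between k (i + 1) and k i, so
  -- the error for each i is at most k i - k (i + 1), and these errors telescope.
  dilate : ∀ m A n → 1 ℕ.≤ m → 1 ℕ.≤ A → m ℕ.* (A ℕ.+ n) ℕ.≤ N →
    let B = A ℕ.+ n; δ = H (m ℕ.* B) - H (m ℕ.* A) - (H B - H A) in 0ℤ ≤ δ × δ ≤ k A - k B
  dilate m A zero 1≤m 1≤A h rewrite ℕP.+-identityʳ A =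
    ℤP.≤-reflexive (by (dilate-zeros (H (m ℕ.* A)) (H A) )) , ℤP.≤-reflexive (by (dilate-zeros′ (H (m ℕ.* A)) (H A) (k A)))
  dilate m A (suc n) 1≤m 1≤A h rewrite ℕP.+-suc A n =
      dilate-lo (H (m ℕ.* A)) (H A) (H (m ℕ.* B)) (H B) (H (m ℕ.* suc B)) (k (suc B)) (proj₁ ih) (block-lo m B 1≤m 1≤B h)
    , dilate-hi (H (m ℕ.* A)) (H A) (H (m ℕ.* B)) (H B) (H (m ℕ.* suc B)) (k (suc B)) (k A) (k B) (proj₂ ih) (block-hi m B 1≤m 1≤B h)
    where
    B : ℕ
    B = A ℕ.+ n
    1≤B : 1 ℕ.≤ B
    1≤B = ℕP.≤-trans 1≤A (ℕP.m≤m+n A n)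
    ih : 0ℤ ≤ H (m ℕ.* B) - H (m ℕ.* A) - (H B - H A) × H (m ℕ.* B) - H (m ℕ.* A) - (H B - H A) ≤ k A - k B
    ih = dilate m A n 1≤m 1≤A (ℕP.≤-trans (ℕP.*-monoʳ-≤ m (ℕP.n≤1+n B)) h)

  -- Written with n ∸ 1 so that nonnegativity needs no exception at 0.
  w : ℕ → ℤ
  w n = H (M ℕ.+ (n ℕ.∸ 1) ℕ.* M) - H M

  w-eq : ∀ n → 1 ℕ.≤ n → w n ≡ H (n ℕ.* M) - H M
  w-eq (suc n) _ = refl

  w≥0 : ∀ n → 0ℤ ≤ w n
  w≥0 n = sub (S-mono-len {k} (ℕP.m≤m+n M ((n ℕ.∸ 1) ℕ.* M)) (λ i _ _ → k≥0 i))

  open AdditiveProperties w using (L; L-lpf)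

  w-* : ∀ m n → 1 ℕ.≤ m → 1 ℕ.≤ n → m ℕ.* n ℕ.≤ X → 0ℤ ≤ w (m ℕ.* n) - w m - w n × w (m ℕ.* n) - w m - w n ≤ k M
  w-* m n@(suc n') 1≤m 1≤n mn≤X = subst (λ d → 0ℤ ≤ d × d ≤ k M) (sym eq)
      (proj₁ bound , ℤP.≤-trans (proj₂ bound) (lin (k≥0 (M ℕ.+ n' ℕ.* M)) (by (w-*-drop (k M) (k (M ℕ.+ n' ℕ.* M))))))
    where
    bound : 0ℤ ≤ H (m ℕ.* (n ℕ.* M)) - H (m ℕ.* M) - (H (n ℕ.* M) - H M) × H (m ℕ.* (n ℕ.* M)) - H (m ℕ.* M) - (H (n ℕ.* M) - H M) ≤ k M - k (n ℕ.* M)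
    bound = dilate m M (n' ℕ.* M) 1≤m 1≤M (ℕP.≤-trans (ℕP.≤-reflexive (sym (ℕP.*-assoc m n M))) (ℕP.*-monoˡ-≤ M mn≤X))
    eq : w (m ℕ.* n) - w m - w n ≡ H (m ℕ.* (n ℕ.* M)) - H (m ℕ.* M) - (H (n ℕ.* M) - H M)
    eq = trans (cong₂ (λ a b → a - b - w n) (trans (w-eq (m ℕ.* n) (ℕP.*-mono-≤ 1≤m 1≤n)) (cong (λ j → H j - H M) (ℕP.*-assoc m n M))) (w-eq m 1≤m))
          (by (w-*-shape (H (m ℕ.* (n ℕ.* M))) (H (m ℕ.* M)) (H (n ℕ.* M)) (H M)))

  -- `w` is superadditive with defect at most k M, and n has fewer than n prime factors to split
  -- off.
  L-near-w : ∀ n → 1 ℕ.≤ n → n ℕ.≤ X → 0ℤ ≤ w n - L n × w n - L n ≤ + n * k M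
  L-near-w = <-induction λ n ih 1≤n n≤X → step n ih 1≤n n≤X
    where
    step : ∀ n → (∀ m → m ℕ.< n → 1 ℕ.≤ m → m ℕ.≤ X → 0ℤ ≤ w m - L m × w m - L m ≤ + m * k M) →
      1 ℕ.≤ n → n ℕ.≤ X → 0ℤ ≤ w n - L n × w n - L n ≤ + n * k M
    step n ih 1≤n n≤X with 2 ℕP.≤? n
    ... | no 2≰n = subst (λ n → 0ℤ ≤ w n - L n × w n - L n ≤ + n * k M) (ℕP.≤-antisym 1≤n (ℕP.≤-pred (ℕP.≰⇒> 2≰n)))
          (ℤP.≤-reflexive (sym w1) , ℤP.≤-trans (ℤP.≤-reflexive w1) (1 · k≥0 M))
      where
      w1 : w 1 - L 1 ≡ 0ℤ
      w1 = trans (cong (λ j → H j - H M - 0ℤ) (ℕP.+-identityʳ M)) (by (w1-zeros (H M)))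
    ... | yes 2≤n = step-lo2 (w n) (w e) (w p) (L n) (L e) (proj₁ add) (proj₁ near) (L-lpf 2≤n)
          , step-hi2 (w n) (w e) (w p) (L n) (L e) (k M) (+ e) (+ n) (proj₂ add) (proj₂ near) (L-lpf 2≤n) (k≥0 M)
              (subst (_≤ + n) (+suc e) (≤-ℤ (cofactor< 2≤n)))
      where
      p e : ℕ
      p = lpf n
      e = n ÷ p
      near : 0ℤ ≤ w e - L e × w e - L e ≤ + e * k M
      near = ih e (cofactor< 2≤n) (1≤cofactor 2≤n) (ℕP.≤-trans (÷-≤ n p) n≤X)
      add : 0ℤ ≤ w n - w e - w p × w n - w e - w p ≤ k M
      add = subst (λ j → 0ℤ ≤ w j - w e - w p × w j - w e - w p ≤ k M) (cofactor 2≤n)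
              (w-* e p (1≤cofactor 2≤n) (1≤lpf 2≤n) (ℕP.≤-trans (ℕP.≤-reflexive (cofactor 2≤n)) n≤X))

  -- k n - k (n+1) = K / (n (n+1)) dominates the error because (n+1)³ ≤ M.
  gap : ∀ n → 1 ℕ.≤ n → n ℕ.< X → + suc n * k M ≤ k n - k (suc n)
  gap n 1≤n n<X = *-cancel-≤ {n ℕ.* suc n} _ _ (ℕP.*-mono-≤ 1≤n (s≤s z≤n)) (begin
      + (n ℕ.* suc n) * (+ suc n * k M)        ≡⟨ trans (sym (ℤP.*-assoc (+ (n ℕ.* suc n)) (+ suc n) (k M))) (cong (_* k M) (sym (ℤP.pos-* (n ℕ.* suc n) (suc n)))) ⟩
      + (n ℕ.* suc n ℕ.* suc n) * k M          ≤⟨ ℤP.*-monoʳ-≤-nonNeg (k M) (≤-ℤ (ℕP.*-mono-≤ (ℕP.*-mono-≤ (ℕP.<⇒≤ n<X) n<X) n<X)) ⟩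
      + M * k M                                ≡⟨ k-spec M 1≤M (ℕP.≤-trans (ℕP.≤-reflexive (sym (ℕP.*-identityˡ M))) (ℕP.*-monoˡ-≤ M 1≤X)) ⟩
      K                                        ≡⟨ by (gap-lemma₁ K (+ n)) ⟩
      (+ n + 1ℤ) * K - + n * K                 ≡⟨ cong₂ (λ a b → (+ n + 1ℤ) * a - + n * b) (sym (k-spec n 1≤n n≤N)) (sym (k-spec (suc n) (s≤s z≤n) sn≤N)) ⟩
      (+ n + 1ℤ) * (+ n * k n) - + n * (+ suc n * k (suc n)) ≡⟨ cong (λ z → (+ n + 1ℤ) * (+ n * k n) - + n * (z * k (suc n))) (+suc n) ⟩
      (+ n + 1ℤ) * (+ n * k n) - + n * ((+ n + 1ℤ) * k (suc n)) ≡⟨ by (gap-lemma₂ (+ n) (k n) (k (suc n))) ⟩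
      + n * (+ n + 1ℤ) * (k n - k (suc n))     ≡⟨ cong (_* (k n - k (suc n))) (trans (cong (+ n *_) (sym (+suc n))) (sym (ℤP.pos-* n (suc n)))) ⟩
      + (n ℕ.* suc n) * (k n - k (suc n))      ∎)
    where
    open ℤP.≤-Reasoning
    sn≤N : suc n ℕ.≤ N
    sn≤N = ℕP.≤-trans n<X (ℕP.≤-trans (ℕP.≤-reflexive (sym (ℕP.*-identityʳ X))) (ℕP.*-monoʳ-≤ X 1≤M))
    n≤N : n ℕ.≤ N
    n≤N = ℕP.≤-trans (ℕP.n≤1+n n) sn≤N

  w-step : ∀ n → 1 ℕ.≤ n → n ℕ.< X → k (suc n) ≤ w (suc n) - w n × w (suc n) - w n ≤ k n
  w-step n 1≤n n<X = subst (k (suc n) ≤_) (sym eq) (block-lo M n 1≤M 1≤n le) , subst (_≤ k n) (sym eq) (block-hi M n 1≤M 1≤n le)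
    where
    le : M ℕ.* suc n ℕ.≤ N
    le = ℕP.≤-trans (ℕP.≤-reflexive (ℕP.*-comm M (suc n))) (ℕP.*-monoˡ-≤ M n<X)
    eq : w (suc n) - w n ≡ H (M ℕ.* suc n) - H (M ℕ.* n)
    eq = trans (cong (λ z → w (suc n) - z) (w-eq n 1≤n)) (trans (by (w-step-shape (H (suc n ℕ.* M)) (H (n ℕ.* M)) (H M)))
      (cong₂ (λ a b → H a - H b) (ℕP.*-comm (suc n) M) (ℕP.*-comm n M)))

  step-lo : ∀ n → 1 ℕ.≤ n → n ℕ.< X → + 2 * k (suc n) - k n ≤ L (suc n) - L n
  step-lo n 1≤n n<X = step-lo-core (L (suc n)) (L n) (w (suc n)) (w n) (k n) (k (suc n)) (+ suc n * k M) (proj₁ (w-step n 1≤n n<X)) (proj₁ (L-near-w n 1≤n (ℕP.<⇒≤ n<X)))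
     (proj₂ (L-near-w (suc n) (s≤s z≤n) n<X)) (gap n 1≤n n<X)

  step-hi : ∀ n → 1 ℕ.≤ n → n ℕ.< X → L (suc n) - L n ≤ + 2 * k n - k (suc n)
  step-hi n 1≤n n<X = step-hi-core (L (suc n)) (L n) (w (suc n)) (w n) (k n) (k (suc n)) (+ n * k M) (+ suc n * k M) (proj₂ (w-step n 1≤n n<X)) (proj₁ (L-near-w (suc n) (s≤s z≤n) n<X))
     (proj₂ (L-near-w n 1≤n (ℕP.<⇒≤ n<X))) (ℤP.*-monoʳ-≤-nonNeg (k M) (≤-ℤ (ℕP.n≤1+n n))) (gap n 1≤n n<X)

opaque
  log : ∀ X → 1 ℕ.≤ X → Logarithm X
  log X 1≤X = record
    { K = K ; k = k ; w = w ; 1≤K = ≤-ℤ (ℕP.1≤n! N) ; k-spec = λ n 1≤n n≤X → k-spec n 1≤n (ℕP.≤-trans n≤X X≤N)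
    ; w≥0 = w≥0 ; step-lo = step-lo ; step-hi = step-hi }
    where
    open LogConstruction X 1≤X
    X≤N : X ℕ.≤ N
    X≤N = ℕP.≤-trans (ℕP.≤-reflexive (sym (ℕP.*-identityʳ X))) (ℕP.*-monoʳ-≤ X 1≤M)

-- Counting lattice points and summing over scales

square-double : ∀ n → 1 ℕ.≤ n → suc n ℕ.* suc n ℕ.≤ 4 ℕ.* (n ℕ.* n)
square-double n 1≤n = ℕP.≤-trans (ℕP.*-mono-≤ le le) (ℕP.≤-reflexive (trans (ℕP.*-assoc 2 n (2 ℕ.* n)) (trans (cong (2 ℕ.*_) (trans (sym (ℕP.*-assoc n 2 n)) (trans (cong (ℕ._* n) (ℕP.*-comm n 2)) (ℕP.*-assoc 2 n n)))) (sym (ℕP.*-assoc 2 2 (n ℕ.* n))))))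
  where
  le : suc n ℕ.≤ 2 ℕ.* n
  le = subst (suc n ℕ.≤_) (cong (n ℕ.+_) (sym (ℕP.+-identityʳ n))) (ℕP.+-monoˡ-≤ n 1≤n)

isqrt : ∀ y → Σ ℕ λ v → v ℕ.* v ℕ.≤ y × y ℕ.< suc v ℕ.* suc v
isqrt zero = 0 , z≤n , s≤s z≤n
isqrt (suc y) with isqrt y
... | v , lo , hi with suc v ℕ.* suc v ℕP.≤? suc y
...   | yes p = suc v , p , ℕP.≤-<-trans hi (ℕP.*-mono-< (ℕP.n<1+n (suc v)) (ℕP.n<1+n (suc v)))
...   | no p = v , ℕP.m≤n⇒m≤1+n lo , ℕP.≰⇒> p

S-count : ∀ {c n} → c ℕ.≤ n → S (λ i → ind (i ℕP.≤? c)) n ≡ + c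
S-count {c} {n} c≤n = trans (S-cut c≤n (λ i c<i _ → ind-no (i ℕP.≤? c) (ℕP.<⇒≱ c<i)))
  (trans (S-cong c (λ i _ i≤c → ind-yes (i ℕP.≤? c) i≤c)) (trans (S-const 1ℤ c) (ℤP.*-identityʳ (+ c))))

S-count-all : ∀ {c n} → n ℕ.≤ c → S (λ i → ind (i ℕP.≤? c)) n ≡ + n
S-count-all {c} {n} n≤c = trans (S-cong n (λ i _ i≤n → ind-yes (i ℕP.≤? c) (ℕP.≤-trans i≤n n≤c))) (trans (S-const 1ℤ n) (ℤP.*-identityʳ (+ n)))

S-cong-between : ∀ {f g : ℕ → ℤ} {m n} → m ℕ.≤ n → (∀ i → m ℕ.< i → i ℕ.≤ n → f i ≡ g i) → S f n - S f m ≡ S g n - S g m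
S-cong-between m≤n h = ℤP.≤-antisym (S-mono-between m≤n (λ i p q → ℤP.≤-reflexive (h i p q))) (S-mono-between m≤n (λ i p q → ℤP.≤-reflexive (sym (h i p q))))

core-s₁3 : ∀ a b → a ≡ a - b + b
core-s₁3 a b = solve (a ∷ b ∷ [])

core-s₂3 : ∀ a b → a - b + a ≡ + 2 * a - b
core-s₂3 a b = solve (a ∷ b ∷ [])

-- Dirichlet's hyperbola method: of two numbers with product at most y < (v + 1)², one is at most v,
-- and the pairs with both at most v fill a square.
hyperbola : ∀ y v → v ℕ.* v ℕ.≤ y → y ℕ.< suc v ℕ.* suc v → 1 ℕ.≤ v →
  S (λ a → + (y ÷ a)) y ≡ + 2 * S (λ a → + (y ÷ a)) v - + v * + v
hyperbola y v lo hi 1≤v = core (S f y) (S f v) (S F y) (S F v) (+ v * + v)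
    (S-cong-between v≤y (λ a v<a a≤y → sym (S-count (small a v<a)))) F-y F-v
  where
  f F : ℕ → ℤ
  f a = + (y ÷ a)
  F a = S (λ b → ind (b ℕP.≤? y ÷ a)) v
  v≤y : v ℕ.≤ y
  v≤y = ℕP.≤-trans (ℕP.≤-trans (ℕP.≤-reflexive (sym (ℕP.*-identityʳ v))) (ℕP.*-monoʳ-≤ v 1≤v)) lo
  small : ∀ a → v ℕ.< a → y ÷ a ℕ.≤ v
  small a v<a = ℕP.≮⇒≥ λ v<q → ℕP.<-irrefl refl (ℕP.<-≤-trans hi (ℕP.≤-trans (ℕP.*-mono-≤ v<q v<a) (÷-* y a)))
  flip : ∀ {a b} → 1 ℕ.≤ a → 1 ℕ.≤ b → b ℕ.≤ y ÷ a → a ℕ.≤ y ÷ b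
  flip {a} {b} 1≤a 1≤b h = ÷-lub 1≤b (subst (ℕ._≤ y) (ℕP.*-comm b a) (÷-glb {y} {a} h))
  F-y : S F y ≡ S f v
  F-y = trans (S-swap (λ a b → ind (b ℕP.≤? y ÷ a)) v y) (S-cong v (λ b 1≤b _ →
    trans (S-cong y (λ a 1≤a _ → ind-⇔ (b ℕP.≤? y ÷ a) (a ℕP.≤? y ÷ b) (flip 1≤a 1≤b) (flip 1≤b 1≤a))) (S-count (÷-≤ y b))))
  F-v : S F v ≡ + v * + v
  F-v = trans (S-cong v (λ a 1≤a a≤v → S-count-all (÷-lub 1≤a (ℕP.≤-trans (ℕP.*-monoʳ-≤ v a≤v) lo)))) (S-const (+ v) v)
  core : ∀ fy fv Fy Fv q → fy - fv ≡ Fy - Fv → Fy ≡ fv → Fv ≡ q → fy ≡ + 2 * fv - q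
  core fy fv Fy Fv q e refl refl = trans (core-s₁3 fy fv) (trans (cong (_+ fv) e) (core-s₂3 fv Fv))

4^≡ : ∀ n → 4 ℕ.^ n ≡ 2 ℕ.^ n ℕ.* 2 ℕ.^ n
4^≡ n = trans (ℕP.^-*-assoc 2 2 n) (trans (cong (λ m → 2 ℕ.^ (n ℕ.+ m)) (ℕP.+-identityʳ n)) (ℕP.^-distribˡ-+-* 2 n n))

pos-cancel : ∀ {l a b} → 1ℤ ≤ l → l * a ≤ l * b → a ≤ b
pos-cancel {+[1+ n ]} {a} {b} _ h = ℤP.*-cancelˡ-≤-pos a b +[1+ n ] h
pos-cancel {+ zero} (+≤+ ())

S-term : ∀ {f : ℕ → ℤ} n → (∀ i → 1 ℕ.≤ i → i ℕ.≤ n → 0ℤ ≤ f i) → ∀ {j} → 1 ℕ.≤ j → j ℕ.≤ n → f j ≤ S f n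
S-term {f} zero h {suc j} 1≤j ()
S-term {f} (suc n) h {j} 1≤j j≤n with ℕP.m≤n⇒m<n∨m≡n j≤n
... | inj₂ refl = subst (_≤ S f n + f (suc n)) (ℤP.+-identityˡ (f (suc n))) (ℤP.+-monoˡ-≤ (f (suc n)) (S-nonneg n (λ i p q → h i p (ℕP.m≤n⇒m≤1+n q))))
... | inj₁ (s≤s j≤n') = ℤP.≤-trans (S-term n (λ i p q → h i p (ℕP.m≤n⇒m≤1+n q)) 1≤j j≤n')
      (subst (_≤ S f n + f (suc n)) (ℤP.+-identityʳ (S f n)) (ℤP.+-monoʳ-≤ (S f n) (h (suc n) (s≤s z≤n) ℕP.≤-refl)))

n<4^1+n : ∀ n → n ℕ.< 4 ℕ.^ suc n
n<4^1+n zero = s≤s z≤n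
n<4^1+n (suc n) = ℕP.≤-<-trans (n<4^1+n n) (ℕP.m<m+n (4 ℕ.^ suc n) (ℕP.≤-trans (ℕP.m^n>0 4 (suc n)) (ℕP.m≤m+n _ _)))

scale : ∀ y → 1 ℕ.≤ y → Σ ℕ λ i → 4 ℕ.^ i ℕ.≤ y × y ℕ.< 4 ℕ.^ suc i
scale y 1≤y with least (λ i → y ℕP.<? 4 ℕ.^ suc i) y (n<4^1+n y)
... | zero , hi , _ = zero , 1≤y , hi
... | suc i , hi , below = suc i , ℕP.≮⇒≥ (λ y< → ℕP.<-irrefl refl (below i y<)) , hi

n<4^n : ∀ n → n ℕ.< 4 ℕ.^ n
n<4^n zero = s≤s z≤n
n<4^n (suc n) = ℕP.≤-<-trans (n<4^n n) (ℕP.m<m+n (4 ℕ.^ n) (ℕP.≤-trans (ℕP.m^n>0 4 n) (ℕP.m≤m+n _ _)))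

open Möbius using (μ; μ-⊴1; dsum-μ; dsum-μ-1)

S-b-rearrange : ∀ q c j p → q * (c * (j * p)) ≡ c * (j * (p * q))
S-b-rearrange q c j p = solve (q ∷ c ∷ j ∷ p ∷ [])

partial-step : ∀ p s j t x → 0ℤ ≤ j → p * s ≤ x * (+ 4 * p - + 2 * j - + 4) → p * t ≤ x → + 2 * p * (s + (j + 1ℤ) * t) ≤ x * (+ 4 * (+ 2 * p) - + 2 * (j + 1ℤ) - + 4)
partial-step p s j t x a q r = lin (2 · sub q ⊞ 2 · ((a ⊞ 0≤+ 1) ⊠ sub r)) (solve (p ∷ s ∷ j ∷ t ∷ x ∷ []))

total-core : ∀ p s x → 0ℤ ≤ x → p * s ≤ x * (+ 4 * p - + 2 * x - + 4) → p * s ≤ p * (+ 4 * x)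
total-core p s x q h = lin (sub h ⊞ 2 · (q ⊠ q) ⊞ 4 · q) (solve (p ∷ s ∷ x ∷ []))

μ⋆-bound-core : ∀ c s x → 0ℤ ≤ c → s ≤ + 4 * x → c * s ≤ + 4 * c * x
μ⋆-bound-core c s x p q = lin (p ⊠ sub q) (solve (c ∷ s ∷ x ∷ []))

-- Since Σ_d b(x/d) counts each scale 4^i at most x/4^i times, a bound of size (i+1) 2^i at scale i is summable.
module Layers (A : ℕ → ℤ) (c : ℤ) (0≤c : 0ℤ ≤ c) (x : ℕ)
  (bound : ∀ i y → 1 ℕ.≤ y → y ℕ.≤ x → 4 ℕ.^ i ℕ.≤ y → y ℕ.< 4 ℕ.^ suc i → A y ⊴ c * (+ suc i * + (2 ℕ.^ i))) where

  weight t : ℕ → ℤ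
  weight j = c * (+ j * + (2 ℕ.^ (j ℕ.∸ 1)))
  t j = + (2 ℕ.^ (j ℕ.∸ 1)) * + (x ÷ 4 ℕ.^ (j ℕ.∸ 1))

  b : ℕ → ℤ
  b y = S (λ j → ind (4 ℕ.^ (j ℕ.∸ 1) ℕP.≤? y) * weight j) x

  weight≥0 : ∀ j → 0ℤ ≤ weight j
  weight≥0 j = 0≤c ⊠ (0≤+ j ⊠ 0≤+ (2 ℕ.^ (j ℕ.∸ 1)))

  A⊴b : ∀ y → 1 ℕ.≤ y → y ℕ.≤ x → A y ⊴ b y
  A⊴b y 1≤y y≤x with scale y 1≤y
  ... | i , lo , hi = ⊴-≤ (bound i y 1≤y y≤x lo hi) (subst (_≤ b y) eq
          (S-term x (λ j _ _ → ind-nonneg (4 ℕ.^ (j ℕ.∸ 1) ℕP.≤? y) ⊠ weight≥0 j) {suc i} (s≤s z≤n) (ℕP.≤-trans (n<4^n i) (ℕP.≤-trans lo y≤x))))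
    where
    eq : ind (4 ℕ.^ i ℕP.≤? y) * weight (suc i) ≡ c * (+ suc i * + (2 ℕ.^ i))
    eq = trans (cong (_* weight (suc i)) (ind-yes (4 ℕ.^ i ℕP.≤? y) lo)) (ℤP.*-identityˡ (weight (suc i)))

  term : ∀ d → 1 ℕ.≤ d → d ℕ.≤ x → μ d * A (x ÷ d) ⊴ b (x ÷ d)
  term d 1≤d d≤x = subst (μ d * A (x ÷ d) ⊴_) (ℤP.*-identityˡ (b (x ÷ d))) (⊴-* (μ-⊴1 d) (A⊴b (x ÷ d) (÷-pos 1≤d d≤x) (÷-≤ x d)))

  S-b : S (λ d → b (x ÷ d)) x ≡ c * S (λ j → + j * t j) x
  S-b = trans (S-swap (λ d j → ind (4 ℕ.^ (j ℕ.∸ 1) ℕP.≤? x ÷ d) * weight j) x x)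
    (trans (S-cong x (λ j _ _ → trans (S-*ʳ (weight j) x) (trans (cong (_* weight j) (count (4 ℕ.^ (j ℕ.∸ 1)) (ℕP.m^n>0 4 (j ℕ.∸ 1))))
      (by (S-b-rearrange (+ (x ÷ 4 ℕ.^ (j ℕ.∸ 1))) c (+ j) (+ (2 ℕ.^ (j ℕ.∸ 1)))))))) (S-* c x))
    where
    flip : ∀ {a b} → 1 ℕ.≤ a → 1 ℕ.≤ b → b ℕ.≤ x ÷ a → a ℕ.≤ x ÷ b
    flip {a} {b} 1≤a 1≤b h = ÷-lub 1≤b (subst (ℕ._≤ x) (ℕP.*-comm b a) (÷-glb {x} {a} h))
    count : ∀ e → 1 ℕ.≤ e → S (λ d → ind (e ℕP.≤? x ÷ d)) x ≡ + (x ÷ e)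
    count e 1≤e = trans (S-cong x (λ d 1≤d _ → ind-⇔ (e ℕP.≤? x ÷ d) (d ℕP.≤? x ÷ e) (flip 1≤d 1≤e) (flip 1≤e 1≤d))) (S-count (÷-≤ x e))

  2^·t : ∀ j → + (2 ℕ.^ (j ℕ.∸ 1)) * t j ≤ + x
  2^·t j = subst (_≤ + x) (trans (cong +_ eq) (trans (ℤP.pos-* p (p ℕ.* q)) (cong (+ p *_) (ℤP.pos-* p q)))) (≤-ℤ (÷-* x (4 ℕ.^ (j ℕ.∸ 1))))
    where
    p q : ℕ
    p = 2 ℕ.^ (j ℕ.∸ 1)
    q = x ÷ 4 ℕ.^ (j ℕ.∸ 1)
    eq : q ℕ.* 4 ℕ.^ (j ℕ.∸ 1) ≡ p ℕ.* (p ℕ.* q)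
    eq = trans (ℕP.*-comm q _) (trans (cong (ℕ._* q) (4^≡ (j ℕ.∸ 1))) (ℕP.*-assoc p p q))

  -- Since t j ≤ x / 2^(j - 1), the sum is at most x times the sum of j / 2^(j - 1), which is 4 - (2
  -- J + 4) / 2^J.
  partial : ∀ J → + (2 ℕ.^ J) * S (λ j → + j * t j) J ≤ + x * (+ 4 * + (2 ℕ.^ J) - + 2 * + J - + 4)
  partial zero = ℤP.≤-reflexive (sym (ℤP.*-zeroʳ (+ x)))
  partial (suc J) = subst₂ (λ p j → p * (S (λ j → + j * t j) J + j * t (suc J)) ≤ + x * (+ 4 * p - + 2 * j - + 4)) (sym (ℤP.pos-* 2 (2 ℕ.^ J))) (sym (+suc J))
      (partial-step (+ (2 ℕ.^ J)) (S (λ j → + j * t j) J) (+ J) (t (suc J)) (+ x) (0≤+ J) (partial J) (2^·t (suc J)))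

  total : S (λ j → + j * t j) x ≤ + 4 * + x
  total = *-cancel-≤ {2 ℕ.^ x} _ _ (ℕP.m^n>0 2 x) (total-core (+ (2 ℕ.^ x)) (S (λ j → + j * t j) x) (+ x) (0≤+ x) (partial x))

  μ⋆-bound : (μ ⋆ A) x ⊴ + 4 * c * + x
  μ⋆-bound = ⊴-≤ (S-⊴ x (λ d p q → term d p q)) (ℤP.≤-trans (ℤP.≤-reflexive S-b) (μ⋆-bound-core c (S (λ j → + j * t j) x) (+ x) 0≤c total))

scale-abs-core : ∀ u m c → - c ≤ u * (- m) → u * m ≤ c
scale-abs-core u m c p = lin (sub p) (solve (u ∷ m ∷ c ∷ []))

scale-abs : ∀ {u a c} → u * a ⊴ c → u * + ∣ a ∣ ≤ c
scale-abs {u} {+ n} (_ , q) = q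
scale-abs {u} { -[1+ n ]} {c} (p , _) = scale-abs-core u (+ suc n) c p

lt : ∀ {a b} → a + 1ℤ ≤ b → a < b
lt {a} {b} p = ℤP.suc[i]≤j⇒i<j (subst (_≤ b) (ℤP.+-comm a 1ℤ) p)

iterate : ∀ (P : ℕ → Set) t → (∀ M → P M → M ℕ.< t → Σ ℕ λ M' → M ℕ.< M' × P M') → ∀ M → P M → Σ ℕ λ M' → t ℕ.≤ M' × P M'
iterate P t step M PM = go t M (ℕP.m≤m+n t M) PM
  where
  go : ∀ fuel M → t ℕ.≤ fuel ℕ.+ M → P M → Σ ℕ λ M' → t ℕ.≤ M' × P M'
  go zero M t≤M PM = M , t≤M , PM
  go (suc fuel) M t≤ PM with t ℕP.≤? M
  ... | yes t≤M = M , t≤M , PM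
  ... | no t≰M with step M PM (ℕP.≰⇒> t≰M)
  ...   | M' , M<M' , PM' = go fuel M' (ℕP.≤-trans t≤ (ℕP.≤-trans (ℕP.≤-reflexive (sym (ℕP.+-suc fuel M))) (ℕP.+-monoʳ-≤ fuel M<M'))) PM'

search : ∀ {P : ℕ → Set} → (∀ n → Dec (P n)) → ∀ m j → (Σ ℕ λ n → m ℕ.< n × n ℕ.≤ m ℕ.+ j × P n) ⊎ (∀ n → m ℕ.< n → n ℕ.≤ m ℕ.+ j → ¬ P n)
search P? m zero = inj₂ λ n m<n n≤m _ → ℕP.<⇒≱ m<n (ℕP.≤-trans n≤m (ℕP.≤-reflexive (ℕP.+-identityʳ m)))
search {P} P? m (suc j) with search P? m j
... | inj₁ (n , p , q , Pn) = inj₁ (n , p , ℕP.≤-trans q (ℕP.+-monoʳ-≤ m (ℕP.n≤1+n j)) , Pn)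
... | inj₂ none with P? (m ℕ.+ suc j)
...   | yes Pn = inj₁ (m ℕ.+ suc j , ℕP.m<m+n m (s≤s z≤n) , ℕP.≤-refl , Pn)
...   | no ¬Pn = inj₂ none′
  where
  none′ : ∀ n → m ℕ.< n → n ℕ.≤ m ℕ.+ suc j → ¬ P n
  none′ n m<n n≤ with ℕP.m≤n⇒m<n∨m≡n n≤
  ... | inj₂ refl = ¬Pn
  ... | inj₁ n< = none n m<n (ℕP.≤-pred (ℕP.≤-trans n< (ℕP.≤-reflexive (ℕP.+-suc m j))))

opaque
  -- `reach` bounds x' / n for n beyond the end of the last window. `cost` collects the coefficients
  -- of the error terms: from n ≤ Y, from n beyond the windows, from Selberg's formula (16408) and
  -- from comparing H with L (4). Both are opaque to keep the numerals from being multiplied out.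
  reach cost : ℕ → ℕ → ℤ
  reach b Y = + 16 * + b * + Y
  cost b Y = + 362 * + 704 * (+ 2 * + Y + + 2 * reach b Y) + (+ 16408 + + 4)

  reach-eq : ∀ b Y → + 16 * + b * + Y ≡ reach b Y
  reach-eq b Y = refl

  reach≥0 : ∀ b Y → 0ℤ ≤ reach b Y
  reach≥0 b Y = 16 · 0≤+ b ⊠ 0≤+ Y

  cost-eq : ∀ b Y → cost b Y ≡ + 362 * + 704 * (+ 2 * + Y + + 2 * reach b Y) + (+ 16408 + + 4)
  cost-eq b Y = refl

  cost≥0 : ∀ b Y → 0ℤ ≤ cost b Y
  cost≥0 b Y = (0≤+ 362 ⊠ 0≤+ 704) ⊠ (2 · 0≤+ Y ⊞ 2 · (16 · 0≤+ b ⊠ 0≤+ Y)) ⊞ (0≤+ 16408 ⊞ 0≤+ 4)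

opaque
  -- Any natural number above z would do; only `≤ceil` is used.
  ceil : ℤ → ℕ
  ceil z = ∣ z ∣

  ≤ceil : ∀ z → z ≤ + ceil z
  ≤ceil z = proj₂ (⊴-abs z)

-- Radicals

S-shift : ∀ (f : ℕ → ℤ) a k → S (λ j → f (a ℕ.+ j)) k ≡ S f (a ℕ.+ k) - S f a
S-shift f a zero = sym (trans (cong (λ z → S f z - S f a) (ℕP.+-identityʳ a)) (ℤP.+-inverseʳ (S f a)))
S-shift f a (suc k) = trans (cong (_+ f (a ℕ.+ suc k)) (S-shift f a k)) (trans (cong (λ z → S f (a ℕ.+ k) - S f a + f z) (ℕP.+-suc a k))
    (trans (by (minus-+-swap (S f (a ℕ.+ k)) (S f a) (f (suc (a ℕ.+ k))))) (cong (λ z → S f z - S f a) (sym (ℕP.+-suc a k)))))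

÷-+ : ∀ a k d → 1 ℕ.≤ d → (a ℕ.+ k) ÷ d ℕ.≤ suc (a ÷ d ℕ.+ k ÷ d)
÷-+ a k d 1≤d = ℕP.≤-pred (ℕP.*-cancelʳ-< d ((a ℕ.+ k) ÷ d) (suc (suc (a ÷ d ℕ.+ k ÷ d))) (ℕP.≤-<-trans (÷-* (a ℕ.+ k) d)
    (ℕP.<-≤-trans (ℕP.+-mono-< (÷-< a d 1≤d) (÷-< k d 1≤d)) (ℕP.≤-reflexive (trans (sym (ℕP.*-distribʳ-+ d (suc (a ÷ d)) (suc (k ÷ d)))) (cong (λ z → suc z ℕ.* d) (ℕP.+-suc (a ÷ d) (k ÷ d))))))))

count-multiples-core : ∀ n a k → n ≤ a + k + 1ℤ → n - a ≤ k + 1ℤ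
count-multiples-core n a k p = lin (sub p) (solve (n ∷ a ∷ k ∷ []))

count-multiples : ∀ a k d → 1 ℕ.≤ d → S (λ j → ind (d ∣? a ℕ.+ j)) k ≤ + (k ÷ d) + 1ℤ
count-multiples a k d 1≤d = ℤP.≤-trans (ℤP.≤-reflexive (trans (S-shift (λ n → ind (d ∣? n)) a k) (cong₂ _-_ (count (a ℕ.+ k)) (count a))))
    (count-multiples-core (+ ((a ℕ.+ k) ÷ d)) (+ (a ÷ d)) (+ (k ÷ d)) (subst (+ ((a ℕ.+ k) ÷ d) ≤_) (trans (+suc (a ÷ d ℕ.+ k ÷ d)) (cong (_+ 1ℤ) (ℤP.pos-+ (a ÷ d) (k ÷ d)))) (≤-ℤ (÷-+ a k d 1≤d))))
  where
  count : ∀ x → S (λ n → ind (d ∣? n)) x ≡ + (x ÷ d)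
  count x = trans (S-cong x (λ n _ _ → sym (ℤP.*-identityʳ (ind (d ∣? n))))) (trans (S-multiples 𝟙 d 1≤d x) (trans (S-const 1ℤ (x ÷ d)) (ℤP.*-identityʳ _)))

module RadicalLog (w : ℕ → ℤ) where
  open AdditiveProperties w

  wₚ : ℕ → ℤ
  wₚ p = ind (prime? p) * w p

  module _ (M : ℕ) where
    private
      P? : ∀ p → Dec (Prime p × p ∣ M)
      P? p = prime? p ×-dec (p ∣? M)

    1≤filtered : ∀ xs → 1 ℕ.≤ product (filter P? xs)
    1≤filtered [] = s≤s z≤n
    1≤filtered (x ∷ xs) with prime? x | x ∣? M
    ... | yes P | yes _ = ℕP.*-mono-≤ {1} {x} {1} (1≤prime P) (1≤filtered xs)
    ... | yes _ | no _ = 1≤filtered xs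
    ... | no _ | yes _ = 1≤filtered xs
    ... | no _ | no _ = 1≤filtered xs

    L-single : ∀ p → L (product (filter P? (p ∷ []))) ≡ ind (p ∣? M) * wₚ p
    L-single p with prime? p | p ∣? M
    ... | yes P | yes _ = trans (cong L (ℕP.*-identityʳ p)) (trans (L-prime P) (sym (trans (ℤP.*-identityˡ (1ℤ * w p)) (ℤP.*-identityˡ (w p)))))
    ... | yes P | no _ = sym (ℤP.*-zeroˡ (1ℤ * w p))
    ... | no _ | yes _ = sym (trans (ℤP.*-identityˡ (0ℤ * w p)) (ℤP.*-zeroˡ (w p)))
    ... | no _ | no _ = sym (ℤP.*-zeroˡ (0ℤ * w p))

    L-filtered : ∀ n → L (product (filter P? (upTo (suc n)))) ≡ S (λ p → ind (p ∣? M) * wₚ p) n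
    L-filtered zero = trans (L-single 0) (ℤP.*-zeroʳ (ind (0 ∣? M)))
    L-filtered (suc n) = begin
        L (product (filter P? (upTo (suc (suc n)))))                                   ≡⟨ cong (λ xs → L (product (filter P? xs))) (sym (ListP.upTo-∷ʳ (suc n))) ⟩
        L (product (filter P? (upTo (suc n) ∷ʳ suc n)))                                ≡⟨ cong (L ∘ product) (ListP.filter-++ P? (upTo (suc n)) (suc n ∷ [])) ⟩
        L (product (filter P? (upTo (suc n)) ++ filter P? (suc n ∷ [])))               ≡⟨ cong L (ListActionP.product-++ (filter P? (upTo (suc n))) (filter P? (suc n ∷ []))) ⟩
        L (product (filter P? (upTo (suc n))) ℕ.* product (filter P? (suc n ∷ [])))    ≡⟨ L-* _ _ (1≤filtered (upTo (suc n))) (1≤filtered (suc n ∷ [])) ⟩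
        L (product (filter P? (upTo (suc n)))) + L (product (filter P? (suc n ∷ [])))  ≡⟨ cong₂ _+_ (L-filtered n) (L-single (suc n)) ⟩
        S (λ p → ind (p ∣? M) * wₚ p) (suc n) ∎
      where open ≡-Reasoning

    L-rad : L (rad M) ≡ S (λ p → ind (p ∣? M) * wₚ p) M
    L-rad = L-filtered M

    1≤rad : 1 ℕ.≤ rad M
    1≤rad = 1≤filtered (upTo (suc M))

-- The triple 1 + u = u + 1, for which coprimality is automatic.
abc-consecutive : ExplicitABC → ∀ u → 1 ℕ.≤ u → suc u ℕ.^ 4 ℕ.< rad (u ℕ.* suc u) ℕ.^ 7
abc-consecutive abc u@(suc _) _ = subst (λ z → suc u ℕ.^ 4 ℕ.< rad z ℕ.^ 7) eq
    (abc 1ℤ (+ u) (+ suc u) (λ ()) (λ ()) (λ ()) (1-coprimeTo u) coprime (1-coprimeTo (suc u)) refl (Data.Integer.Base.+<+ (s≤s z≤n)))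
  where
  eq : ∣ 1ℤ * + u * + suc u ∣ ≡ u ℕ.* suc u
  eq = trans (ℤP.abs-* (1ℤ * + u) (+ suc u)) (cong (λ z → ∣ z ∣ ℕ.* suc u) (ℤP.*-identityˡ (+ u)))
  coprime : ∀ {d} → (d ∣ u) × (d ∣ suc u) → d ≡ 1
  coprime {d} (p , q) = ∣P.∣1⇒≡1 (∣P.∣m+n∣m⇒∣n (subst (d ∣_) (ℕP.+-comm 1 u) q) p)

-- Polynomial inequalities (x-core is the one behind x)

fold-flip : ∀ a → a ≡ - 1ℤ * (- 1ℤ * a)
fold-flip a = solve (a ∷ [])

pos<-cancel-twice′ : ∀ a b → b ≤ a → + 2 * b ≤ + 2 * a
pos<-cancel-twice′ a b p = lin (2 · sub p) (solve (a ∷ b ∷ []))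

Δ-crude-core : ∀ e K a b c → 0ℤ ≤ e → a ≤ c → b ≤ c → 0ℤ ≤ K → e * K * a + e * K * b ≤ + 2 * e * K * c
Δ-crude-core e K a b c 0≤e p t u = lin ((0≤e ⊠ u) ⊠ (sub p ⊞ sub t)) (solve (e ∷ K ∷ a ∷ b ∷ c ∷ []))

x'≤cM-core : ∀ x x' Y z b M → x' ≤ + 2 * x → x ≤ (z + 1ℤ) * Y → z + 1ℤ ≤ M * (+ 2 * (+ 2 * b)) → 0ℤ ≤ Y → 0ℤ ≤ b → 0ℤ ≤ M → x' ≤ + 16 * b * Y * M
x'≤cM-core x x' Y z b M p t u v w y = lin (sub p ⊞ 2 · sub t ⊞ 2 · (v ⊠ sub u) ⊞ 8 · (w ⊠ v ⊠ y)) (solve (x ∷ x' ∷ Y ∷ z ∷ b ∷ M ∷ []))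

tail-core : ∀ A B a b m e K x x' → A ≡ a * m → B ≡ b * m → a ≤ e * K * x' → 0ℤ ≤ b → x' ≤ + 2 * x → 0ℤ ≤ m → 0ℤ ≤ K → 0ℤ ≤ e → A - B ≤ e * K * (+ 2 * x) * m
tail-core ._ ._ a b m e K x x' refl refl p t u v w y = lin (sub p ⊠ v ⊞ t ⊠ v ⊞ (y ⊠ w ⊠ sub u) ⊠ v) (solve (a ∷ b ∷ m ∷ e ∷ K ∷ x ∷ x' ∷ []))

H-bound-core : ∀ H H₀ l l' g k K → H - l - g ≤ + 2 * k → g ≤ + 2 * K → k ≤ K → l ≤ l' → 0ℤ ≤ H₀ → H - H₀ ≤ l' + + 4 * K
H-bound-core H H₀ l l' g k K p t u v w = lin (sub p ⊞ sub t ⊞ 2 · sub u ⊞ sub v ⊞ w) (solve (H ∷ H₀ ∷ l ∷ l' ∷ g ∷ k ∷ K ∷ []))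

1≤2Θ-core₁ : ∀ s b → + 48 ≤ s → 1ℤ ≤ b → 1ℤ ≤ + 2 * (+ 128 * s * b)
1≤2Θ-core₁ s b p t = ℤP.≤-trans (+≤+ (s≤s z≤n)) (lin {+ 2} (2 · (128 · sub (ℤP.≤-trans {+ 1} (+≤+ (s≤s z≤n)) p) ⊠ ℤP.≤-trans (0≤+ 1) t) ⊞ 2 · (128 · sub t) ⊞ 0≤+ 254) (solve (s ∷ b ∷ [])))

upper-pick : ∀ s a b A B f g E → a ≡ 1ℤ * A → b ≡ - 1ℤ * B → s * (a - b) ≤ E → f ≤ + 2 * A → g ≤ + 2 * B → 0ℤ ≤ s → s * (f + g) ≤ + 2 * E
upper-pick s ._ ._ A B f g E refl refl p t w v = lin (2 · sub p ⊞ v ⊠ sub t ⊞ v ⊠ sub w) (solve (s ∷ A ∷ B ∷ f ∷ g ∷ E ∷ []))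

upper-pick2 : ∀ s a b A B f g E → a ≡ - 1ℤ * A → b ≡ - - 1ℤ * B → - E ≤ s * (a - b) → f ≤ + 2 * A → g ≤ + 2 * B → 0ℤ ≤ s → s * (f + g) ≤ + 2 * E
upper-pick2 s ._ ._ A B f g E refl refl p t w v = lin (2 · sub p ⊞ v ⊠ sub t ⊞ v ⊠ sub w) (solve (s ∷ A ∷ B ∷ f ∷ g ∷ E ∷ []))

lower-dist₂ : ∀ u a b → + 2 * (u * a) - + 2 * (u * b) ≡ + 2 * (u * (a - b))
lower-dist₂ u a b = solve (u ∷ a ∷ b ∷ [])

twice-pick : ∀ a c → a ≤ c → + 2 * (1ℤ * a) ≤ + 2 * c
twice-pick a c p = lin (2 · sub p) (solve (a ∷ c ∷ []))

twice-pick2 : ∀ a c → - c ≤ a → + 2 * (- 1ℤ * a) ≤ + 2 * c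
twice-pick2 a c p = lin (2 · sub p) (solve (a ∷ c ∷ []))

chain-zeros : ∀ e q K x a b c → q * (a - a) ≡ q * K * (b - b) + e * K * x * (c - c)
chain-zeros e q K x a b c = solve (e ∷ q ∷ K ∷ x ∷ a ∷ b ∷ c ∷ [])

three-s₁ : ∀ Q F h x A₀ A₁ A₂ A₃ H₀ H₁ H₂ H₃ →
  + 8 * (F * (H₁ - H₀) - Q * (A₁ - A₀)) + Q * (+ 7 * h * (H₂ - H₁) - + 8 * (A₂ - A₁)) + + 8 * (F * (H₃ - H₂) - Q * (A₃ - A₂)) + + 16 * (x * (H₂ - H₁))
  ≡ + 8 * (F * (H₃ - H₀)) - Q * h * (H₂ - H₁) - + 8 * (Q * (A₃ - A₀)) - + 8 * (F - (Q * h + + 2 * x)) * (H₂ - H₁)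
three-s₁ Q F h x A₀ A₁ A₂ A₃ H₀ H₁ H₂ H₃ = solve (Q ∷ F ∷ h ∷ x ∷ A₀ ∷ A₁ ∷ A₂ ∷ A₃ ∷ H₀ ∷ H₁ ∷ H₂ ∷ H₃ ∷ [])

three-s₂ : ∀ F a b J → a - b - + 8 * (F - F) * J ≡ a - b
three-s₂ F a b J = solve (F ∷ a ∷ b ∷ J ∷ [])

L-bounded-core₀ : ∀ K h → 1ℤ ≤ K → 1ℤ ≤ h → 1ℤ ≤ K * h
L-bounded-core₀ K h p t = lin (sub p ⊠ ℤP.≤-trans (0≤+ 1) t ⊞ sub t) (solve (K ∷ h ∷ []))

-- Up to errors, Selberg's formula bounds 4 Θ T below by (4 Θ - 1) K h l and the windows bound it
-- above by (4 Θ - 2) K h l. The surplus K h l is therefore bounded by the errors.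
L-bounded-core : ∀ e₁ e₂ e₃ Θ K D l T tY tM x h H Y c e → e ≡ e₁ * e₂ * (+ 2 * Y + + 2 * c) + (e₃ + + 4) →
  + 4 * Θ * l * K * h - l * K * h ≤ + 4 * Θ * (T + e₃ * (K * K) * x) → tY ≤ e₁ * K * Y * (e₂ * K * (+ 2 * x)) → T - tM ≤ e₁ * K * (+ 2 * x) * (e₂ * K * c) →
  + 2 * Θ * (tM - tY) ≤ (+ 2 * Θ - 1ℤ) * K * h * H → H ≤ l + + 4 * K → x ≤ + 2 * D * h → h ≤ x → 1ℤ ≤ + 2 * Θ → 0ℤ ≤ K → 0ℤ ≤ h → 0ℤ ≤ e →
  K * h * l ≤ K * h * (+ 8 * Θ * D * e * K)
L-bounded-core e₁ e₂ e₃ Θ K D l T tY tM x h H Y c e eq p t u v w y z a 0≤K 0≤h 0≤e = second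
  where
  0≤Θ′ : 0ℤ ≤ Θ
  0≤Θ′ = pos-cancel {+ 2} (≤-ℤ (s≤s z≤n)) (ℤP.≤-trans (0≤+ 1) a)
  T≤ : T ≤ tM - tY + e₁ * e₂ * (+ 2 * Y + + 2 * c) * (K * K) * x
  T≤ = lin (sub t ⊞ sub u) (solve (e₁ ∷ e₂ ∷ K ∷ T ∷ tY ∷ tM ∷ x ∷ Y ∷ c ∷ []))
  first : ∀ e′ → + 4 * Θ * l * K * h - l * K * h ≤ + 4 * Θ * (tM - tY + e′ * (K * K) * x) → e ≡ e′ + + 4 → K * h * l ≤ K * h * (+ 8 * Θ * D * e * K)
  first e′ p′ refl = lin (sub p′ ⊞ 2 · sub v ⊞ 2 · ((sub a ⊠ 0≤K) ⊠ 0≤h ⊠ sub w) ⊞ (4 · 0≤Θ′ ⊠ 0≤e) ⊠ (0≤K ⊠ 0≤K) ⊠ sub y ⊞ 16 · (0≤Θ′ ⊠ (0≤K ⊠ 0≤K) ⊠ sub z) ⊞ 8 · (0≤K ⊠ 0≤K ⊠ 0≤h))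
    (solve (e′ ∷ Θ ∷ K ∷ D ∷ l ∷ tY ∷ tM ∷ x ∷ h ∷ H ∷ []))
  merge : ∀ f → T ≤ tM - tY + f * (K * K) * x → + 4 * Θ * l * K * h - l * K * h ≤ + 4 * Θ * (tM - tY + (f + e₃) * (K * K) * x)
  merge f T≤ = lin (sub p ⊞ 4 · 0≤Θ′ ⊠ sub T≤) (solve (e₃ ∷ Θ ∷ K ∷ l ∷ T ∷ tY ∷ tM ∷ x ∷ h ∷ f ∷ []))
  second : K * h * l ≤ K * h * (+ 8 * Θ * D * e * K)
  second = first (e₁ * e₂ * (+ 2 * Y + + 2 * c) + e₃) (merge (e₁ * e₂ * (+ 2 * Y + + 2 * c)) T≤) (trans eq (sym (ℤP.+-assoc (e₁ * e₂ * (+ 2 * Y + + 2 * c)) e₃ (+ 4))))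

no-change-core : ∀ s D h x a b → 0ℤ ≤ D → x ≤ + 2 * D * h → + 48 * D ≤ s → 1ℤ ≤ h → b ≤ a → 1ℤ ≤ b → 1ℤ ≤ D → + 2 * (+ 6 * x * b) < s * (h * a + h * b)
no-change-core s D h x a b 0≤D p t u w y v = lt (lin
    ((12 · sub p) ⊠ 0≤b ⊞ sub t ⊠ (0≤h ⊠ (0≤a ⊞ 0≤b)) ⊞ 48 · (0≤D ⊠ (0≤h ⊠ sub w)) ⊞ 72 · (sub v ⊠ (0≤h ⊠ 0≤b)) ⊞ 72 · (sub u ⊠ 0≤b) ⊞ 72 · sub y ⊞ 0≤+ 71)
    (solve (s ∷ D ∷ h ∷ x ∷ a ∷ b ∷ [])))
  where
  0≤b : 0ℤ ≤ b
  0≤b = ℤP.≤-trans (0≤+ 1) y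
  0≤a : 0ℤ ≤ a
  0≤a = ℤP.≤-trans 0≤b w
  0≤h : 0ℤ ≤ h
  0≤h = ℤP.≤-trans (0≤+ 1) u

contradiction-core : ∀ c d h x D β K H → d ≡ + 40 * c → 0ℤ ≤ c → x ≤ + 2 * D * h → + 2 * h ≤ x → d * D + 1ℤ ≤ β → β * K ≤ + 2 * H → 1ℤ ≤ h → 1ℤ ≤ K →
  + 2 * (c * K * (x + h) + c * K * x + (c * K * (x + h) + c * K * x)) < h * H
contradiction-core c ._ h x D β K H refl 0≤c p t u v w y = pos<-cancel (lin
    (20 · (0≤c ⊠ 0≤K ⊠ sub p) ⊞ 4 · (0≤c ⊠ 0≤K ⊠ sub t) ⊞ 0≤h ⊠ 0≤K ⊠ sub u ⊞ 0≤h ⊠ sub v ⊞ sub w ⊠ 0≤K ⊞ sub y)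
    (solve (c ∷ h ∷ x ∷ D ∷ β ∷ K ∷ H ∷ [])))
  where
  0≤h : 0ℤ ≤ h
  0≤h = ℤP.≤-trans (0≤+ 1) w
  0≤K : 0ℤ ≤ K
  0≤K = ℤP.≤-trans (0≤+ 1) y
  pos<-cancel : ∀ {a b} → 1ℤ + + 2 * a ≤ + 2 * b → a < b
  pos<-cancel {a} {b} p = ℤP.≰⇒> λ b≤a → ℤP.<⇒≱ (ℤP.suc[i]≤j⇒i<j p) (pos<-cancel-twice′ a b b≤a)

step-join : ∀ e q K x a b c a' b' c' a'' b'' c'' → q * (b - c) ≤ q * K * (b' - c') + e * K * x * (b'' - c'') → q * (a - b) ≤ q * K * (a' - b') + e * K * x * (a'' - b'') →
  q * (a - c) ≤ q * K * (a' - c') + e * K * x * (a'' - c'')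
step-join e q K x a b c a' b' c' a'' b'' c'' p r = lin (sub p ⊞ sub r) (solve (e ∷ q ∷ K ∷ x ∷ a ∷ b ∷ c ∷ a' ∷ b' ∷ c' ∷ a'' ∷ b'' ∷ c'' ∷ []))

near-shape : ∀ s a b → s * a - s * (a - b) ≡ s * b
near-shape s a b = solve (s ∷ a ∷ b ∷ [])

near-core : ∀ s A A* k k* h x D → s * A ≤ s * A* + + 6 * x * k → + 2 * A* ≤ h * k* → s * (k* - k) ≤ k → x ≤ + 2 * D * h → + 48 * D ≤ s → + 48 ≤ s → 0ℤ ≤ s → 0ℤ ≤ h → 0ℤ ≤ k →
  s * (+ 8 * A) ≤ s * (+ 7 * h * k)
near-core s A A* k k* h x D p r u v w y 0≤s 0≤h 0≤k =
  lin (8 · sub p ⊞ 4 · (0≤s ⊠ sub r) ⊞ 4 · (0≤h ⊠ sub u) ⊞ 48 · (sub v ⊠ 0≤k) ⊞ 2 · (sub w ⊠ (0≤h ⊠ 0≤k)) ⊞ sub y ⊠ (0≤h ⊠ 0≤k) ⊞ 44 · (0≤h ⊠ 0≤k))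
    (solve (s ∷ A ∷ A* ∷ k ∷ k* ∷ h ∷ x ∷ D ∷ []))

K≤4sH-core : ∀ s n B n₁ k K H → n * k ≡ K → n₁ ≡ n + B → n ≤ (B + 1ℤ) * s → 1ℤ ≤ B → (n₁ - n) * k ≤ + 2 * H → 0ℤ ≤ s → 0ℤ ≤ k → K ≤ + 4 * s * H
K≤4sH-core s n B ._ k ._ H refl refl p r u 0≤s 0≤k = lin (sub p ⊠ 0≤k ⊞ (0≤s ⊠ sub r) ⊠ 0≤k ⊞ 2 · (0≤s ⊠ sub u)) (solve (s ∷ n ∷ B ∷ k ∷ H ∷ []))

H≤4bK-shape : ∀ b N → + 2 * (+ 2 * (b * N)) ≡ + 4 * b * N
H≤4bK-shape b N = solve (b ∷ N ∷ [])

H≤4bK-core : ∀ b N M k K H → N * k ≡ K → H ≤ (M - N) * k → M ≤ + 4 * b * N → 0ℤ ≤ N → 0ℤ ≤ k → H ≤ + 4 * b * K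
H≤4bK-core b N M k ._ H refl p r u 0≤k = lin (sub p ⊞ (sub r ⊞ u) ⊠ 0≤k) (solve (b ∷ N ∷ M ∷ k ∷ H ∷ []))

gain-core : ∀ s b K H J → K ≤ + 4 * s * J → H ≤ + 4 * b * K → 0ℤ ≤ b → + 8 * H ≤ + 128 * s * b * J
gain-core s b K H J p r u = lin (8 · sub r ⊞ 32 · (u ⊠ sub p)) (solve (s ∷ b ∷ K ∷ H ∷ J ∷ []))

abs-sum-combine : ∀ Q Θ F h A H J → + 8 * (Q * A) ≤ + 8 * (F * H) - Q * h * J → + 8 * H ≤ Θ * J → 0ℤ ≤ Θ → 0ℤ ≤ Q → 0ℤ ≤ h → + 8 * (Q * Θ * A) ≤ + 8 * ((Θ * F - Q * h) * H)
abs-sum-combine Q Θ F h A H J p r 0≤Θ 0≤Q 0≤h = lin (0≤Θ ⊠ sub p ⊞ 0≤Q ⊠ 0≤h ⊠ sub r) (solve (Q ∷ Θ ∷ F ∷ h ∷ A ∷ H ∷ J ∷ []))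

core-s₁ : ∀ c₁ c₂ Θ K l l' R R' d t' t x x' h →
  + 4 * Θ * (l' * R' + t' - - (c₁ * (K * K) * x') + (c₁ * (K * K) * x - (l * R + t)) + (l' - l) * (c₂ * K * x' - R') + c₂ * K * x' * (+ 2 * K - (l' - l)) + (c₁ + + 2 * c₂) * (K * K) * (+ 2 * x - x')) + l * (K * h - + 4 * Θ * d)
  ≡ + 4 * Θ * (t' - t + (+ 3 * c₁ + + 4 * c₂) * (K * K) * x) - (+ 4 * Θ * l * K * h - l * K * h) + + 4 * Θ * l * (R' - R - (d - K * h))
core-s₁ c₁ c₂ Θ K l l' R R' d t' t x x' h = solve (c₁ ∷ c₂ ∷ Θ ∷ K ∷ l ∷ l' ∷ R ∷ R' ∷ d ∷ t' ∷ t ∷ x ∷ x' ∷ h ∷ [])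

core-s₂ : ∀ Θ l ρ a → a + + 4 * Θ * l * (ρ - ρ) ≡ a
core-s₂ Θ l ρ a = solve (Θ ∷ l ∷ ρ ∷ a ∷ [])

bound-core : ∀ Q q K B N → N ≤ + 2 * q * B → q * q ≤ Q → 0ℤ ≤ q → 0ℤ ≤ K → 0ℤ ≤ B → q * (Q * K * B + K * N) ≤ Q * ((q + + 2) * K * B)
bound-core Q q K B N a b c u v = lin (c ⊠ u ⊠ sub a ⊞ 2 · (u ⊠ v ⊠ sub b)) (solve (Q ∷ q ∷ K ∷ B ∷ N ∷ []))

window-core : ∀ c₁ c₂ c₃ q Q Θ K h x D T A H → c₂ ≡ + 2 * c₃ → c₃ ≡ + 2 * c₁ + + 4 → q * T ≤ q * K * A + c₁ * K * x * H → Q * Θ * A ≤ (Θ * (Q * h + + 2 * x) - Q * h) * H → q ≤ Q →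
  x ≤ + 2 * D * h → c₂ * Θ * D ≤ q → 0ℤ ≤ c₃ → 0ℤ ≤ Θ → 0ℤ ≤ K → 0ℤ ≤ q → 0ℤ ≤ Q → 0ℤ ≤ h → 0ℤ ≤ x → 0ℤ ≤ H →
  q * Q * (+ 2 * Θ * T) ≤ q * Q * ((+ 2 * Θ - 1ℤ) * K * h * H)
window-core c₁ ._ ._ q Q Θ K h x D T A H refl refl p r u v w 0≤c 0≤Θ 0≤K 0≤q 0≤Q 0≤h 0≤x 0≤H =
  lin (2 · (0≤Q ⊠ 0≤Θ ⊠ sub p) ⊞ 2 · (0≤q ⊠ 0≤K ⊠ sub r) ⊞ 4 · (sub u ⊠ (0≤Θ ⊠ 0≤x) ⊠ (0≤K ⊠ 0≤H)) ⊞ (0≤c ⊠ 0≤Q ⊠ 0≤Θ) ⊠ (0≤K ⊠ 0≤H) ⊠ sub v ⊞ (0≤Q ⊠ 0≤K ⊠ 0≤h) ⊠ 0≤H ⊠ sub w)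
    (solve (c₁ ∷ q ∷ Q ∷ Θ ∷ K ∷ h ∷ x ∷ D ∷ T ∷ A ∷ H ∷ []))

L≤-core₁ : ∀ a b c b2 c2 u u' K → u' ≡ u + 1ℤ → a ≤ b2 → b2 ≡ b + b → b ≤ c2 → c2 ≡ c + c → c ≤ + 2 * (u' - 1ℤ) * K → a ≤ + 8 * u * K
L≤-core₁ a b c ._ ._ u ._ K refl p refl r refl t = lin (sub p ⊞ 2 · sub r ⊞ 4 · sub t) (solve (a ∷ b ∷ c ∷ u ∷ K ∷ []))

T-eq-dist : ∀ a b c → a * (b - c) ≡ a * b - a * c
T-eq-dist a b c = solve (a ∷ b ∷ c ∷ [])

k≤3h-core : ∀ k h → k + 1ℤ ≤ (h + 1ℤ) * + 2 → 1ℤ ≤ h → k ≤ + 3 * h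
k≤3h-core k h p q = lin (sub p ⊞ sub q) (solve (k ∷ h ∷ []))

kLa-core : ∀ e k h h2 a l p s K m → + 4 * (h * a) ≤ + 7 * (p + s) → p ≤ e * K * m → s ≤ h2 * l → h2 ≤ k → k ≤ + 3 * h → + 21 * l ≤ + 2 * a → 0ℤ ≤ a → 0ℤ ≤ l → 0ℤ ≤ k →
  + 2 * (k * a) ≤ + 21 * e * (K * m)
kLa-core e k h h2 a l p s K m x y z t u v 0≤a 0≤l 0≤k =
  lin (3 · sub x ⊞ 21 · sub y ⊞ 21 · sub z ⊞ 21 · (sub t ⊠ 0≤l) ⊞ 4 · (sub u ⊠ 0≤a) ⊞ 0≤k ⊠ sub v) (solve (e ∷ k ∷ h ∷ h2 ∷ a ∷ l ∷ p ∷ s ∷ K ∷ m ∷ []))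

cases-core : ∀ c m l n a T k K → m * l ≤ T * (k * n) + + 2 * K * m → + 2 * (k * a) ≤ c * (K * m) → n ≤ + 2 * a → 0ℤ ≤ T → 0ℤ ≤ k → m * l ≤ m * ((+ 2 + c * T) * K)
cases-core c m l n a T k K p q r 0≤T 0≤k = lin (sub p ⊞ 0≤T ⊠ sub q ⊞ (0≤T ⊠ 0≤k) ⊠ sub r) (solve (c ∷ m ∷ l ∷ n ∷ a ∷ T ∷ k ∷ K ∷ []))

cases-core2 : ∀ c k a K m M → + 2 * (k * a) ≤ c * (K * m) → m ≤ M → 1ℤ ≤ k → 0ℤ ≤ a → 0ℤ ≤ K → 0ℤ ≤ c → a ≤ c * M * K
cases-core2 c k a K m M p q r 0≤a 0≤K 0≤c = lin (sub p ⊞ (0≤c ⊠ 0≤K) ⊠ sub q ⊞ 2 · (sub r ⊠ 0≤a) ⊞ 0≤a) (solve (c ∷ k ∷ a ∷ K ∷ m ∷ M ∷ []))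

4K≤Lk-core : ∀ K a l → + 42 * K ≤ a → + 2 * a ≤ + 21 * l → + 21 * (+ 4 * K) ≤ + 21 * l
4K≤Lk-core K a l p q = lin (2 · sub p ⊞ sub q) (solve (K ∷ a ∷ l ∷ []))

m≤-1≤4K : ∀ K → 1ℤ ≤ K → 1ℤ ≤ + 4 * K
m≤-1≤4K K p = lin (4 · sub p ⊞ 0≤+ 3) (solve (K ∷ []))

m≤-trivial : ∀ m T k → m ≤ k → 1ℤ ≤ T → 0ℤ ≤ k → m ≤ + 42 * T * k
m≤-trivial m T k p q r = lin (sub p ⊞ 42 · (sub q ⊠ r) ⊞ 41 · r) (solve (m ∷ T ∷ k ∷ []))

m≤-core : ∀ m T k lm lk ln K → m * lm ≤ T * (k * ln) + + 2 * K * m → lk ≤ lm → ln ≤ + 21 * lk → + 4 * K ≤ lk → 0ℤ ≤ m → 0ℤ ≤ T → 0ℤ ≤ k → lk * m ≤ lk * (+ 42 * T * k)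
m≤-core m T k lm lk ln K p q r t 0≤m 0≤T 0≤k = lin (2 · sub p ⊞ 2 · (0≤m ⊠ sub q) ⊞ 2 · (0≤T ⊠ 0≤k ⊠ sub r) ⊞ 0≤m ⊠ sub t) (solve (m ∷ T ∷ k ∷ lm ∷ lk ∷ ln ∷ K ∷ []))

large-core : ∀ n k v p → n ≤ + 21 * k → k ≤ v + v → v ≤ p → n ≤ + 42 * p
large-core n k v p x y z = lin (sub x ⊞ 21 · sub y ⊞ 42 · sub z) (solve (n ∷ k ∷ v ∷ p ∷ []))

kLa≤-shape : ∀ n a k l → n ≡ a + k → n * l - a * l ≡ k * l
kLa≤-shape ._ a k l refl = solve (a ∷ k ∷ l ∷ [])

gap-core : ∀ e f k v v' m T a l n lv ψ d s P K → v' ≡ v + 1ℤ → k * a ≤ d → d ≤ s + P → P ≤ v * n + f * ψ → s ≤ k * l → n ≤ + 21 * l → l ≤ lv + lv → lv ≤ + 2 * (v' - 1ℤ) * K → ψ ≤ e * K * m → m ≤ + 42 * T * k →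
  v * v ≤ k → 0ℤ ≤ e → 0ℤ ≤ f → 0ℤ ≤ v → 0ℤ ≤ K → k * a ≤ k * (l + (+ 84 + f * (e * (+ 42 * T))) * K)
gap-core e f k v ._ m T a l n lv ψ d s P K refl p₁ p₂ p₃ p₄ p₅ p₆ p₇ p₈ p₉ p₀ 0≤e 0≤f 0≤v 0≤K =
  ℤP.≤-trans first (lin (0≤v ⊠ sub p₅ ⊞ 21 · (0≤v ⊠ sub p₆) ⊞ 42 · (0≤v ⊠ sub p₇) ⊞ 84 · (0≤K ⊠ sub p₀) ⊞ 0≤f ⊠ sub p₈ ⊞ (0≤f ⊠ 0≤e ⊠ 0≤K) ⊠ sub p₉) (solve (e ∷ f ∷ k ∷ v ∷ m ∷ T ∷ l ∷ n ∷ lv ∷ ψ ∷ K ∷ [])))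
  where
  first : k * a ≤ k * l + v * n + f * ψ
  first = lin (sub p₁ ⊞ sub p₂ ⊞ sub p₃ ⊞ sub p₄) (solve (f ∷ k ∷ v ∷ a ∷ l ∷ n ∷ ψ ∷ d ∷ s ∷ P ∷ []))

cases-core3 : ∀ f l a b → f + l ≤ a → a ≤ l + b → f ≤ b
cases-core3 f l a b p q = lin (sub p ⊞ sub q) (solve (f ∷ l ∷ a ∷ b ∷ []))

lip-core : ∀ x a b → 0ℤ ≤ x → a ≤ b → + 6 * x * a ≤ + 6 * x * b
lip-core x a b p t = lin (6 · (p ⊠ sub t)) (solve (x ∷ a ∷ b ∷ []))

ρ-bound-hi : ∀ Q q ρ a b → 0ℤ ≤ q → Q * ρ ≤ a → q * a ≤ Q * b → Q * (q * ρ) ≤ Q * b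
ρ-bound-hi Q q ρ a b p t u = lin (p ⊠ sub t ⊞ sub u) (solve (Q ∷ q ∷ ρ ∷ a ∷ b ∷ []))

ρ-bound-lo : ∀ Q q ρ a b → 0ℤ ≤ q → - a ≤ Q * ρ → q * a ≤ Q * b → Q * (- b) ≤ Q * (q * ρ)
ρ-bound-lo Q q ρ a b p t u = lin (p ⊠ sub t ⊞ sub u) (solve (Q ∷ q ∷ ρ ∷ a ∷ b ∷ []))

ρ≤3KB-core : ∀ q ρ K B → q * ρ ≤ (q + + 2) * K * B → 1ℤ ≤ q → 0ℤ ≤ K → 0ℤ ≤ B → q * ρ ≤ q * (+ 3 * K * B)
ρ≤3KB-core q ρ K B p t u v = lin (sub p ⊞ 2 · (sub t ⊠ u ⊠ v)) (solve (q ∷ ρ ∷ K ∷ B ∷ []))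

S-rΔ-shape : ∀ r a b → r * a ≡ b * r + r * (a - b)
S-rΔ-shape r a b = solve (r ∷ a ∷ b ∷ [])

U-bound-shape : ∀ r q a b → r * - (q * (b - a)) ≡ q * (r * (a - b))
U-bound-shape r q a b = solve (r ∷ q ∷ a ∷ b ∷ [])

U-bound-core : ∀ p' p ρ K n' n B e → ρ ≡ p' - p - K * (n' - n) → n' - n ≡ B → (p' + n' * K) * e - (p + n * K) * e ≡ (ρ + + 2 * K * B) * e
U-bound-core p' p ._ K n' n ._ e refl refl = solve (p' ∷ p ∷ K ∷ n' ∷ n ∷ e ∷ [])

abs-bound-shape : ∀ q a b → q * a + q * (b - a) ≡ q * b
abs-bound-shape q a b = solve (q ∷ a ∷ b ∷ [])

abs-bound-core₁ : ∀ n' n q d B → n' - n ≡ B → n' * (q * d) - n * (q * d) ≡ q * B * d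
abs-bound-core₁ n' n q d ._ refl = solve (n' ∷ n ∷ q ∷ d ∷ [])

abs-bound-core₂ : ∀ q a b n' n B e → n' - n ≡ B → q * a + n' * e - (q * b + n * e) ≡ q * (a - b) + B * e
abs-bound-core₂ q a b n' n ._ e refl = solve (q ∷ a ∷ b ∷ n' ∷ n ∷ e ∷ [])

Bk-core₁ : ∀ n' n a B → n' - n ≡ B → n' * a - n * a ≡ B * a
Bk-core₁ n' n a ._ refl = solve (n' ∷ n ∷ a ∷ [])

doubled-core₁ : ∀ M k K M2 → M2 ≡ M + M → M * k ≡ K → M2 * k - M * k ≡ K
doubled-core₁ M k ._ ._ refl refl = solve (M ∷ k ∷ [])

windows-join : ∀ Θ K h a b c a' b' c' → + 2 * Θ * (b - c) ≤ (+ 2 * Θ - 1ℤ) * K * h * (b' - c') → + 2 * Θ * (a - b) ≤ (+ 2 * Θ - 1ℤ) * K * h * (a' - b') → + 2 * Θ * (a - c) ≤ (+ 2 * Θ - 1ℤ) * K * h * (a' - c')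
windows-join Θ K h a b c a' b' c' p r = lin (sub p ⊞ sub r) (solve (Θ ∷ K ∷ h ∷ a ∷ b ∷ c ∷ a' ∷ b' ∷ c' ∷ []))

windows-zeros : ∀ Θ K h a b → + 2 * Θ * (a - a) ≡ (+ 2 * Θ - 1ℤ) * K * h * (b - b)
windows-zeros Θ K h a b = solve (Θ ∷ K ∷ h ∷ a ∷ b ∷ [])

prime-power-bound-core₀ : ∀ D → 1ℤ ≤ D → + 4 ≤ + 4 * D
prime-power-bound-core₀ D p = lin (4 · sub p) (solve (D ∷ []))

prime-power-bound-core : ∀ Θ D K v u h x x' d l → d ≤ v * l → l ≤ + 8 * u * K → u * u ≤ v + 1ℤ → v * v ≤ x' → x' ≤ + 2 * x → x ≤ + 2 * D * h → + 128 * Θ * D + 1ℤ ≤ u →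
  0ℤ ≤ Θ → 0ℤ ≤ D → 0ℤ ≤ K → 0ℤ ≤ v → 0ℤ ≤ u → + 4 * D * (+ 4 * Θ * d) ≤ + 4 * D * (K * h)
prime-power-bound-core Θ D K v u h x x' d l p r t w y z b 0≤Θ 0≤D 0≤K 0≤v 0≤u =
  lin (16 · (0≤D ⊠ 0≤Θ ⊠ sub p) ⊞ 16 · (0≤D ⊠ 0≤Θ ⊠ (0≤v ⊠ sub r)) ⊞ 0≤K ⊠ sub w ⊞ 0≤K ⊠ sub y ⊞ 2 · (0≤K ⊠ sub z) ⊞ 0≤K ⊠ 0≤v ⊠ sub t ⊞ (0≤K ⊠ 0≤v) ⊠ (0≤u ⊠ sub b) ⊞ (0≤K ⊠ 0≤v) ⊠ (sub (ℤP.≤-trans one b)))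
    (solve (Θ ∷ D ∷ K ∷ v ∷ u ∷ h ∷ x ∷ x' ∷ d ∷ l ∷ []))
  where
  one : 1ℤ ≤ + 128 * Θ * D + 1ℤ
  one = lin (128 · 0≤Θ ⊠ 0≤D) (solve (Θ ∷ D ∷ []))

L-4^-core : ∀ j K → 0ℤ ≤ j → 0ℤ ≤ K → j * K ≤ + 2 * j * K
L-4^-core j K p t = lin (p ⊠ t) (solve (j ∷ K ∷ []))

too-large-core : ∀ l K B J → l ≤ B * K → + 3 * B + 1ℤ ≤ J → 1ℤ ≤ K → + 3 * l + 1ℤ ≤ J * K
too-large-core l K B J p t w = lin (3 · sub p ⊞ sub t ⊠ ℤP.≤-trans (0≤+ 1) w ⊞ sub w) (solve (l ∷ K ∷ B ∷ J ∷ []))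

42K≤La-core : ∀ e K l J → + 3 * e ≤ J → J * K ≤ + 3 * l → 0ℤ ≤ K → + 3 * (e * K) ≤ + 3 * l
42K≤La-core e K l J p q t = lin (sub p ⊠ t ⊞ sub q) (solve (e ∷ K ∷ l ∷ J ∷ []))

Ln≤2La-core : ∀ l a K → l - a ≤ + 2 * 1ℤ * K → + 42 * K ≤ a → 0ℤ ≤ K → l ≤ + 2 * a
Ln≤2La-core l a K p q t = lin (sub p ⊞ sub q ⊞ 40 · t) (solve (l ∷ a ∷ K ∷ []))

mLm-core : ∀ m l s K H → m * l - K * m - H ≤ s → H ≤ m * K → m * l ≤ s + + 2 * K * m
mLm-core m l s K H p q = lin (sub p ⊞ sub q) (solve (m ∷ l ∷ s ∷ K ∷ H ∷ []))

2n'≤3n-core : ∀ s n' n → + 2 ≤ s → s * n' ≤ s * n + n → 0ℤ ≤ n → s * (+ 2 * n') ≤ s * (+ 3 * n)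
2n'≤3n-core s n' n p q t = lin (2 · sub q ⊞ sub p ⊠ t) (solve (s ∷ n' ∷ n ∷ []))

core-s₁2 : ∀ s n n' b → (s * n + n - s * n') * b ≡ s * (n * b) + n * b - s * (n' * b)
core-s₁2 s n n' b = solve (s ∷ n ∷ n' ∷ b ∷ [])

core-s₂2 : ∀ s n a b → s * (n * b) + n * b - s * (n * a) ≡ n * b - n * (s * (a - b))
core-s₂2 s n a b = solve (s ∷ n ∷ a ∷ b ∷ [])

bound-core2 : ∀ s Q K y₁ y₂ z a b → K * y₁ ≤ z * a → K * y₂ ≤ z * b → z * b ≤ K * y₂ + K → s * (a - b) ≤ b → Q ≤ y₂ → + 2 * s ≤ Q →
  0ℤ ≤ s → 0ℤ ≤ Q → 0ℤ ≤ K → 0ℤ ≤ z * b → 0ℤ ≤ z → s * (Q * K * (y₁ - y₂) + K * y₂) ≤ Q * (+ 2 * z * b)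
bound-core2 s Q K y₁ y₂ z a b h₁ h₂ h₃ h₄ h₅ h₆ 0≤s 0≤Q 0≤K 0≤zb 0≤z =
  lin (0≤s ⊠ 0≤Q ⊠ sub h₁ ⊞ 0≤s ⊠ 0≤Q ⊠ sub h₃ ⊞ 0≤Q ⊠ 0≤z ⊠ sub h₄ ⊞ 0≤s ⊠ 0≤K ⊠ sub h₅ ⊞ 2 · (0≤s ⊠ sub h₂) ⊞ sub h₆ ⊠ 0≤zb)
    (solve (s ∷ Q ∷ K ∷ y₁ ∷ y₂ ∷ z ∷ a ∷ b ∷ []))

eq-split : ∀ r a n q → r * (a - n) ≡ n * (r * q - r) + r * (a - n * q)
eq-split r a n q = solve (r ∷ a ∷ n ∷ q ∷ [])

part₂-mul : ∀ a b n → a ≤ b → 0ℤ ≤ n → a * n ≤ n * b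
part₂-mul a b n p q = lin (q ⊠ sub p) (solve (a ∷ b ∷ n ∷ []))

block-core : ∀ q T₁ T ΔN R₁ R U₁ U d A B K x k H → T₁ ≡ ΔN * R₁ + U₁ → T ≡ ΔN * R + U → ΔN * (q * (R₁ - R)) ≤ d * ((q + + 2) * K * B) →
  q * (U₁ - U) ≤ (R₁ - R + + 2 * K * B) * (+ 6 * x * k) → R₁ - R ≤ + 3 * K * B → q * B * d ≤ q * A + B * (+ 6 * x * k) → d ≤ + 3 * x * k → B * k ≤ + 2 * H →
  0ℤ ≤ K → 0ℤ ≤ B → 0ℤ ≤ x → 0ℤ ≤ + 6 * x * k → q * (T₁ - T) ≤ q * K * A + + 84 * K * x * H
block-core q ._ ._ ΔN R₁ R U₁ U d A B K x k H refl refl a b c f g i 0≤K 0≤B 0≤x 0≤e =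
  lin (sub a ⊞ sub b ⊞ 0≤e ⊠ sub c ⊞ 0≤K ⊠ sub f ⊞ 2 · (0≤K ⊠ 0≤B ⊠ sub g) ⊞ 42 · (0≤K ⊠ 0≤x ⊠ sub i))
    (solve (q ∷ ΔN ∷ R₁ ∷ R ∷ U₁ ∷ U ∷ d ∷ A ∷ B ∷ K ∷ x ∷ k ∷ H ∷ []))

48≤s-core : ∀ D → 1ℤ ≤ D → + 48 ≤ + 48 * D
48≤s-core D p = lin (48 · sub p) (solve (D ∷ []))

H-dyadic-zeros : ∀ a → + 2 * (a - a) ≡ 0ℤ
H-dyadic-zeros a = solve (a ∷ [])

H-dyadic-core : ∀ j K a b c → j * K ≤ + 2 * (b - a) → K ≤ + 2 * (c - b) → (j + 1ℤ) * K ≤ + 2 * (c - a)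
H-dyadic-core j K a b c p q = lin (sub p ⊞ sub q) (solve (j ∷ K ∷ a ∷ b ∷ c ∷ []))

check-step₁ : ∀ k2 k3 k4 L2 L3 → + 6 * (L3 - L2 - (+ 2 * k3 - k2) + (L2 + L2 - L3 - (+ 2 * k4 - k3))) ≡ + 6 * L2 - + 2 * (+ 3 * k3) + + 3 * (+ 2 * k2) - + 3 * (+ 4 * k4)
check-step₁ k2 k3 k4 L2 L3 = solve (k2 ∷ k3 ∷ k4 ∷ L2 ∷ L3 ∷ [])

check-step₂ : ∀ K L2 → + 6 * L2 - + 2 * K + + 3 * K - + 3 * K ≡ + 2 * (+ 3 * L2) - + 2 * K
check-step₂ K L2 = solve (K ∷ L2 ∷ [])

tlo-s₁ : ∀ i a b d → i * (d - (+ 2 * b - a)) ≡ i * d - + 2 * ((i + 1ℤ) * b) + + 2 * b + i * a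
tlo-s₁ i a b d = solve (i ∷ a ∷ b ∷ d ∷ [])

tlo-s₂ : ∀ t K b → t - + 2 * K + + 2 * b + K ≡ t - (K - + 2 * b)
tlo-s₂ t K b = solve (t ∷ K ∷ b ∷ [])

thi-s₁ : ∀ i a b d → i * (+ 2 * a - b - d) ≡ + 2 * (i * a) - (i + 1ℤ) * b + b - i * d
thi-s₁ i a b d = solve (i ∷ a ∷ b ∷ d ∷ [])

thi-s₂ : ∀ t K b → + 2 * K - K + b - t ≡ K + b - t
thi-s₂ t K b = solve (t ∷ K ∷ b ∷ [])

tele-move : ∀ a b → a + (b - a) ≡ b
tele-move a b = solve (a ∷ b ∷ [])

term-core′ : ∀ K i k → i * k ≡ K → + 352 * K * i * (+ 2 * k) ≡ + 704 * (K * K)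
term-core′ .(i * c) i c refl = solve (i ∷ c ∷ [])

part₂-scale-mono : ∀ c a b → 0ℤ ≤ c → a ≤ b → c * a ≤ c * b
part₂-scale-mono c a b p q = lin (p ⊠ sub q) (solve (a ∷ b ∷ c ∷ []))

1≤L-core : ∀ c Q K → 1ℤ ≤ c → 1ℤ ≤ Q → 1ℤ ≤ K → 1ℤ ≤ c * Q * K
1≤L-core c Q K s p q = lin (ℤP.≤-trans (0≤+ 1) s ⊠ (sub p ⊠ ℤP.≤-trans (0≤+ 1) q) ⊞ ℤP.≤-trans (0≤+ 1) s ⊠ sub q ⊞ sub s) (solve (c ∷ Q ∷ K ∷ []))

R-lip-combine : ∀ s Q d e f → 0ℤ ≤ s → Q * d ≤ e → s * e ≤ Q * f → Q * (s * d) ≤ Q * f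
R-lip-combine s Q d e f p q t = lin (p ⊠ sub q ⊞ sub t) (solve (s ∷ Q ∷ d ∷ e ∷ f ∷ []))

R-lip-combine′ : ∀ s Q d e f → 0ℤ ≤ s → - e ≤ Q * d → s * e ≤ Q * f → Q * (- f) ≤ Q * (s * d)
R-lip-combine′ s Q d e f p q t = lin (p ⊠ sub q ⊞ sub t) (solve (s ∷ Q ∷ d ∷ e ∷ f ∷ []))

S-∣r∣-core : ∀ c p K y → p ≤ c * K * y → 1ℤ ≤ y → 0ℤ ≤ K → p + y * K + + 4 * K ≤ (c + + 5) * K * y
S-∣r∣-core c p K y a b d = lin (sub a ⊞ 4 · (sub b ⊠ d)) (solve (c ∷ p ∷ K ∷ y ∷ []))

tail-factor : ∀ a b c → a * c - b * c ≡ c * (a - b)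
tail-factor a b c = solve (a ∷ b ∷ c ∷ [])

compare-core : ∀ a n q → a ≤ n * (q + 1ℤ) → a - n * q ≤ n
compare-core a n q p = lin (sub p) (solve (a ∷ n ∷ q ∷ []))

tail-bound-core : ∀ n y z K a b c → 0ℤ ≤ a + b + c → n * y ≤ z → 0ℤ ≤ K → n * (a * (y * K) + b * K * y) + n * (c * K * y) ≤ (a + b + c) * K * z
tail-bound-core n y z K a b c s p q = lin (s ⊠ (q ⊠ sub p)) (solve (n ∷ y ∷ z ∷ K ∷ a ∷ b ∷ c ∷ []))

partial-sum-shape : ∀ a b → a - (a - b) ≡ b
partial-sum-shape a b = solve (a ∷ b ∷ [])

partial-sum-join : ∀ a b K z → a * (z * K) + b * K * z ≡ (a + b) * K * z
partial-sum-join a b K z = solve (a ∷ b ∷ K ∷ z ∷ [])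

Δ-fine-core : ∀ Q K y' y x h k → K * y' ≤ (x + h) * k → K * y ≤ x * k → x * k ≤ K * y + K → Q ≤ y → 0ℤ ≤ Q → 0ℤ ≤ K → Q * K * (y' - y) + K * y ≤ (Q * h + + 2 * x) * k
Δ-fine-core Q K y' y x h k a b c d 0≤Q 0≤K = lin (0≤Q ⊠ sub a ⊞ 2 · sub b ⊞ 0≤Q ⊠ sub c ⊞ 0≤K ⊠ sub d) (solve (Q ∷ K ∷ y' ∷ y ∷ x ∷ h ∷ k ∷ []))

Δ-coarse-core : ∀ Q h x k → 1ℤ ≤ Q → + 2 * h ≤ x → 0ℤ ≤ h → 0ℤ ≤ k → (Q * h + + 2 * x) * k ≤ Q * (+ 3 * x * k)
Δ-coarse-core Q h x k p q t u = lin ((ℤP.≤-trans (0≤+ 1) p ⊠ (sub q ⊞ t) ⊞ 2 · (sub p ⊠ (sub q ⊞ 2 · t))) ⊠ u) (solve (Q ∷ h ∷ x ∷ k ∷ []))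

Δ-lip-shape : ∀ s a b c d → s * (a - b) - s * (c - d) ≡ s * (a - c - (b - d))
Δ-lip-shape s a b c d = solve (s ∷ a ∷ b ∷ c ∷ d ∷ [])

Δ-lip-core : ∀ x h k → + 2 * h ≤ x → 0ℤ ≤ h → 0ℤ ≤ k → + 2 * (x + h) * k + + 2 * x * k ≤ + 6 * x * k
Δ-lip-core x h k p q t = lin ((2 · sub p ⊞ 2 · q) ⊠ t) (solve (x ∷ h ∷ k ∷ []))

r⊴-large-shape : ∀ a C → a + 0ℤ * C ≡ a
r⊴-large-shape a C = solve (a ∷ C ∷ [])

split-zeros : ∀ a b c w → a * (0ℤ * w) ≡ b * (0ℤ * w) + c * (0ℤ * w)
split-zeros a b c w = solve (a ∷ b ∷ c ∷ w ∷ [])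

term-none : ∀ l x y z f → x ≤ y → 0ℤ ≤ l → 0ℤ ≤ z → 0ℤ ≤ f → l * x - l * y ≤ l * z + f
term-none l x y z f p q r t = lin (q ⊠ sub p ⊞ q ⊠ r ⊞ t) (solve (l ∷ x ∷ y ∷ z ∷ f ∷ []))

term-some : ∀ l x y z f → x ≤ y + z + 1ℤ → 0ℤ ≤ l → l ≤ f → l * x - l * y ≤ l * z + f
term-some l x y z f p q r = lin (q ⊠ sub p ⊞ sub r) (solve (l ∷ x ∷ y ∷ z ∷ f ∷ []))

term-low : ∀ s l d → s ≤ l → 0ℤ ≤ d → 1ℤ * s ≤ 1ℤ * l + d
term-low s l d p q = lin (sub p ⊞ q) (solve (s ∷ l ∷ d ∷ []))

term-high : ∀ s l d → s ≤ d → 1ℤ * s ≤ 0ℤ * l + d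
term-high s l d p = lin (sub p) (solve (s ∷ l ∷ d ∷ []))

*7-mono : ∀ a b → a ≤ b → + 7 * a ≤ + 7 * b
*7-mono a b p = lin (7 · sub p) (solve (a ∷ b ∷ []))

pairs-core : ∀ h la lu s g₁ g₂ → + 4 * (h * la) ≤ + 7 * s → + 4 * lu ≤ + 7 * (g₁ + g₂) → la ≤ lu → + 4 * ((h + 1ℤ) * la) ≤ + 7 * (s + g₁ + g₂)
pairs-core h la lu s g₁ g₂ p q r = lin (sub p ⊞ sub q ⊞ 4 · sub r) (solve (h ∷ la ∷ lu ∷ s ∷ g₁ ∷ g₂ ∷ []))

core-shape : ∀ K Ly → + 2 * 1ℤ * K - (Ly - 0ℤ) ≡ + 2 * (0ℤ + 1ℤ) * K - Ly
core-shape K Ly = solve (K ∷ Ly ∷ [])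

H-shift-zeros : ∀ a → 0ℤ ≡ 0ℤ + a - a
H-shift-zeros a = solve (a ∷ [])

at1-move : ∀ C y → 1ℤ * C * y ≡ 1ℤ * (y * C)
at1-move C y = solve (C ∷ y ∷ [])

ℤ-hi-core : ∀ y v → y + 1ℤ ≤ (v + 1ℤ) * (v + 1ℤ) → y ≤ v * v + + 2 * v
ℤ-hi-core y v p = lin (sub p) (solve (y ∷ v ∷ []))

yk-core : ∀ y v kv K → v * kv ≡ K → y ≤ v * v + + 2 * v → 0ℤ ≤ kv → 1ℤ ≤ v → 0ℤ ≤ K → y * kv ≤ + 3 * (v * K)
yk-core y v kv .(v * kv) refl p q s t = lin (sub p ⊠ q ⊞ 2 · (sub s ⊠ t)) (solve (y ∷ v ∷ kv ∷ []))

L-gap-core : ∀ l m y v κ → l - m ≤ (y - v * v) * (+ 2 * κ) → y ≤ v * v + + 2 * v → 0ℤ ≤ κ → l - m ≤ + 4 * (v * κ)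
L-gap-core l m y v κ p q s = lin (sub p ⊞ 2 · (sub q ⊠ s)) (solve (l ∷ m ∷ y ∷ v ∷ κ ∷ []))

Ly≤-core : ∀ l m v κ K → v * v * κ ≡ K → l - (m + m) ≤ + 4 * (v * κ) → m ≤ + 2 * (v - 1ℤ) * K → 1ℤ ≤ v → 0ℤ ≤ κ → l ≤ + 4 * (v * K)
Ly≤-core l m v κ .(v * v * κ) refl p q s t = lin (sub p ⊞ 2 · sub q ⊞ 4 · (sub s ⊠ (ℤP.≤-trans (0≤+ 1) s ⊠ t))) (solve (l ∷ m ∷ v ∷ κ ∷ []))

Hy-core : ∀ h l g ky v K → h - l - g ≤ + 2 * ky → g ≤ + 2 * K → ky ≤ K → l ≤ + 4 * (v * K) → 1ℤ ≤ v → 0ℤ ≤ K → h ≤ + 8 * (v * K)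
Hy-core h l g ky v K p q s t u x = lin (sub p ⊞ sub q ⊞ 2 · sub s ⊞ sub t ⊞ 4 · (sub u ⊠ x)) (solve (h ∷ l ∷ g ∷ ky ∷ v ∷ K ∷ []))

y·L≤-core : ∀ y d v κ K → v * v * κ ≡ K → d ≤ + 4 * (v * κ) → y ≤ v * v + + 2 * v → 1ℤ ≤ v → 0ℤ ≤ κ → 0ℤ ≤ y → y * d ≤ + 12 * (v * K)
y·L≤-core y d v κ .(v * v * κ) refl p q s t u = lin (u ⊠ sub p ⊞ 4 · (sub q ⊠ (0≤v ⊠ t)) ⊞ 8 · (sub s ⊠ (0≤v ⊠ (0≤v ⊠ t)))) (solve (y ∷ d ∷ v ∷ κ ∷ []))
  where
  0≤v : 0ℤ ≤ v
  0≤v = ℤP.≤-trans (0≤+ 1) s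

ψ-eq-move : ∀ a b c → a ≡ a - b + c + b - c
ψ-eq-move a b c = solve (a ∷ b ∷ c ∷ [])

eq-core₁ : ∀ a b s p e c t → s ≡ a - t → p ≡ b + e - c → a + b ≡ s + p - e + c + t
eq-core₁ a b ._ ._ e c t refl refl = solve (a ∷ b ∷ e ∷ c ∷ t ∷ [])

pointwise-shape : ∀ l K C → 0ℤ * (l - K + 1ℤ * C) ≡ 0ℤ * l - K * 0ℤ
pointwise-shape l K C = solve (l ∷ K ∷ C ∷ [])

pointwise-shape2 : ∀ L l K C → L * (l - K + 0ℤ * C) ≡ L * l - K * L
pointwise-shape2 L l K C = solve (L ∷ l ∷ K ∷ C ∷ [])

W-incr-core : ∀ a b c d e → e ≤ a - b → d ≤ c → e ≤ a + c - (b + d)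
W-incr-core a b c d e p q = lin (sub p ⊞ sub q) (solve (a ∷ b ∷ c ∷ d ∷ e ∷ []))

L-near-shape : ∀ K → + 2 * 1ℤ * K ≡ + 2 * K
L-near-shape K = solve (K ∷ [])

R-incr≡-core : ∀ R' R p' p K y' y C s' s → R' ≡ p' - K * y' + C * s' → R ≡ p - K * y + C * s → s' ≡ s → R' - R ≡ p' - p - K * (y' - y)
R-incr≡-core ._ ._ p' p K y' y C s' .s' refl refl refl = solve (p' ∷ p ∷ K ∷ y' ∷ y ∷ C ∷ s' ∷ [])

ψ-incr-core : ∀ e W' W s' s l' l K y' y c → e ≤ W' - W → s' - s ≤ (y' - y) * l' → l' - l ≤ + 2 * K →
  W' - + 2 * K * s' ≤ c * (K * K) * y' → - (c * (K * K) * y) ≤ W - + 2 * K * s → y ≤ y' → y' ≤ + 2 * y → 0ℤ ≤ K → 0ℤ ≤ c →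
  e ≤ + 2 * K * (y' - y) * l + (+ 3 * c + + 4) * (K * K) * y
ψ-incr-core e W' W s' s l' l K y' y q a b c d f g h p t =
  lin (sub a ⊞ 2 · (p ⊠ sub b) ⊞ 2 · (p ⊠ (sub g ⊠ sub c)) ⊞ sub d ⊞ sub f ⊞ (t ⊞ 0≤+ 4) ⊠ (p ⊠ p ⊠ sub h))
    (solve (e ∷ W' ∷ W ∷ s' ∷ s ∷ l' ∷ l ∷ K ∷ y' ∷ y ∷ q ∷ []))

R-incr-lower : ∀ d p' p K y' y Q → d ≡ p' - p - K * (y' - y) → p ≤ p' → 0ℤ ≤ y → 0ℤ ≤ Q → 0ℤ ≤ K → y ≤ y' → - (Q * K * (y' - y) + K * y) ≤ Q * d
R-incr-lower ._ p' p K y' y Q refl a b c e f = lin (c ⊠ sub a ⊞ e ⊠ b) (solve (p' ∷ p ∷ K ∷ y' ∷ y ∷ Q ∷ []))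

R-incr-upper : ∀ q d p' p K y' y Q l → d ≡ p' - p - K * (y' - y) → l * (p' - p) ≤ + 2 * K * (y' - y) * l + q * (K * K) * y →
  q * Q * K ≤ l → 0ℤ ≤ y → 0ℤ ≤ Q → 0ℤ ≤ K → l * (Q * d) ≤ l * (Q * K * (y' - y) + K * y)
R-incr-upper q ._ p' p K y' y Q l refl a b c e f = lin (e ⊠ sub a ⊞ sub b ⊠ (f ⊠ c)) (solve (q ∷ p' ∷ p ∷ K ∷ y' ∷ y ∷ Q ∷ l ∷ []))

doubling-core : ∀ y y' → + 2 ≤ y → + 2 * y' + 1ℤ ≤ + 3 * (y + 1ℤ) → + 2 * y' ≤ + 2 * (+ 2 * y)
doubling-core y y' p q = lin (sub p ⊞ sub q) (solve (y ∷ y' ∷ []))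

sum-G-core : ∀ c w l q → c ≤ q + 1ℤ → w ≤ l → 0ℤ ≤ w → 0ℤ ≤ q → c * w ≤ l + l * q
sum-G-core c w l q p t u v = lin (sub p ⊠ u ⊞ (v ⊞ 0≤+ 1) ⊠ sub t) (solve (c ∷ w ∷ l ∷ q ∷ []))

rad-log-one-of : ∀ a b c w → c ≤ 1ℤ → 1ℤ ≤ a + b → 0ℤ ≤ w → c * w ≤ a * w + b * w
rad-log-one-of a b c w p q r = lin (sub p ⊠ r ⊞ sub q ⊠ r) (solve (a ∷ b ∷ c ∷ w ∷ []))

k-anti-core : ∀ a b ka kb K → a * ka ≡ K → b * kb ≡ K → a ≤ b → 0ℤ ≤ ka → b * kb ≤ b * ka
k-anti-core a b ka kb .(a * ka) refl e p q = subst (_≤ b * ka) (sym e) (lin (sub p ⊠ q) (solve (a ∷ b ∷ ka ∷ [])))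

k-half-core : ∀ a b ka kb K → a * ka ≡ K → b * kb ≡ K → b ≤ + 2 * a → 0ℤ ≤ kb → a * ka ≤ a * (+ 2 * kb)
k-half-core a b ka kb .(b * kb) e refl p q = subst (_≤ a * (+ 2 * kb)) (sym e) (lin (sub p ⊠ q) (solve (a ∷ b ∷ kb ∷ [])))

L-step≤-core : ∀ a b → 0ℤ ≤ b → + 2 * a - b ≤ + 2 * a
L-step≤-core a b p = lin p (solve (a ∷ b ∷ []))

L-grow-lo : ∀ a b c → 0ℤ ≤ b - a → 0ℤ ≤ c - b → 0ℤ ≤ c - a
L-grow-lo a b c p q = lin (p ⊞ q) (solve (a ∷ b ∷ c ∷ []))

L-grow-hi : ∀ a b c n ka kb → b - a ≤ n * (+ 2 * ka) → c - b ≤ + 2 * kb → kb ≤ ka → c - a ≤ (n + 1ℤ) * (+ 2 * ka)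
L-grow-hi a b c n ka kb p q r = lin (sub p ⊞ sub q ⊞ 2 · sub r) (solve (a ∷ b ∷ c ∷ n ∷ ka ∷ kb ∷ []))

L-diff-ratio-core : ∀ Lb La a b c ka K → Lb - La ≤ (b - a) * (+ 2 * ka) → b ≤ (c + 1ℤ) * a → 0ℤ ≤ ka → a * ka ≡ K → Lb - La ≤ + 2 * c * K
L-diff-ratio-core Lb La a b c ka .(a * ka) p q r refl = lin (sub p ⊞ 2 · (sub q ⊠ r)) (solve (Lb ∷ La ∷ a ∷ b ∷ c ∷ ka ∷ []))

L-linear-core : ∀ l n k K → l - 0ℤ ≤ (n - 1ℤ) * (+ 2 * k) → k ≡ K → l ≤ + 2 * (n - 1ℤ) * K
L-linear-core l n c .c p refl = lin (sub p) (solve (l ∷ n ∷ c ∷ []))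

L-lower-core : ∀ j K L2 Lj Ly → 0ℤ ≤ j → K ≤ + 3 * L2 → Lj ≡ j * L2 → Lj ≤ Ly → j * K ≤ + 3 * Ly
L-lower-core j K L2 .(j * L2) Ly r p refl q = lin (r ⊠ sub p ⊞ 3 · sub q) (solve (j ∷ K ∷ L2 ∷ Ly ∷ []))

L2-hi-shape : ∀ K → + 2 * (+ 2 - 1ℤ) * K ≡ + 2 * K
L2-hi-shape K = solve (K ∷ [])

L-upper-more : ∀ j K → 0ℤ ≤ K → + 2 * j * K ≤ + 2 * (j + 1ℤ) * K
L-upper-more j K p = lin (2 · p) (solve (j ∷ K ∷ []))

L-upper-core : ∀ j K L2 Lj Ly → 0ℤ ≤ j → j ≡ 0ℤ ⊎ L2 ≤ + 2 * K → Lj ≡ j * L2 → Ly - Lj ≤ + 2 * 1ℤ * K → Ly ≤ + 2 * (j + 1ℤ) * K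
L-upper-core j K L2 .(j * L2) Ly r (inj₂ p) refl q = lin (r ⊠ sub p ⊞ sub q) (solve (j ∷ K ∷ L2 ∷ Ly ∷ []))
L-upper-core .0ℤ K L2 Lj Ly r (inj₁ refl) refl q = lin (sub q) (core-shape K Ly)

H-L-drift-zeros : ∀ k h → - (+ 2 * (k - k)) ≡ h - h
H-L-drift-zeros k h = solve (k ∷ h ∷ [])

H-L-drift-zeros′ : ∀ k h → h - h ≡ k - k
H-L-drift-zeros′ k h = solve (k ∷ h ∷ [])

H-L-drift-lo : ∀ kn km km' h H L L' → - (+ 2 * (kn - km)) ≤ (H - L) - h → L' - L ≤ + 2 * km - km' → - (+ 2 * (kn - km')) ≤ (H + km' - L') - h
H-L-drift-lo kn km km' h H L L' p q = lin (sub p ⊞ sub q) (solve (kn ∷ km ∷ km' ∷ h ∷ H ∷ L ∷ L' ∷ []))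

H-L-drift-hi : ∀ kn km km' h H L L' → (H - L) - h ≤ kn - km → + 2 * km' - km ≤ L' - L → (H + km' - L') - h ≤ kn - km'
H-L-drift-hi kn km km' h H L L' p q = lin (sub p ⊞ sub q) (solve (kn ∷ km ∷ km' ∷ h ∷ H ∷ L ∷ L' ∷ []))

H-L-γ-lo : ∀ kn kX h g → g - h ≤ kn - kX → 0ℤ ≤ kX → - kn ≤ h - g
H-L-γ-lo kn kX h g p q = lin (sub p ⊞ q) (solve (kn ∷ kX ∷ h ∷ g ∷ []))

H-L-γ-hi : ∀ kn kX h g → - (+ 2 * (kn - kX)) ≤ g - h → 0ℤ ≤ kX → h - g ≤ + 2 * kn
H-L-γ-hi kn kX h g p q = lin (sub p ⊞ 2 · q) (solve (kn ∷ kX ∷ h ∷ g ∷ []))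

γ-bound-core : ∀ k1 g K → k1 ≡ K → (- k1 ≤ 0ℤ + k1 - 0ℤ - g) × (0ℤ + k1 - 0ℤ - g ≤ + 2 * k1) → 0ℤ ≤ K → g ⊴ + 2 * K
γ-bound-core c g .c refl (p , q) r = lin (sub q ⊞ r) (solve (c ∷ g ∷ [])) , lin (sub p) (solve (c ∷ g ∷ []))

floor-k-lo : ∀ y q a ka K → a * ka ≡ K → 0ℤ ≤ ka → q * a ≤ y → K * q ≤ y * ka
floor-k-lo y q a ka .(a * ka) refl p h = lin (sub h ⊠ p) (solve (y ∷ q ∷ a ∷ ka ∷ []))

floor-k-hi : ∀ y q a ka K → a * ka ≡ K → 0ℤ ≤ ka → y ≤ (q + 1ℤ) * a → y * ka ≤ K * q + K
floor-k-hi y q a ka .(a * ka) refl p h = lin (sub h ⊠ p) (solve (y ∷ q ∷ a ∷ ka ∷ []))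

stirling-lo : ∀ l y y' s T K H → y' ≡ y + 1ℤ → s ≡ l * y' - T → T ≤ y * K + (H - K) → 0ℤ ≤ K → y' * l - K * y' - H ≤ s
stirling-lo l y .(y + 1ℤ) .(l * (y + 1ℤ) - T) T K H refl refl p q = lin (sub p ⊞ 2 · q) (solve (l ∷ y ∷ T ∷ K ∷ H ∷ []))

stirling-hi : ∀ l y y' s T K H → y' ≡ y + 1ℤ → s ≡ l * y' - T → y * K - + 2 * (H - K) ≤ T → 0ℤ ≤ K → s ≤ y' * l - K * y' + + 2 * H
stirling-hi l y .(y + 1ℤ) .(l * (y + 1ℤ) - T) T K H refl refl p q = lin (sub p ⊞ q) (solve (l ∷ y ∷ T ∷ K ∷ H ∷ []))

E-eq-expand : ∀ l K i C q → (l - K + i * C) * q ≡ l * q - K * q + i * C * q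
E-eq-expand l K i C q = solve (l ∷ K ∷ i ∷ C ∷ q ∷ [])

E-bound-sqrt-upper : ∀ y v K Ly Lv kv g Hy Hv SL A E → E ≡ SL - K * (+ 2 * A - v * v) + y * (+ 2 * g) → 0ℤ ≤ K → 1ℤ ≤ v → v * v ≤ y →
  y * (Ly - (Lv + Lv)) ≤ + 12 * (v * K) → y * kv ≤ + 3 * (v * K) → Hy ≤ + 8 * (v * K) → SL ≤ y * Ly - K * y + + 2 * Hy → y * Hv ≤ K * A + v * K →
  - kv ≤ Hv - Lv - g → E ≤ + 44 * (v * K)
E-bound-sqrt-upper y v K Ly Lv kv g Hy Hv SL A ._ refl p q s a b c d e f =
  lin (sub s ⊠ p ⊞ sub a ⊞ 2 · sub b ⊞ 2 · sub c ⊞ sub d ⊞ 2 · sub e ⊞ 2 · (ℤP.≤-trans (0≤v ⊠ 0≤v) s ⊠ sub f) ⊞ 8 · (0≤v ⊠ p))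
    (solve (y ∷ v ∷ K ∷ Ly ∷ Lv ∷ kv ∷ g ∷ Hy ∷ Hv ∷ SL ∷ A ∷ []))
  where
  0≤v : 0ℤ ≤ v
  0≤v = ℤP.≤-trans (0≤+ 1) q

E-bound-sqrt-lower : ∀ y v K Ly Lv kv g Hy Hv SL A E → E ≡ SL - K * (+ 2 * A - v * v) + y * (+ 2 * g) → 0ℤ ≤ K → 1ℤ ≤ v → v * v ≤ y → y ≤ v * v + + 2 * v →
  0ℤ ≤ y * (Ly - (Lv + Lv)) → y * kv ≤ + 3 * (v * K) → Hy ≤ + 8 * (v * K) → y * Ly - K * y - Hy ≤ SL → K * A ≤ y * Hv →
  Hv - Lv - g ≤ + 2 * kv → - (+ 44 * (v * K)) ≤ E
E-bound-sqrt-lower y v K Ly Lv kv g Hy Hv SL A ._ refl p q s s' a b c d e f =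
  lin (sub s' ⊠ p ⊞ a ⊞ 4 · sub b ⊞ sub c ⊞ sub d ⊞ 2 · sub e ⊞ 2 · (ℤP.≤-trans (0≤v ⊠ 0≤v) s ⊠ sub f) ⊞ 22 · (0≤v ⊠ p))
    (solve (y ∷ v ∷ K ∷ Ly ∷ Lv ∷ kv ∷ g ∷ Hy ∷ Hv ∷ SL ∷ A ∷ []))
  where
  0≤v : 0ℤ ≤ v
  0≤v = ℤP.≤-trans (0≤+ 1) q

E-bound-core : ∀ v t K → v ≤ + 2 * t → 0ℤ ≤ K → + 44 * (v * K) ≤ + 88 * (t * K)
E-bound-core v t K p q = lin (44 · (sub p ⊠ q)) (solve (v ∷ t ∷ K ∷ []))

R-bound-shape : ∀ K x → + 4 * (+ 88 * K) * x ≡ + 352 * K * x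
R-bound-shape K x = solve (K ∷ x ∷ [])

R-bound-core : ∀ i p K → 0ℤ ≤ i → 0ℤ ≤ p → 0ℤ ≤ K → + 88 * (p * K) ≤ + 88 * K * ((i + 1ℤ) * p)
R-bound-core i p K a b c = lin (88 · (a ⊠ (b ⊠ c))) (solve (i ∷ p ∷ K ∷ []))

G-bound-core : ∀ l p K s → 0ℤ ≤ p → 0ℤ ≤ K → l ≤ + 2 * (+ 2 * s) * K → l * (+ 88 * (p * K)) + + 88 * (p * K) * l ≤ + 704 * (K * K) * (s * p)
G-bound-core l p K s a b h = lin (176 · (a ⊠ b ⊠ sub h)) (solve (l ∷ p ∷ K ∷ s ∷ []))

G-⋆-expand : ∀ r s q l → r * (s + q * l) ≡ l * r * q + r * s
G-⋆-expand r s q l = solve (r ∷ s ∷ q ∷ l ∷ [])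

Z-bound-shape : ∀ K x → + 4 * (+ 704 * K) * x ≡ + 2816 * K * x
Z-bound-shape K x = solve (K ∷ x ∷ [])

r⋆ψ-expand : ∀ r R K q C s → r * (R + K * q - C * s) ≡ r * R + K * (r * q) - C * (r * s)
r⋆ψ-expand r R K q C s = solve (r ∷ R ∷ K ∷ q ∷ C ∷ s ∷ [])

C-bound-shape : ∀ K → + 2 * (+ 2 * K) ≡ + 4 * K
C-bound-shape K = solve (K ∷ [])

E-bound-linear-core : ∀ v y K → v ≤ y → 0ℤ ≤ K → + 44 * (v * K) ≤ + 44 * (y * K)
E-bound-linear-core v y K p q = lin (44 · (sub p ⊠ q)) (solve (v ∷ y ∷ K ∷ []))

selberg-core : ∀ K n y → n ≤ y → 0ℤ ≤ y → 0ℤ ≤ K → + 2816 * (K * K) * y + K * (+ 44 * (y * K)) + + 4 * K * (+ 352 * K * y) + n * (+ 704 * (K * K)) ≤ + 5000 * (K * K) * y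
selberg-core K n y p q s = lin (704 · (sub p ⊠ (s ⊠ s)) ⊞ 28 · (q ⊠ (s ⊠ s))) (solve (K ∷ n ∷ y ∷ []))

W-eq-core : ∀ a b s p K l c → s ≡ a - K * l → p ≡ b - K * l + c → a + b ≡ s + p + + 2 * K * l - c
W-eq-core a b ._ ._ K l c refl refl = solve (a ∷ b ∷ K ∷ l ∷ c ∷ [])

W-eq-expand : ∀ l K i C p → (l - K + i * C) * p ≡ l * p - K * (1ℤ * p) + i * (C * p)
W-eq-expand l K i C p = solve (l ∷ K ∷ i ∷ C ∷ p ∷ [])

ψ-bound-core : ∀ p R K y C → R ≡ p - K * y + C * 1ℤ → R ≤ + 352 * K * y → - (+ 4 * K) ≤ C → 1ℤ ≤ y → 0ℤ ≤ K → p ≤ + 357 * K * y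
ψ-bound-core p ._ K y C refl a b c d = lin (sub a ⊞ sub b ⊞ 4 · (sub c ⊠ d)) (solve (p ∷ K ∷ y ∷ C ∷ []))

W-bound-core : ∀ W Z l c → W ≡ Z + l - c → Z - c ≡ W - l
W-bound-core ._ Z l c refl = solve (Z ∷ l ∷ c ∷ [])

W-bound-bound : ∀ K y a b d → 0ℤ ≤ y → 0ℤ ≤ K → 0ℤ ≤ d → a * (K * K) * y + + 4 * K * (b * K * y) ≤ (a + + 4 * b + d) * (K * K) * y
W-bound-bound K y a b d p q s = lin (s ⊠ (p ⊠ (q ⊠ q))) (solve (K ∷ y ∷ a ∷ b ∷ d ∷ []))

Λ-by-lpf-ones : ∀ c → 1ℤ * (1ℤ * c) ≡ c
Λ-by-lpf-ones c = solve (c ∷ [])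

prime-powers-drop : ∀ a b → 0ℤ ≤ b → a - b ≤ a
prime-powers-drop a b p = lin p (solve (a ∷ b ∷ []))

-- Prime number theory

module Analysis {X : ℕ} (lg : Logarithm X) where
  open Logarithm lg public using (K; k; w; 1≤K; k-spec; w≥0; step-lo; step-hi)
  open AdditiveProperties w public hiding (Λ≥0; L≥0; Λ-at; Λ-at≥0; Λ-at-*; S-Λ-at)

  Λ≥0 : ∀ n → 0ℤ ≤ Λ n
  Λ≥0 = AdditiveProperties.Λ≥0 w w≥0

  L≥0 : ∀ n → 0ℤ ≤ L n
  L≥0 = AdditiveProperties.L≥0 w w≥0

  K≥0 : 0ℤ ≤ K
  K≥0 = ℤP.≤-trans (0≤+ 1) 1≤K

  H : ℕ → ℤ
  H = S k

  k≥0 : ∀ {n} → 1 ℕ.≤ n → n ℕ.≤ X → 0ℤ ≤ k n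
  k≥0 {n} 1≤n n≤X = *-cancel-≤ {n} 0ℤ (k n) 1≤n (subst₂ _≤_ (sym (ℤP.*-zeroʳ (+ n))) (sym (k-spec n 1≤n n≤X)) K≥0)

  k-anti : ∀ {a b} → 1 ℕ.≤ a → a ℕ.≤ b → b ℕ.≤ X → k b ≤ k a
  k-anti {a} {b} 1≤a a≤b b≤X = *-cancel-≤ {b} (k b) (k a) (ℕP.≤-trans 1≤a a≤b)
    (k-anti-core (+ a) (+ b) (k a) (k b) K (k-spec a 1≤a (ℕP.≤-trans a≤b b≤X)) (k-spec b (ℕP.≤-trans 1≤a a≤b) b≤X) (≤-ℤ a≤b) (k≥0 1≤a (ℕP.≤-trans a≤b b≤X)))

  k-half : ∀ {a b} → 1 ℕ.≤ a → a ℕ.≤ b → b ℕ.≤ 2 ℕ.* a → b ℕ.≤ X → k a ≤ + 2 * k b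
  k-half {a} {b} 1≤a a≤b b≤2a b≤X = *-cancel-≤ {a} (k a) (+ 2 * k b) 1≤a
    (k-half-core (+ a) (+ b) (k a) (k b) K (k-spec a 1≤a (ℕP.≤-trans a≤b b≤X)) (k-spec b (ℕP.≤-trans 1≤a a≤b) b≤X)
      (subst (+ b ≤_) (ℤP.pos-* 2 a) (≤-ℤ b≤2a)) (k≥0 (ℕP.≤-trans 1≤a a≤b) b≤X))

  k1 : 1 ℕ.≤ X → k 1 ≡ K
  k1 1≤X = trans (sym (ℤP.*-identityˡ (k 1))) (k-spec 1 ℕP.≤-refl 1≤X)

  L-step≥0 : ∀ {n} → 1 ℕ.≤ n → n ℕ.< X → 0ℤ ≤ L (suc n) - L n
  L-step≥0 {n} 1≤n n<X = ℤP.≤-trans (sub (k-half 1≤n (ℕP.n≤1+n n) le n<X)) (step-lo n 1≤n n<X)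
    where
    le : suc n ℕ.≤ 2 ℕ.* n
    le = subst (suc n ℕ.≤_) (cong (n ℕ.+_) (sym (ℕP.+-identityʳ n))) (ℕP.+-monoˡ-≤ n 1≤n)

  L-step≤ : ∀ {n} → 1 ℕ.≤ n → n ℕ.< X → L (suc n) - L n ≤ + 2 * k n
  L-step≤ {n} 1≤n n<X = ℤP.≤-trans (step-hi n 1≤n n<X) (L-step≤-core (k n) (k (suc n)) (k≥0 (s≤s z≤n) n<X))

  L-grow : ∀ {a} n → 1 ℕ.≤ a → a ℕ.+ n ℕ.≤ X → 0ℤ ≤ L (a ℕ.+ n) - L a × L (a ℕ.+ n) - L a ≤ + n * (+ 2 * k a)
  L-grow {a} zero 1≤a le rewrite ℕP.+-identityʳ a = ℤP.≤-reflexive (sym (ℤP.+-inverseʳ (L a))) , ℤP.≤-reflexive (ℤP.+-inverseʳ (L a))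
  L-grow {a} (suc n) 1≤a le rewrite ℕP.+-suc a n =
      L-grow-lo (L a) (L b) (L (suc b)) (proj₁ ih) (L-step≥0 1≤b le)
    , subst (λ z → L (suc b) - L a ≤ z * (+ 2 * k a)) (sym (+suc n)) (L-grow-hi (L a) (L b) (L (suc b)) (+ n) (k a) (k b) (proj₂ ih) (L-step≤ 1≤b le) (k-anti 1≤a (ℕP.m≤m+n a n) (ℕP.<⇒≤ le)))
    where
    b : ℕ
    b = a ℕ.+ n
    1≤b : 1 ℕ.≤ b
    1≤b = ℕP.≤-trans 1≤a (ℕP.m≤m+n a n)
    ih : 0ℤ ≤ L b - L a × L b - L a ≤ + n * (+ 2 * k a)
    ih = L-grow n 1≤a (ℕP.<⇒≤ le)

  L-mono : ∀ {a b} → 1 ℕ.≤ a → a ℕ.≤ b → b ℕ.≤ X → L a ≤ L b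
  L-mono {a} {b} 1≤a a≤b b≤X = ℤP.0≤i-j⇒j≤i (subst (λ c → 0ℤ ≤ L c - L a) eq (proj₁ (L-grow (b ℕ.∸ a) 1≤a (subst (ℕ._≤ X) (sym eq) b≤X))))
    where
    eq : a ℕ.+ (b ℕ.∸ a) ≡ b
    eq = ℕP.m+[n∸m]≡n a≤b

  L-diff : ∀ {a b} → 1 ℕ.≤ a → a ℕ.≤ b → b ℕ.≤ X → L b - L a ≤ (+ b - + a) * (+ 2 * k a)
  L-diff {a} {b} 1≤a a≤b b≤X = subst₂ (λ c d → L c - L a ≤ d * (+ 2 * k a)) eq (+∸ a≤b) (proj₂ (L-grow (b ℕ.∸ a) 1≤a (subst (ℕ._≤ X) (sym eq) b≤X)))
    where
    eq : a ℕ.+ (b ℕ.∸ a) ≡ b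
    eq = ℕP.m+[n∸m]≡n a≤b

  -- log b ≤ log a + 2 (b/a - 1) ≤ log a + 2 c
  L-diff-ratio : ∀ {a b} c → 1 ℕ.≤ a → a ℕ.≤ b → b ℕ.≤ X → + b ≤ (+ c + 1ℤ) * + a → L b - L a ≤ + 2 * + c * K
  L-diff-ratio {a} {b} c 1≤a a≤b b≤X h = L-diff-ratio-core (L b) (L a) (+ a) (+ b) (+ c) (k a) K (L-diff 1≤a a≤b b≤X) h (k≥0 1≤a (ℕP.≤-trans a≤b b≤X)) (k-spec a 1≤a (ℕP.≤-trans a≤b b≤X))

  L-linear : ∀ {n} → 1 ℕ.≤ n → n ℕ.≤ X → L n ≤ + 2 * (+ n - 1ℤ) * K
  L-linear {n} 1≤n n≤X = L-linear-core (L n) (+ n) (k 1) K (L-diff ℕP.≤-refl 1≤n n≤X) (k1 (ℕP.≤-trans 1≤n n≤X))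

  -- The step at 1 only yields 0 ≤ L 2. The steps at 2 and 3 together bound L 4 - L 2 below by K/3,
  -- and this difference is L 2 by additivity.
  L2-lo : 4 ℕ.≤ X → K ≤ + 3 * L 2
  L2-lo 4≤X = core (k 2) (k 3) (k 4) (L 2) (L 3) (L 4) K (step-lo 2 (s≤s z≤n) (ℕP.<⇒≤ 4≤X)) (step-lo 3 (s≤s z≤n) 4≤X)
      (L-* 2 2 (s≤s z≤n) (s≤s z≤n)) (k-spec 2 (s≤s z≤n) (ℕP.≤-trans (s≤s (s≤s z≤n)) 4≤X)) (k-spec 3 (s≤s z≤n) (ℕP.<⇒≤ 4≤X)) (k-spec 4 (s≤s z≤n) 4≤X)
    where
    core : ∀ k2 k3 k4 L2 L3 L4 K → + 2 * k3 - k2 ≤ L3 - L2 → + 2 * k4 - k3 ≤ L4 - L3 → L4 ≡ L2 + L2 →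
      + 2 * k2 ≡ K → + 3 * k3 ≡ K → + 4 * k4 ≡ K → K ≤ + 3 * L2
    core k2 k3 k4 L2 L3 .(L2 + L2) K p q refl e2 e3 e4 = ℤP.*-cancelˡ-≤-pos K (+ 3 * L2) (+ 2) (lin (6 · (sub p ⊞ sub q)) (by (check k2 k3 k4 L2 L3 K e2 e3 e4)))
      where
      check : ∀ k2 k3 k4 L2 L3 K → + 2 * k2 ≡ K → + 3 * k3 ≡ K → + 4 * k4 ≡ K →
        + 6 * (L3 - L2 - (+ 2 * k3 - k2) + (L2 + L2 - L3 - (+ 2 * k4 - k3))) ≡ + 2 * (+ 3 * L2) - + 2 * K
      check k2 k3 k4 L2 L3 K e2 e3 e4 = trans (check-step₁ k2 k3 k4 L2 L3) (trans (cong₂ (λ a b → + 6 * L2 - + 2 * a + + 3 * b - + 3 * (+ 4 * k4)) e3 e2)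
          (trans (cong (λ a → + 6 * L2 - + 2 * K + + 3 * K - + 3 * a) e4) (check-step₂ K L2)))

  L-lower : ∀ j {y} → 4 ℕ.≤ X → 2 ℕ.^ j ℕ.≤ y → y ℕ.≤ X → + j * K ≤ + 3 * L y
  L-lower j {y} 4≤X le y≤X = L-lower-core (+ j) K (L 2) (L (2 ℕ.^ j)) (L y) (0≤+ j) (L2-lo 4≤X) (L-^ 2 j (s≤s z≤n)) (L-mono (ℕP.m^n>0 2 j) le y≤X)

  L2-hi : 2 ℕ.≤ X → L 2 ≤ + 2 * K
  L2-hi 2≤X = ℤP.≤-trans (L-linear (s≤s z≤n) 2≤X) (ℤP.≤-reflexive (by (L2-hi-shape K)))

  L-upper : ∀ j {y} → 1 ℕ.≤ y → y ℕ.< 2 ℕ.^ j → y ℕ.≤ X → L y ≤ + 2 * + j * K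
  L-upper zero {suc y} 1≤y (s≤s ()) y≤X
  L-upper (suc j) {y} 1≤y y< y≤X with y ℕP.<? 2 ℕ.^ j
  ... | yes y<′ = ℤP.≤-trans (L-upper j 1≤y y<′ y≤X) (subst (λ z → + 2 * + j * K ≤ + 2 * z * K) (sym (+suc j)) (L-upper-more (+ j) K K≥0))
  ... | no y≮ = subst (λ z → L y ≤ + 2 * z * K) (sym (+suc j)) (L-upper-core (+ j) K (L 2) (L (2 ℕ.^ j)) (L y) (0≤+ j) (bound2 j 2^j≤y) (L-^ 2 j (s≤s z≤n)) diff)
    where
    2^j≤y : 2 ℕ.^ j ℕ.≤ y
    2^j≤y = ℕP.≮⇒≥ y≮
    diff : L y - L (2 ℕ.^ j) ≤ + 2 * 1ℤ * K
    diff = L-diff-ratio 1 (ℕP.m^n>0 2 j) 2^j≤y y≤X (subst (+ y ≤_) (ℤP.pos-* 2 (2 ℕ.^ j)) (≤-ℤ (ℕP.<⇒≤ y<)))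
    -- For j = 0 the point 2 may lie beyond the cutoff X, but then L 2 enters with coefficient 0.
    bound2 : ∀ i → 2 ℕ.^ i ℕ.≤ y → + i ≡ 0ℤ ⊎ L 2 ≤ + 2 * K
    bound2 zero _ = inj₁ refl
    bound2 (suc i) h = inj₂ (L2-hi (ℕP.≤-trans (ℕP.≤-trans (ℕP.≤-reflexive (sym (ℕP.*-identityʳ 2))) (ℕP.*-monoʳ-≤ 2 (ℕP.m^n>0 2 i))) (ℕP.≤-trans h y≤X)))

  -- Euler's constant, Stirling's formula and floor sums

  γ : ℤ
  γ = H X - L X

  -- H n - L n converges to γ with error 2 k n.
  H-L-drift : ∀ n j → 1 ℕ.≤ n → n ℕ.+ j ℕ.≤ X → let m = n ℕ.+ j; d = (H m - L m) - (H n - L n) in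
    - (+ 2 * (k n - k m)) ≤ d × d ≤ k n - k m
  H-L-drift n zero 1≤n le rewrite ℕP.+-identityʳ n = ℤP.≤-reflexive (by (H-L-drift-zeros (k n) (H n - L n))) , ℤP.≤-reflexive (by (H-L-drift-zeros′ (k n) (H n - L n)))
  H-L-drift n (suc j) 1≤n le rewrite ℕP.+-suc n j =
      H-L-drift-lo (k n) (k m) (k (suc m)) (H n - L n) (H m) (L m) (L (suc m)) (proj₁ ih) (step-hi m 1≤m le)
    , H-L-drift-hi (k n) (k m) (k (suc m)) (H n - L n) (H m) (L m) (L (suc m)) (proj₂ ih) (step-lo m 1≤m le)
    where
    m : ℕ
    m = n ℕ.+ j
    1≤m : 1 ℕ.≤ m
    1≤m = ℕP.≤-trans 1≤n (ℕP.m≤m+n n j)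
    ih : - (+ 2 * (k n - k m)) ≤ (H m - L m) - (H n - L n) × (H m - L m) - (H n - L n) ≤ k n - k m
    ih = H-L-drift n j 1≤n (ℕP.<⇒≤ le)

  H-L-γ : ∀ n → 1 ℕ.≤ n → n ℕ.≤ X → - k n ≤ H n - L n - γ × H n - L n - γ ≤ + 2 * k n
  H-L-γ n 1≤n n≤X = H-L-γ-lo (k n) (k X) (H n - L n) γ (proj₂ drift) kX≥0 , H-L-γ-hi (k n) (k X) (H n - L n) γ (proj₁ drift) kX≥0
    where
    kX≥0 : 0ℤ ≤ k X
    kX≥0 = k≥0 (ℕP.≤-trans 1≤n n≤X) ℕP.≤-refl
    drift : - (+ 2 * (k n - k X)) ≤ γ - (H n - L n) × γ - (H n - L n) ≤ k n - k X
    drift = subst (λ m → - (+ 2 * (k n - k m)) ≤ (H m - L m) - (H n - L n) × (H m - L m) - (H n - L n) ≤ k n - k m) (ℕP.m+[n∸m]≡n n≤X)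
              (H-L-drift n (X ℕ.∸ n) 1≤n (ℕP.≤-reflexive (ℕP.m+[n∸m]≡n n≤X)))

  γ-bound : 1 ℕ.≤ X → γ ⊴ + 2 * K
  γ-bound 1≤X = γ-bound-core (k 1) γ K (k1 1≤X) (H-L-γ 1 ℕP.≤-refl 1≤X) K≥0

  floor-k : ∀ y {a} → 1 ℕ.≤ a → a ℕ.≤ X → K * + (y ÷ a) ≤ + y * k a × + y * k a ≤ K * + (y ÷ a) + K
  floor-k y {a} 1≤a a≤X = floor-k-lo (+ y) (+ (y ÷ a)) (+ a) (k a) K (k-spec a 1≤a a≤X) (k≥0 1≤a a≤X) (subst (_≤ + y) (ℤP.pos-* (y ÷ a) a) (≤-ℤ (÷-* y a)))
      , floor-k-hi (+ y) (+ (y ÷ a)) (+ a) (k a) K (k-spec a 1≤a a≤X) (k≥0 1≤a a≤X)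
          (subst (+ y ≤_) (trans (ℤP.pos-* (suc (y ÷ a)) a) (cong (_* + a) (+suc (y ÷ a)))) (≤-ℤ (ℕP.<⇒≤ (÷-< y a 1≤a))))

  S-floor : ∀ y {v} → v ℕ.≤ X → K * S (λ a → + (y ÷ a)) v ≤ + y * H v × + y * H v ≤ K * S (λ a → + (y ÷ a)) v + + v * K
  S-floor y {v} v≤X =
      subst₂ _≤_ (S-* K v) (S-* (+ y) v) (S-mono v (λ a 1≤a a≤v → proj₁ (floor-k y 1≤a (ℕP.≤-trans a≤v v≤X))))
    , subst₂ _≤_ (S-* (+ y) v) (trans (S-+ {λ a → K * + (y ÷ a)} {λ _ → K} v) (cong₂ _+_ (S-* K v) (S-const K v)))
        (S-mono v (λ a 1≤a a≤v → proj₂ (floor-k y 1≤a (ℕP.≤-trans a≤v v≤X))))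

  -- Partial summation against the constant 1: each i (L (i + 1) - L i) equals K up to a multiple of
  -- k (i + 1), and these multiples sum to the harmonic error.
  stirling : ∀ y → 1 ℕ.≤ y → y ℕ.≤ X → + y * L y - K * + y - H y ≤ S L y × S L y ≤ + y * L y - K * + y + + 2 * H y
  stirling (suc y) _ y≤X = stirling-lo (L (suc y)) (+ y) (+ suc y) (S L (suc y)) T K (H (suc y)) (+suc y) abel′ T-hi K≥0
                         , stirling-hi (L (suc y)) (+ y) (+ suc y) (S L (suc y)) T K (H (suc y)) (+suc y) abel′ T-lo K≥0
    where
    T : ℤ
    T = S (λ i → S 𝟙 i * (L (suc i) - L i)) y
    S𝟙 : ∀ i → S 𝟙 i ≡ + i
    S𝟙 i = trans (S-const 1ℤ i) (ℤP.*-identityʳ (+ i))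
    abel′ : S L (suc y) ≡ L (suc y) * + suc y - T
    abel′ = trans (S-cong (suc y) (λ i _ _ → sym (ℤP.*-identityʳ (L i)))) (trans (abel L 𝟙 y) (cong (λ z → L (suc y) * z - T) (S𝟙 (suc y))))
    H-shift : ∀ y → S (λ i → k (suc i)) y ≡ H (suc y) - k 1
    H-shift zero = by (H-shift-zeros (k 1))
    H-shift (suc y) = trans (cong (_+ k (suc (suc y))) (H-shift y)) (by (minus-+-swap (H (suc y)) (k 1) (k (suc (suc y)))))
    H-shift′ : S (λ i → k (suc i)) y ≡ H (suc y) - K
    H-shift′ = trans (H-shift y) (cong (λ z → H (suc y) - z) (k1 (ℕP.≤-trans (s≤s z≤n) y≤X)))
    term : ∀ i → 1 ℕ.≤ i → i ℕ.≤ y → K - + 2 * k (suc i) ≤ S 𝟙 i * (L (suc i) - L i) × S 𝟙 i * (L (suc i) - L i) ≤ K + k (suc i)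
    term i 1≤i i≤y rewrite S𝟙 i =
        tlo (+ i) (k i) (k (suc i)) K (L (suc i) - L i) (k-spec i 1≤i (ℕP.<⇒≤ i<X)) sspec (0≤+ i) (step-lo i 1≤i i<X)
      , thi (+ i) (k i) (k (suc i)) K (L (suc i) - L i) (k-spec i 1≤i (ℕP.<⇒≤ i<X)) sspec (0≤+ i) (step-hi i 1≤i i<X)
      where
      i<X : i ℕ.< X
      i<X = ℕP.≤-trans (s≤s i≤y) y≤X
      sspec : (+ i + 1ℤ) * k (suc i) ≡ K
      sspec = trans (cong (_* k (suc i)) (sym (+suc i))) (k-spec (suc i) (s≤s z≤n) i<X)
      tlo : ∀ i a b K d → i * a ≡ K → (i + 1ℤ) * b ≡ K → 0ℤ ≤ i → + 2 * b - a ≤ d → K - + 2 * b ≤ i * d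
      tlo i a b K d e₁ e₂ p q = lin (p ⊠ sub q) (trans (tlo-s₁ i a b d) (trans (cong₂ (λ x y → i * d - + 2 * x + + 2 * b + y) e₂ e₁) (tlo-s₂ (i * d) K b)))
      thi : ∀ i a b K d → i * a ≡ K → (i + 1ℤ) * b ≡ K → 0ℤ ≤ i → d ≤ + 2 * a - b → i * d ≤ K + b
      thi i a b K d e₁ e₂ p q = lin (p ⊠ sub q) (trans (thi-s₁ i a b d) (trans (cong₂ (λ x y → + 2 * y - x + b - i * d) e₂ e₁) (thi-s₂ (i * d) K b)))
    T-lo : + y * K - + 2 * (H (suc y) - K) ≤ T
    T-lo = subst (_≤ T) (trans (S-minus {λ _ → K} {λ i → + 2 * k (suc i)} y) (cong₂ _-_ (S-const K y) (trans (S-* (+ 2) y) (cong (+ 2 *_) H-shift′))))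
             (S-mono y (λ i p q → proj₁ (term i p q)))
    T-hi : T ≤ + y * K + (H (suc y) - K)
    T-hi = subst (T ≤_) (trans (S-+ {λ _ → K} {λ i → k (suc i)} y) (cong₂ _+_ (S-const K y) H-shift′))
             (S-mono y (λ i p q → proj₂ (term i p q)))

  -- Selberg's formula

  C : ℤ
  C = + 2 * γ

  -- The correction at n = 1 is what makes `E` small: Stirling's formula minus K times the divisor
  -- sum leaves a linear term - 2 γ y, which C = 2 γ cancels.
  r R : ℕ → ℤ
  r n = Λ n - K + ind (n ℕP.≟ 1) * C
  R = S r

  E : ℕ → ℤ
  E = 𝟙 ⋆ R

  E-eq : ∀ y → 1 ℕ.≤ y → E y ≡ S L y - K * S (λ a → + (y ÷ a)) y + + y * C
  E-eq y 1≤y = begin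
      E y
        ≡⟨ ⋆-S r y ⟩
      S (λ n → (Λ n - K + ind (n ℕP.≟ 1) * C) * + (y ÷ n)) y
        ≡⟨ S-cong y (λ n _ _ → by (E-eq-expand (Λ n) K (ind (n ℕP.≟ 1)) C (+ (y ÷ n)))) ⟩
      S (λ n → Λ n * + (y ÷ n) - K * + (y ÷ n) + ind (n ℕP.≟ 1) * C * + (y ÷ n)) y
        ≡⟨ S-+ {λ n → Λ n * + (y ÷ n) - K * + (y ÷ n)} {λ n → ind (n ℕP.≟ 1) * C * + (y ÷ n)} y ⟩
      S (λ n → Λ n * + (y ÷ n) - K * + (y ÷ n)) y + S (λ n → ind (n ℕP.≟ 1) * C * + (y ÷ n)) y
        ≡⟨ cong₂ _+_ (trans (S-minus {λ n → Λ n * + (y ÷ n)} {λ n → K * + (y ÷ n)} y) (cong₂ _-_ (sym (S-dsum-⋆ Λ y)) (S-* K y))) first ⟩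
      S L y - K * S (λ a → + (y ÷ a)) y + + y * C ∎
    where
    open ≡-Reasoning
    at1 : ∀ n → ind (n ℕP.≟ 1) * C * + (y ÷ n) ≡ ind (n ℕP.≟ 1) * (+ y * C)
    at1 n with n ℕP.≟ 1
    ... | yes refl = trans (cong (λ z → 1ℤ * C * + z) (÷-1 y)) (by (at1-move C (+ y)))
    ... | no _ = refl
    first : S (λ n → ind (n ℕP.≟ 1) * C * + (y ÷ n)) y ≡ + y * C
    first = trans (S-cong y (λ n _ _ → at1 n)) (ind1-sum y (+ y * C) 1≤y)

  -- After the hyperbola method the terms in y log y, K y and γ y cancel. What is left comes from
  -- rounding, from y - v² and from H y, each of order v K.
  E-bound-sqrt : ∀ y v → 1 ℕ.≤ v → y ℕ.≤ X → v ℕ.* v ℕ.≤ y → y ℕ.< suc v ℕ.* suc v → E y ⊴ + 44 * (+ v * K)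
  E-bound-sqrt y v 1≤v y≤X lo hi =
      E-bound-sqrt-lower (+ y) (+ v) K (L y) (L v) (k v) γ (H y) (H v) (S L y) A (E y) E≡ K≥0 1≤v′ lo′ ℤ-hi y·L≥ yk Hy (proj₁ Sti) (proj₁ fl) (proj₂ HL)
    , E-bound-sqrt-upper (+ y) (+ v) K (L y) (L v) (k v) γ (H y) (H v) (S L y) A (E y) E≡ K≥0 1≤v′ lo′ y·L≤ yk Hy (proj₂ Sti) (proj₂ fl) (proj₁ HL)
    where
    v≤y : v ℕ.≤ y
    v≤y = ℕP.≤-trans (ℕP.≤-trans (ℕP.≤-reflexive (sym (ℕP.*-identityʳ v))) (ℕP.*-monoʳ-≤ v 1≤v)) lo
    v≤X : v ℕ.≤ X
    v≤X = ℕP.≤-trans v≤y y≤X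
    1≤y : 1 ℕ.≤ y
    1≤y = ℕP.≤-trans 1≤v v≤y
    1≤vv : 1 ℕ.≤ v ℕ.* v
    1≤vv = ℕP.*-mono-≤ 1≤v 1≤v
    vv≤X : v ℕ.* v ℕ.≤ X
    vv≤X = ℕP.≤-trans lo y≤X
    A κ : ℤ
    A = S (λ a → + (y ÷ a)) v
    κ = k (v ℕ.* v)
    1≤v′ : 1ℤ ≤ + v
    1≤v′ = ≤-ℤ 1≤v
    lo′ : + v * + v ≤ + y
    lo′ = subst (_≤ + y) (ℤP.pos-* v v) (≤-ℤ lo)
    ℤ-hi : + y ≤ + v * + v + + 2 * + v
    ℤ-hi = ℤ-hi-core (+ y) (+ v) (subst₂ _≤_ (+suc y) (trans (ℤP.pos-* (suc v) (suc v)) (cong₂ _*_ (+suc v) (+suc v))) (≤-ℤ hi))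
    E≡ : E y ≡ S L y - K * (+ 2 * A - + v * + v) + + y * (+ 2 * γ)
    E≡ = trans (E-eq y 1≤y) (cong (λ z → S L y - K * z + + y * C) (hyperbola y v lo hi 1≤v))
    fl : K * A ≤ + y * H v × + y * H v ≤ K * A + + v * K
    fl = S-floor y v≤X
    Sti : + y * L y - K * + y - H y ≤ S L y × S L y ≤ + y * L y - K * + y + + 2 * H y
    Sti = stirling y 1≤y y≤X
    HL : - k v ≤ H v - L v - γ × H v - L v - γ ≤ + 2 * k v
    HL = H-L-γ v 1≤v v≤X
    yk : + y * k v ≤ + 3 * (+ v * K)
    yk = yk-core (+ y) (+ v) (k v) K (k-spec v 1≤v v≤X) ℤ-hi (k≥0 1≤v v≤X) 1≤v′ K≥0
    κ-spec : + v * + v * κ ≡ K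
    κ-spec = trans (cong (_* κ) (sym (ℤP.pos-* v v))) (k-spec (v ℕ.* v) 1≤vv vv≤X)
    κ≥0 : 0ℤ ≤ κ
    κ≥0 = k≥0 1≤vv vv≤X
    Lvv : L (v ℕ.* v) ≡ L v + L v
    Lvv = L-* v v 1≤v 1≤v
    L-gap : L y - (L v + L v) ≤ + 4 * (+ v * κ)
    L-gap = L-gap-core (L y) (L v + L v) (+ y) (+ v) κ (subst₂ (λ a b → L y - a ≤ (+ y - b) * (+ 2 * κ)) Lvv (ℤP.pos-* v v) (L-diff 1≤vv lo y≤X)) ℤ-hi κ≥0
    Ly≤ : L y ≤ + 4 * (+ v * K)
    Ly≤ = Ly≤-core (L y) (L v) (+ v) κ K κ-spec L-gap (L-linear 1≤v v≤X) 1≤v′ κ≥0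
    Hy : H y ≤ + 8 * (+ v * K)
    Hy = Hy-core (H y) (L y) γ (k y) (+ v) K (proj₂ (H-L-γ y 1≤y y≤X)) (proj₂ (γ-bound (ℕP.≤-trans 1≤y y≤X)))
           (subst (k y ≤_) (k1 (ℕP.≤-trans 1≤y y≤X)) (k-anti ℕP.≤-refl 1≤y y≤X)) Ly≤ 1≤v′ K≥0
    y·L≤ : + y * (L y - (L v + L v)) ≤ + 12 * (+ v * K)
    y·L≤ = y·L≤-core (+ y) (L y - (L v + L v)) (+ v) κ K κ-spec L-gap ℤ-hi 1≤v′ κ≥0 (0≤+ y)
    y·L≥ : 0ℤ ≤ + y * (L y - (L v + L v))
    y·L≥ = 0≤+ y ⊠ sub (subst (_≤ L y) Lvv (L-mono 1≤vv lo y≤X))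

  E-bound : ∀ i y → 1 ℕ.≤ y → y ℕ.≤ X → y ℕ.< 4 ℕ.^ suc i → E y ⊴ + 88 * (+ (2 ℕ.^ i) * K)
  E-bound i y 1≤y y≤X y< with isqrt y
  ... | zero , lo , hi = ⊥-elim (ℕP.<⇒≱ hi 1≤y)
  ... | v@(suc _) , lo , hi = ⊴-≤ (E-bound-sqrt y v (s≤s z≤n) y≤X lo hi) (E-bound-core (+ v) (+ (2 ℕ.^ i)) K (subst (+ v ≤_) (ℤP.pos-* 2 (2 ℕ.^ i)) (≤-ℤ v≤)) K≥0)
    where
    v≤ : v ℕ.≤ 2 ℕ.* 2 ℕ.^ i
    v≤ = ℕP.<⇒≤ (ℕP.≰⇒> λ h → ℕP.<⇒≱ y< (ℕP.≤-trans (ℕP.≤-trans (ℕP.≤-reflexive (4^≡ (suc i))) (ℕP.*-mono-≤ h h)) lo))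

  R-bound : ∀ x → x ℕ.≤ X → R x ⊴ + 352 * K * + x
  R-bound x x≤X = subst₂ _⊴_ (⋆-inverse μ dsum-μ-1 dsum-μ R refl x) (by (R-bound-shape K (+ x)))
      (Layers.μ⋆-bound E (+ 88 * K) (88 · K≥0) x (λ i y 1≤y y≤x _ y< → ⊴-≤ (E-bound i y 1≤y (ℕP.≤-trans y≤x x≤X) y<)
        (subst (λ s → + 88 * (+ (2 ℕ.^ i) * K) ≤ + 88 * K * (s * + (2 ℕ.^ i))) (sym (+suc i)) (R-bound-core (+ i) (+ (2 ℕ.^ i)) K (0≤+ i) (0≤+ (2 ℕ.^ i)) K≥0))))

  -- `Z` differs from the left side of Selberg's formula by terms of order K² y only: partial
  -- summation turns S Lr y into L y R y, and ψ is R + K y - C.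
  G Z Lr : ℕ → ℤ
  G y = S (λ N → dsum r N * L N) y
  Lr n = L n * r n
  Z y = S Lr y + (r ⋆ ψ) y

  S-dsum-r : ∀ y → S (dsum r) y ≡ E y
  S-dsum-r y = trans (S-dsum-⋆ r y) (sym (⋆-S r y))

  -- Partial summation: one bound holds for E on all of [1 , y], and the increments of L telescope
  -- to L y, which is O(K) times the scale index i + 1.
  G-bound : ∀ i y → 1 ℕ.≤ y → y ℕ.≤ X → y ℕ.< 4 ℕ.^ suc i → G y ⊴ + 704 * (K * K) * (+ suc i * + (2 ℕ.^ i))
  G-bound i (suc n) _ y≤X y< = subst (_⊴ + 704 * (K * K) * (+ suc i * + (2 ℕ.^ i))) (sym G≡)
      (⊴-≤ (⊴-- (⊴-scale (L y) (L≥0 y) (E-bound i y (s≤s z≤n) y≤X y<)) (S-⊴ n term))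
        (subst (λ z → L y * B + z ≤ + 704 * (K * K) * (+ suc i * + (2 ℕ.^ i))) (sym telescope)
          (G-bound-core (L y) (+ (2 ℕ.^ i)) K (+ suc i) (0≤+ (2 ℕ.^ i)) K≥0 Ly)))
    where
    y : ℕ
    y = suc n
    B : ℤ
    B = + 88 * (+ (2 ℕ.^ i) * K)
    G≡ : G y ≡ L y * E y - S (λ j → E j * (L (suc j) - L j)) n
    G≡ = trans (S-cong y (λ N _ _ → ℤP.*-comm (dsum r N) (L N))) (trans (abel L (dsum r) n)
      (cong₂ (λ a b → L y * a - b) (S-dsum-r y) (S-cong n (λ j _ _ → cong (_* (L (suc j) - L j)) (S-dsum-r j)))))
    term : ∀ j → 1 ℕ.≤ j → j ℕ.≤ n → E j * (L (suc j) - L j) ⊴ B * (L (suc j) - L j)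
    term j 1≤j j≤n = ⊴-* (E-bound i j 1≤j (ℕP.≤-trans (ℕP.m≤n⇒m≤1+n j≤n) y≤X) (ℕP.≤-<-trans (ℕP.m≤n⇒m≤1+n j≤n) y<))
      (⊴-of-nonneg (L-step≥0 1≤j (ℕP.≤-trans (s≤s j≤n) y≤X)) ℤP.≤-refl)
    telescope : S (λ j → B * (L (suc j) - L j)) n ≡ B * L y
    telescope = trans (S-* B n) (cong (B *_) (tele n))
      where
      tele : ∀ n → S (λ j → L (suc j) - L j) n ≡ L (suc n)
      tele zero = refl
      tele (suc n) = trans (cong (_+ (L (suc (suc n)) - L (suc n))) (tele n)) (by (tele-move (L (suc n)) (L (suc (suc n)))))
    Ly : L y ≤ + 2 * (+ 2 * + suc i) * K
    Ly = subst (λ z → L y ≤ + 2 * z * K) (ℤP.pos-* 2 (suc i)) (L-upper (2 ℕ.* suc i) (s≤s z≤n) (subst (y ℕ.<_) (ℕP.^-*-assoc 2 2 (suc i)) y<) y≤X)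

  -- The derivation property of L turns Σ_{n ≤ y} L n (r * 1)(n) into a sum of Z.
  G-⋆ : ∀ y → G y ≡ (𝟙 ⋆ Z) y
  G-⋆ y = begin
      G y
        ≡⟨ S-dsum r L y ⟩
      S (λ d → r d * S (λ m → L (m ℕ.* d)) (y ÷ d)) y
        ≡⟨ S-cong y (λ d 1≤d _ → trans (cong (r d *_) (inner d 1≤d)) (by (G-⋆-expand (r d) (S L (y ÷ d)) (+ (y ÷ d)) (L d)))) ⟩
      S (λ d → L d * r d * + (y ÷ d) + r d * S L (y ÷ d)) y
        ≡⟨ S-+ {λ d → L d * r d * + (y ÷ d)} {λ d → r d * S L (y ÷ d)} y ⟩
      (Lr ⋆ +_) y + (r ⋆ S L) y
        ≡⟨ cong₂ _+_ (sym (⋆-S Lr y)) (trans (⋆-cong {r} {r} {S L} {𝟙 ⋆ ψ} (λ _ → refl) S-L y) (⋆-comm r 𝟙 ψ refl y)) ⟩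
      (𝟙 ⋆ S Lr) y + (𝟙 ⋆ r ⋆ ψ) y
        ≡⟨ sym (S-+ {λ n → 1ℤ * S Lr (y ÷ n)} {λ n → 1ℤ * (r ⋆ ψ) (y ÷ n)} y) ⟩
      S (λ n → 1ℤ * S Lr (y ÷ n) + 1ℤ * (r ⋆ ψ) (y ÷ n)) y
        ≡⟨ S-cong y (λ n _ _ → sym (ℤP.*-distribˡ-+ 1ℤ (S Lr (y ÷ n)) ((r ⋆ ψ) (y ÷ n)))) ⟩
      (𝟙 ⋆ Z) y ∎
    where
    open ≡-Reasoning
    inner : ∀ d → 1 ℕ.≤ d → S (λ m → L (m ℕ.* d)) (y ÷ d) ≡ S L (y ÷ d) + + (y ÷ d) * L d
    inner d 1≤d = trans (S-cong (y ÷ d) (λ m 1≤m _ → L-* m d 1≤m 1≤d)) (trans (S-+ {L} {λ _ → L d} (y ÷ d)) (cong (_+_ (S L (y ÷ d))) (S-const (L d) (y ÷ d))))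

  Z-bound : ∀ x → x ℕ.≤ X → Z x ⊴ + 2816 * (K * K) * + x
  Z-bound x x≤X = subst₂ _⊴_ (trans (⋆-cong {μ} {μ} {G} {𝟙 ⋆ Z} (λ _ → refl) G-⋆ x) (⋆-inverse μ dsum-μ-1 dsum-μ Z refl x)) (by (Z-bound-shape (K * K) (+ x)))
      (Layers.μ⋆-bound G (+ 704 * (K * K)) (704 · (K≥0 ⊠ K≥0)) x (λ i y 1≤y y≤x _ y< → G-bound i y 1≤y (ℕP.≤-trans y≤x x≤X) y<))

  R-eq : ∀ n → R n ≡ ψ n - K * + n + C * sgn n
  R-eq n = trans (S-+ {λ i → Λ i - K} {λ i → ind (i ℕP.≟ 1) * C} n) (cong₂ _+_
      (trans (S-minus {Λ} {λ _ → K} n) (cong (λ z → ψ n - z) (trans (S-const K n) (ℤP.*-comm (+ n) K)))) (at1 n))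
    where
    at1 : ∀ n → S (λ i → ind (i ℕP.≟ 1) * C) n ≡ C * sgn n
    at1 zero = sym (ℤP.*-zeroʳ C)
    at1 (suc n) = trans (ind1-sum (suc n) C (s≤s z≤n)) (sym (ℤP.*-identityʳ C))

  r⋆ψ : ∀ x → (r ⋆ ψ) x ≡ (r ⋆ R) x + K * E x - C * R x
  r⋆ψ x = begin
      (r ⋆ ψ) x
        ≡⟨ S-cong x (λ n _ _ → trans (cong (r n *_) (ψ-eq (x ÷ n))) (by (r⋆ψ-expand (r n) (R (x ÷ n)) K (+ (x ÷ n)) C (sgn (x ÷ n))))) ⟩
      S (λ n → r n * R (x ÷ n) + K * (r n * + (x ÷ n)) - C * (r n * sgn (x ÷ n))) x
        ≡⟨ S-minus {λ n → r n * R (x ÷ n) + K * (r n * + (x ÷ n))} {λ n → C * (r n * sgn (x ÷ n))} x ⟩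
      S (λ n → r n * R (x ÷ n) + K * (r n * + (x ÷ n))) x - S (λ n → C * (r n * sgn (x ÷ n))) x
        ≡⟨ cong₂ _-_ (trans (S-+ {λ n → r n * R (x ÷ n)} {λ n → K * (r n * + (x ÷ n))} x) (cong (_+_ ((r ⋆ R) x)) (trans (S-* K x) (cong (K *_) (sym (⋆-S r x))))))
                     (trans (S-* C x) (cong (C *_) (⋆-sgn r x))) ⟩
      (r ⋆ R) x + K * E x - C * R x ∎
    where
    open ≡-Reasoning
    ψ-eq : ∀ n → ψ n ≡ R n + K * + n - C * sgn n
    ψ-eq n = trans (by (ψ-eq-move (ψ n) (K * + n) (C * sgn n))) (cong (λ z → z + K * + n - C * sgn n) (sym (R-eq n)))

  C-bound : 1 ℕ.≤ X → C ⊴ + 4 * K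
  C-bound 1≤X = subst (C ⊴_) (by (C-bound-shape K)) (⊴-scale (+ 2) (0≤+ 2) (γ-bound 1≤X))

  E-bound-linear : ∀ y → 1 ℕ.≤ y → y ℕ.≤ X → E y ⊴ + 44 * (+ y * K)
  E-bound-linear y 1≤y y≤X with isqrt y
  ... | zero , lo , hi = ⊥-elim (ℕP.<⇒≱ hi 1≤y)
  ... | v@(suc _) , lo , hi = ⊴-≤ (E-bound-sqrt y v (s≤s z≤n) y≤X lo hi) (E-bound-linear-core (+ v) (+ y) K (≤-ℤ (ℕP.≤-trans (ℕP.m≤m*n v v) lo)) K≥0)

  -- The errors are 2816 from Z, 44 from K E, 4 · 352 from C R and 704 from partial summation, 4972
  -- in all, rounded up.
  selberg : ∀ y → 1 ℕ.≤ y → y ℕ.≤ X → L y * R y + (r ⋆ R) y ⊴ + 5000 * (K * K) * + y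
  selberg y@(suc n) 1≤y y≤X = subst (_⊴ + 5000 * (K * K) * + y) (sym eq)
      (⊴-≤ (⊴-+ (⊴-+ (⊴-- (Z-bound y y≤X) (⊴-scale K K≥0 (E-bound-linear y 1≤y y≤X))) (⊴-* (C-bound (ℕP.≤-trans 1≤y y≤X)) (R-bound y y≤X))) T-bound)
        (selberg-core K (+ n) (+ y) (≤-ℤ (ℕP.n≤1+n n)) (0≤+ y) K≥0))
    where
    T : ℤ
    T = S (λ i → R i * (L (suc i) - L i)) n
    T-bound : T ⊴ + n * (+ 704 * (K * K))
    T-bound = subst (T ⊴_) (S-const (+ 704 * (K * K)) n) (S-⊴ n term)
      where
      term : ∀ i → 1 ℕ.≤ i → i ℕ.≤ n → R i * (L (suc i) - L i) ⊴ + 704 * (K * K)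
      term i 1≤i i≤n = subst (R i * (L (suc i) - L i) ⊴_) (term-core′ K (+ i) (k i) (k-spec i 1≤i (ℕP.<⇒≤ i<X)))
          (⊴-* (R-bound i (ℕP.<⇒≤ i<X)) (⊴-of-nonneg (L-step≥0 1≤i i<X) (L-step≤ 1≤i i<X)))
        where
        i<X : i ℕ.< X
        i<X = ℕP.≤-trans (s≤s i≤n) y≤X
    eq : L y * R y + (r ⋆ R) y ≡ Z y - K * E y + C * R y + T
    eq = eq-core₁ (L y * R y) ((r ⋆ R) y) (S Lr y) ((r ⋆ ψ) y) (K * E y) (C * R y) T (abel L r n) (r⋆ψ y)

  -- Upper bounds for ψ in short intervals

  LΛ W : ℕ → ℤ
  LΛ n = L n * Λ n
  W y = S LΛ y + (Λ ⋆ ψ) y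

  ψ≥0 : ∀ n → 0ℤ ≤ ψ n
  ψ≥0 n = S-nonneg n (λ i _ _ → Λ≥0 i)

  ψ-mono : ∀ {m n} → m ℕ.≤ n → ψ m ≤ ψ n
  ψ-mono m≤n = S-mono-len m≤n (λ i _ _ → Λ≥0 i)

  W-eq : ∀ y → 1 ℕ.≤ y → W y ≡ Z y + + 2 * K * S L y - C * ψ y
  W-eq y 1≤y = W-eq-core (S LΛ y) ((Λ ⋆ ψ) y) (S Lr y) ((r ⋆ ψ) y) K (S L y) (C * ψ y) Lr≡ rψ≡
    where
    pointwise : ∀ n → Lr n ≡ LΛ n - K * L n
    pointwise n with n ℕP.≟ 1
    ... | yes refl = by (pointwise-shape (Λ 1) K C)
    ... | no _ = by (pointwise-shape2 (L n) (Λ n) K C)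
    Lr≡ : S Lr y ≡ S LΛ y - K * S L y
    Lr≡ = trans (S-cong y (λ n _ _ → pointwise n)) (trans (S-minus {LΛ} {λ n → K * L n} y) (cong (λ z → S LΛ y - z) (S-* K y)))
    at1 : ∀ n → ind (n ℕP.≟ 1) * (C * ψ (y ÷ n)) ≡ ind (n ℕP.≟ 1) * (C * ψ y)
    at1 n with n ℕP.≟ 1
    ... | yes refl = cong (λ z → 1ℤ * (C * ψ z)) (÷-1 y)
    ... | no _ = refl
    rψ≡ : (r ⋆ ψ) y ≡ (Λ ⋆ ψ) y - K * S L y + C * ψ y
    rψ≡ = trans (S-cong y (λ n _ _ → by (W-eq-expand (Λ n) K (ind (n ℕP.≟ 1)) C (ψ (y ÷ n)))))
      (trans (S-+ {λ n → Λ n * ψ (y ÷ n) - K * (1ℤ * ψ (y ÷ n))} {λ n → ind (n ℕP.≟ 1) * (C * ψ (y ÷ n))} y)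
        (cong₂ _+_ (trans (S-minus {λ n → Λ n * ψ (y ÷ n)} {λ n → K * (1ℤ * ψ (y ÷ n))} y) (cong (λ z → (Λ ⋆ ψ) y - z) (trans (S-* K y) (cong (K *_) (sym (S-L y))))))
          (trans (S-cong y (λ n _ _ → at1 n)) (ind1-sum y (C * ψ y) 1≤y))))

  ψ-bound : ∀ y → 1 ℕ.≤ y → y ℕ.≤ X → ψ y ≤ + 357 * K * + y
  ψ-bound y@(suc _) 1≤y y≤X = ψ-bound-core (ψ y) (R y) K (+ y) C (R-eq y) (proj₂ (R-bound y y≤X)) (proj₁ (C-bound (ℕP.≤-trans 1≤y y≤X))) (≤-ℤ 1≤y) K≥0

  W-bound : ∀ y → 1 ℕ.≤ y → y ℕ.≤ X → W y - + 2 * K * S L y ⊴ + 5000 * (K * K) * + y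
  W-bound y 1≤y y≤X = subst (_⊴ + 5000 * (K * K) * + y) (W-bound-core (W y) (Z y) (+ 2 * K * S L y) (C * ψ y) (W-eq y 1≤y))
     (⊴-≤ (⊴-- (Z-bound y y≤X) (⊴-* (C-bound (ℕP.≤-trans 1≤y y≤X)) (⊴-of-nonneg (ψ≥0 y) (ψ-bound y 1≤y y≤X))))
       (W-bound-bound K (+ y) (+ 2816) (+ 357) (+ 756) (0≤+ y) K≥0 (0≤+ 756)))

  module _ {y y' : ℕ} (1≤y : 1 ℕ.≤ y) (y≤y' : y ℕ.≤ y') (y'≤2y : y' ℕ.≤ 2 ℕ.* y) (y'≤X : y' ℕ.≤ X) where
    private
      y≤X : y ℕ.≤ X
      y≤X = ℕP.≤-trans y≤y' y'≤X
      1≤y' : 1 ℕ.≤ y'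
      1≤y' = ℕP.≤-trans 1≤y y≤y'
      y'≤2y′ : + y' ≤ + 2 * + y
      y'≤2y′ = subst (+ y' ≤_) (ℤP.pos-* 2 y) (≤-ℤ y'≤2y)

    W-incr : L y * (ψ y' - ψ y) ≤ W y' - W y
    W-incr = W-incr-core (S LΛ y') (S LΛ y) ((Λ ⋆ ψ) y') ((Λ ⋆ ψ) y) (L y * (ψ y' - ψ y)) part₁ part₂
      where
      part₁ : L y * (ψ y' - ψ y) ≤ S LΛ y' - S LΛ y
      part₁ = subst (_≤ S LΛ y' - S LΛ y) (trans (cong₂ _-_ (S-* (L y) y') (S-* (L y) y)) (by (*-distribˡ-minus (L y) (ψ y') (ψ y))))
        (S-mono-between {λ i → L y * Λ i} {LΛ} y≤y' (λ i y<i i≤y' → *-monoʳ-nonneg (L y) (L i) (Λ i) (L-mono 1≤y (ℕP.<⇒≤ y<i) (ℕP.≤-trans i≤y' y'≤X)) (Λ≥0 i)))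
      part₂ : (Λ ⋆ ψ) y ≤ (Λ ⋆ ψ) y'
      part₂ = subst (_≤ (Λ ⋆ ψ) y') (⋆-extend Λ ψ refl y≤y') (S-mono y' (λ n _ _ → part₂-scale-mono (Λ n) (ψ (y ÷ n)) (ψ (y' ÷ n)) (Λ≥0 n) (ψ-mono (÷-mono n y≤y'))))

    S-L-incr : S L y' - S L y ≤ (+ y' - + y) * L y'
    S-L-incr = subst (S L y' - S L y ≤_) (trans (cong₂ _-_ (S-const (L y') y') (S-const (L y') y)) (by (*-distribʳ-minus (+ y') (+ y) (L y'))))
        (S-mono-between {L} {λ _ → L y'} y≤y' (λ i y<i i≤y' → L-mono (ℕP.≤-trans 1≤y (ℕP.<⇒≤ y<i)) i≤y' y'≤X))

    L-near : L y' - L y ≤ + 2 * K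
    L-near = subst (L y' - L y ≤_) (by (L-near-shape K)) (L-diff-ratio 1 1≤y y≤y' y'≤X y'≤2y′)

    R-incr≡ : R y' - R y ≡ ψ y' - ψ y - K * (+ y' - + y)
    R-incr≡ = R-incr≡-core (R y') (R y) (ψ y') (ψ y) K (+ y') (+ y) C (sgn y') (sgn y) (R-eq y') (R-eq y) (trans (sgn1 1≤y') (sym (sgn1 1≤y)))
      where
      sgn1 : ∀ {y} → 1 ℕ.≤ y → sgn y ≡ 1ℤ
      sgn1 (s≤s _) = refl

    -- Twice the expected increment K (y' - y), plus an error that becomes small relative to K y as
    -- L y / K grows. The 15004 is 3 · 5000 + 4.
    ψ-incr : L y * (ψ y' - ψ y) ≤ + 2 * K * (+ y' - + y) * L y + + 15004 * (K * K) * + y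
    ψ-incr = ψ-incr-core (L y * (ψ y' - ψ y)) (W y') (W y) (S L y') (S L y) (L y') (L y) K (+ y') (+ y) (+ 5000)
        W-incr S-L-incr L-near (proj₂ (W-bound y' 1≤y' y'≤X)) (proj₁ (W-bound y 1≤y y≤X)) (≤-ℤ y≤y') y'≤2y′ K≥0 (0≤+ 5000)

    -- The increment of ψ lies between 0 and about twice its expected size K (y' - y), so R moves by
    -- at most about K (y' - y) in either direction. The factor 2 from Selberg's formula is exactly
    -- what this symmetry permits.
    R-incr : ∀ Q → 1 ℕ.≤ Q → + 15004 * + Q * K ≤ L y → + Q * (R y' - R y) ⊴ + Q * K * (+ y' - + y) + K * + y
    R-incr Q 1≤Q big =
        R-incr-lower (R y' - R y) (ψ y') (ψ y) K (+ y') (+ y) (+ Q) R-incr≡ (ψ-mono y≤y') (0≤+ y) (0≤+ Q) K≥0 (≤-ℤ y≤y')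
      , pos-cancel {L y} 1≤L (R-incr-upper (+ 15004) (R y' - R y) (ψ y') (ψ y) K (+ y') (+ y) (+ Q) (L y) R-incr≡ ψ-incr big (0≤+ y) (0≤+ Q) K≥0)
      where
      1≤L : 1ℤ ≤ L y
      1≤L = ℤP.≤-trans (1≤L-core (+ 15004) (+ Q) K (+≤+ (s≤s z≤n)) (≤-ℤ 1≤Q) 1≤K) big

  -- Prime powers in an interval without primes

  Λ-at : ℕ → ℕ → ℤ
  Λ-at = AdditiveProperties.Λ-at w w≥0

  Λ-at≥0 : ∀ p d → 0ℤ ≤ Λ-at p d
  Λ-at≥0 = AdditiveProperties.Λ-at≥0 w w≥0

  -- The sum is L (p^j) for the largest power p^j ≤ y. The induction descends from y to y / p.
  S-Λ-at-≤ : ∀ {p} → Prime p → ∀ y → 1 ℕ.≤ y → y ℕ.≤ X → S (Λ-at p) y ≤ L y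
  S-Λ-at-≤ {p} P = <-induction λ y ih 1≤y y≤X → step y ih 1≤y y≤X
    where
    step : ∀ y → (∀ m → m ℕ.< y → 1 ℕ.≤ m → m ℕ.≤ X → S (Λ-at p) m ≤ L m) → 1 ℕ.≤ y → y ℕ.≤ X → S (Λ-at p) y ≤ L y
    step y ih 1≤y y≤X with p ℕP.≤? y
    ... | yes p≤y = ℤP.≤-trans (AdditiveProperties.S-Λ-at w w≥0 P y p≤y) (ℤP.≤-trans (ℤP.≤-trans
            (ℤP.+-monoʳ-≤ (w p) (ih (y ÷ p) smaller 1≤q (ℕP.≤-trans (÷-≤ y p) y≤X)))
            (ℤP.≤-reflexive (trans (ℤP.+-comm (w p) (L (y ÷ p))) (sym (L-prime-* P (y ÷ p) 1≤q)))))
            (L-mono (ℕP.*-mono-≤ 1≤q (1≤prime P)) (÷-* y p) y≤X))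
      where
      1≤q : 1 ℕ.≤ y ÷ p
      1≤q = ÷-pos (1≤prime P) p≤y
      smaller : y ÷ p ℕ.< y
      smaller = ℕP.<-≤-trans (subst (ℕ._< y ÷ p ℕ.* p) (ℕP.*-identityʳ (y ÷ p)) (ℕP.*-monoʳ-< (y ÷ p) {{ℕ.>-nonZero 1≤q}} (2≤prime P))) (÷-* y p)
    ... | no p≰y = ℤP.≤-trans (ℤP.≤-reflexive (S-zero y vanish)) (L≥0 y)
      where
      vanish : ∀ d → 1 ℕ.≤ d → d ℕ.≤ y → Λ-at p d ≡ 0ℤ
      vanish d 1≤d d≤y with 2 ℕP.≤? d
      ... | yes 2≤d = trans (cong (_* Λ d) (ind-no (lpf d ℕP.≟ p) λ { refl → p≰y (ℕP.≤-trans (lpf-least 2≤d 2≤d ∣P.∣-refl) d≤y) })) (ℤP.*-zeroˡ (Λ d))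
      ... | no 2≰d = subst (λ d → Λ-at p d ≡ 0ℤ) (ℕP.≤-antisym 1≤d (ℕP.≤-pred (ℕP.≰⇒> 2≰d))) (ℤP.*-zeroʳ (ind (lpf 1 ℕP.≟ p)))

  Λ-by-lpf : ∀ {d v} → 2 ℕ.≤ d → lpf d ℕ.≤ v → Λ d ≡ S (λ p → ind (prime? p) * Λ-at p d) v
  Λ-by-lpf {d} {v} 2≤d le = sym (begin
      S (λ p → ind (prime? p) * Λ-at p d) v                  ≡⟨ S-cong v (λ p _ _ → by (*-swapˡ (ind (prime? p)) (ind (lpf d ℕP.≟ p)) (Λ d))) ⟩
      S (λ p → ind (lpf d ℕP.≟ p) * (ind (prime? p) * Λ d)) v ≡⟨ S-pick (λ p → ind (prime? p) * Λ d) (1≤lpf 2≤d) v ⟩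
      ind (lpf d ℕP.≤? v) * (ind (prime? (lpf d)) * Λ d)      ≡⟨ cong₂ (λ a b → a * (b * Λ d)) (ind-yes (lpf d ℕP.≤? v) le) (ind-yes (prime? (lpf d)) (lpf-prime 2≤d)) ⟩
      1ℤ * (1ℤ * Λ d)                                        ≡⟨ by (Λ-by-lpf-ones (Λ d)) ⟩
      Λ d ∎)
    where
    open ≡-Reasoning

  lpf-nonprime : ∀ {d v} → 2 ℕ.≤ d → ¬ Prime d → d ℕ.< suc v ℕ.* suc v → lpf d ℕ.≤ v
  lpf-nonprime {d} {v} 2≤d np d< = ℕP.≮⇒≥ λ v<p → ℕP.<⇒≱ d< (ℕP.≤-trans (ℕP.*-mono-≤ (ℕP.≤-trans v<p p≤e) v<p) (ℕP.≤-reflexive (cofactor 2≤d)))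
    where
    e : ℕ
    e = d ÷ lpf d
    2≤e : 2 ℕ.≤ e
    2≤e = ℕP.≤∧≢⇒< (1≤cofactor 2≤d) (λ 1≡e → np (subst Prime (trans (sym (ℕP.*-identityˡ (lpf d))) (trans (cong (ℕ._* lpf d) 1≡e) (cofactor 2≤d))) (lpf-prime 2≤d)))
    p≤e : lpf d ℕ.≤ e
    p≤e = lpf-least 2≤d 2≤e (subst (e ∣_) (cofactor 2≤d) (∣P.m∣m*n (lpf d)))

  -- Only powers of primes at most v can contribute, since the others would be primes; each such
  -- prime contributes at most L x'.
  prime-powers : ∀ {x x' v} → 1 ℕ.≤ x → x ℕ.≤ x' → x' ℕ.≤ X → x' ℕ.< suc v ℕ.* suc v →
    (∀ p → x ℕ.< p → p ℕ.≤ x' → ¬ Prime p) → ψ x' - ψ x ≤ + v * L x'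
  prime-powers {x} {x'} {v} 1≤x x≤x' x'≤X x'< void = begin
      ψ x' - ψ x                                  ≡⟨ S-cong-between x≤x' (λ d x<d d≤x' → Λ-by-lpf {d} {v} (ℕP.≤-trans (s≤s 1≤x) x<d)
                                                        (lpf-nonprime {d} {v} (ℕP.≤-trans (s≤s 1≤x) x<d) (void d x<d d≤x') (ℕP.≤-<-trans d≤x' x'<))) ⟩
      S F x' - S F x                              ≤⟨ prime-powers-drop (S F x') (S F x) (S-nonneg x (λ d _ _ → S-nonneg v (λ p _ _ → ind-nonneg (prime? p) ⊠ Λ-at≥0 p d))) ⟩
      S F x'                                      ≡⟨ S-swap (λ d p → ind (prime? p) * Λ-at p d) v x' ⟩
      S (λ p → S (λ d → ind (prime? p) * Λ-at p d) x') v ≤⟨ S-mono v (λ p _ _ → bound p) ⟩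
      S (λ _ → L x') v                            ≡⟨ S-const (L x') v ⟩
      + v * L x' ∎
    where
    open ℤP.≤-Reasoning
    F : ℕ → ℤ
    F d = S (λ p → ind (prime? p) * Λ-at p d) v
    bound : ∀ p → S (λ d → ind (prime? p) * Λ-at p d) x' ≤ L x'
    bound p with prime? p
    ... | yes P = ℤP.≤-trans (ℤP.≤-reflexive (trans (S-* 1ℤ x') (ℤP.*-identityˡ (S (Λ-at p) x')))) (S-Λ-at-≤ P x' (ℕP.≤-trans 1≤x x≤x') x'≤X)
    ... | no _ = ℤP.≤-trans (ℤP.≤-reflexive (trans (S-* {Λ-at p} 0ℤ x') (ℤP.*-zeroˡ (S (Λ-at p) x')))) (L≥0 x')

  -- The remainder on multiplicative scales

  module Variation (Q : ℕ) (2≤Q : 2 ℕ.≤ Q) where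
    -- The range where `R-incr` holds with error K y / Q and where rounding y to an integer costs a
    -- relative 1/Q at most.
    Good : ℕ → Set
    Good y = (+ 15004 * + Q * K ≤ L y) × Q ℕ.≤ y

    1≤Q : 1 ℕ.≤ Q
    1≤Q = ℕP.<⇒≤ 2≤Q

    Good⇒2≤ : ∀ {y} → Good y → 2 ℕ.≤ y
    Good⇒2≤ (_ , Q≤y) = ℕP.≤-trans 2≤Q Q≤y

    Good-mono : ∀ {y y'} → Good y → y ℕ.≤ y' → y' ℕ.≤ X → Good y'
    Good-mono g@(p , q) y≤y' y'≤X = ℤP.≤-trans p (L-mono (ℕP.<⇒≤ (Good⇒2≤ g)) y≤y' y'≤X) , ℕP.≤-trans q y≤y'

    doubling : ∀ {y y'} → 2 ℕ.≤ y → 2 ℕ.* y' ℕ.< 3 ℕ.* suc y → y' ℕ.≤ 2 ℕ.* y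
    doubling {y} {y'} 2≤y h = ℤP.drop‿+≤+ (subst (+ y' ≤_) (sym (ℤP.pos-* 2 y)) (pos-cancel {+ 2} (≤-ℤ (s≤s z≤n)) (doubling-core (+ y) (+ y') (≤-ℤ 2≤y)
        (subst₂ _≤_ (trans (+suc (2 ℕ.* y')) (cong (_+ 1ℤ) (ℤP.pos-* 2 y'))) (trans (ℤP.pos-* 3 (suc y)) (cong (+ 3 *_) (+suc y))) (≤-ℤ h)))))

    module Lipschitz (z n n' s : ℕ) (1≤n : 1 ℕ.≤ n) (n≤n' : n ℕ.≤ n') (n'≤X : n' ℕ.≤ X) (z≤X : z ℕ.≤ X)
      (2≤s : 2 ℕ.≤ s) (2s≤Q : 2 ℕ.* s ℕ.≤ Q) (close : s ℕ.* n' ℕ.≤ s ℕ.* n ℕ.+ n) (good : Good (z ÷ n')) where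
      private
        y₁ y₂ : ℕ
        y₁ = z ÷ n
        y₂ = z ÷ n'
        n≤X : n ℕ.≤ X
        n≤X = ℕP.≤-trans n≤n' n'≤X
        1≤n' : 1 ℕ.≤ n'
        1≤n' = ℕP.≤-trans 1≤n n≤n'
        2n'≤3n : 2 ℕ.* n' ℕ.≤ 3 ℕ.* n
        2n'≤3n = ℤP.drop‿+≤+ (subst₂ _≤_ (sym (ℤP.pos-* 2 n')) (sym (ℤP.pos-* 3 n)) (pos-cancel {+ s} (≤-ℤ (ℕP.<⇒≤ 2≤s))
            (2n'≤3n-core (+ s) (+ n') (+ n) (≤-ℤ 2≤s) (subst₂ _≤_ (ℤP.pos-* s n') (trans (ℤP.pos-+ (s ℕ.* n) n) (cong (_+ + n) (ℤP.pos-* s n))) (≤-ℤ close)) (0≤+ n))))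
        y₁≤2y₂ : y₁ ℕ.≤ 2 ℕ.* y₂
        y₁≤2y₂ = doubling (Good⇒2≤ good) (ℕP.*-cancelʳ-< n (2 ℕ.* y₁) (3 ℕ.* suc y₂) (ℕP.<-≤-trans
            (ℕP.≤-<-trans (ℕP.≤-reflexive (ℕP.*-assoc 2 y₁ n)) (ℕP.≤-<-trans (ℕP.*-monoʳ-≤ 2 (÷-* z n)) (ℕP.*-monoʳ-< 2 (÷-< z n' 1≤n'))))
            (ℕP.≤-trans (ℕP.≤-reflexive (trans (sym (ℕP.*-assoc 2 (suc y₂) n')) (trans (cong (ℕ._* n') (ℕP.*-comm 2 (suc y₂))) (ℕP.*-assoc (suc y₂) 2 n'))))
              (ℕP.≤-trans (ℕP.*-monoʳ-≤ (suc y₂) 2n'≤3n) (ℕP.≤-reflexive (trans (sym (ℕP.*-assoc (suc y₂) 3 n)) (cong (ℕ._* n) (ℕP.*-comm (suc y₂) 3))))))))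

      k-close : + s * (k n - k n') ≤ k n'
      k-close = *-cancel-≤ {n} _ _ 1≤n (core (+ s) (+ n) (+ n') (k n) (k n') K (k-spec n 1≤n n≤X) (k-spec n' 1≤n' n'≤X)
          (subst₂ _≤_ (ℤP.pos-* s n') (trans (ℤP.pos-+ (s ℕ.* n) n) (cong (_+ + n) (ℤP.pos-* s n))) (≤-ℤ close)) (k≥0 1≤n' n'≤X))
        where
        core : ∀ s n n' a b K → n * a ≡ K → n' * b ≡ K → s * n' ≤ s * n + n → 0ℤ ≤ b → n * (s * (a - b)) ≤ n * b
        core s n n' a b K e₁ e₂ p q = lin (sub p ⊠ q) (trans (core-s₁2 s n n' b) (trans (cong (λ z → s * (n * b) + n * b - s * z) (trans e₂ (sym e₁))) (core-s₂2 s n a b)))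

      -- The arguments z / n and z / n' differ by a relative 1/s, so R changes by about z k n' / s;
      -- the factor 2 absorbs the rounding and the error 1/Q, because 2 s ≤ Q.
      R-lip : + s * (R y₁ - R y₂) ⊴ + 2 * + z * k n'
      R-lip = lo , hi
        where
        incr : + Q * (R y₁ - R y₂) ⊴ + Q * K * (+ y₁ - + y₂) + K * + y₂
        incr = R-incr (ℕP.<⇒≤ (Good⇒2≤ good)) (÷-antimono 1≤n n≤n') y₁≤2y₂ (ℕP.≤-trans (÷-≤ z n) z≤X) Q 1≤Q (proj₁ good)
        bound : + s * (+ Q * K * (+ y₁ - + y₂) + K * + y₂) ≤ + Q * (+ 2 * + z * k n')
        bound = bound-core2 (+ s) (+ Q) K (+ y₁) (+ y₂) (+ z) (k n) (k n') (proj₁ (floor-k z 1≤n n≤X)) (proj₁ (floor-k z 1≤n' n'≤X)) (proj₂ (floor-k z 1≤n' n'≤X)) k-close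
            (≤-ℤ (proj₂ good)) (subst (_≤ + Q) (ℤP.pos-* 2 s) (≤-ℤ 2s≤Q)) (0≤+ s) (0≤+ Q) K≥0 (0≤+ z ⊠ k≥0 1≤n' n'≤X) (0≤+ z)
        hi : + s * (R y₁ - R y₂) ≤ + 2 * + z * k n'
        hi = pos-cancel {+ Q} (≤-ℤ 1≤Q) (R-lip-combine (+ s) (+ Q) (R y₁ - R y₂) (+ Q * K * (+ y₁ - + y₂) + K * + y₂) (+ 2 * + z * k n') (0≤+ s) (proj₂ incr) bound)
        lo : - (+ 2 * + z * k n') ≤ + s * (R y₁ - R y₂)
        lo = pos-cancel {+ Q} (≤-ℤ 1≤Q) (R-lip-combine′ (+ s) (+ Q) (R y₁ - R y₂) (+ Q * K * (+ y₁ - + y₂) + K * + y₂) (+ 2 * + z * k n') (0≤+ s) (proj₁ incr) bound)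

    -- Mertens' theorem in the form Σ_{n ≤ N} R(z/n) = O(K z).
    module PartialSums (z N : ℕ) (1≤N : 1 ℕ.≤ N) (N≤z : N ℕ.≤ z) (z≤X : z ℕ.≤ X) where
      private
        y : ℕ
        y = z ÷ N
        1≤y : 1 ℕ.≤ y
        1≤y = ÷-pos 1≤N N≤z
        y≤X : y ℕ.≤ X
        y≤X = ℕP.≤-trans (÷-≤ z N) z≤X
        1≤X : 1 ℕ.≤ X
        1≤X = ℕP.≤-trans 1≤y y≤X
        V : ℕ → ℤ
        V n = S (λ i → R (z ÷ i)) n

      ∣r∣ : ℕ → ℤ
      ∣r∣ n = Λ n + K + ind (n ℕP.≟ 1) * (+ 4 * K)

      r⊴ : ∀ n → r n ⊴ ∣r∣ n
      r⊴ n = ⊴-+ (⊴-- (⊴-of-nonneg (Λ≥0 n) ℤP.≤-refl) (⊴-of-nonneg K≥0 ℤP.≤-refl)) (⊴-scale (ind (n ℕP.≟ 1)) (ind-nonneg (n ℕP.≟ 1)) (C-bound 1≤X))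

      S-∣r∣ : ∀ {y} → 1 ℕ.≤ y → y ℕ.≤ X → S ∣r∣ y ≤ + 362 * K * + y
      S-∣r∣ {y} 1≤y y≤X = ℤP.≤-trans (ℤP.≤-reflexive (trans (S-+ {λ n → Λ n + K} {λ n → ind (n ℕP.≟ 1) * (+ 4 * K)} y)
          (cong₂ _+_ (trans (S-+ {Λ} {λ _ → K} y) (cong (_+_ (ψ y)) (S-const K y))) (ind1-sum y (+ 4 * K) 1≤y))))
          (S-∣r∣-core (+ 357) (ψ y) K (+ y) (ψ-bound y 1≤y y≤X) (≤-ℤ 1≤y) K≥0)

      -- Exchange of summation: r m is counted once for every n in (N , z / m], and n > N forces m ≤
      -- z / N.
      tail : V z - V N ≡ S (λ m → r m * (+ (z ÷ m) - + N)) y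
      tail = begin
          V z - V N
            ≡⟨ S-cong-between N≤z (λ n N<n n≤z → expand n N<n) ⟩
          S F z - S F N
            ≡⟨ cong₂ _-_ (trans (S-swap (λ n m → ind (m ℕP.≤? z ÷ n) * r m) y z) (S-cong y λ m 1≤m m≤y → trans (S-*ʳ (r m) z) (cong (_* r m) (trans (S-cong z (λ n 1≤n _ → ind-⇔ (m ℕP.≤? z ÷ n) (n ℕP.≤? z ÷ m) (flip 1≤n 1≤m) (flip 1≤m 1≤n))) (S-count (÷-≤ z m))))))
                         (trans (S-swap (λ n m → ind (m ℕP.≤? z ÷ n) * r m) y N) (S-cong y λ m 1≤m m≤y → trans (S-*ʳ (r m) N) (cong (_* r m) (trans (S-cong N (λ n 1≤n n≤N → ind-⇔ (m ℕP.≤? z ÷ n) (n ℕP.≤? z ÷ m) (flip 1≤n 1≤m) (flip 1≤m 1≤n))) (S-count-all (flip 1≤N 1≤m m≤y)))))) ⟩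
          S (λ m → + (z ÷ m) * r m) y - S (λ m → + N * r m) y
            ≡⟨ sym (S-minus {λ m → + (z ÷ m) * r m} {λ m → + N * r m} y) ⟩
          S (λ m → + (z ÷ m) * r m - + N * r m) y
            ≡⟨ S-cong y (λ m _ _ → by (tail-factor (+ (z ÷ m)) (+ N) (r m))) ⟩
          S (λ m → r m * (+ (z ÷ m) - + N)) y ∎
        where
        open ≡-Reasoning
        F : ℕ → ℤ
        F n = S (λ m → ind (m ℕP.≤? z ÷ n) * r m) y
        flip : ∀ {a b} → 1 ℕ.≤ a → 1 ℕ.≤ b → b ℕ.≤ z ÷ a → a ℕ.≤ z ÷ b
        flip {a} {b} 1≤a 1≤b h = ÷-lub 1≤b (subst (ℕ._≤ z) (ℕP.*-comm b a) (÷-glb {z} {a} h))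
        expand : ∀ n → N ℕ.< n → R (z ÷ n) ≡ F n
        expand n N<n = sym (trans (S-cut (÷-antimono 1≤N (ℕP.<⇒≤ N<n)) (λ m m> _ → trans (cong (_* r m) (ind-no (m ℕP.≤? z ÷ n) (ℕP.<⇒≱ m>))) (ℤP.*-zeroˡ (r m))))
          (S-cong (z ÷ n) (λ m _ m≤ → trans (cong (_* r m) (ind-yes (m ℕP.≤? z ÷ n) m≤)) (ℤP.*-identityˡ (r m)))))

      compare : ∀ m → 1 ℕ.≤ m → + (z ÷ m) - + N * + (y ÷ m) ⊴ + N
      compare m 1≤m = ⊴-of-nonneg (sub (subst (_≤ + (z ÷ m)) (ℤP.pos-* N (y ÷ m)) (≤-ℤ lo))) (compare-core (+ (z ÷ m)) (+ N) (+ (y ÷ m)) (subst (+ (z ÷ m) ≤_) (trans (ℤP.pos-* N (suc (y ÷ m))) (cong (+ N *_) (+suc (y ÷ m)))) (≤-ℤ hi)))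
        where
        lo : N ℕ.* (y ÷ m) ℕ.≤ z ÷ m
        lo = ÷-lub 1≤m (ℕP.≤-trans (ℕP.≤-reflexive (ℕP.*-assoc N (y ÷ m) m)) (ℕP.≤-trans (ℕP.*-monoʳ-≤ N (÷-* y m)) (ℕP.≤-trans (ℕP.≤-reflexive (ℕP.*-comm N y)) (÷-* z N))))
        hi : z ÷ m ℕ.≤ N ℕ.* suc (y ÷ m)
        hi = ℕP.<⇒≤ (ℕP.*-cancelʳ-< m (z ÷ m) (N ℕ.* suc (y ÷ m)) (ℕP.≤-<-trans (÷-* z m) (ℕP.<-≤-trans (÷-< z N 1≤N)
          (ℕP.≤-trans (ℕP.*-monoˡ-≤ N (÷-< y m 1≤m)) (ℕP.≤-reflexive (trans (ℕP.*-comm (suc (y ÷ m) ℕ.* m) N) (sym (ℕP.*-assoc N (suc (y ÷ m)) m))))))))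

      -- Replacing z ÷ m by N (y ÷ m) costs at most N for each m, which the bound for the sum of |r|
      -- pays. The main part becomes N (E y - R y), and N y ≤ z.
      tail-bound : V z - V N ⊴ + 758 * K * + z
      tail-bound = subst (_⊴ + 758 * K * + z) (sym eq) (⊴-≤ (⊴-+ part₁ part₂) (tail-bound-core (+ N) (+ y) (+ z) K (+ 44) (+ 352) (+ 362) (0≤+ 44 ⊞ 0≤+ 352 ⊞ 0≤+ 362) (subst (_≤ + z) (trans (cong +_ (ℕP.*-comm y N)) (ℤP.pos-* N y)) (≤-ℤ (÷-* z N))) K≥0))
        where
        err : ℕ → ℤ
        err m = r m * (+ (z ÷ m) - + N * + (y ÷ m))
        eq : V z - V N ≡ + N * (E y - R y) + S err y
        eq = trans tail (trans (S-cong y (λ m _ _ → by (eq-split (r m) (+ (z ÷ m)) (+ N) (+ (y ÷ m)))))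
            (trans (S-+ {λ m → + N * (r m * + (y ÷ m) - r m)} {err} y) (cong (_+ S err y) (trans (S-* (+ N) y)
              (cong (+ N *_) (trans (S-minus {λ m → r m * + (y ÷ m)} {r} y) (cong (_- R y) (sym (⋆-S r y)))))))))
        part₁ : + N * (E y - R y) ⊴ + N * (+ 44 * (+ y * K) + + 352 * K * + y)
        part₁ = ⊴-scale (+ N) (0≤+ N) (⊴-- (E-bound-linear y 1≤y y≤X) (R-bound y y≤X))
        part₂ : S err y ⊴ + N * (+ 362 * K * + y)
        part₂ = ⊴-≤ (S-⊴ y (λ m 1≤m _ → ⊴-* (r⊴ m) (compare m 1≤m))) (ℤP.≤-trans (ℤP.≤-reflexive (S-*ʳ (+ N) y)) (part₂-mul (S ∣r∣ y) (+ 362 * K * + y) (+ N) (S-∣r∣ 1≤y y≤X) (0≤+ N)))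

      partial-sum : V N ⊴ + 802 * K * + z
      partial-sum = subst₂ _⊴_ (by (partial-sum-shape (V z) (V N))) (by (partial-sum-join (+ 44) (+ 758) K (+ z))) (⊴-- (subst (_⊴ + 44 * (+ z * K)) E≡ (E-bound-linear z (ℕP.≤-trans 1≤N N≤z) z≤X)) tail-bound)
        where
        E≡ : E z ≡ V z
        E≡ = S-cong z (λ n _ _ → ℤP.*-identityˡ (R (z ÷ n)))

    -- Increments of R over the dilated intervals (x/n , x'/n]

    module Blocks (x h : ℕ) (2h≤x : 2 ℕ.* h ℕ.≤ x) (x+h≤X : x ℕ.+ h ℕ.≤ X) where
      x' : ℕ
      x' = x ℕ.+ h

      x≤X : x ℕ.≤ X
      x≤X = ℕP.≤-trans (ℕP.m≤m+n x h) x+h≤X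

      2h≤x′ : + 2 * + h ≤ + x
      2h≤x′ = subst (_≤ + x) (ℤP.pos-* 2 h) (≤-ℤ 2h≤x)

      Δ ∣Δ∣ rΔ : ℕ → ℤ
      Δ n = R (x' ÷ n) - R (x ÷ n)
      ∣Δ∣ n = + ∣ Δ n ∣
      rΔ n = r n * Δ n

      -- The extremal size of Δ n is h k n, that is K h / n; the excess 2 x k n / Q comes from the
      -- error in `R-incr` and from the floors.
      Δ-fine : ∀ n → 1 ℕ.≤ n → n ℕ.≤ X → Good (x ÷ n) → + Q * Δ n ⊴ (+ Q * + h + + 2 * + x) * k n
      Δ-fine n 1≤n n≤X good = ⊴-≤ (R-incr (ℕP.<⇒≤ (Good⇒2≤ good)) (÷-mono n (ℕP.m≤m+n x h)) y'≤2y (ℕP.≤-trans (÷-≤ x' n) x+h≤X) Q 1≤Q (proj₁ good))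
          (Δ-fine-core (+ Q) K (+ (x' ÷ n)) (+ (x ÷ n)) (+ x) (+ h) (k n) (subst (λ z → K * + (x' ÷ n) ≤ z * k n) (ℤP.pos-+ x h) (proj₁ (floor-k x' 1≤n n≤X))) (proj₁ (floor-k x 1≤n n≤X)) (proj₂ (floor-k x 1≤n n≤X))
            (≤-ℤ (proj₂ good)) (0≤+ Q) K≥0)
        where
        2x'≤3x : 2 ℕ.* x' ℕ.≤ 3 ℕ.* x
        2x'≤3x = ℕP.≤-trans (ℕP.≤-reflexive (ℕP.*-distribˡ-+ 2 x h)) (ℕP.≤-trans (ℕP.+-monoʳ-≤ (2 ℕ.* x) 2h≤x) (ℕP.≤-reflexive (ℕP.+-comm (2 ℕ.* x) x)))
        y'≤2y : x' ÷ n ℕ.≤ 2 ℕ.* (x ÷ n)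
        y'≤2y = doubling (Good⇒2≤ good) (ℕP.*-cancelʳ-< n (2 ℕ.* (x' ÷ n)) (3 ℕ.* suc (x ÷ n))
          (ℕP.≤-<-trans (ℕP.≤-trans (ℕP.≤-reflexive (ℕP.*-assoc 2 (x' ÷ n) n)) (ℕP.≤-trans (ℕP.*-monoʳ-≤ 2 (÷-* x' n)) 2x'≤3x))
            (ℕP.<-≤-trans (ℕP.*-monoʳ-< 3 (÷-< x n 1≤n)) (ℕP.≤-reflexive (sym (ℕP.*-assoc 3 (suc (x ÷ n)) n))))))

      Δ-coarse : ∀ n → 1 ℕ.≤ n → n ℕ.≤ X → Good (x ÷ n) → ∣Δ∣ n ≤ + 3 * + x * k n
      Δ-coarse n 1≤n n≤X good = pos-cancel {+ Q} (≤-ℤ 1≤Q) (ℤP.≤-trans (scale-abs {+ Q} {Δ n} (Δ-fine n 1≤n n≤X good))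
          (Δ-coarse-core (+ Q) (+ h) (+ x) (k n) (≤-ℤ 1≤Q) 2h≤x′ (0≤+ h) (k≥0 1≤n n≤X)))

      Δ-lip : ∀ n n' s → 1 ℕ.≤ n → n ℕ.≤ n' → n' ℕ.≤ X → 2 ℕ.≤ s → 2 ℕ.* s ℕ.≤ Q → s ℕ.* n' ℕ.≤ s ℕ.* n ℕ.+ n → Good (x ÷ n') →
        + s * (Δ n - Δ n') ⊴ + 6 * + x * k n'
      Δ-lip n n' s 1≤n n≤n' n'≤X 2≤s 2s≤Q close good =
          subst (_⊴ + 6 * + x * k n') (by (Δ-lip-shape (+ s) (R (x' ÷ n)) (R (x' ÷ n')) (R (x ÷ n)) (R (x ÷ n'))))
            (⊴-≤ (⊴-- (Lipschitz.R-lip x' n n' s 1≤n n≤n' n'≤X x+h≤X 2≤s 2s≤Q close good') (Lipschitz.R-lip x n n' s 1≤n n≤n' n'≤X x≤X 2≤s 2s≤Q close good))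
              (subst (λ z → + 2 * z * k n' + + 2 * + x * k n' ≤ + 6 * + x * k n') (sym (ℤP.pos-+ x h)) (Δ-lip-core (+ x) (+ h) (k n') 2h≤x′ (0≤+ h) (k≥0 (ℕP.≤-trans 1≤n n≤n') n'≤X))))
        where
        good' : Good (x' ÷ n')
        good' = Good-mono good (÷-mono n' (ℕP.m≤m+n x h)) (ℕP.≤-trans (÷-≤ x' n') x+h≤X)

      r⊴-large : ∀ n → 2 ℕ.≤ n → r n ⊴ Λ n + K
      r⊴-large n 2≤n = subst (_⊴ Λ n + K) (sym (trans (cong (λ i → Λ n - K + i * C) (ind-no (n ℕP.≟ 1) λ { refl → ℕP.<-irrefl refl 2≤n })) (by (r⊴-large-shape (Λ n - K) C))))
          (⊴-- (⊴-of-nonneg (Λ≥0 n) ℤP.≤-refl) (⊴-of-nonneg K≥0 ℤP.≤-refl))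

      -- A block (N , N + N/q] is short enough for Δ to be almost constant and long enough for
      -- `R-incr` to bound the sum of r by K times its length.
      module Block (q : ℕ) (2≤q : 2 ℕ.≤ q) (qq≤Q : q ℕ.* q ℕ.≤ Q) (N : ℕ) (goodN : Good N)
        (N₁≤X : N ℕ.+ N ÷ q ℕ.≤ X) (good : Good (x ÷ (N ℕ.+ N ÷ q))) where
        N₁ : ℕ
        N₁ = N ℕ.+ N ÷ q
        private
          1≤N : 1 ℕ.≤ N
          1≤N = ℕP.<⇒≤ (Good⇒2≤ goodN)
          1≤q : 1 ℕ.≤ q
          1≤q = ℕP.<⇒≤ 2≤q
          2q≤Q : 2 ℕ.* q ℕ.≤ Q
          2q≤Q = ℕP.≤-trans (ℕP.*-monoˡ-≤ q 2≤q) qq≤Q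
          q≤N : q ℕ.≤ N
          q≤N = ℕP.≤-trans (ℕP.≤-trans (ℕP.m≤m+n q (q ℕ.+ 0)) 2q≤Q) (proj₂ goodN)
          N≤N₁ : N ℕ.≤ N₁
          N≤N₁ = ℕP.m≤m+n N (N ÷ q)
          N₁≤2N : N₁ ℕ.≤ 2 ℕ.* N
          N₁≤2N = ℕP.+-monoʳ-≤ N (ℕP.≤-trans (÷-≤ N q) (ℕP.m≤m+n N 0))
          N≤X : N ℕ.≤ X
          N≤X = ℕP.≤-trans N≤N₁ N₁≤X
          B ρ d e : ℤ
          B = + (N ÷ q)
          ρ = R N₁ - R N
          d = ∣Δ∣ N
          e = + 6 * + x * k N
          B≥0 : 0ℤ ≤ B
          B≥0 = 0≤+ (N ÷ q)
          B≡ : + N₁ - + N ≡ B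
          B≡ = trans (cong (_- + N) (ℤP.pos-+ N (N ÷ q))) (by (+-minus-cancel (+ N) B))
          N≤2qB : + N ≤ + 2 * + q * B
          N≤2qB = below-multiple (+ N) (+ q) B (subst (+ N ≤_) (trans (ℤP.pos-* (suc (N ÷ q)) q) (cong (_* + q) (+suc (N ÷ q)))) (≤-ℤ (ℕP.<⇒≤ (÷-< N q 1≤q)))) (≤-ℤ (÷-pos 1≤q q≤N)) (0≤+ q)
          goodAt : ∀ {n} → 1 ℕ.≤ n → n ℕ.≤ N₁ → Good (x ÷ n)
          goodAt {n} 1≤n n≤N₁ = Good-mono good (÷-antimono 1≤n n≤N₁) (ℕP.≤-trans (÷-≤ x n) x≤X)
          lip : ∀ n → N ℕ.< n → n ℕ.≤ N₁ → + q * (Δ N - Δ n) ⊴ e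
          lip n N<n n≤N₁ = ⊴-≤ (Δ-lip N n q 1≤N (ℕP.<⇒≤ N<n) (ℕP.≤-trans n≤N₁ N₁≤X) 2≤q 2q≤Q close (goodAt (ℕP.≤-trans (s≤s z≤n) N<n) n≤N₁))
              (lip-core (+ x) (k n) (k N) (0≤+ x) (k-anti 1≤N (ℕP.<⇒≤ N<n) (ℕP.≤-trans n≤N₁ N₁≤X)))
            where
            close : q ℕ.* n ℕ.≤ q ℕ.* N ℕ.+ N
            close = ℕP.≤-trans (ℕP.*-monoʳ-≤ q n≤N₁) (ℕP.≤-trans (ℕP.≤-reflexive (ℕP.*-distribˡ-+ q N (N ÷ q))) (ℕP.+-monoʳ-≤ (q ℕ.* N) (ℕP.≤-trans (ℕP.≤-reflexive (ℕP.*-comm q (N ÷ q))) (÷-* N q))))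
          e≥0 : 0ℤ ≤ e
          e≥0 = 6 · 0≤+ x ⊠ k≥0 1≤N N≤X
          ρ-bound : + q * ρ ⊴ (+ q + + 2) * K * B
          ρ-bound = pos-cancel {+ Q} (≤-ℤ 1≤Q) (ρ-bound-lo (+ Q) (+ q) ρ (+ Q * K * B + K * + N) ((+ q + + 2) * K * B) (0≤+ q) (proj₁ incr) bound)
                  , pos-cancel {+ Q} (≤-ℤ 1≤Q) (ρ-bound-hi (+ Q) (+ q) ρ (+ Q * K * B + K * + N) ((+ q + + 2) * K * B) (0≤+ q) (proj₂ incr) bound)
            where
            incr : + Q * ρ ⊴ + Q * K * B + K * + N
            incr = subst (λ z → + Q * ρ ⊴ + Q * K * z + K * + N) B≡ (R-incr 1≤N N≤N₁ N₁≤2N N₁≤X Q 1≤Q (proj₁ goodN))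
            bound : + q * (+ Q * K * B + K * + N) ≤ + Q * ((+ q + + 2) * K * B)
            bound = bound-core (+ Q) (+ q) K B (+ N) N≤2qB (subst (_≤ + Q) (ℤP.pos-* q q) (≤-ℤ qq≤Q)) (0≤+ q) K≥0 B≥0
          ρ≤3KB : ρ ≤ + 3 * K * B
          ρ≤3KB = pos-cancel {+ q} (≤-ℤ 1≤q) (ρ≤3KB-core (+ q) ρ K B (proj₂ ρ-bound) (≤-ℤ 1≤q) K≥0 B≥0)
          U : ℕ → ℤ
          U n = r n * (Δ n - Δ N)
          S-rΔ : ∀ n → S rΔ n ≡ Δ N * R n + S U n
          S-rΔ n = trans (S-cong n (λ i _ _ → by (S-rΔ-shape (r i) (Δ i) (Δ N)))) (trans (S-+ {λ i → Δ N * r i} {U} n) (cong (_+ S U n) (S-* (Δ N) n)))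
          U-bound : + q * (S U N₁ - S U N) ≤ (ρ + + 2 * K * B) * e
          U-bound = subst₂ _≤_ (trans (cong₂ _-_ (S-* (+ q) N₁) (S-* (+ q) N)) (by (*-distribˡ-minus (+ q) (S U N₁) (S U N))))
              (trans (cong₂ _-_ (total N₁) (total N)) (U-bound-core (ψ N₁) (ψ N) ρ K (+ N₁) (+ N) B e (R-incr≡ 1≤N N≤N₁ N₁≤2N N₁≤X) B≡))
              (S-mono-between {λ n → + q * U n} {λ n → (Λ n + K) * e} N≤N₁ (λ n N<n n≤N₁ →
                subst (_≤ (Λ n + K) * e) (by (U-bound-shape (r n) (+ q) (Δ n) (Δ N))) (proj₂ (⊴-* (r⊴-large n (ℕP.≤-trans (s≤s 1≤N) N<n)) (⊴-neg (lip n N<n n≤N₁))))))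
            where
            total : ∀ n → S (λ i → (Λ i + K) * e) n ≡ (ψ n + + n * K) * e
            total n = trans (S-*ʳ e n) (cong (_* e) (trans (S-+ {Λ} {λ _ → K} n) (cong (_+_ (ψ n)) (S-const K n))))
          abs-bound : + q * B * d ≤ + q * (S ∣Δ∣ N₁ - S ∣Δ∣ N) + B * e
          abs-bound = subst₂ _≤_ (trans (cong₂ _-_ (S-const (+ q * d) N₁) (S-const (+ q * d) N)) (abs-bound-core₁ (+ N₁) (+ N) (+ q) d B B≡))
              (trans (cong₂ _-_ (total N₁) (total N)) (abs-bound-core₂ (+ q) (S ∣Δ∣ N₁) (S ∣Δ∣ N) (+ N₁) (+ N) B e B≡))
              (S-mono-between {λ _ → + q * d} {λ n → + q * ∣Δ∣ n + e} N≤N₁ (λ n N<n n≤N₁ → scale-abs {+ q} {Δ N}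
                (subst (_⊴ + q * ∣Δ∣ n + e) (by (abs-bound-shape (+ q) (Δ n) (Δ N))) (⊴-+ (⊴-scale (+ q) (0≤+ q) (⊴-abs (Δ n))) (lip n N<n n≤N₁)))))
            where
            total : ∀ n → S (λ i → + q * ∣Δ∣ i + e) n ≡ + q * S ∣Δ∣ n + + n * e
            total n = trans (S-+ {λ i → + q * ∣Δ∣ i} {λ _ → e} n) (cong₂ _+_ (S-* (+ q) n) (S-const e n))
          Bk : B * k N ≤ + 2 * (H N₁ - H N)
          Bk = subst₂ _≤_ (trans (cong₂ _-_ (S-const (k N) N₁) (S-const (k N) N)) (Bk-core₁ (+ N₁) (+ N) (k N) B B≡))
              (trans (cong₂ _-_ (S-* (+ 2) N₁) (S-* (+ 2) N)) (by (*-distribˡ-minus (+ 2) (H N₁) (H N))))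
              (S-mono-between {λ _ → k N} {λ n → + 2 * k n} N≤N₁ (λ n N<n n≤N₁ → k-half 1≤N (ℕP.<⇒≤ N<n) (ℕP.≤-trans n≤N₁ N₁≤2N) (ℕP.≤-trans n≤N₁ N₁≤X)))

        -- Writing Δ n as Δ N plus a difference, the constant part gives Δ N (R N₁ - R N), which is
        -- at most K |Δ N| per integer up to a relative 2/q. The difference is O(x k N / q), and |r|
        -- ≤ Λ + K has sum O(K B) over the block.
        block : + q * (S rΔ N₁ - S rΔ N) ≤ + q * K * (S ∣Δ∣ N₁ - S ∣Δ∣ N) + + 84 * K * + x * (H N₁ - H N)
        block = block-core (+ q) (S rΔ N₁) (S rΔ N) (Δ N) (R N₁) (R N) (S U N₁) (S U N) d (S ∣Δ∣ N₁ - S ∣Δ∣ N) B K (+ x) (k N) (H N₁ - H N)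
            (S-rΔ N₁) (S-rΔ N) (proj₂ (⊴-* (⊴-abs (Δ N)) ρ-bound)) U-bound ρ≤3KB abs-bound (Δ-coarse N 1≤N N≤X (goodAt 1≤N N≤N₁)) Bk K≥0 B≥0 (0≤+ x) e≥0

      -- With h ≥ x / (2 D) and s ≥ 48 D, the Lipschitz error 6 x k n / s is at most h k n / 4. The
      -- size of β is dictated by Mertens' bound: beyond 40 · 802 · D, the harmonic mass of (N , 2^β
      -- N] is too large for Δ to keep one sign and a size h k n / 2 throughout.
      module Windows (D s β q : ℕ) (1≤D : 1 ℕ.≤ D) (1≤h : 1 ℕ.≤ h) (x≤2Dh : + x ≤ + 2 * + D * + h)
        (48D≤s : + 48 * + D ≤ + s) (2s≤Q : 2 ℕ.* s ℕ.≤ Q) (β-large : + 32080 * + D + 1ℤ ≤ + β)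
        (2≤q : 2 ℕ.≤ q) (qq≤Q : q ℕ.* q ℕ.≤ Q) where
        b : ℕ
        b = 2 ℕ.^ β

        1≤b : 1 ℕ.≤ b
        1≤b = ℕP.m^n>0 2 β

        48≤s : + 48 ≤ + s
        48≤s = ℤP.≤-trans (48≤s-core (+ D) (≤-ℤ 1≤D)) 48D≤s

        2≤s : 2 ℕ.≤ s
        2≤s = ℤP.drop‿+≤+ (ℤP.≤-trans (+≤+ (s≤s (s≤s z≤n))) 48≤s)

        H-dyadic : ∀ N j → 1 ℕ.≤ N → 2 ℕ.^ j ℕ.* N ℕ.≤ X → + j * K ≤ + 2 * (H (2 ℕ.^ j ℕ.* N) - H N)
        H-dyadic N zero 1≤N le = ℤP.≤-reflexive (sym (trans (cong (λ m → + 2 * (H m - H N)) (ℕP.*-identityˡ N)) (by (H-dyadic-zeros (H N)))))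
        H-dyadic N (suc j) 1≤N le = subst₂ (λ a m → a * K ≤ + 2 * (H m - H N)) (sym (+suc j)) (sym eq)
            (H-dyadic-core (+ j) K (H N) (H M) (H (M ℕ.+ M)) (H-dyadic N j 1≤N (ℕP.≤-trans (ℕP.m≤m+n M M) 2M≤X)) doubled)
          where
          M : ℕ
          M = 2 ℕ.^ j ℕ.* N
          1≤M : 1 ℕ.≤ M
          1≤M = ℕP.*-mono-≤ (ℕP.m^n>0 2 j) 1≤N
          eq : 2 ℕ.^ suc j ℕ.* N ≡ M ℕ.+ M
          eq = trans (ℕP.*-assoc 2 (2 ℕ.^ j) N) (cong (M ℕ.+_) (ℕP.+-identityʳ M))
          2M≤X : M ℕ.+ M ℕ.≤ X
          2M≤X = ℕP.≤-trans (ℕP.≤-reflexive (sym eq)) le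
          doubled : K ≤ + 2 * (H (M ℕ.+ M) - H M)
          doubled = subst₂ _≤_ (trans (cong₂ _-_ (S-const (k M) (M ℕ.+ M)) (S-const (k M) M)) (doubled-core₁ (+ M) (k M) K (+ (M ℕ.+ M)) (ℤP.pos-+ M M) (k-spec M 1≤M (ℕP.≤-trans (ℕP.m≤m+n M M) 2M≤X))))
              (trans (cong₂ _-_ (S-* (+ 2) (M ℕ.+ M)) (S-* (+ 2) M)) (by (*-distribˡ-minus (+ 2) (H (M ℕ.+ M)) (H M))))
              (S-mono-between {λ _ → k M} {λ n → + 2 * k n} (ℕP.m≤m+n M M) (λ n M<n n≤ → k-half 1≤M (ℕP.<⇒≤ M<n) (ℕP.≤-trans n≤ (ℕP.≤-reflexive (cong (M ℕ.+_) (sym (ℕP.+-identityʳ M))))) (ℕP.≤-trans n≤ 2M≤X)))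

        S-Δ-bound : ∀ M → 1 ℕ.≤ M → M ℕ.≤ x → S Δ M ⊴ + 802 * K * (+ x + + h) + + 802 * K * + x
        S-Δ-bound M 1≤M M≤x = subst₂ _⊴_ (sym (S-minus {λ n → R (x' ÷ n)} {λ n → R (x ÷ n)} M)) (cong (λ z → + 802 * K * z + + 802 * K * + x) (ℤP.pos-+ x h))
          (⊴-- (PartialSums.partial-sum x' M 1≤M (ℕP.≤-trans M≤x (ℕP.m≤m+n x h)) x+h≤X) (PartialSums.partial-sum x M 1≤M M≤x x≤X))

        module Small (N : ℕ) (1≤N : 1 ℕ.≤ N) (s≤N : s ℕ.≤ N) (bN≤x : b ℕ.* N ℕ.≤ x) (good : Good (x ÷ (b ℕ.* N))) where
          private
            M : ℕ
            M = b ℕ.* N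
            N≤M : N ℕ.≤ M
            N≤M = ℕP.m≤n*m N b {{ℕ.>-nonZero 1≤b}}
            M≤X : M ℕ.≤ X
            M≤X = ℕP.≤-trans bN≤x x≤X
            eqM : N ℕ.+ (M ℕ.∸ N) ≡ M
            eqM = ℕP.m+[n∸m]≡n N≤M

          SmallAt : ℕ → Set
          SmallAt n = + 2 * ∣Δ∣ n ≤ + h * k n

          private
            -- A sign change of Δ between consecutive non-small points would contradict the Lipschitz bound.
            module _ (large : ∀ n → N ℕ.< n → n ℕ.≤ M → ¬ SmallAt n) where
              data Sign (n : ℕ) : Set where
                pos : Δ n ≡ ∣Δ∣ n → Sign n
                neg : Δ n ≡ - ∣Δ∣ n → Sign n

              sign-of : ∀ n → Sign n
              sign-of n = go (Δ n) refl
                where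
                go : ∀ a → Δ n ≡ a → Sign n
                go (+ m) e = pos (trans e (cong (λ z → + ∣ z ∣) (sym e)))
                go -[1+ m ] e = neg (trans e (cong (λ z → - (+ ∣ z ∣)) (sym e)))

              large′ : ∀ n → N ℕ.< n → n ℕ.≤ M → + h * k n ≤ + 2 * ∣Δ∣ n
              large′ n p q = ℤP.<⇒≤ (ℤP.≰⇒> (large n p q))

              no-change : ∀ n → N ℕ.< n → suc n ℕ.≤ M → ∀ u → Δ n ≡ u * ∣Δ∣ n → Δ (suc n) ≡ - u * ∣Δ∣ (suc n) → u ≡ 1ℤ ⊎ u ≡ - 1ℤ → ⊥
              no-change n N<n n<M u e₁ e₂ u≡ = ℤP.<⇒≱ (no-change-core (+ s) (+ D) (+ h) (+ x) (k n) (k (suc n)) (0≤+ D) x≤2Dh 48D≤s (≤-ℤ 1≤h) (k-anti 1≤n (ℕP.n≤1+n n) sn≤X) k>0 (≤-ℤ 1≤D)) (upper u≡)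
                where
                1≤n : 1 ℕ.≤ n
                1≤n = ℕP.≤-trans (s≤s z≤n) N<n
                sn≤X : suc n ℕ.≤ X
                sn≤X = ℕP.≤-trans n<M M≤X
                k>0 : 1ℤ ≤ k (suc n)
                k>0 = ℤP.i<j⇒suc[i]≤j (ℤP.≤∧≢⇒< (k≥0 (s≤s z≤n) sn≤X) λ 0≡k → ℤP.<⇒≱ (ℤP.<-≤-trans (Data.Integer.Base.+<+ (s≤s z≤n)) 1≤K)
                  (ℤP.≤-reflexive (trans (sym (k-spec (suc n) (s≤s z≤n) sn≤X)) (trans (cong (+ suc n *_) (sym 0≡k)) (ℤP.*-zeroʳ (+ suc n))))))
                lip : + s * (Δ n - Δ (suc n)) ⊴ + 6 * + x * k (suc n)
                lip = Δ-lip n (suc n) s 1≤n (ℕP.n≤1+n n) sn≤X 2≤s 2s≤Q (ℕP.≤-trans (ℕP.≤-reflexive (trans (ℕP.*-suc s n) (ℕP.+-comm s (s ℕ.* n)))) (ℕP.+-monoʳ-≤ (s ℕ.* n) (ℕP.≤-trans s≤N (ℕP.<⇒≤ N<n))))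
                  (Good-mono good (÷-antimono (s≤s z≤n) n<M) (ℕP.≤-trans (÷-≤ x (suc n)) x≤X))
                upper : u ≡ 1ℤ ⊎ u ≡ - 1ℤ → + s * (+ h * k n + + h * k (suc n)) ≤ + 2 * (+ 6 * + x * k (suc n))
                upper (inj₁ refl) = upper-pick (+ s) (Δ n) (Δ (suc n)) (∣Δ∣ n) (∣Δ∣ (suc n)) (+ h * k n) (+ h * k (suc n)) (+ 6 * + x * k (suc n)) e₁ e₂ (proj₂ lip) (large′ n N<n (ℕP.<⇒≤ n<M)) (large′ (suc n) (ℕP.m≤n⇒m≤1+n N<n) n<M) (0≤+ s)
                upper (inj₂ refl) = upper-pick2 (+ s) (Δ n) (Δ (suc n)) (∣Δ∣ n) (∣Δ∣ (suc n)) (+ h * k n) (+ h * k (suc n)) (+ 6 * + x * k (suc n)) e₁ e₂ (proj₁ lip) (large′ n N<n (ℕP.<⇒≤ n<M)) (large′ (suc n) (ℕP.m≤n⇒m≤1+n N<n) n<M) (0≤+ s)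

              propagate : ∀ n u → u ≡ 1ℤ ⊎ u ≡ - 1ℤ → N ℕ.< n → suc n ℕ.≤ M → Δ n ≡ u * ∣Δ∣ n → Δ (suc n) ≡ u * ∣Δ∣ (suc n)
              propagate n u u≡ N<n n<M e = choose u≡ (sign-of (suc n)) e
                where
                choose : ∀ {u} → u ≡ 1ℤ ⊎ u ≡ - 1ℤ → Sign (suc n) → Δ n ≡ u * ∣Δ∣ n → Δ (suc n) ≡ u * ∣Δ∣ (suc n)
                choose (inj₁ refl) (pos e') e = trans e' (sym (ℤP.*-identityˡ (∣Δ∣ (suc n))))
                choose (inj₂ refl) (neg e') e = trans e' (sym (ℤP.-1*i≡-i (∣Δ∣ (suc n))))
                choose (inj₂ refl) (pos e') e = ⊥-elim (no-change n N<n n<M (- 1ℤ) e (trans e' (sym (ℤP.*-identityˡ (∣Δ∣ (suc n))))) (inj₂ refl))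
                choose (inj₁ refl) (neg e') e = ⊥-elim (no-change n N<n n<M 1ℤ e (trans e' (sym (ℤP.-1*i≡-i (∣Δ∣ (suc n))))) (inj₁ refl))

              constant : ∀ u → u ≡ 1ℤ ⊎ u ≡ - 1ℤ → Δ (suc N) ≡ u * ∣Δ∣ (suc N) → ∀ n → N ℕ.< n → n ℕ.≤ M → Δ n ≡ u * ∣Δ∣ n
              constant u u≡ e (suc n) (s≤s N≤n) n≤M = split (ℕP.m≤n⇒m<n∨m≡n N≤n)
                where
                split : N ℕ.< n ⊎ N ≡ n → Δ (suc n) ≡ u * ∣Δ∣ (suc n)
                split (inj₂ N≡n) = subst (λ i → Δ (suc i) ≡ u * ∣Δ∣ (suc i)) N≡n e
                split (inj₁ N<n) = propagate n u u≡ N<n n≤M (constant u u≡ e n N<n (ℕP.<⇒≤ n≤M))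

              -- With one sign u, the sum of Δ over (N , M] has size at least h/2 times the harmonic
              -- mass, hence at least h β K / 4, whereas `S-Δ-bound` at M and at N leaves only O(K
              -- x).
              contradiction : ∀ u → u ≡ 1ℤ ⊎ u ≡ - 1ℤ → (∀ n → N ℕ.< n → n ℕ.≤ M → Δ n ≡ u * ∣Δ∣ n) → ⊥
              contradiction u u≡ e = ℤP.<⇒≱ (contradiction-core (+ 802) (+ 32080) (+ h) (+ x) (+ D) (+ β) K (H M - H N) refl (0≤+ 802) x≤2Dh 2h≤x′ β-large (H-dyadic N β 1≤N M≤X) (≤-ℤ 1≤h) 1≤K)
                  (ℤP.≤-trans lower (twice u≡))
                where
                lower : + h * (H M - H N) ≤ + 2 * (u * (S Δ M - S Δ N))
                lower = subst₂ _≤_ (trans (cong₂ _-_ (S-* (+ h) M) (S-* (+ h) N)) (by (*-distribˡ-minus (+ h) (H M) (H N))))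
                    (trans (cong₂ _-_ (trans (S-* (+ 2) M) (cong (+ 2 *_) (S-* u M))) (trans (S-* (+ 2) N) (cong (+ 2 *_) (S-* u N)))) (by (lower-dist₂ u (S Δ M) (S Δ N))))
                    (S-mono-between {λ n → + h * k n} {λ n → + 2 * (u * Δ n)} N≤M (λ n p q → ℤP.≤-trans (large′ n p q) (ℤP.≤-reflexive (cong (+ 2 *_) (fold u≡ n (e n p q))))))
                  where
                  fold : ∀ {u} → u ≡ 1ℤ ⊎ u ≡ - 1ℤ → ∀ n → Δ n ≡ u * ∣Δ∣ n → ∣Δ∣ n ≡ u * Δ n
                  fold (inj₁ refl) n e = trans (sym (ℤP.*-identityˡ (∣Δ∣ n))) (trans (sym e) (sym (ℤP.*-identityˡ (Δ n))))
                  fold (inj₂ refl) n e = trans (by (fold-flip (∣Δ∣ n))) (cong (- 1ℤ *_) (sym e))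
                bounds : S Δ M - S Δ N ⊴ + 802 * K * (+ x + + h) + + 802 * K * + x + (+ 802 * K * (+ x + + h) + + 802 * K * + x)
                bounds = ⊴-- (S-Δ-bound M (ℕP.≤-trans 1≤N N≤M) bN≤x) (S-Δ-bound N 1≤N (ℕP.≤-trans N≤M bN≤x))
                twice : u ≡ 1ℤ ⊎ u ≡ - 1ℤ → + 2 * (u * (S Δ M - S Δ N)) ≤ + 2 * (+ 802 * K * (+ x + + h) + + 802 * K * + x + (+ 802 * K * (+ x + + h) + + 802 * K * + x))
                twice (inj₁ refl) = twice-pick (S Δ M - S Δ N) _ (proj₂ bounds)
                twice (inj₂ refl) = twice-pick2 (S Δ M - S Δ N) _ (proj₁ bounds)

              impossible : Sign (suc N) → ⊥
              impossible (pos e) = contradiction 1ℤ (inj₁ refl) (constant 1ℤ (inj₁ refl) (trans e (sym (ℤP.*-identityˡ (∣Δ∣ (suc N))))))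
              impossible (neg e) = contradiction (- 1ℤ) (inj₂ refl) (constant (- 1ℤ) (inj₂ refl) (trans e (sym (ℤP.-1*i≡-i (∣Δ∣ (suc N))))))

          small-point : Σ ℕ λ n → N ℕ.< n × n ℕ.≤ M × SmallAt n
          small-point = [ found , (λ none → ⊥-elim (refute (λ n p q → none n p (ℕP.≤-trans q (ℕP.≤-reflexive (sym eqM)))))) ]′ (search (λ n → + 2 * ∣Δ∣ n ℤP.≤? + h * k n) N (M ℕ.∸ N))
            where
            found : (Σ ℕ λ n → N ℕ.< n × n ℕ.≤ N ℕ.+ (M ℕ.∸ N) × SmallAt n) → Σ ℕ λ n → N ℕ.< n × n ℕ.≤ M × SmallAt n
            found (n , p , q , small) = n , p , ℕP.≤-trans q (ℕP.≤-reflexive eqM) , small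
            refute : (∀ n → N ℕ.< n → n ℕ.≤ M → ¬ SmallAt n) → ⊥
            refute large = impossible large (sign-of large (suc N))

        module Chain (q-large : + 344 * (+ 128 * + s * + (2 ℕ.^ β)) * + D ≤ + q) where
          -- 1/Θ is the relative saving in a window: on a stretch of harmonic mass at least K / (4
          -- s), inside a window of mass at most 4 b K, the trivial bound improves by 1/8.
          Θ : ℤ
          Θ = + 128 * + s * + b

          Θ≥0 : 0ℤ ≤ Θ
          Θ≥0 = 128 · 0≤+ s ⊠ 0≤+ b

          q≤Q : q ℕ.≤ Q
          q≤Q = ℕP.≤-trans (ℕP.m≤m*n q q {{ℕ.>-nonZero (ℕP.<⇒≤ 2≤q)}}) qq≤Q

          s≤Q : s ℕ.≤ Q
          s≤Q = ℕP.≤-trans (ℕP.m≤m+n s (s ℕ.+ 0)) 2s≤Q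

          -- The saving is halved to 1 / (2 Θ); the other half pays for the block errors 1/q and the
          -- errors 1/Q.
          WindowBound : ℕ → ℕ → Set
          WindowBound N M = + 2 * Θ * (S rΔ M - S rΔ N) ≤ (+ 2 * Θ - 1ℤ) * K * + h * (H M - H N)

          module Window (Z : ℕ) (goodZ : Good (x ÷ Z)) (1≤Z : 1 ℕ.≤ Z) (N : ℕ) (goodN : Good N) (4bN≤Z : 2 ℕ.* (2 ℕ.* (b ℕ.* N)) ℕ.≤ Z) where
            private
              t : ℕ
              t = 2 ℕ.* (b ℕ.* N)
              1≤N : 1 ℕ.≤ N
              1≤N = ℕP.<⇒≤ (Good⇒2≤ goodN)
              Z≤x : Z ℕ.≤ x
              Z≤x = ℕP.≤-trans (ℕP.m≤m+n Z (Z ℕ.+ 0)) (÷-glb {x} {Z} (Good⇒2≤ goodZ))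
              Z≤X : Z ℕ.≤ X
              Z≤X = ℕP.≤-trans Z≤x x≤X
              goodAt : ∀ {n} → 1 ℕ.≤ n → n ℕ.≤ Z → Good (x ÷ n)
              goodAt {n} 1≤n n≤Z = Good-mono goodZ (÷-antimono 1≤n n≤Z) (ℕP.≤-trans (÷-≤ x n) x≤X)
              bN≤t : b ℕ.* N ℕ.≤ t
              bN≤t = ℕP.m≤m+n (b ℕ.* N) _
              t≤Z : t ℕ.≤ Z
              t≤Z = ℕP.≤-trans (ℕP.m≤m+n t _) 4bN≤Z
              N≤bN : N ℕ.≤ b ℕ.* N
              N≤bN = ℕP.m≤n*m N b {{ℕ.>-nonZero 1≤b}}
              1≤bN : 1 ℕ.≤ b ℕ.* N
              1≤bN = ℕP.≤-trans 1≤N N≤bN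

              BlockSum : ℕ → Set
              BlockSum M = + q * (S rΔ M - S rΔ N) ≤ + q * K * (S ∣Δ∣ M - S ∣Δ∣ N) + + 84 * K * + x * (H M - H N)
              P : ℕ → Set
              P M = N ℕ.≤ M × M ℕ.≤ 2 ℕ.* t × BlockSum M

              step : ∀ M → P M → M ℕ.< t → Σ ℕ λ M' → M ℕ.< M' × P M'
              step M (N≤M , _ , bs) M<t = M₁ , M<M₁ , ℕP.≤-trans N≤M (ℕP.<⇒≤ M<M₁) , M₁≤2t , step-join (+ 84) (+ q) K (+ x) (S rΔ M₁) (S rΔ M) (S rΔ N) (S ∣Δ∣ M₁) (S ∣Δ∣ M) (S ∣Δ∣ N) (H M₁) (H M) (H N) bs
                  (Block.block q 2≤q qq≤Q M goodM (ℕP.≤-trans M₁≤Z Z≤X) (goodAt (ℕP.≤-trans (s≤s z≤n) M<M₁) M₁≤Z))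
                where
                M₁ : ℕ
                M₁ = M ℕ.+ M ÷ q
                q≤M : q ℕ.≤ M
                q≤M = ℕP.≤-trans (ℕP.≤-trans q≤Q (proj₂ goodN)) N≤M
                M<M₁ : M ℕ.< M₁
                M<M₁ = ℕP.m<m+n M (÷-pos (ℕP.<⇒≤ 2≤q) q≤M)
                M₁≤2t : M₁ ℕ.≤ 2 ℕ.* t
                M₁≤2t = ℕP.+-mono-≤ (ℕP.<⇒≤ M<t) (ℕP.≤-trans (÷-≤ M q) (ℕP.≤-trans (ℕP.<⇒≤ M<t) (ℕP.m≤m+n t 0)))
                M₁≤Z : M₁ ℕ.≤ Z
                M₁≤Z = ℕP.≤-trans M₁≤2t 4bN≤Z
                goodM : Good M
                goodM = Good-mono goodN N≤M (ℕP.≤-trans (ℕP.<⇒≤ M<M₁) (ℕP.≤-trans M₁≤Z Z≤X))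

              opaque
                chain : Σ ℕ λ M → t ℕ.≤ M × P M
                -- The last block may overshoot t, but by less than a factor 2, so it ends before 4
                -- b N ≤ Z.
                chain = iterate P t step N (ℕP.≤-refl , ℕP.≤-trans N≤bN (ℕP.≤-trans bN≤t (ℕP.m≤m+n t _)) , ℤP.≤-reflexive (by (chain-zeros (+ 84) (+ q) K (+ x) (S rΔ N) (S ∣Δ∣ N) (H N))))

                small : Σ ℕ λ n → N ℕ.< n × n ℕ.≤ b ℕ.* N × + 2 * ∣Δ∣ n ≤ + h * k n
                small = Small.small-point N 1≤N (ℕP.≤-trans s≤Q (proj₂ goodN)) (ℕP.≤-trans bN≤t (ℕP.≤-trans t≤Z Z≤x)) (goodAt 1≤bN (ℕP.≤-trans bN≤t t≤Z))

            M : ℕ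
            M = proj₁ chain

            2bN≤M : 2 ℕ.* (b ℕ.* N) ℕ.≤ M
            2bN≤M = proj₁ (proj₂ chain)

            M≤Z : M ℕ.≤ Z
            M≤Z = ℕP.≤-trans (proj₁ (proj₂ (proj₂ (proj₂ chain)))) 4bN≤Z

            N≤M : N ℕ.≤ M
            N≤M = proj₁ (proj₂ (proj₂ chain))

            private
              n* n₁ : ℕ
              n* = proj₁ small
              n₁ = n* ℕ.+ n* ÷ s
              N<n* : N ℕ.< n*
              N<n* = proj₁ (proj₂ small)
              n*≤bN : n* ℕ.≤ b ℕ.* N
              n*≤bN = proj₁ (proj₂ (proj₂ small))
              1≤n* : 1 ℕ.≤ n*
              1≤n* = ℕP.≤-trans (s≤s z≤n) N<n*
              n*≤n₁ : n* ℕ.≤ n₁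
              n*≤n₁ = ℕP.m≤m+n n* (n* ÷ s)
              n₁≤2n* : n₁ ℕ.≤ 2 ℕ.* n*
              n₁≤2n* = ℕP.+-monoʳ-≤ n* (ℕP.≤-trans (÷-≤ n* s) (ℕP.m≤m+n n* 0))
              -- This is why a window extends at least to 2 b N: the stretch following a small point
              -- n* ≤ b N must still fit.
              n₁≤M : n₁ ℕ.≤ M
              n₁≤M = ℕP.≤-trans n₁≤2n* (ℕP.≤-trans (ℕP.*-monoʳ-≤ 2 n*≤bN) 2bN≤M)
              n₁≤Z : n₁ ℕ.≤ Z
              n₁≤Z = ℕP.≤-trans n₁≤M M≤Z
              1≤s : 1 ℕ.≤ s
              1≤s = ℕP.<⇒≤ 2≤s
              s≤n* : s ℕ.≤ n*
              s≤n* = ℕP.≤-trans (ℕP.≤-trans s≤Q (proj₂ goodN)) (ℕP.<⇒≤ N<n*)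

              fine : ∀ {m m'} → 1 ℕ.≤ m → m ℕ.≤ m' → m' ℕ.≤ Z → + Q * (S ∣Δ∣ m' - S ∣Δ∣ m) ≤ (+ Q * + h + + 2 * + x) * (H m' - H m)
              fine {m} {m'} 1≤m m≤m' m'≤Z = subst₂ _≤_ (trans (cong₂ _-_ (S-* (+ Q) m') (S-* (+ Q) m)) (by (*-distribˡ-minus (+ Q) (S ∣Δ∣ m') (S ∣Δ∣ m))))
                  (trans (cong₂ _-_ (S-* (+ Q * + h + + 2 * + x) m') (S-* (+ Q * + h + + 2 * + x) m)) (by (*-distribˡ-minus (+ Q * + h + + 2 * + x) (H m') (H m))))
                  (S-mono-between {λ n → + Q * ∣Δ∣ n} {λ n → (+ Q * + h + + 2 * + x) * k n} m≤m' (λ n m<n n≤m' →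
                    scale-abs {+ Q} {Δ n} (Δ-fine n (ℕP.≤-trans 1≤m (ℕP.<⇒≤ m<n)) (ℕP.≤-trans n≤m' (ℕP.≤-trans m'≤Z Z≤X)) (goodAt (ℕP.≤-trans 1≤m (ℕP.<⇒≤ m<n)) (ℕP.≤-trans n≤m' m'≤Z)))))

              -- Near a small point the trivial bound improves by a factor 7/8.
              near : ∀ n → n* ℕ.< n → n ℕ.≤ n₁ → + 8 * ∣Δ∣ n ≤ + 7 * + h * k n
              near n n*<n n≤n₁ = pos-cancel {+ s} (≤-ℤ 1≤s) (near-core (+ s) (∣Δ∣ n) (∣Δ∣ n*) (k n) (k n*) (+ h) (+ x) (+ D)
                  (scale-abs {+ s} {Δ n} (subst (_⊴ + s * ∣Δ∣ n* + + 6 * + x * k n) (by (near-shape (+ s) (Δ n*) (Δ n)))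
                    (⊴-- (⊴-scale (+ s) (0≤+ s) (⊴-abs (Δ n*))) lip)))
                  (proj₂ (proj₂ (proj₂ small))) (Lipschitz.k-close x n* n s 1≤n* (ℕP.<⇒≤ n*<n) n≤X x≤X 2≤s 2s≤Q close (goodAt 1≤n n≤Z)) x≤2Dh 48D≤s 48≤s (0≤+ s) (0≤+ h) (k≥0 1≤n n≤X))
                where
                1≤n : 1 ℕ.≤ n
                1≤n = ℕP.≤-trans 1≤n* (ℕP.<⇒≤ n*<n)
                n≤Z : n ℕ.≤ Z
                n≤Z = ℕP.≤-trans n≤n₁ n₁≤Z
                n≤X : n ℕ.≤ X
                n≤X = ℕP.≤-trans n≤Z Z≤X
                close : s ℕ.* n ℕ.≤ s ℕ.* n* ℕ.+ n*
                close = ℕP.≤-trans (ℕP.*-monoʳ-≤ s n≤n₁) (ℕP.≤-trans (ℕP.≤-reflexive (ℕP.*-distribˡ-+ s n* (n* ÷ s))) (ℕP.+-monoʳ-≤ (s ℕ.* n*) (ℕP.≤-trans (ℕP.≤-reflexive (ℕP.*-comm s (n* ÷ s))) (÷-* n* s))))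
                lip : + s * (Δ n* - Δ n) ⊴ + 6 * + x * k n
                lip = Δ-lip n* n s 1≤n* (ℕP.<⇒≤ n*<n) n≤X 2≤s 2s≤Q close (goodAt 1≤n n≤Z)

              near-sum : + 8 * (S ∣Δ∣ n₁ - S ∣Δ∣ n*) ≤ + 7 * + h * (H n₁ - H n*)
              near-sum = subst₂ _≤_ (trans (cong₂ _-_ (S-* (+ 8) n₁) (S-* (+ 8) n*)) (by (*-distribˡ-minus (+ 8) (S ∣Δ∣ n₁) (S ∣Δ∣ n*))))
                  (trans (cong₂ _-_ (S-* (+ 7 * + h) n₁) (S-* (+ 7 * + h) n*)) (by (*-distribˡ-minus (+ 7 * + h) (H n₁) (H n*))))
                  (S-mono-between {λ n → + 8 * ∣Δ∣ n} {λ n → + 7 * + h * k n} n*≤n₁ near)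

              H-const : ∀ m m' c → S (λ _ → c) m' - S (λ _ → c) m ≡ (+ m' - + m) * c
              H-const m m' c = trans (cong₂ _-_ (S-const c m') (S-const c m)) (by (*-distribʳ-minus (+ m') (+ m) c))

              -- There are n* ÷ s terms, each at least k n* / 2; rounding n* / s down costs another
              -- factor 2.
              K≤4sH : K ≤ + 4 * + s * (H n₁ - H n*)
              K≤4sH = K≤4sH-core (+ s) (+ n*) (+ (n* ÷ s)) (+ n₁) (k n*) K (H n₁ - H n*) (k-spec n* 1≤n* n*≤X) (ℤP.pos-+ n* (n* ÷ s))
                  (subst (+ n* ≤_) (trans (ℤP.pos-* (suc (n* ÷ s)) s) (cong (_* + s) (+suc (n* ÷ s)))) (≤-ℤ (ℕP.<⇒≤ (÷-< n* s 1≤s)))) (≤-ℤ (÷-pos 1≤s s≤n*)) half (0≤+ s) (k≥0 1≤n* n*≤X)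
                where
                n*≤X : n* ℕ.≤ X
                n*≤X = ℕP.≤-trans n*≤n₁ (ℕP.≤-trans n₁≤Z Z≤X)
                half : (+ n₁ - + n*) * k n* ≤ + 2 * (H n₁ - H n*)
                half = subst₂ _≤_ (H-const n* n₁ (k n*)) (trans (cong₂ _-_ (S-* (+ 2) n₁) (S-* (+ 2) n*)) (by (*-distribˡ-minus (+ 2) (H n₁) (H n*))))
                    (S-mono-between {λ _ → k n*} {λ n → + 2 * k n} n*≤n₁ (λ n n*<n n≤n₁ → k-half 1≤n* (ℕP.<⇒≤ n*<n) (ℕP.≤-trans n≤n₁ n₁≤2n*) (ℕP.≤-trans n≤n₁ (ℕP.≤-trans n₁≤Z Z≤X))))

              H≤4bK : H M - H N ≤ + 4 * + b * K
              H≤4bK = H≤4bK-core (+ b) (+ N) (+ M) (k N) K (H M - H N) (k-spec N 1≤N N≤X) (subst (H M - H N ≤_) (H-const N M (k N))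
                    (S-mono-between {k} {λ _ → k N} N≤M (λ n N<n n≤M → k-anti 1≤N (ℕP.<⇒≤ N<n) (ℕP.≤-trans n≤M (ℕP.≤-trans M≤Z Z≤X)))))
                  (subst (+ M ≤_) (trans (ℤP.pos-* 2 t) (trans (cong (+ 2 *_) (trans (ℤP.pos-* 2 (b ℕ.* N)) (cong (+ 2 *_) (ℤP.pos-* b N)))) (by (H≤4bK-shape (+ b) (+ N))))) (≤-ℤ (proj₁ (proj₂ (proj₂ (proj₂ chain))))))
                  (0≤+ N) (k≥0 1≤N N≤X)
                where
                N≤X : N ℕ.≤ X
                N≤X = ℕP.≤-trans N≤M (ℕP.≤-trans M≤Z Z≤X)

              H-mono : ∀ {m m'} → 1 ℕ.≤ m → m ℕ.≤ m' → m' ℕ.≤ Z → 0ℤ ≤ H m' - H m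
              H-mono 1≤m m≤m' m'≤Z = sub (S-mono-len m≤m' (λ i m<i i≤m' → k≥0 (ℕP.≤-trans 1≤m (ℕP.<⇒≤ m<i)) (ℕP.≤-trans i≤m' (ℕP.≤-trans m'≤Z Z≤X))))

              gain : + 8 * (H M - H N) ≤ Θ * (H n₁ - H n*)
              gain = gain-core (+ s) (+ b) K (H M - H N) (H n₁ - H n*) K≤4sH H≤4bK (0≤+ b)

              -- The trivial bound on both sides of (n* , n₁], the improved one inside it, and
              -- `gain` to express the saving as a share of the whole window.
              abs-sum : + Q * Θ * (S ∣Δ∣ M - S ∣Δ∣ N) ≤ (Θ * (+ Q * + h + + 2 * + x) - + Q * + h) * (H M - H N)
              abs-sum = pos-cancel {+ 8} (≤-ℤ (s≤s z≤n)) (abs-sum-combine (+ Q) Θ (+ Q * + h + + 2 * + x) (+ h) (S ∣Δ∣ M - S ∣Δ∣ N) (H M - H N) (H n₁ - H n*)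
                  (three (+ Q) (+ Q * + h + + 2 * + x) (+ h) (+ x) (S ∣Δ∣ N) (S ∣Δ∣ n*) (S ∣Δ∣ n₁) (S ∣Δ∣ M) (H N) (H n*) (H n₁) (H M) refl
                    (fine 1≤N (ℕP.<⇒≤ N<n*) (ℕP.≤-trans n*≤n₁ n₁≤Z)) near-sum (fine (ℕP.≤-trans 1≤n* n*≤n₁) n₁≤M M≤Z) (H-mono 1≤n* n*≤n₁ n₁≤Z) (0≤+ Q) (0≤+ x))
                  gain Θ≥0 (0≤+ Q) (0≤+ h))
                where
                three : ∀ Q F h x A₀ A₁ A₂ A₃ H₀ H₁ H₂ H₃ → F ≡ Q * h + + 2 * x → Q * (A₁ - A₀) ≤ F * (H₁ - H₀) → + 8 * (A₂ - A₁) ≤ + 7 * h * (H₂ - H₁) →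
                  Q * (A₃ - A₂) ≤ F * (H₃ - H₂) → 0ℤ ≤ H₂ - H₁ → 0ℤ ≤ Q → 0ℤ ≤ x → + 8 * (Q * (A₃ - A₀)) ≤ + 8 * (F * (H₃ - H₀)) - Q * h * (H₂ - H₁)
                three Q F h x A₀ A₁ A₂ A₃ H₀ H₁ H₂ H₃ e p r u y 0≤Q 0≤x = lin (8 · sub p ⊞ 0≤Q ⊠ sub r ⊞ 8 · sub u ⊞ 16 · (0≤x ⊠ y))
                    (trans (three-s₁ Q F h x A₀ A₁ A₂ A₃ H₀ H₁ H₂ H₃) (trans (cong (λ z → + 8 * (F * (H₃ - H₀)) - Q * h * (H₂ - H₁) - + 8 * (Q * (A₃ - A₀)) - + 8 * (F - z) * (H₂ - H₁)) (sym e)) (three-s₂ F (+ 8 * (F * (H₃ - H₀)) - Q * h * (H₂ - H₁)) (+ 8 * (Q * (A₃ - A₀))) (H₂ - H₁))))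

            window : WindowBound N M
            window = pos-cancel {+ q * + Q} (ℤP.≤-trans (+≤+ (s≤s z≤n)) (subst (1ℤ ≤_) (ℤP.pos-* q Q) (≤-ℤ (ℕP.*-mono-≤ (ℕP.<⇒≤ 2≤q) 1≤Q))))
                (window-core (+ 84) (+ 344) (+ 172) (+ q) (+ Q) Θ K (+ h) (+ x) (+ D) (S rΔ M - S rΔ N) (S ∣Δ∣ M - S ∣Δ∣ N) (H M - H N) refl refl
                  (proj₂ (proj₂ (proj₂ (proj₂ chain)))) abs-sum (≤-ℤ q≤Q) x≤2Dh q-large (0≤+ 172) Θ≥0 K≥0 (0≤+ q) (0≤+ Q) (0≤+ h) (0≤+ x) (H-mono 1≤N N≤M M≤Z))

          opaque
            next-window : ∀ Z → Good (x ÷ Z) → 1 ℕ.≤ Z → ∀ N → Good N → 2 ℕ.* (2 ℕ.* (b ℕ.* N)) ℕ.≤ Z → Σ ℕ λ M → N ℕ.< M × M ℕ.≤ Z × WindowBound N M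
            next-window Z goodZ 1≤Z N goodN le = Window.M Z goodZ 1≤Z N goodN le
              , ℕP.<-≤-trans (ℕP.≤-<-trans (ℕP.m≤n*m N b {{ℕ.>-nonZero 1≤b}}) (ℕP.m<m+n (b ℕ.* N) (ℕP.≤-trans (ℕP.*-mono-≤ 1≤b (ℕP.<⇒≤ (Good⇒2≤ goodN))) (ℕP.m≤m+n _ _)))) (Window.2bN≤M Z goodZ 1≤Z N goodN le)
              , Window.M≤Z Z goodZ 1≤Z N goodN le , Window.window Z goodZ 1≤Z N goodN le

          windows : ∀ Z n₀ → Good (x ÷ Z) → 1 ℕ.≤ Z → Good n₀ → n₀ ℕ.≤ Z → Σ ℕ λ M → n₀ ℕ.≤ M × M ℕ.≤ Z × Z ℕ.< M ℕ.* (2 ℕ.* (2 ℕ.* b)) × WindowBound n₀ M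
          windows Z n₀ goodZ 1≤Z good₀ n₀≤Z = finish (iterate P (suc (Z ÷ c)) step n₀ (ℕP.≤-refl , n₀≤Z , ℤP.≤-reflexive (by (windows-zeros Θ K (+ h) (S rΔ n₀) (H n₀)))))
            where
            c : ℕ
            c = 2 ℕ.* (2 ℕ.* b)
            1≤c : 1 ℕ.≤ c
            1≤c = ℕP.≤-trans 1≤b (ℕP.≤-trans (ℕP.m≤m+n b _) (ℕP.m≤m+n (2 ℕ.* b) _))
            P : ℕ → Set
            P M = n₀ ℕ.≤ M × M ℕ.≤ Z × WindowBound n₀ M
            Z≤X : Z ℕ.≤ X
            Z≤X = ℕP.≤-trans (ℕP.≤-trans (ℕP.m≤m+n Z (Z ℕ.+ 0)) (÷-glb {x} {Z} (Good⇒2≤ goodZ))) x≤X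
            quadruple : ∀ b M → 2 ℕ.* (2 ℕ.* (b ℕ.* M)) ≡ M ℕ.* (2 ℕ.* (2 ℕ.* b))
            quadruple b M = trans (cong (2 ℕ.*_) (sym (ℕP.*-assoc 2 b M))) (trans (sym (ℕP.*-assoc 2 (2 ℕ.* b) M)) (ℕP.*-comm (2 ℕ.* (2 ℕ.* b)) M))
            extend : ∀ M → P M → (Σ ℕ λ M' → M ℕ.< M' × M' ℕ.≤ Z × WindowBound M M') → Σ ℕ λ M' → M ℕ.< M' × P M'
            extend M (n₀≤M , _ , wb) (M' , M<M' , M'≤Z , wb') = M' , M<M' , ℕP.≤-trans n₀≤M (ℕP.<⇒≤ M<M') , M'≤Z , windows-join Θ K (+ h) (S rΔ M') (S rΔ M) (S rΔ n₀) (H M') (H M) (H n₀) wb wb'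
            step : ∀ M → P M → M ℕ.< suc (Z ÷ c) → Σ ℕ λ M' → M ℕ.< M' × P M'
            step M PM (s≤s M≤) = extend M PM (next-window Z goodZ 1≤Z M (Good-mono good₀ (proj₁ PM) (ℕP.≤-trans (proj₁ (proj₂ PM)) Z≤X)) (ℕP.≤-trans (ℕP.≤-reflexive (quadruple b M)) (÷-glb {Z} {c} M≤)))
            finish : (Σ ℕ λ M → suc (Z ÷ c) ℕ.≤ M × P M) → Σ ℕ λ M → n₀ ℕ.≤ M × M ℕ.≤ Z × Z ℕ.< M ℕ.* (2 ℕ.* (2 ℕ.* b)) × WindowBound n₀ M
            finish (M , t≤M , n₀≤M , M≤Z , wb) = M , n₀≤M , M≤Z , ℕP.<-≤-trans (÷-< Z c 1≤c) (ℕP.*-monoˡ-≤ c t≤M) , wb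

          -- Confronting Selberg's formula with the windows

          1≤x : 1 ℕ.≤ x
          1≤x = ℕP.≤-trans 1≤h (ℕP.≤-trans (ℕP.m≤m+n h (h ℕ.+ 0)) 2h≤x)

          h≤x : h ℕ.≤ x
          h≤x = ℕP.≤-trans (ℕP.m≤m+n h (h ℕ.+ 0)) 2h≤x

          x≤x' : x ℕ.≤ x'
          x≤x' = ℕP.m≤m+n x h

          x'≤2x : x' ℕ.≤ 2 ℕ.* x
          x'≤2x = ℕP.+-monoʳ-≤ x (ℕP.≤-trans h≤x (ℕP.m≤m+n x 0))

          x'≤2x′ : + x' ≤ + 2 * + x
          x'≤2x′ = subst (+ x' ≤_) (ℤP.pos-* 2 x) (≤-ℤ x'≤2x)

          1≤x' : 1 ℕ.≤ x'
          1≤x' = ℕP.≤-trans 1≤x x≤x'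

          -- Here v is the square root of x' and u that of v + 1, so `L-linear` at u + 1 gives L x'
          -- ≤ 8 u K. Then v L x' is of order x'^(3/4) K, small against K h ≥ K x / (2 D).
          prime-power-bound : ∀ v u → x' ℕ.< suc v ℕ.* suc v → v ℕ.* v ℕ.≤ x' → suc v ℕ.* suc v ℕ.≤ X →
            suc v ℕ.< suc u ℕ.* suc u → u ℕ.* u ℕ.≤ suc v → suc u ℕ.* suc u ℕ.≤ X → + 128 * Θ * + D + 1ℤ ≤ + u →
            (∀ p → x ℕ.< p → p ℕ.≤ x' → ¬ Prime p) → + 4 * Θ * (ψ x' - ψ x) ≤ K * + h
          prime-power-bound v u hi lo vv≤X hi′ lo′ uu≤X u-large void = pos-cancel {+ 4 * + D} (ℤP.≤-trans (+≤+ (s≤s z≤n)) (prime-power-bound-core₀ (+ D) (≤-ℤ 1≤D)))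
              (prime-power-bound-core Θ (+ D) K (+ v) (+ u) (+ h) (+ x) (+ x') (ψ x' - ψ x) (L x') ψ≤ L≤ (subst₂ _≤_ (ℤP.pos-* u u) (+suc v) (≤-ℤ lo′)) (subst (_≤ + x') (ℤP.pos-* v v) (≤-ℤ lo)) x'≤2x′ x≤2Dh u-large Θ≥0 (0≤+ D) K≥0 (0≤+ v) (0≤+ u))
            where
            ψ≤ : ψ x' - ψ x ≤ + v * L x'
            ψ≤ = prime-powers {x} {x'} {v} 1≤x x≤x' x+h≤X hi void
            L≤ : L x' ≤ + 8 * + u * K
            L≤ = L≤-core₁ (L x') (L (suc v)) (L (suc u)) (L (suc v ℕ.* suc v)) (L (suc u ℕ.* suc u)) (+ u) (+ suc u) K (+suc u)
                (L-mono 1≤x' (ℕP.<⇒≤ hi) vv≤X) (L-* (suc v) (suc v) (s≤s z≤n) (s≤s z≤n)) (L-mono (s≤s z≤n) (ℕP.<⇒≤ hi′) uu≤X) (L-* (suc u) (suc u) (s≤s z≤n) (s≤s z≤n))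
                (L-linear (s≤s z≤n) (ℕP.≤-trans (ℕP.m≤m*n (suc u) (suc u)) uu≤X))

          module _ (small-ψ : + 4 * Θ * (ψ x' - ψ x) ≤ K * + h) where
            private
              T : ℤ
              T = S rΔ x'

            T-eq : T ≡ (r ⋆ R) x' - (r ⋆ R) x
            T-eq = trans (S-cong x' (λ n _ _ → by (T-eq-dist (r n) (R (x' ÷ n)) (R (x ÷ n))))) (trans (S-minus {λ n → r n * R (x' ÷ n)} {λ n → r n * R (x ÷ n)} x')
                (cong (λ z → (r ⋆ R) x' - z) (⋆-extend r R refl x≤x')))

            -- The difference of Selberg's formula at x' and at x. In an interval without primes R
            -- x' - R x is close to its minimum - K h, so T has to compensate with nearly K h L x.
            -- The 16408 is 3 · 5000 + 4 · 352.
            T-lower : + 4 * Θ * L x * K * + h - L x * K * + h ≤ + 4 * Θ * (T + + 16408 * (K * K) * + x)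
            T-lower = core (+ 5000) (+ 352) (+ 16408) Θ K (L x) (L x') (R x) (R x') (ψ x' - ψ x) T ((r ⋆ R) x') ((r ⋆ R) x) (+ x) (+ x') (+ h) refl (0≤+ 5000) (0≤+ 352) T-eq
                (proj₁ (selberg x' 1≤x' x+h≤X)) (proj₂ (selberg x 1≤x x≤X)) (trans (R-incr≡ 1≤x x≤x' x'≤2x x+h≤X) (cong (λ z → ψ x' - ψ x - K * z) h≡))
                small-ψ (L-near 1≤x x≤x' x'≤2x x+h≤X) (sub (L-mono 1≤x x≤x' x+h≤X)) (proj₂ (R-bound x' x+h≤X)) x'≤2x′ Θ≥0 K≥0 (L≥0 x) (0≤+ x')
              where
              h≡ : + x' - + x ≡ + h
              h≡ = trans (cong (_- + x) (ℤP.pos-+ x h)) (by (+-minus-cancel (+ x) (+ h)))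
              core : ∀ c₁ c₂ c₃ Θ K l l' R R' d T t' t x x' h → c₃ ≡ + 3 * c₁ + + 4 * c₂ → 0ℤ ≤ c₁ → 0ℤ ≤ c₂ → T ≡ t' - t → - (c₁ * (K * K) * x') ≤ l' * R' + t' → l * R + t ≤ c₁ * (K * K) * x →
                R' - R ≡ d - K * h → + 4 * Θ * d ≤ K * h → l' - l ≤ + 2 * K → 0ℤ ≤ l' - l → R' ≤ c₂ * K * x' → x' ≤ + 2 * x → 0ℤ ≤ Θ → 0ℤ ≤ K → 0ℤ ≤ l → 0ℤ ≤ x' →
                + 4 * Θ * l * K * h - l * K * h ≤ + 4 * Θ * (T + c₃ * (K * K) * x)
              core c₁ c₂ ._ Θ K l l' R R' d ._ t' t x x' h refl 0≤c₁ 0≤c₂ refl p r e u v y w z 0≤Θ 0≤K 0≤l 0≤x' =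
                lin (4 · 0≤Θ ⊠ (sub p ⊞ sub r ⊞ y ⊠ sub w ⊞ (0≤c₂ ⊠ 0≤K ⊠ 0≤x') ⊠ sub v ⊞ (0≤c₁ ⊞ 2 · 0≤c₂) ⊠ (0≤K ⊠ 0≤K) ⊠ sub z) ⊞ 0≤l ⊠ sub u)
                  (trans (core-s₁ c₁ c₂ Θ K l l' R R' d t' t x x' h) (trans (cong (λ z → + 4 * Θ * (t' - t + (+ 3 * c₁ + + 4 * c₂) * (K * K) * x) - (+ 4 * Θ * l * K * h - l * K * h) + + 4 * Θ * l * (R' - R - z)) (sym e))
                    (core-s₂ Θ l (R' - R) (+ 4 * Θ * (t' - t + (+ 3 * c₁ + + 4 * c₂) * (K * K) * x) - (+ 4 * Θ * l * K * h - l * K * h)))))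

            module _ (Y : ℕ) (1≤Y : 1 ℕ.≤ Y) (goodY : ∀ {y} → Y ℕ.≤ y → y ℕ.≤ X → Good y) (YY≤x : Y ℕ.* Y ℕ.≤ x) where
              private
                -- Windows run from Y to x / Y, so that both n and x / n stay where `goodY` applies.
                top : ℕ
                top = x ÷ Y
                Y≤Z : Y ℕ.≤ top
                Y≤Z = ÷-lub 1≤Y YY≤x
                1≤Z : 1 ℕ.≤ top
                1≤Z = ℕP.≤-trans 1≤Y Y≤Z
                Z≤x : top ℕ.≤ x
                Z≤x = ÷-≤ x Y
                chained : Σ ℕ λ M → Y ℕ.≤ M × M ℕ.≤ top × top ℕ.< M ℕ.* (2 ℕ.* (2 ℕ.* b)) × WindowBound Y M
                chained = windows top Y (goodY (÷-lub 1≤Z (ℕP.≤-trans (ℕP.≤-reflexive (ℕP.*-comm Y top)) (÷-* x Y))) (ℕP.≤-trans (÷-≤ x top) x≤X)) 1≤Z (goodY ℕP.≤-refl (ℕP.≤-trans Y≤Z (ℕP.≤-trans Z≤x x≤X))) Y≤Z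

              module _ (M : ℕ) (Y≤M : Y ℕ.≤ M) (M≤Z : M ℕ.≤ top) (Z<4bM : top ℕ.< M ℕ.* (2 ℕ.* (2 ℕ.* b))) (wb : WindowBound Y M) where
                private
                  1≤M : 1 ℕ.≤ M
                  1≤M = ℕP.≤-trans 1≤Y Y≤M
                  M≤x : M ℕ.≤ x
                  M≤x = ℕP.≤-trans M≤Z Z≤x
                  M≤x' : M ℕ.≤ x'
                  M≤x' = ℕP.≤-trans M≤x x≤x'
                  module PS = PartialSums x x 1≤x ℕP.≤-refl x≤X

                  -- Below Y and beyond the windows the linear bound on R suffices: either n or x' /
                  -- n is bounded there, and the total is O(K² x).
                  Δ-crude : ∀ n c → + (x' ÷ n) ≤ c → + (x ÷ n) ≤ c → Δ n ⊴ + 704 * K * c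
                  Δ-crude n c p t = ⊴-≤ (⊴-- (R-bound (x' ÷ n) (ℕP.≤-trans (÷-≤ x' n) x+h≤X)) (R-bound (x ÷ n) (ℕP.≤-trans (÷-≤ x n) x≤X))) (Δ-crude-core (+ 352) K (+ (x' ÷ n)) (+ (x ÷ n)) c (0≤+ 352) p t K≥0)

                  head : S rΔ Y ≤ + 362 * K * + Y * (+ 704 * K * (+ 2 * + x))
                  head = ℤP.≤-trans (proj₂ (S-⊴ Y (λ n _ _ → ⊴-* (PS.r⊴ n) (Δ-crude n (+ 2 * + x) (ℤP.≤-trans (≤-ℤ (÷-≤ x' n)) x'≤2x′) (ℤP.≤-trans (≤-ℤ (÷-≤ x n)) (ℤP.≤-trans (≤-ℤ x≤x') x'≤2x′))))))
                    (ℤP.≤-trans (ℤP.≤-reflexive (S-*ʳ (+ 704 * K * (+ 2 * + x)) Y)) (*-monoʳ-nonneg (S PS.∣r∣ Y) (+ 362 * K * + Y) (+ 704 * K * (+ 2 * + x)) (PS.S-∣r∣ 1≤Y (ℕP.≤-trans Y≤Z (ℕP.≤-trans Z≤x x≤X))) (704 · K≥0 ⊠ (2 · 0≤+ x))))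

                  x'≤cM : + x' ≤ reach b Y * + M
                  x'≤cM = subst (λ c → + x' ≤ c * + M) (reach-eq b Y) (x'≤cM-core (+ x) (+ x') (+ Y) (+ top) (+ b) (+ M) x'≤2x′ (subst (+ x ≤_) (trans (ℤP.pos-* (suc top) Y) (cong (_* + Y) (+suc top))) (≤-ℤ (ℕP.<⇒≤ (÷-< x Y 1≤Y))))
                      (subst₂ _≤_ (+suc top) (trans (ℤP.pos-* M (2 ℕ.* (2 ℕ.* b))) (cong (+ M *_) (trans (ℤP.pos-* 2 (2 ℕ.* b)) (cong (+ 2 *_) (ℤP.pos-* 2 b))))) (≤-ℤ Z<4bM)) (0≤+ Y) (0≤+ b) (0≤+ M))

                  x'÷n≤c : ∀ {z} n → M ℕ.< n → z ℕ.≤ x' → + (z ÷ n) ≤ reach b Y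
                  x'÷n≤c {z} n M<n z≤x' = pos-cancel {+ M} (≤-ℤ 1≤M) (ℤP.≤-trans (subst (+ M * + (z ÷ n) ≤_) refl (ℤP.≤-trans (ℤP.≤-reflexive (sym (ℤP.pos-* M (z ÷ n))))
                      (≤-ℤ (ℕP.≤-trans (ℕP.≤-trans (ℕP.*-monoˡ-≤ (z ÷ n) (ℕP.<⇒≤ M<n)) (ℕP.≤-trans (ℕP.≤-reflexive (ℕP.*-comm n (z ÷ n))) (÷-* z n))) z≤x')))) (ℤP.≤-trans x'≤cM (ℤP.≤-reflexive (ℤP.*-comm (reach b Y) (+ M)))))

                  tail : S rΔ x' - S rΔ M ≤ + 362 * K * (+ 2 * + x) * (+ 704 * K * reach b Y)
                  tail = ℤP.≤-trans (S-mono-between {rΔ} {λ n → PS.∣r∣ n * (+ 704 * K * reach b Y)} M≤x' (λ n M<n _ → proj₂ (⊴-* (PS.r⊴ n) (Δ-crude n (reach b Y) (x'÷n≤c n M<n ℕP.≤-refl) (x'÷n≤c n M<n x≤x')))))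
                      (tail-core (S (λ n → PS.∣r∣ n * (+ 704 * K * reach b Y)) x') (S (λ n → PS.∣r∣ n * (+ 704 * K * reach b Y)) M) (S PS.∣r∣ x') (S PS.∣r∣ M) (+ 704 * K * reach b Y) (+ 362) K (+ x) (+ x')
                        (S-*ʳ (+ 704 * K * reach b Y) x') (S-*ʳ (+ 704 * K * reach b Y) M) (PS.S-∣r∣ 1≤x' x+h≤X) (⊴-nonneg (S-⊴ M (λ n _ _ → PS.r⊴ n))) x'≤2x′ (704 · K≥0 ⊠ reach≥0 b Y) K≥0 (0≤+ 362))

                  H-bound : H M - H Y ≤ L x + + 4 * K
                  H-bound = H-bound-core (H M) (H Y) (L M) (L x) γ (k M) K (proj₂ (H-L-γ M 1≤M M≤X)) (proj₂ (γ-bound (ℕP.≤-trans 1≤x x≤X))) (subst (k M ≤_) (k1 (ℕP.≤-trans 1≤x x≤X)) (k-anti ℕP.≤-refl 1≤M M≤X)) (L-mono 1≤M M≤x x≤X)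
                      (S-nonneg Y (λ i 1≤i i≤Y → k≥0 1≤i (ℕP.≤-trans i≤Y (ℕP.≤-trans Y≤M M≤X))))
                    where
                    M≤X : M ℕ.≤ X
                    M≤X = ℕP.≤-trans M≤x x≤X

                L-bounded : L x ≤ + 8 * Θ * + D * cost b Y * K
                L-bounded = pos-cancel {K * + h} (ℤP.≤-trans (+≤+ (s≤s z≤n)) (L-bounded-core₀ K (+ h) 1≤K (≤-ℤ 1≤h)))
                    (L-bounded-core (+ 362) (+ 704) (+ 16408) Θ K (+ D) (L x) T (S rΔ Y) (S rΔ M) (+ x) (+ h) (H M - H Y) (+ Y) (reach b Y) (cost b Y) (cost-eq b Y) T-lower head tail wb H-bound x≤2Dh (≤-ℤ h≤x) 1≤2Θ K≥0 (0≤+ h) (cost≥0 b Y))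
                  where
                  1≤2Θ : 1ℤ ≤ + 2 * Θ
                  1≤2Θ = 1≤2Θ-core₁ (+ s) (+ b) 48≤s (≤-ℤ 1≤b)

              bounded : L x ≤ + 8 * Θ * + D * cost b Y * K
              bounded = case chained of λ where (M , Y≤M , M≤Z , Z< , wb) → L-bounded M Y≤M M≤Z Z< wb

          conclusion : ∀ v u → x' ℕ.< suc v ℕ.* suc v → v ℕ.* v ℕ.≤ x' → suc v ℕ.* suc v ℕ.≤ X →
            suc v ℕ.< suc u ℕ.* suc u → u ℕ.* u ℕ.≤ suc v → suc u ℕ.* suc u ℕ.≤ X → + 128 * Θ * + D + 1ℤ ≤ + u →
            (∀ p → x ℕ.< p → p ℕ.≤ x' → ¬ Prime p) →
            ∀ Y → 1 ℕ.≤ Y → (∀ {y} → Y ℕ.≤ y → y ℕ.≤ X → Good y) → Y ℕ.* Y ℕ.≤ x → L x ≤ + 8 * Θ * + D * cost b Y * K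
          conclusion v u hi lo vv≤X hi′ lo′ uu≤X u-large void = bounded (prime-power-bound v u hi lo vv≤X hi′ lo′ uu≤X u-large void)

  -- Smooth numbers in an interval, under abc

  module Smooth (a k m : ℕ) (1≤a : 1 ℕ.≤ a) (n≤X : a ℕ.+ k ℕ.≤ X) (m≤X : m ℕ.≤ X)
    (smooth : ∀ p u → Prime p → a ℕ.< u → u ℕ.≤ a ℕ.+ k → p ∣ u → p ℕ.≤ m) where
    open RadicalLog w using (wₚ; L-rad; 1≤rad)

    n : ℕ
    n = a ℕ.+ k

    -- The logarithm of the radical of u, for u in the interval, where no prime factor exceeds m.
    primes-of : ℕ → ℤ
    primes-of u = S (λ p → ind (p ∣? u) * wₚ p) m

    wₚ≥0 : ∀ p → 0ℤ ≤ wₚ p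
    wₚ≥0 p = ind-nonneg (prime? p) ⊠ w≥0 p

    wₚ≤Λ : ∀ p → wₚ p ≤ Λ p
    wₚ≤Λ p with prime? p
    ... | yes P = ℤP.≤-reflexive (trans (ℤP.*-identityˡ (w p)) (sym (Λ-prime P)))
    ... | no _ = ℤP.≤-trans (ℤP.≤-reflexive (ℤP.*-zeroˡ (w p))) (Λ≥0 p)

    -- Legendre's formula for log k!, from which only the terms with p ≤ m are retained.
    floors : ∀ k → S (λ p → Λ p * + (k ÷ p)) m ≤ S L k
    floors k = ℤP.≤-trans (S-mono-len (ℕP.m≤m+n m k) (λ p _ _ → Λ≥0 p ⊠ 0≤+ (k ÷ p))) (ℤP.≤-reflexive (trans (⋆-extend Λ +_ refl (ℕP.m≤n+m k m)) (sym (S-dsum-⋆ Λ k))))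

    -- Each p ≤ m divides at most k/p + 1 of the k numbers; the 1 adds up to at most ψ m and the k/p
    -- to at most log k!.
    sum-G : ∀ k → S (λ j → primes-of (a ℕ.+ j)) k ≤ ψ m + S L k
    sum-G k = begin
        S (λ j → primes-of (a ℕ.+ j)) k
          ≡⟨ S-swap (λ j p → ind (p ∣? a ℕ.+ j) * wₚ p) m k ⟩
        S (λ p → S (λ j → ind (p ∣? a ℕ.+ j) * wₚ p) k) m
          ≤⟨ S-mono m (λ p 1≤p _ → ℤP.≤-trans (ℤP.≤-reflexive (S-*ʳ (wₚ p) k)) (sum-G-core (S (λ j → ind (p ∣? a ℕ.+ j)) k) (wₚ p) (Λ p) (+ (k ÷ p)) (count-multiples a k p 1≤p) (wₚ≤Λ p) (wₚ≥0 p) (0≤+ (k ÷ p)))) ⟩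
        S (λ p → Λ p + Λ p * + (k ÷ p)) m
          ≡⟨ S-+ {Λ} {λ p → Λ p * + (k ÷ p)} m ⟩
        ψ m + S (λ p → Λ p * + (k ÷ p)) m
          ≤⟨ ℤP.+-monoʳ-≤ (ψ m) (floors k) ⟩
        ψ m + S L k ∎
      where
      open ℤP.≤-Reasoning

    rad-log : ∀ u → a ℕ.< u → suc u ℕ.≤ n → L (rad (u ℕ.* suc u)) ≤ primes-of u + primes-of (suc u)
    rad-log u a<u su≤n = begin
        L (rad M)                          ≡⟨ L-rad M ⟩
        S f M                              ≤⟨ S-mono-len (ℕP.m≤m+n M m) (λ p _ _ → ind-nonneg (p ∣? M) ⊠ wₚ≥0 p) ⟩
        S f (M ℕ.+ m)                      ≡⟨ S-cut {f} (ℕP.m≤n+m m M) (λ p m<p _ → vanish p m<p) ⟩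
        S f m                              ≤⟨ S-mono m (λ p _ _ → split p) ⟩
        S (λ p → ind (p ∣? u) * wₚ p + ind (p ∣? suc u) * wₚ p) m ≡⟨ S-+ {λ p → ind (p ∣? u) * wₚ p} {λ p → ind (p ∣? suc u) * wₚ p} m ⟩
        primes-of u + primes-of (suc u) ∎
      where
      open ℤP.≤-Reasoning
      M : ℕ
      M = u ℕ.* suc u
      f : ℕ → ℤ
      f p = ind (p ∣? M) * wₚ p
      vanish : ∀ p → m ℕ.< p → f p ≡ 0ℤ
      vanish p m<p with prime? p | p ∣? M
      ... | no _ | d = trans (cong (ind d *_) (ℤP.*-zeroˡ (w p))) (ℤP.*-zeroʳ (ind d))
      ... | yes P | no _ = ℤP.*-zeroˡ (1ℤ * w p)
      ... | yes P | yes p∣M with euclidsLemma u (suc u) P p∣M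
      ...   | inj₁ p∣u = ⊥-elim (ℕP.<⇒≱ m<p (smooth p u P a<u (ℕP.<⇒≤ su≤n) p∣u))
      ...   | inj₂ p∣su = ⊥-elim (ℕP.<⇒≱ m<p (smooth p (suc u) P (ℕP.m≤n⇒m≤1+n a<u) su≤n p∣su))
      split : ∀ p → f p ≤ ind (p ∣? u) * wₚ p + ind (p ∣? suc u) * wₚ p
      split p with prime? p | p ∣? M
      ... | no _ | d = ℤP.≤-reflexive (by (split-zeros (ind d) (ind (p ∣? u)) (ind (p ∣? suc u)) (w p)))
      ... | yes P | no _ = ℤP.≤-trans (ℤP.≤-reflexive (ℤP.*-zeroˡ (1ℤ * w p))) (ind-nonneg (p ∣? u) ⊠ (1 · w≥0 p) ⊞ ind-nonneg (p ∣? suc u) ⊠ (1 · w≥0 p))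
      ... | yes P | yes p∣M = rad-log-one-of (ind (p ∣? u)) (ind (p ∣? suc u)) 1ℤ (1ℤ * w p) ℤP.≤-refl covered (1 · w≥0 p)
        where
        covered : 1ℤ ≤ ind (p ∣? u) + ind (p ∣? suc u)
        covered with euclidsLemma u (suc u) P p∣M
        ... | inj₁ p∣u = subst (λ z → 1ℤ ≤ z + ind (p ∣? suc u)) (sym (ind-yes (p ∣? u) p∣u)) (ℤP.+-monoʳ-≤ 1ℤ (ind-nonneg (p ∣? suc u)))
        ... | inj₂ p∣su = subst (λ z → 1ℤ ≤ ind (p ∣? u) + z) (sym (ind-yes (p ∣? suc u) p∣su)) (ℤP.+-monoˡ-≤ 1ℤ (ind-nonneg (p ∣? u)))

    -- Erdős' argument: p-parts of the product of (a , n] exceed those of k! by at most one power of p not exceeding n.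
    erdős : S L n - S L a ≤ S L k + S (λ p → ind (prime? p) * S (Λ-at p) n) m
    erdős = begin
        S L n - S L a
          ≡⟨ cong₂ _-_ (S-dsum-⋆ Λ n) (trans (S-dsum-⋆ Λ a) (sym (⋆-extend Λ +_ refl (ℕP.m≤m+n a k)))) ⟩
        (Λ ⋆ +_) n - S (λ d → Λ d * + (a ÷ d)) n
          ≡⟨ sym (S-minus {λ d → Λ d * + (n ÷ d)} {λ d → Λ d * + (a ÷ d)} n) ⟩
        S (λ d → Λ d * + (n ÷ d) - Λ d * + (a ÷ d)) n
          ≤⟨ S-mono n (λ d 1≤d d≤n → term d 1≤d) ⟩
        S (λ d → Λ d * + (k ÷ d) + F d) n
          ≡⟨ S-+ {λ d → Λ d * + (k ÷ d)} {F} n ⟩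
        S (λ d → Λ d * + (k ÷ d)) n + S F n
          ≡⟨ cong₂ _+_ (trans (⋆-extend Λ +_ refl (ℕP.m≤n+m k a)) (sym (S-dsum-⋆ Λ k))) (trans (S-swap (λ d p → ind (prime? p) * Λ-at p d) m n) (S-cong m (λ p _ _ → S-* (ind (prime? p)) n))) ⟩
        S L k + S (λ p → ind (prime? p) * S (Λ-at p) n) m ∎
      where
      open ℤP.≤-Reasoning
      F : ℕ → ℤ
      F d = S (λ p → ind (prime? p) * Λ-at p d) m
      F≥0 : ∀ d → 0ℤ ≤ F d
      F≥0 d = S-nonneg m (λ p _ _ → ind-nonneg (prime? p) ⊠ Λ-at≥0 p d)
      term : ∀ d → 1 ℕ.≤ d → Λ d * + (n ÷ d) - Λ d * + (a ÷ d) ≤ Λ d * + (k ÷ d) + F d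
      term d 1≤d with n ÷ d ℕP.≤? a ÷ d
      ... | yes le = term-none (Λ d) (+ (n ÷ d)) (+ (a ÷ d)) (+ (k ÷ d)) (F d) (≤-ℤ le) (Λ≥0 d) (0≤+ (k ÷ d)) (F≥0 d)
      ... | no n÷d≰ = term-some (Λ d) (+ (n ÷ d)) (+ (a ÷ d)) (+ (k ÷ d)) (F d) (subst (+ (n ÷ d) ≤_) (trans (+suc (a ÷ d ℕ.+ k ÷ d)) (cong (_+ 1ℤ) (ℤP.pos-+ (a ÷ d) (k ÷ d)))) (≤-ℤ (÷-+ a k d 1≤d))) (Λ≥0 d) Λ≤F
        where
        -- Here the last multiple of d up to n exceeds a, so smoothness of the interval applies to
        -- the prime factors of d.
        u : ℕ
        u = n ÷ d ℕ.* d
        a<u : a ℕ.< u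
        a<u = ℕP.<-≤-trans (÷-< a d 1≤d) (ℕP.*-monoˡ-≤ d (ℕP.≰⇒> n÷d≰))
        Λ≤F : Λ d ≤ F d
        Λ≤F with 2 ℕP.≤? d
        ... | yes 2≤d = ℤP.≤-reflexive (Λ-by-lpf {d} {m} 2≤d (smooth (lpf d) u (lpf-prime 2≤d) a<u (÷-* n d) (∣P.∣-trans (lpf∣ 2≤d) (divides (n ÷ d) refl))))
        ... | no 2≰d = subst (λ d → Λ d ≤ F d) (ℕP.≤-antisym 1≤d (ℕP.≤-pred (ℕP.≰⇒> 2≰d))) (F≥0 1)

    -- A prime up to v is charged the full L n; a larger one is charged c times its own logarithm,
    -- and those charges make up c ψ m.
    prime-part : ∀ v c → 0ℤ ≤ c → (∀ p → Prime p → v ℕ.< p → p ℕ.≤ m → L n ≤ c * L p) →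
      S (λ p → ind (prime? p) * S (Λ-at p) n) m ≤ + v * L n + c * ψ m
    prime-part v c 0≤c large = begin
        S (λ p → ind (prime? p) * S (Λ-at p) n) m            ≤⟨ S-mono m (λ p _ p≤m → term p p≤m) ⟩
        S (λ p → ind (p ℕP.≤? v) * L n + c * Λ p) m          ≡⟨ S-+ {λ p → ind (p ℕP.≤? v) * L n} {λ p → c * Λ p} m ⟩
        S (λ p → ind (p ℕP.≤? v) * L n) m + S (λ p → c * Λ p) m ≡⟨ cong₂ _+_ (S-*ʳ (L n) m) (S-* c m) ⟩
        S (λ p → ind (p ℕP.≤? v)) m * L n + c * ψ m          ≤⟨ ℤP.+-monoˡ-≤ (c * ψ m) (*-monoʳ-nonneg (S (λ p → ind (p ℕP.≤? v)) m) (+ v) (L n) count (L≥0 n)) ⟩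
        + v * L n + c * ψ m ∎
      where
      open ℤP.≤-Reasoning
      count : S (λ p → ind (p ℕP.≤? v)) m ≤ + v
      count with v ℕP.≤? m
      ... | yes v≤m = ℤP.≤-reflexive (S-count v≤m)
      ... | no v≰m = ℤP.≤-trans (ℤP.≤-reflexive (S-count-all (ℕP.<⇒≤ (ℕP.≰⇒> v≰m)))) (≤-ℤ (ℕP.<⇒≤ (ℕP.≰⇒> v≰m)))
      1≤n : 1 ℕ.≤ n
      1≤n = ℕP.≤-trans 1≤a (ℕP.m≤m+n a k)
      term : ∀ p → p ℕ.≤ m → ind (prime? p) * S (Λ-at p) n ≤ ind (p ℕP.≤? v) * L n + c * Λ p
      term p p≤m with prime? p | p ℕP.≤? v
      ... | no _ | d = ℤP.≤-trans (ℤP.≤-reflexive (ℤP.*-zeroˡ (S (Λ-at p) n))) (ind-nonneg d ⊠ L≥0 n ⊞ 0≤c ⊠ Λ≥0 p)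
      ... | yes P | yes _ = term-low (S (Λ-at p) n) (L n) (c * Λ p) (S-Λ-at-≤ P n 1≤n n≤X) (0≤c ⊠ Λ≥0 p)
      ... | yes P | no p≰v = term-high (S (Λ-at p) n) (L n) (c * Λ p) (ℤP.≤-trans (S-Λ-at-≤ P n 1≤n n≤X) (subst (λ z → L n ≤ c * z) (trans (L-prime P) (sym (Λ-prime P))) (large p P (ℕP.≰⇒> p≰v) p≤m)))

    module ABC (abc : ExplicitABC) (rad≤X : ∀ u → suc u ℕ.≤ n → rad (u ℕ.* suc u) ℕ.^ 7 ℕ.≤ X) where
      abc-log : ∀ u → a ℕ.< u → suc u ℕ.≤ n → + 4 * L (suc u) ≤ + 7 * (primes-of u + primes-of (suc u))
      abc-log u a<u su≤n = ℤP.≤-trans (subst₂ _≤_ (L-^ (suc u) 4 (s≤s z≤n)) (L-^ (rad (u ℕ.* suc u)) 7 (1≤rad (u ℕ.* suc u)))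
          (L-mono (ℕP.m^n>0 (suc u) 4) (ℕP.<⇒≤ (abc-consecutive abc u (ℕP.≤-trans (s≤s z≤n) a<u))) (rad≤X u su≤n)))
          (*7-mono (L (rad (u ℕ.* suc u))) (primes-of u + primes-of (suc u)) (rad-log u a<u su≤n))

      -- abc is applied to the disjoint pairs (a + 1 , a + 2), (a + 3 , a + 4), ..., so that each
      -- number of the interval is counted once.
      pairs : ∀ h → h ℕ.+ h ℕ.≤ k → + 4 * (+ h * L a) ≤ + 7 * S (λ j → primes-of (a ℕ.+ j)) (h ℕ.+ h)
      pairs zero _ = ℤP.≤-refl
      pairs (suc h) le rewrite ℕP.+-suc h h = subst (λ z → + 4 * (z * L a) ≤ + 7 * (S g (h ℕ.+ h) + g (suc (h ℕ.+ h)) + g (suc (suc (h ℕ.+ h))))) (sym (+suc h))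
          (pairs-core (+ h) (L a) (L (suc u)) (S g (h ℕ.+ h)) (g (suc (h ℕ.+ h))) (g (suc (suc (h ℕ.+ h)))) (pairs h (ℕP.≤-trans (ℕP.m≤n⇒m≤1+n (ℕP.n≤1+n _)) le))
            (subst (λ z → + 4 * L (suc u) ≤ + 7 * (primes-of u + primes-of z)) (sym (ℕP.+-suc a (suc (h ℕ.+ h)))) (abc-log u (ℕP.m<m+n a (s≤s z≤n)) su≤n)) (L-mono 1≤a (ℕP.≤-trans (ℕP.m≤m+n a _) (ℕP.n≤1+n u)) (ℕP.≤-trans su≤n n≤X)))
        where
        g : ℕ → ℤ
        g j = primes-of (a ℕ.+ j)
        u : ℕ
        u = a ℕ.+ suc (h ℕ.+ h)
        su≤n : suc u ℕ.≤ n
        su≤n = ℕP.≤-trans (ℕP.≤-reflexive (sym (ℕP.+-suc a (suc (h ℕ.+ h))))) (ℕP.+-monoʳ-≤ a le)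

      abc-bound : ∀ h → h ℕ.+ h ℕ.≤ k → + 4 * (+ h * L a) ≤ + 7 * (ψ m + S L (h ℕ.+ h))
      abc-bound h le = ℤP.≤-trans (pairs h le) (*7-mono (S (λ j → primes-of (a ℕ.+ j)) (h ℕ.+ h)) (ψ m + S L (h ℕ.+ h)) (sum-G (h ℕ.+ h)))

      -- Each Jᵢ turns a bound L y ≤ B K into a contradiction for y ≥ 4^Jᵢ, because J K ≤ 3 L y
      -- there: J₀ is for m, J₁ for a when k is small, J₃ for a ratio below a / k when k is large;
      -- J₂ ensures 42 K ≤ L a.
      module Endgame (T : ℕ) (1≤T : 1 ℕ.≤ T) (J₀ J₁ J₂ J₃ : ℕ)
        (J₀-large : + 3 * (+ 2 + + 21 * + 357 * + T) + 1ℤ ≤ + J₀) (J₁-large : + 3 * (+ 21 * + 357 * + (4 ℕ.^ J₀)) + 1ℤ ≤ + J₁)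
        (J₂-large : + 126 ≤ + J₂) (J₃-large : + 3 * (+ 84 + + 42 * (+ 357 * (+ 42 * + T))) + 1ℤ ≤ + J₃)
        (4^J₁≤a : 4 ℕ.^ J₁ ℕ.≤ a) (4^J₂≤a : 4 ℕ.^ J₂ ℕ.≤ a) (2≤k : 2 ℕ.≤ k) (k≤a : k ℕ.≤ a) (4n≤X : 4 ℕ.* n ℕ.≤ X)
        (gap≰k : ¬ (a ÷ (2 ℕ.* 4 ℕ.^ J₃) ℕ.≤ k)) (size : S L m ≤ + T * (+ k * L n)) where
        private
          c : ℤ
          c = + 21 * + 357
          M₀ D : ℕ
          M₀ = 4 ℕ.^ J₀
          D = 2 ℕ.* 4 ℕ.^ J₃
          1≤k : 1 ℕ.≤ k
          1≤k = ℕP.<⇒≤ 2≤k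
          k≤n : k ℕ.≤ n
          k≤n = ℕP.m≤n+m k a
          a≤n : a ℕ.≤ n
          a≤n = ℕP.m≤m+n a k
          a≤X : a ℕ.≤ X
          a≤X = ℕP.≤-trans a≤n n≤X
          k≤X : k ℕ.≤ X
          k≤X = ℕP.≤-trans k≤n n≤X
          4≤X : 4 ℕ.≤ X
          4≤X = ℕP.≤-trans (ℕP.*-monoʳ-≤ 4 (ℕP.≤-trans 1≤a a≤n)) 4n≤X

          L-4^ : ∀ j {y} → 4 ℕ.^ j ℕ.≤ y → y ℕ.≤ X → + j * K ≤ + 3 * L y
          L-4^ j {y} le y≤X = ℤP.≤-trans (L-4^-core (+ j) K (0≤+ j) K≥0) (subst (λ z → z * K ≤ + 3 * L y) (ℤP.pos-* 2 j) (L-lower (2 ℕ.* j) 4≤X (ℕP.≤-trans (ℕP.≤-reflexive (sym (ℕP.^-*-assoc 2 2 j))) le) y≤X))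

          too-large : ∀ {l B J} → J * K ≤ + 3 * l → + 3 * B + 1ℤ ≤ J → l ≤ B * K → ⊥
          too-large {l} {B} {J} p q t = ℤP.<⇒≱ (lt (too-large-core l K B J t q 1≤K)) p

          42K≤La : + 42 * K ≤ L a
          42K≤La = pos-cancel {+ 3} (≤-ℤ (s≤s z≤n)) (42K≤La-core (+ 42) K (L a) (+ J₂) J₂-large (L-4^ J₂ 4^J₂≤a a≤X) K≥0)

          Ln≤2La : L n ≤ + 2 * L a
          Ln≤2La = Ln≤2La-core (L n) (L a) K (L-diff-ratio 1 1≤a a≤n n≤X (subst (+ n ≤_) (ℤP.pos-* 2 a) (≤-ℤ (ℕP.+-monoʳ-≤ a (ℕP.≤-trans k≤a (ℕP.m≤m+n a 0)))))) 42K≤La K≥0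

          ψm : ψ m ≤ + 357 * K * + m
          ψm = bound m m≤X
            where
            bound : ∀ m → m ℕ.≤ X → ψ m ≤ + 357 * K * + m
            bound zero _ = ℤP.≤-reflexive (sym (ℤP.*-zeroʳ (+ 357 * K)))
            bound (suc m) le = ψ-bound (suc m) (s≤s z≤n) le

          mLm : ∀ m → m ℕ.≤ X → + m * L m ≤ S L m + + 2 * K * + m
          mLm zero _ = ℤP.≤-reflexive (sym (trans (ℤP.+-identityˡ (+ 2 * K * 0ℤ)) (ℤP.*-zeroʳ (+ 2 * K))))
          mLm m@(suc _) le = mLm-core (+ m) (L m) (S L m) K (H m) (proj₁ (stirling m (s≤s z≤n) le)) (subst (H m ≤_) (S-const K m) (S-mono m (λ i 1≤i i≤m → subst (Logarithm.k lg i ≤_) (k1 (ℕP.≤-trans (s≤s z≤n) le)) (k-anti ℕP.≤-refl 1≤i (ℕP.≤-trans i≤m le)))))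

          S-L≤ : ∀ {i} → i ℕ.≤ k → S L i ≤ + i * L k
          S-L≤ {i} i≤k = subst (S L i ≤_) (S-const (L k) i) (S-mono i (λ j 1≤j j≤i → L-mono 1≤j (ℕP.≤-trans j≤i i≤k) k≤X))

          mL≤ : + m * L m ≤ + T * (+ k * L n) + + 2 * K * + m
          mL≤ = ℤP.≤-trans (mLm m m≤X) (ℤP.+-monoˡ-≤ (+ 2 * K * + m) size)

          -- With k ≤ 3 h, abc gives (4/3) k L a ≤ 7 ψ m + 7 k L k, and the hypothesis absorbs the
          -- last term into half of the left side. So k L a = O(K m); since m L m = O(k L n + K m),
          -- m is bounded, and then a.
          short : + 21 * L k ≤ + 2 * L a → ⊥
          short h21 = cases (M₀ ℕP.≤? m)
            where
            h : ℕ
            h = k ÷ 2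
            h*2≤k : h ℕ.+ h ℕ.≤ k
            h*2≤k = ℕP.≤-trans (ℕP.≤-reflexive (trans (cong (h ℕ.+_) (sym (ℕP.+-identityʳ h))) (ℕP.*-comm 2 h))) (÷-* k 2)
            k≤3h : + k ≤ + 3 * + h
            k≤3h = k≤3h-core (+ k) (+ h) (subst₂ _≤_ (+suc k) (trans (ℤP.pos-* (suc h) 2) (cong (_* + 2) (+suc h))) (≤-ℤ (÷-< k 2 (s≤s z≤n)))) (≤-ℤ (÷-pos {k} {2} (s≤s z≤n) 2≤k))
            kLa : + 2 * (+ k * L a) ≤ c * (K * + m)
            kLa = kLa-core (+ 357) (+ k) (+ h) (+ (h ℕ.+ h)) (L a) (L k) (ψ m) (S L (h ℕ.+ h)) K (+ m) (abc-bound h h*2≤k) ψm (S-L≤ h*2≤k) (≤-ℤ h*2≤k) k≤3h h21 (L≥0 a) (L≥0 k) (0≤+ k)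
            cases : Dec (M₀ ℕ.≤ m) → ⊥
            cases (yes M₀≤m) = too-large {L m} {+ 2 + c * + T} {+ J₀} (L-4^ J₀ M₀≤m m≤X) J₀-large (pos-cancel {+ m} (≤-ℤ (ℕP.≤-trans (ℕP.m^n>0 4 J₀) M₀≤m))
                (cases-core c (+ m) (L m) (L n) (L a) (+ T) (+ k) K mL≤ kLa Ln≤2La (0≤+ T) (0≤+ k)))
            cases (no M₀≰m) = too-large {L a} {c * + M₀} {+ J₁} (L-4^ J₁ 4^J₁≤a a≤X) J₁-large (cases-core2 c (+ k) (L a) K (+ m) (+ M₀) kLa (≤-ℤ (ℕP.<⇒≤ (ℕP.≰⇒> M₀≰m))) (≤-ℤ 1≤k) (L≥0 a) K≥0 (0≤+ 21 ⊠ 0≤+ 357))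

          -- Now L n = O(L k), whence m = O(k) from `size`. Erdős' inequality becomes k L a ≤ k L k
          -- + O(K k), so a/k is bounded, against `gap≰k`.
          long : + 2 * L a ≤ + 21 * L k → ⊥
          long h21 = cases (D ℕ.* k ℕP.≤? a)
            where
            4K≤Lk : + 4 * K ≤ L k
            4K≤Lk = pos-cancel {+ 21} (≤-ℤ (s≤s z≤n)) (4K≤Lk-core K (L a) (L k) 42K≤La h21)
            Ln≤ : L n ≤ + 21 * L k
            Ln≤ = ℤP.≤-trans Ln≤2La h21
            m≤ : + m ≤ + 42 * + T * + k
            m≤ = compare (m ℕP.≤? k)
              where
              compare : Dec (m ℕ.≤ k) → + m ≤ + 42 * + T * + k
              compare (yes m≤k) = m≤-trivial (+ m) (+ T) (+ k) (≤-ℤ m≤k) (≤-ℤ 1≤T) (0≤+ k)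
              compare (no m≰k) = pos-cancel {L k} (ℤP.≤-trans (m≤-1≤4K K 1≤K) 4K≤Lk) (m≤-core (+ m) (+ T) (+ k) (L m) (L k) (L n) K mL≤ (L-mono 1≤k (ℕP.<⇒≤ (ℕP.≰⇒> m≰k)) m≤X) Ln≤ 4K≤Lk (0≤+ m) (0≤+ T) (0≤+ k))
            -- The square root balances `prime-part`: v L n is still O(K k), since L (v + 1) ≤ 2 v
            -- K, and every prime above v has logarithm at least L n / 42.
            v : ℕ
            v = proj₁ (isqrt k)
            vv≤k : v ℕ.* v ℕ.≤ k
            vv≤k = proj₁ (proj₂ (isqrt k))
            k<vv : k ℕ.< suc v ℕ.* suc v
            k<vv = proj₂ (proj₂ (isqrt k))
            1≤v : 1 ℕ.≤ v
            1≤v = ℕP.≰⇒> λ v≤0 → ℕP.<⇒≱ (ℕP.<-≤-trans k<vv (ℕP.*-mono-≤ (s≤s v≤0) (s≤s v≤0))) 1≤k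
            vv≤X : suc v ℕ.* suc v ℕ.≤ X
            vv≤X = ℕP.≤-trans (square-double v 1≤v) (ℕP.≤-trans (ℕP.*-monoʳ-≤ 4 (ℕP.≤-trans vv≤k k≤n)) 4n≤X)
            v≤X : suc v ℕ.≤ X
            v≤X = ℕP.≤-trans (ℕP.m≤m*n (suc v) (suc v)) vv≤X
            Lk≤ : L k ≤ L (suc v) + L (suc v)
            Lk≤ = subst (L k ≤_) (L-* (suc v) (suc v) (s≤s z≤n) (s≤s z≤n)) (L-mono 1≤k (ℕP.<⇒≤ k<vv) vv≤X)
            large : ∀ p → Prime p → v ℕ.< p → p ℕ.≤ m → L n ≤ + 42 * L p
            large p P v<p p≤m = large-core (L n) (L k) (L (suc v)) (L p) Ln≤ Lk≤ (L-mono (s≤s z≤n) v<p (ℕP.≤-trans p≤m m≤X))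
            kLa≤ : + k * L a ≤ S L n - S L a
            kLa≤ = subst (_≤ S L n - S L a) (trans (cong₂ _-_ (S-const (L a) n) (S-const (L a) a)) (kLa≤-shape (+ n) (+ a) (+ k) (L a) (ℤP.pos-+ a k)))
                (S-mono-between {λ _ → L a} {L} a≤n (λ i a<i i≤n → L-mono 1≤a (ℕP.<⇒≤ a<i) (ℕP.≤-trans i≤n n≤X)))
            gap : L a ≤ L k + (+ 84 + + 42 * (+ 357 * (+ 42 * + T))) * K
            gap = pos-cancel {+ k} (≤-ℤ 1≤k) (gap-core (+ 357) (+ 42) (+ k) (+ v) (+ suc v) (+ m) (+ T) (L a) (L k) (L n) (L (suc v)) (ψ m) (S L n - S L a) (S L k) (S (λ p → ind (prime? p) * S (Λ-at p) n) m) K (+suc v)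
                kLa≤ erdős (prime-part v (+ 42) (0≤+ 42) large) (S-L≤ ℕP.≤-refl) Ln≤ Lk≤ (L-linear (s≤s z≤n) v≤X) ψm m≤ (subst (_≤ + k) (ℤP.pos-* v v) (≤-ℤ vv≤k)) (0≤+ 357) (0≤+ 42) (0≤+ v) K≥0)
            cases : Dec (D ℕ.* k ℕ.≤ a) → ⊥
            cases (yes Dk≤a) = too-large {L (4 ℕ.^ J₃)} {+ 84 + + 42 * (+ 357 * (+ 42 * + T))} {+ J₃} (L-4^ J₃ ℕP.≤-refl (ℕP.≤-trans (ℕP.≤-trans (ℕP.m≤m*n (4 ℕ.^ J₃) k {{ℕ.>-nonZero 1≤k}}) 4k≤a) a≤X)) J₃-large
                (cases-core3 (L (4 ℕ.^ J₃)) (L k) (L a) ((+ 84 + + 42 * (+ 357 * (+ 42 * + T))) * K) (subst (_≤ L a) (L-* (4 ℕ.^ J₃) k (ℕP.m^n>0 4 J₃) 1≤k) (L-mono (ℕP.*-mono-≤ (ℕP.m^n>0 4 J₃) 1≤k) 4k≤a a≤X)) gap)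
              where
              4k≤a : 4 ℕ.^ J₃ ℕ.* k ℕ.≤ a
              4k≤a = ℕP.≤-trans (ℕP.*-monoˡ-≤ k (ℕP.m≤m+n (4 ℕ.^ J₃) _)) Dk≤a
            cases (no Dk≰a) = gap≰k (ℕP.<⇒≤ (ℕP.≰⇒> λ k≤ → Dk≰a (ℕP.≤-trans (ℕP.≤-reflexive (ℕP.*-comm D k)) (÷-glb {a} {D} k≤))))

        impossible : ⊥
        impossible = split (+ 21 * L k ℤP.≤? + 2 * L a)
          where
          split : Dec (+ 21 * L k ≤ + 2 * L a) → ⊥
          split (yes h) = short h
          split (no h) = long (ℤP.<⇒≤ (ℤP.≰⇒> h))

-- A prime in (x , x + x/D]

goodY-core : ∀ c Q K l J → c * Q * + 3 ≤ J → J * K ≤ + 3 * l → 0ℤ ≤ K → + 3 * (c * Q * K) ≤ + 3 * l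
goodY-core c Q K l J p t u = lin (sub p ⊠ u ⊞ sub t) (solve (c ∷ Q ∷ K ∷ l ∷ J ∷ []))

module PrimeGap (D : ℕ) (2≤D : 2 ℕ.≤ D) where
  1≤D : 1 ℕ.≤ D
  1≤D = ℕP.<⇒≤ 2≤D

  -- Each parameter depends only on D and its predecessors, never on x or the cutoff. The summand s
  -- in q gives 2 s ≤ Q, and the summand Q in J gives Q ≤ Y.
  s β q Q J Y : ℕ
  s = ceil (+ 48 * + D)
  β = ceil (+ 32080 * + D + 1ℤ)
  q = 2 ℕ.+ s ℕ.+ ceil (+ 344 * (+ 128 * + s * + (2 ℕ.^ β)) * + D)
  Q = q ℕ.* q
  J = ceil (+ 15004 * + Q * + 3) ℕ.+ Q
  Y = 4 ℕ.^ J

  θ budget : ℤ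
  θ = + 128 * + s * + (2 ℕ.^ β)
  budget = + 8 * θ * + D * cost (2 ℕ.^ β) Y

  J₁ a X₀ : ℕ
  J₁ = ceil (+ 3 * budget + 1ℤ)
  a = ceil (+ 128 * θ * + D + 1ℤ)
  -- The fourth power of `a` forces a ≤ u for the twice iterated square root u of x'.
  X₀ = Y ℕ.* Y ℕ.+ 4 ℕ.^ J₁ ℕ.+ a ℕ.* a ℕ.* (a ℕ.* a) ℕ.+ D

  2≤q : 2 ℕ.≤ q
  2≤q = s≤s (s≤s z≤n)

  s≤q : s ℕ.≤ q
  s≤q = ℕP.≤-trans (ℕP.m≤n+m s 2) (ℕP.m≤m+n (2 ℕ.+ s) _)

  2s≤Q : 2 ℕ.* s ℕ.≤ Q
  2s≤Q = ℕP.*-mono-≤ 2≤q s≤q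

  2≤Q : 2 ℕ.≤ Q
  2≤Q = ℕP.*-mono-≤ 2≤q (ℕP.<⇒≤ 2≤q)

  q-large : + 344 * (+ 128 * + s * + (2 ℕ.^ β)) * + D ≤ + q
  q-large = ℤP.≤-trans (≤ceil (+ 344 * (+ 128 * + s * + (2 ℕ.^ β)) * + D)) (≤-ℤ (ℕP.m≤n+m _ (2 ℕ.+ s)))

  Q≤Y : Q ℕ.≤ Y
  Q≤Y = ℕP.≤-trans (ℕP.m≤n+m Q _) (ℕP.<⇒≤ (n<4^n J))

  1≤Y : 1 ℕ.≤ Y
  1≤Y = ℕP.m^n>0 4 J

  module _ (x : ℕ) (X₀≤x : X₀ ℕ.≤ x) where
    private
      YY≤x : Y ℕ.* Y ℕ.≤ x
      YY≤x = ℕP.≤-trans (ℕP.≤-trans (ℕP.≤-trans (ℕP.m≤m+n _ _) (ℕP.m≤m+n _ _)) (ℕP.m≤m+n _ D)) X₀≤x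
      4^J₁≤x : 4 ℕ.^ J₁ ℕ.≤ x
      4^J₁≤x = ℕP.≤-trans (ℕP.≤-trans (ℕP.≤-trans (ℕP.m≤n+m _ (Y ℕ.* Y)) (ℕP.m≤m+n _ _)) (ℕP.m≤m+n _ D)) X₀≤x
      a⁴≤x : a ℕ.* a ℕ.* (a ℕ.* a) ℕ.≤ x
      a⁴≤x = ℕP.≤-trans (ℕP.≤-trans (ℕP.m≤n+m _ (Y ℕ.* Y ℕ.+ 4 ℕ.^ J₁)) (ℕP.m≤m+n _ D)) X₀≤x
      D≤x : D ℕ.≤ x
      D≤x = ℕP.≤-trans (ℕP.m≤n+m D _) X₀≤x
      1≤x : 1 ℕ.≤ x
      1≤x = ℕP.≤-trans 1≤D D≤x
      h x' X : ℕ
      h = x ÷ D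
      x' = x ℕ.+ h
      -- Rounding up squares leads to (v + 1)² ≤ 8 x and (u + 1)² ≤ 32 x, which must stay in the
      -- range of the logarithm.
      X = 32 ℕ.* x
      1≤h : 1 ℕ.≤ h
      1≤h = ÷-pos 1≤D D≤x
      2h≤x : 2 ℕ.* h ℕ.≤ x
      2h≤x = ℕP.≤-trans (ℕP.*-monoˡ-≤ h 2≤D) (ℕP.≤-trans (ℕP.≤-reflexive (ℕP.*-comm D h)) (÷-* x D))
      x≤2Dh : + x ≤ + 2 * + D * + h
      x≤2Dh = below-multiple (+ x) (+ D) (+ h) (subst (+ x ≤_) (trans (ℤP.pos-* (suc h) D) (cong (_* + D) (+suc h))) (≤-ℤ (ℕP.<⇒≤ (÷-< x D 1≤D)))) (≤-ℤ 1≤h) (0≤+ D)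
      x'≤2x : x' ℕ.≤ 2 ℕ.* x
      x'≤2x = ℕP.+-monoʳ-≤ x (ℕP.≤-trans (÷-≤ x D) (ℕP.m≤m+n x 0))
      2x≤X : 2 ℕ.* x ℕ.≤ X
      2x≤X = ℕP.*-monoˡ-≤ x {2} {32} (s≤s (s≤s z≤n))
      x+h≤X : x' ℕ.≤ X
      x+h≤X = ℕP.≤-trans x'≤2x 2x≤X
      4≤X : 4 ℕ.≤ X
      4≤X = ℕP.≤-trans (ℕP.*-monoʳ-≤ 4 1≤x) (ℕP.*-monoˡ-≤ x {4} {32} (s≤s (s≤s (s≤s (s≤s z≤n)))))
      lg : Logarithm X
      lg = log X (ℕP.≤-trans (s≤s z≤n) 4≤X)
      K : ℤ
      K = Logarithm.K lg
      L : ℕ → ℤ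
      L = Analysis.L lg
      K≥0 : 0ℤ ≤ K
      K≥0 = Analysis.K≥0 lg

      L-4^ : ∀ j {y} → 4 ℕ.^ j ℕ.≤ y → y ℕ.≤ X → + j * K ≤ + 3 * L y
      L-4^ j {y} le y≤X = ℤP.≤-trans (L-4^-core (+ j) K (0≤+ j) K≥0) (subst (λ z → z * K ≤ + 3 * L y) (ℤP.pos-* 2 j) (Analysis.L-lower lg (2 ℕ.* j) 4≤X (ℕP.≤-trans (ℕP.≤-reflexive (sym (ℕP.^-*-assoc 2 2 j))) le) y≤X))

      goodY : ∀ {y} → Y ℕ.≤ y → y ℕ.≤ X → Analysis.Variation.Good lg Q 2≤Q y
      goodY {y} Y≤y y≤X = pos-cancel {+ 3} (≤-ℤ (s≤s z≤n)) (goodY-core (+ 15004) (+ Q) K (L y) (+ J) (ℤP.≤-trans (≤ceil (+ 15004 * + Q * + 3)) (≤-ℤ (ℕP.m≤m+n _ Q))) (L-4^ J Y≤y y≤X) K≥0) , ℕP.≤-trans Q≤Y Y≤y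

      refute : (∀ p → x ℕ.< p → p ℕ.≤ x' → ¬ Prime p) → ∀ v → v ℕ.* v ℕ.≤ x' → x' ℕ.< suc v ℕ.* suc v →
        ∀ u → u ℕ.* u ℕ.≤ suc v → suc v ℕ.< suc u ℕ.* suc u → ⊥
      refute void v lo hi u lo′ hi′ = ℤP.<⇒≱ (lt {+ 3 * L x} {+ J₁ * K} (too-large-core (L x) K budget (+ J₁) bounded (≤ceil (+ 3 * budget + 1ℤ)) (Logarithm.1≤K lg))) (L-4^ J₁ 4^J₁≤x (ℕP.≤-trans (ℕP.m≤m+n x (x ℕ.+ 0)) 2x≤X))
        where
        square-reflects : ∀ {m n} → m ℕ.* m ℕ.< n ℕ.* n → m ℕ.< n
        square-reflects p = ℕP.≰⇒> λ n≤m → ℕP.<⇒≱ p (ℕP.*-mono-≤ n≤m n≤m)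
        x≤x' : x ℕ.≤ x'
        x≤x' = ℕP.m≤m+n x h
        aa≤v : a ℕ.* a ℕ.< suc v
        aa≤v = square-reflects (ℕP.≤-<-trans (ℕP.≤-trans a⁴≤x x≤x') hi)
        a≤u : a ℕ.≤ u
        a≤u = ℕP.≤-pred (square-reflects (ℕP.<-trans aa≤v hi′))
        1≤v : 1 ℕ.≤ v
        1≤v = ℕP.≤-pred (square-reflects {1} {suc v} (ℕP.≤-<-trans (ℕP.≤-trans 1≤x x≤x') hi))
        1≤u : 1 ℕ.≤ u
        1≤u = ℕP.≤-pred (square-reflects {1} {suc u} (ℕP.≤-<-trans (s≤s z≤n) hi′))
        vv≤8x : suc v ℕ.* suc v ℕ.≤ 8 ℕ.* x
        vv≤8x = ℕP.≤-trans (square-double v 1≤v) (ℕP.≤-trans (ℕP.*-monoʳ-≤ 4 (ℕP.≤-trans lo x'≤2x)) (ℕP.≤-reflexive (sym (ℕP.*-assoc 4 2 x))))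
        vv≤X : suc v ℕ.* suc v ℕ.≤ X
        vv≤X = ℕP.≤-trans vv≤8x (ℕP.*-monoˡ-≤ x {8} {32} (s≤s (s≤s (s≤s (s≤s (s≤s (s≤s (s≤s (s≤s z≤n)))))))))
        uu≤X : suc u ℕ.* suc u ℕ.≤ X
        uu≤X = ℕP.≤-trans (square-double u 1≤u) (ℕP.≤-trans (ℕP.*-monoʳ-≤ 4 (ℕP.≤-trans lo′ (ℕP.≤-trans (ℕP.m≤m*n (suc v) (suc v)) vv≤8x))) (ℕP.≤-reflexive (sym (ℕP.*-assoc 4 8 x))))
        bounded : L x ≤ budget * K
        bounded = Analysis.Variation.Blocks.Windows.Chain.conclusion lg Q 2≤Q x h 2h≤x x+h≤X D s β q 1≤D 1≤h x≤2Dh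
          (≤ceil (+ 48 * + D)) 2s≤Q (≤ceil (+ 32080 * + D + 1ℤ)) 2≤q ℕP.≤-refl q-large
          v u hi lo vv≤X hi′ lo′ uu≤X (ℤP.≤-trans (≤ceil (+ 128 * θ * + D + 1ℤ)) (≤-ℤ a≤u)) void Y 1≤Y goodY YY≤x

      absurd : (∀ p → x ℕ.< p → p ℕ.≤ x' → ¬ Prime p) → ⊥
      absurd void = refute void v (proj₁ (proj₂ (isqrt x'))) (proj₂ (proj₂ (isqrt x'))) (proj₁ (isqrt (suc v))) (proj₁ (proj₂ (isqrt (suc v)))) (proj₂ (proj₂ (isqrt (suc v))))
        where
        v : ℕ
        v = proj₁ (isqrt x')

    prime-in-interval : Σ ℕ λ p → x ℕ.< p × p ℕ.≤ x ℕ.+ x ÷ D × Prime p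
    prime-in-interval = [ id , (λ none → ⊥-elim (absurd none)) ]′ (search prime? x (x ÷ D))

-- Products of factorials

ΣF : ∀ {n} → (Fin n → ℤ) → ℤ
ΣF {zero} f = 0ℤ
ΣF {suc n} f = f Fin.zero + ΣF (f ∘ Fin.suc)

ΣF-cong : ∀ {n} {f g : Fin n → ℤ} → (∀ i → f i ≡ g i) → ΣF f ≡ ΣF g
ΣF-cong {zero} h = refl
ΣF-cong {suc n} h = cong₂ _+_ (h Fin.zero) (ΣF-cong (h ∘ Fin.suc))

ΣF-zero : ∀ {n} {f : Fin n → ℤ} → (∀ i → f i ≡ 0ℤ) → ΣF f ≡ 0ℤ
ΣF-zero {zero} h = refl
ΣF-zero {suc n} h = cong₂ _+_ (h Fin.zero) (ΣF-zero (h ∘ Fin.suc))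

ΣF-nonneg : ∀ {n} {f : Fin n → ℤ} → (∀ i → 0ℤ ≤ f i) → 0ℤ ≤ ΣF f
ΣF-nonneg {zero} h = ℤP.≤-refl
ΣF-nonneg {suc n} h = h Fin.zero ⊞ ΣF-nonneg (h ∘ Fin.suc)

ΣF-term-left : ∀ a b → 0ℤ ≤ b → a ≤ a + b
ΣF-term-left a b p = lin p (solve (a ∷ b ∷ []))

ΣF-term-right : ∀ a b c → 0ℤ ≤ a → c ≤ b → c ≤ a + b
ΣF-term-right a b c p q = lin (p ⊞ sub q) (solve (a ∷ b ∷ c ∷ []))

ΣF-term : ∀ {n} {f : Fin n → ℤ} → (∀ i → 0ℤ ≤ f i) → ∀ i → f i ≤ ΣF f
ΣF-term {suc n} {f} h Fin.zero = ΣF-term-left (f Fin.zero) (ΣF (f ∘ Fin.suc)) (ΣF-nonneg (h ∘ Fin.suc))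
ΣF-term {suc n} {f} h (Fin.suc i) = ΣF-term-right (f Fin.zero) (ΣF (f ∘ Fin.suc)) (f (Fin.suc i)) (h Fin.zero) (ΣF-term (h ∘ Fin.suc) i)

ΣF-+ : ∀ {n} (f g : Fin n → ℤ) → ΣF (λ i → f i + g i) ≡ ΣF f + ΣF g
ΣF-+ {zero} f g = refl
ΣF-+ {suc n} f g = trans (cong (_+_ (f Fin.zero + g Fin.zero)) (ΣF-+ (f ∘ Fin.suc) (g ∘ Fin.suc)))
    (by (+-interchange (f Fin.zero) (g Fin.zero) (ΣF (f ∘ Fin.suc)) (ΣF (g ∘ Fin.suc))))

ΣF-*ʳ : ∀ {n} (f : Fin n → ℤ) c → ΣF (λ i → f i * c) ≡ ΣF f * c
ΣF-*ʳ {zero} f c = refl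
ΣF-*ʳ {suc n} f c = trans (cong (_+_ (f Fin.zero * c)) (ΣF-*ʳ (f ∘ Fin.suc) c)) (sym (ℤP.*-distribʳ-+ c (f Fin.zero) (ΣF (f ∘ Fin.suc))))

ΣF-swap : ∀ {m n} (f : Fin m → Fin n → ℤ) → ΣF (λ i → ΣF (f i)) ≡ ΣF (λ j → ΣF (λ i → f i j))
ΣF-swap {zero} {n} f = sym (ΣF-zero {n} {λ j → ΣF (λ i → f i j)} (λ _ → refl))
ΣF-swap {suc m} f = trans (cong (_+_ (ΣF (f Fin.zero))) (ΣF-swap (f ∘ Fin.suc))) (sym (ΣF-+ (f Fin.zero) (λ j → ΣF (λ i → f (Fin.suc i) j))))

ΣF-≤-step : ∀ a b c n → a ≤ c → b ≤ n * c → a + b ≤ (n + 1ℤ) * c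
ΣF-≤-step a b c n p q = lin (sub p ⊞ sub q) (solve (a ∷ b ∷ c ∷ n ∷ []))

ΣF-≤ : ∀ {n} {f : Fin n → ℤ} c → (∀ i → f i ≤ c) → ΣF f ≤ + n * c
ΣF-≤ {zero} c h = ℤP.≤-refl
ΣF-≤ {suc n} {f} c h = subst (λ z → f Fin.zero + ΣF (f ∘ Fin.suc) ≤ z * c) (sym (+suc n)) (ΣF-≤-step (f Fin.zero) (ΣF (f ∘ Fin.suc)) c (+ n) (h Fin.zero) (ΣF-≤ c (h ∘ Fin.suc)))

ΣF-pick : ∀ {n} (f : Fin n → ℤ) j₀ → ΣF (λ j → ind (j₀ FinP.≟ j) * f j) ≡ f j₀
ΣF-pick {suc n} f Fin.zero = trans (cong₂ _+_ (ℤP.*-identityˡ (f Fin.zero)) (ΣF-zero (λ j → ℤP.*-zeroˡ (f (Fin.suc j))))) (ℤP.+-identityʳ _)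
ΣF-pick {suc n} f (Fin.suc j₀) = trans (cong₂ _+_ (ℤP.*-zeroˡ (f Fin.zero)) (trans (ΣF-cong (λ j → cong (_* f (Fin.suc j))
    (ind-⇔ (Fin.suc j₀ FinP.≟ Fin.suc j) (j₀ FinP.≟ j) FinP.suc-injective (cong Fin.suc)))) (ΣF-pick (f ∘ Fin.suc) j₀))) (ℤP.+-identityˡ _)

split-parts : ∀ a b → b ≡ a * b + (1ℤ - a) * b
split-parts a b = solve (a ∷ b ∷ [])

module Unmatched {s t} (σ : Fin s → Fin t) (σ-injective : Injective _≡_ _≡_ σ) where
  matched? : ∀ i → Dec (∃ λ j → σ j ≡ i)
  matched? i = FinP.any? (λ j → σ j FinP.≟ i)

  U : Fin t → ℤ
  U i = not-ind (matched? i)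

  U≥0 : ∀ i → 0ℤ ≤ U i
  U≥0 i with matched? i
  ... | yes _ = 0≤+ 0
  ... | no _ = 0≤+ 1

  count : ∀ i → ind (matched? i) ≡ ΣF (λ j → ind (σ j FinP.≟ i))
  count i with matched? i
  ... | yes (j₀ , e) = sym (trans (ΣF-cong (λ j → trans (ind-⇔ (σ j FinP.≟ i) (j₀ FinP.≟ j) (λ e′ → σ-injective (trans e (sym e′))) (λ { refl → e }))
          (sym (ℤP.*-identityʳ (ind (j₀ FinP.≟ j)))))) (ΣF-pick 𝟙′ j₀))
    where
    𝟙′ : Fin s → ℤ
    𝟙′ _ = 1ℤ
  ... | no none = sym (ΣF-zero (λ j → ind-no (σ j FinP.≟ i) (λ e → none (j , e))))

  split : ∀ (f : Fin t → ℤ) → ΣF f ≡ ΣF (f ∘ σ) + ΣF (λ i → U i * f i)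
  split f = begin
      ΣF f
        ≡⟨ ΣF-cong (λ i → by (split-parts (ind (matched? i)) (f i))) ⟩
      ΣF (λ i → ind (matched? i) * f i + U i * f i)
        ≡⟨ ΣF-+ (λ i → ind (matched? i) * f i) (λ i → U i * f i) ⟩
      ΣF (λ i → ind (matched? i) * f i) + ΣF (λ i → U i * f i)
        ≡⟨ cong (_+ ΣF (λ i → U i * f i)) (trans (ΣF-cong (λ i → trans (cong (_* f i) (count i)) (sym (ΣF-*ʳ (λ j → ind (σ j FinP.≟ i)) (f i)))))
             (trans (ΣF-swap (λ i j → ind (σ j FinP.≟ i) * f i)) (ΣF-cong (λ j → ΣF-pick f (σ j))))) ⟩
      ΣF (f ∘ σ) + ΣF (λ i → U i * f i) ∎
    where
    open ≡-Reasoning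

module FactorialSums (w : ℕ → ℤ) where
  open AdditiveProperties w

  L-! : ∀ n → L (n !) ≡ S L n
  L-! zero = refl
  L-! (suc n) = trans (L-* (suc n) (n !) (s≤s z≤n) (ℕP.1≤n! n)) (trans (ℤP.+-comm (L (suc n)) (L (n !))) (cong (_+ L (suc n)) (L-! n)))

  1≤vprod : ∀ {n} (v : Vec ℕ n) → 1 ℕ.≤ vprod (Vec.map _! v)
  1≤vprod Vec.[] = s≤s z≤n
  1≤vprod (m Vec.∷ v) = ℕP.*-mono-≤ (ℕP.1≤n! m) (1≤vprod v)

  L-vprod : ∀ {n} (v : Vec ℕ n) → L (vprod (Vec.map _! v)) ≡ ΣF (λ i → S L (lookup v i))
  L-vprod Vec.[] = refl
  L-vprod (m Vec.∷ v) = trans (L-* (m !) (vprod (Vec.map _! v)) (ℕP.1≤n! m) (1≤vprod v)) (cong₂ _+_ (L-! m) (L-vprod v))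

  -- An additive function applied to the equation, with the matched factorials cancelled. It is used
  -- both for the logarithm and for the p-adic valuations.
  unmatched-sum : ∀ {s t} (σ : Fin s → Fin t) (inj : Injective _≡_ _≡_ σ) (a : Vec ℕ t) (n : Vec ℕ s) →
    vprod (Vec.map _! a) ≡ vprod (Vec.map _! n) →
    ΣF (λ i → Unmatched.U σ inj i * S L (lookup a i)) ≡ ΣF (λ j → S L (lookup n j) - S L (lookup a (σ j)))
  unmatched-sum σ inj a n eq = sym (trans (ΣF-+ (λ j → S L (lookup n j)) (λ j → - S L (lookup a (σ j)))) (trans (cong (_+ ΣF (λ j → - S L (lookup a (σ j))))
      (trans (sym (L-vprod n)) (trans (cong L (sym eq)) (trans (L-vprod a) (Unmatched.split σ inj (λ i → S L (lookup a i)))))))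
      (cancel (λ j → S L (lookup a (σ j))) (ΣF (λ i → Unmatched.U σ inj i * S L (lookup a i))))))
    where
    cancel : ∀ {n} (f : Fin n → ℤ) c → ΣF f + c + ΣF (λ j → - f j) ≡ c
    cancel f c = trans (by (+-swapʳ (ΣF f) c (ΣF (λ j → - f j)))) (trans (cong (_+ c) (trans (sym (ΣF-+ f (λ j → - f j))) (ΣF-zero (λ j → ℤP.+-inverseʳ (f j))))) (ℤP.+-identityˡ c))

incr≥1-core : ∀ N A B c → B + c ≤ N → A ≤ B → c ≤ N - A
incr≥1-core N A B c p q = lin (sub p ⊞ sub q) (solve (N ∷ A ∷ B ∷ c ∷ []))

val-divisible-core : ∀ a → 0ℤ ≤ a → 1ℤ ≤ a + 1ℤ
val-divisible-core a h = lin h (solve (a ∷ []))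

-- The p-adic valuation is the additive function of the indicator of p.
module Valuation {p} (P : Prime p) where
  δ : ℕ → ℤ
  δ q = ind (q ℕP.≟ p)

  δ≥0 : ∀ q → 0ℤ ≤ δ q
  δ≥0 q = ind-nonneg (q ℕP.≟ p)

  open AdditiveProperties δ renaming (L to val) public
  open FactorialSums δ public

  val≥0 : ∀ n → 0ℤ ≤ val n
  val≥0 = L≥0 δ≥0

  val-divisible : ∀ {n} → 1 ℕ.≤ n → p ∣ n → 1ℤ ≤ val n
  val-divisible {n} 1≤n p∣n = subst (1ℤ ≤_) (sym (trans (cong val (sym (÷-∣ (1≤prime P) p∣n))) (L-prime-* P (n ÷ p) (÷-pos (1≤prime P) (∣P.∣⇒≤ {{ℕ.>-nonZero 1≤n}} p∣n)))))
      (subst (λ z → 1ℤ ≤ val (n ÷ p) + z) (sym (ind-yes (p ℕP.≟ p) refl)) (val-divisible-core (val (n ÷ p)) (val≥0 (n ÷ p))))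

  val-small : ∀ n → 1 ℕ.≤ n → n ℕ.< p → val n ≡ 0ℤ
  val-small = <-induction λ n ih 1≤n n<p → step n ih 1≤n n<p
    where
    step : ∀ n → (∀ m → m ℕ.< n → 1 ℕ.≤ m → m ℕ.< p → val m ≡ 0ℤ) → 1 ℕ.≤ n → n ℕ.< p → val n ≡ 0ℤ
    step n ih 1≤n n<p with 2 ℕP.≤? n
    ... | no 2≰n = subst (λ n → val n ≡ 0ℤ) (ℕP.≤-antisym 1≤n (ℕP.≤-pred (ℕP.≰⇒> 2≰n))) refl
    ... | yes 2≤n = trans (L-lpf 2≤n) (cong₂ _+_ (ih (n ÷ lpf n) (cofactor< 2≤n) (1≤cofactor 2≤n) (ℕP.<-trans (cofactor< 2≤n) n<p))
          (ind-no (lpf n ℕP.≟ p) λ { refl → ℕP.<⇒≱ n<p (lpf-least 2≤n 2≤n ∣P.∣-refl) }))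

  S-val-small : ∀ n → n ℕ.< p → S val n ≡ 0ℤ
  S-val-small n n<p = S-zero n (λ i 1≤i i≤n → val-small i 1≤i (ℕP.≤-<-trans i≤n n<p))

  -- Apply `unmatched-sum` to the p-adic valuation: the side of the increments is positive because u
  -- is a factor of one quotient of factorials, while the unmatched side would vanish if all
  -- unmatched entries were below p.
  divides-unmatched : ∀ {s t} (σ : Fin s → Fin t) (inj : Injective _≡_ _≡_ σ) (a : Vec ℕ t) (n : Vec ℕ s) →
    vprod (Vec.map _! a) ≡ vprod (Vec.map _! n) → (∀ j → lookup a (σ j) ℕ.≤ lookup n j) →
    ∀ j u → lookup a (σ j) ℕ.< u → u ℕ.≤ lookup n j → p ∣ u →
    ∃ λ i → ¬ (∃ λ j → σ j ≡ i) × p ℕ.≤ lookup a i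
  divides-unmatched σ inj a n eq less j u a<u u≤n p∣u with FinP.any? (λ i → unmatched? i ×-dec (p ℕP.≤? lookup a i))
    where
    unmatched? : ∀ i → Dec (¬ (∃ λ j → σ j ≡ i))
    unmatched? i with Unmatched.matched? σ inj i
    ... | yes m = no (λ ¬m → ¬m m)
    ... | no ¬m = yes ¬m
  ... | yes found = found
  ... | no none = ⊥-elim (ℤP.<⇒≱ (Data.Integer.Base.+<+ (s≤s z≤n)) (ℤP.≤-trans positive (ℤP.≤-reflexive (trans (sym (unmatched-sum σ inj a n eq)) (ΣF-zero vanish)))))
    where
    vanish : ∀ i → Unmatched.U σ inj i * S val (lookup a i) ≡ 0ℤ
    vanish i with Unmatched.matched? σ inj i
    ... | yes _ = ℤP.*-zeroˡ (S val (lookup a i))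
    ... | no ¬m = trans (ℤP.*-identityˡ (S val (lookup a i))) (S-val-small (lookup a i) (ℕP.≰⇒> λ p≤ → none (i , ¬m , p≤)))
    incr≥0 : ∀ j → 0ℤ ≤ S val (lookup n j) - S val (lookup a (σ j))
    incr≥0 j = sub (S-mono-len (less j) (λ i _ _ → val≥0 i))
    1≤u : 1 ℕ.≤ u
    1≤u = ℕP.≤-trans (s≤s z≤n) a<u
    incr≥1 : 1ℤ ≤ S val (lookup n j) - S val (lookup a (σ j))
    incr≥1 = ℤP.≤-trans (val-divisible 1≤u p∣u) (incr≥1-core (S val (lookup n j)) (S val (lookup a (σ j))) (S val (ℕ.pred u)) (val u)
        (subst (λ z → S val (ℕ.pred u) + val z ≤ S val (lookup n j)) (ℕP.suc-pred u {{ℕ.>-nonZero 1≤u}}) (subst (λ z → S val z ≤ S val (lookup n j)) (sym (ℕP.suc-pred u {{ℕ.>-nonZero 1≤u}})) (S-mono-len u≤n (λ i _ _ → val≥0 i))))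
        (S-mono-len (ℕP.≤-pred (ℕP.≤-trans a<u (ℕP.≤-reflexive (sym (ℕP.suc-pred u {{ℕ.>-nonZero 1≤u}}))))) (λ i _ _ → val≥0 i)))
    positive : 1ℤ ≤ ΣF (λ j → S val (lookup n j) - S val (lookup a (σ j)))
    positive = ℤP.≤-trans incr≥1 (ΣF-term incr≥0 j)

greatest : ∀ {P : ℕ → Set} → (∀ n → Dec (P n)) → P 0 → ∀ N → Σ ℕ λ m → m ℕ.≤ N × P m × (∀ j → j ℕ.≤ N → P j → j ℕ.≤ m)
greatest P? P0 zero = 0 , z≤n , P0 , λ j j≤0 _ → j≤0
greatest {P} P? P0 (suc N) with P? (suc N)
... | yes PN = suc N , ℕP.≤-refl , PN , λ j j≤ _ → j≤
... | no ¬PN with greatest P? P0 N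
...   | m , m≤N , Pm , max = m , ℕP.m≤n⇒m≤1+n m≤N , Pm , max′
  where
  max′ : ∀ j → j ℕ.≤ suc N → P j → j ℕ.≤ m
  max′ j j≤ Pj with ℕP.m≤n⇒m<n∨m≡n j≤
  ... | inj₁ (s≤s j≤N) = max j j≤N Pj
  ... | inj₂ refl = ⊥-elim (¬PN Pj)

-- Contradiction for large a

module Threshold (T : ℕ) where
  J₀ J₁ J₂ J₃ D A₀ : ℕ
  J₀ = ceil (+ 3 * (+ 2 + + 21 * + 357 * + T) + 1ℤ)
  J₁ = ceil (+ 3 * (+ 21 * + 357 * + (4 ℕ.^ J₀)) + 1ℤ)
  J₂ = ceil (+ 126)
  J₃ = ceil (+ 3 * (+ 84 + + 42 * (+ 357 * (+ 42 * + T))) + 1ℤ)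
  D = 2 ℕ.* 4 ℕ.^ J₃

  2≤D : 2 ℕ.≤ D
  2≤D = ℕP.*-monoʳ-≤ 2 (ℕP.m^n>0 4 J₃)

  -- Two prime gap thresholds are combined: the one for 2 yields k ≤ a, the one for D excludes a/D ≤
  -- k.
  A₀ = PrimeGap.X₀ 2 ℕP.≤-refl ℕ.+ PrimeGap.X₀ D 2≤D ℕ.+ 4 ℕ.^ J₁ ℕ.+ 4 ℕ.^ J₂

  module _ {a : ℕ} (A₀≤a : A₀ ℕ.≤ a) where
    gap₂≤a : PrimeGap.X₀ 2 ℕP.≤-refl ℕ.≤ a
    gap₂≤a = ℕP.≤-trans (ℕP.≤-trans (ℕP.≤-trans (ℕP.m≤m+n _ _) (ℕP.m≤m+n _ _)) (ℕP.m≤m+n _ (4 ℕ.^ J₂))) A₀≤a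

    gapD≤a : PrimeGap.X₀ D 2≤D ℕ.≤ a
    gapD≤a = ℕP.≤-trans (ℕP.≤-trans (ℕP.≤-trans (ℕP.m≤n+m _ (PrimeGap.X₀ 2 ℕP.≤-refl)) (ℕP.m≤m+n _ _)) (ℕP.m≤m+n _ (4 ℕ.^ J₂))) A₀≤a

    4^J₁≤a : 4 ℕ.^ J₁ ℕ.≤ a
    4^J₁≤a = ℕP.≤-trans (ℕP.≤-trans (ℕP.m≤n+m _ (PrimeGap.X₀ 2 ℕP.≤-refl ℕ.+ PrimeGap.X₀ D 2≤D)) (ℕP.m≤m+n _ (4 ℕ.^ J₂))) A₀≤a

    4^J₂≤a : 4 ℕ.^ J₂ ℕ.≤ a
    4^J₂≤a = ℕP.≤-trans (ℕP.m≤n+m _ _) A₀≤a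

    module _ (k : ℕ) (no-prime : ∀ p → Prime p → a ℕ.< p → ¬ (p ℕ.≤ a ℕ.+ k)) where
      k≤a : k ℕ.≤ a
      k≤a = beyond (PrimeGap.prime-in-interval 2 ℕP.≤-refl a gap₂≤a)
        where
        beyond : (Σ ℕ λ p → a ℕ.< p × p ℕ.≤ a ℕ.+ a ÷ 2 × Prime p) → k ℕ.≤ a
        beyond (p , a<p , p≤ , P) = ℕP.≮⇒≥ λ a<k → no-prime p P a<p (ℕP.≤-trans p≤ (ℕP.+-monoʳ-≤ a (ℕP.≤-trans (÷-≤ a 2) (ℕP.<⇒≤ a<k))))

      gap≰k : ¬ (a ÷ D ℕ.≤ k)
      gap≰k a÷D≤k = beyond (PrimeGap.prime-in-interval D 2≤D a gapD≤a)
        where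
        beyond : (Σ ℕ λ p → a ℕ.< p × p ℕ.≤ a ℕ.+ a ÷ D × Prime p) → ⊥
        beyond (p , a<p , p≤ , P) = no-prime p P a<p (ℕP.≤-trans p≤ (ℕP.+-monoʳ-≤ a a÷D≤k))

      impossible : 2 ℕ.≤ k → ∀ m X (lg : Logarithm X) → 4 ℕ.* (a ℕ.+ k) ℕ.≤ X → m ℕ.≤ a ℕ.+ k → 1 ℕ.≤ T →
        ExplicitABC → (∀ u → suc u ℕ.≤ a ℕ.+ k → rad (u ℕ.* suc u) ℕ.^ 7 ℕ.≤ X) →
        (∀ p u → Prime p → a ℕ.< u → u ℕ.≤ a ℕ.+ k → p ∣ u → p ℕ.≤ m) →
        S (Analysis.L lg) m ≤ + T * (+ k * Analysis.L lg (a ℕ.+ k)) → ⊥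
      impossible 2≤k m X lg 4n≤X m≤n 1≤T abc rad≤X smooth size =
          Analysis.Smooth.ABC.Endgame.impossible lg a k m 1≤a n≤X (ℕP.≤-trans m≤n n≤X) smooth abc rad≤X
            T 1≤T J₀ J₁ J₂ J₃ (≤ceil _) (≤ceil _) (≤ceil _) (≤ceil _) 4^J₁≤a 4^J₂≤a 2≤k k≤a 4n≤X gap≰k size
        where
        n≤X : a ℕ.+ k ℕ.≤ X
        n≤X = ℕP.≤-trans (ℕP.m≤m+n (a ℕ.+ k) _) 4n≤X
        1≤a : 1 ℕ.≤ a
        1≤a = ℕP.≤-trans (ℕP.m^n>0 4 J₂) 4^J₂≤a

-- Finiteness of the sets of solutions

vectors : ℕ → ∀ n → List (Vec ℕ n)
vectors B zero = Vec.[] ∷ []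
vectors B (suc n) = cartesianProductWith Vec._∷_ (upTo (suc B)) (vectors B n)

∈-vectors : ∀ B {n} (v : Vec ℕ n) → (∀ i → lookup v i ℕ.≤ B) → v ∈ vectors B n
∈-vectors B Vec.[] h = here refl
∈-vectors B (x Vec.∷ v) h = ∈P.∈-cartesianProductWith⁺ Vec._∷_ (∈P.∈-upTo⁺ (s≤s (h Fin.zero))) (∈-vectors B v (h ∘ Fin.suc))

-- A sum of all the seventh powers that abc can bring in; adding it to the cutoff keeps them in the
-- range where L is monotone.
radicals : ℕ → ℕ
radicals zero = 0
radicals (suc n) = radicals n ℕ.+ rad (n ℕ.* suc n) ℕ.^ 7

rad≤radicals : ∀ n u → suc u ℕ.≤ n → rad (u ℕ.* suc u) ℕ.^ 7 ℕ.≤ radicals n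
rad≤radicals (suc n) u (s≤s u≤n) with ℕP.m≤n⇒m<n∨m≡n u≤n
... | inj₁ u<n = ℕP.≤-trans (rad≤radicals n u u<n) (ℕP.m≤m+n (radicals n) _)
... | inj₂ refl = ℕP.m≤n+m _ (radicals n)

increment-core : ∀ d c k l → d ≤ c * k → 0ℤ ≤ l → d * l ≤ c * (k * l)
increment-core d c k l p q = lin (sub p ⊠ q) (solve (d ∷ c ∷ k ∷ l ∷ []))

module Solutions (abc : ExplicitABC) (t s′ c : ℕ) (1≤c : 1 ℕ.≤ c) where
  s T : ℕ
  s = suc s′
  T = s ℕ.* c

  1≤T : 1 ℕ.≤ T
  1≤T = ℕP.*-mono-≤ {1} {s} {1} (s≤s z≤n) 1≤c

  open Threshold T using (A₀; impossible)

  gap₂≤A₀ : PrimeGap.X₀ 2 ℕP.≤-refl ℕ.≤ A₀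
  gap₂≤A₀ = ℕP.≤-trans (ℕP.≤-trans (ℕP.m≤m+n _ _) (ℕP.m≤m+n _ _)) (ℕP.m≤m+n _ _)

  module _ (σ : IndexChoice t s) (a : Vec ℕ t) (n : Vec ℕ s) (sol : InNc t s c σ a n) where
    private
      τ : Fin s → Fin t
      τ = proj₁ σ
      τ-injective : Injective _≡_ _≡_ τ
      τ-injective = proj₁ (proj₂ σ)
      a↓ : Decreasing a
      a↓ = proj₁ (proj₁ sol)
      n↓ : Decreasing n
      n↓ = proj₁ (proj₂ (proj₁ sol))
      equation : vprod (Vec.map _! a) ≡ vprod (Vec.map _! n)
      equation = proj₂ (proj₂ (proj₂ (proj₂ (proj₂ (proj₁ sol)))))
      nontrivial : Nontrivial t s a n
      nontrivial = proj₁ (proj₂ sol)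
      a<n : ∀ j → lookup a (τ j) ℕ.< lookup n j
      a<n = proj₁ (proj₂ (proj₂ sol))
      a₁ n₁ k : ℕ
      a₁ = lookup a (τ Fin.zero)
      n₁ = lookup n Fin.zero
      k = n₁ ℕ.∸ a₁
      a₁+k : a₁ ℕ.+ k ≡ n₁
      a₁+k = ℕP.m+[n∸m]≡n (ℕP.<⇒≤ (a<n Fin.zero))
      -- The one use of nontriviality: k = 1 would make (a₁ , n₁) a forbidden pair, and abc needs
      -- two consecutive numbers in (a₁ , n₁].
      2≤k : 2 ℕ.≤ k
      2≤k = ℕP.+-cancelˡ-≤ a₁ 2 k (ℕP.≤-trans (ℕP.≤-reflexive (ℕP.+-comm a₁ 2)) (ℕP.≤-trans (ℕP.≤∧≢⇒< (a<n Fin.zero) (λ e → proj₂ (nontrivial (τ Fin.zero) Fin.zero) (sym e))) (ℕP.≤-reflexive (sym a₁+k))))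
      k-ratio : ∀ j → lookup n j ℕ.∸ lookup a (τ j) ℕ.≤ c ℕ.* k
      -- The hypothesis on ratios concerns j ≥ 2 only; for the first pair c ≥ 1 is enough.
      k-ratio Fin.zero = ℕP.m≤n*m k c {{ℕ.>-nonZero 1≤c}}
      k-ratio j@(Fin.suc _) = proj₂ (proj₂ (proj₂ sol)) Fin.zero j refl (λ ())

    a≤a₁ : ∀ i → lookup a i ℕ.≤ a₁
    a≤a₁ i = a↓ (τ Fin.zero) i (ℕP.≤-trans (ℕP.≤-reflexive (proj₂ (proj₂ σ) Fin.zero refl)) z≤n)

    n≤n₁ : ∀ j → lookup n j ℕ.≤ n₁
    n≤n₁ j = n↓ Fin.zero j z≤n

    a≤n₁ : ∀ i → lookup a i ℕ.≤ n₁
    a≤n₁ i = ℕP.≤-trans (a≤a₁ i) (ℕP.<⇒≤ (a<n Fin.zero))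

    private
      in-unmatched : ∀ p u → Prime p → a₁ ℕ.< u → u ℕ.≤ n₁ → p ∣ u → ∃ λ i → ¬ (∃ λ j → τ j ≡ i) × p ℕ.≤ lookup a i
      in-unmatched p u P a<u u≤n p∣u = Valuation.divides-unmatched P τ τ-injective a n equation (λ j → ℕP.<⇒≤ (a<n j)) Fin.zero u a<u u≤n p∣u

      -- Such a prime divides itself, so it would be at most some unmatched entry, hence at most a₁.
      no-prime : ∀ p → Prime p → a₁ ℕ.< p → ¬ (p ℕ.≤ n₁)
      no-prime p P a<p p≤n = case in-unmatched p p P a<p p≤n ∣P.∣-refl of λ where (i , _ , p≤aᵢ) → ℕP.<⇒≱ a<p (ℕP.≤-trans p≤aᵢ (a≤a₁ i))

      module _ (A₀≤a₁ : A₀ ℕ.≤ a₁) where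
        X : ℕ
        -- The summand 4 n₁ leaves room for the square of ⌊√k⌋ + 1 in the case of large k.
        X = 4 ℕ.* n₁ ℕ.+ radicals n₁
        1≤n₁ : 1 ℕ.≤ n₁
        1≤n₁ = ℕP.≤-trans (s≤s z≤n) (a<n Fin.zero)
        n₁≤X : n₁ ℕ.≤ X
        n₁≤X = ℕP.≤-trans (ℕP.m≤m+n n₁ _) (ℕP.m≤m+n (4 ℕ.* n₁) (radicals n₁))
        lg : Logarithm X
        lg = log X (ℕP.≤-trans 1≤n₁ n₁≤X)
        w : ℕ → ℤ
        w = Logarithm.w lg
        L : ℕ → ℤ
        L = Analysis.L lg
        L≥0 : ∀ i → 0ℤ ≤ L i
        L≥0 = Analysis.L≥0 lg

        increment : ∀ j → S L (lookup n j) - S L (lookup a (τ j)) ≤ + c * (+ k * L n₁)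
        increment j = ℤP.≤-trans (subst (S L (lookup n j) - S L (lookup a (τ j)) ≤_) (trans (cong₂ _-_ (S-const (L n₁) (lookup n j)) (S-const (L n₁) (lookup a (τ j)))) (by (*-distribʳ-minus (+ lookup n j) (+ lookup a (τ j)) (L n₁))))
            (S-mono-between {L} {λ _ → L n₁} (ℕP.<⇒≤ (a<n j)) (λ i a<i i≤n → Analysis.L-mono lg (ℕP.≤-trans (s≤s z≤n) a<i) (ℕP.≤-trans i≤n (n≤n₁ j)) n₁≤X)))
            (increment-core (+ lookup n j - + lookup a (τ j)) (+ c) (+ k) (L n₁) (subst₂ _≤_ (+∸ (ℕP.<⇒≤ (a<n j))) (ℤP.pos-* c k) (≤-ℤ (k-ratio j))) (L≥0 n₁))

        unmatched-bound : ∀ i → ¬ (∃ λ j → τ j ≡ i) → S L (lookup a i) ≤ + T * (+ k * L n₁)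
        unmatched-bound i ¬m = begin
            S L (lookup a i)                                                  ≡⟨ sym (ℤP.*-identityˡ (S L (lookup a i))) ⟩
            1ℤ * S L (lookup a i)                                             ≡⟨ cong (λ z → (1ℤ - z) * S L (lookup a i)) (sym (ind-no (Unmatched.matched? τ τ-injective i) ¬m)) ⟩
            Unmatched.U τ τ-injective i * S L (lookup a i)                    ≤⟨ ΣF-term (λ i → Unmatched.U≥0 τ τ-injective i ⊠ S-nonneg (lookup a i) (λ j _ _ → L≥0 j)) i ⟩
            ΣF (λ i → Unmatched.U τ τ-injective i * S L (lookup a i))         ≡⟨ FactorialSums.unmatched-sum w τ τ-injective a n equation ⟩
            ΣF (λ j → S L (lookup n j) - S L (lookup a (τ j)))                ≤⟨ ΣF-≤ (+ c * (+ k * L n₁)) increment ⟩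
            + s * (+ c * (+ k * L n₁))                                        ≡⟨ trans (sym (ℤP.*-assoc (+ s) (+ c) (+ k * L n₁))) (cong (_* (+ k * L n₁)) (sym (ℤP.pos-* s c))) ⟩
            + T * (+ k * L n₁) ∎
          where open ℤP.≤-Reasoning

        Small : ℕ → Set
        Small m = S L m ≤ + T * (+ k * L n₁)

        absurd : (Σ ℕ λ m → m ℕ.≤ n₁ × Small m × (∀ j → j ℕ.≤ n₁ → Small j → j ℕ.≤ m)) → ⊥
        absurd (m , m≤n₁ , size , max) = go n₁ a₁+k m≤n₁ (ℕP.m≤m+n (4 ℕ.* n₁) (radicals n₁)) (λ u su≤ → ℕP.≤-trans (rad≤radicals n₁ u su≤) (ℕP.m≤n+m _ (4 ℕ.* n₁))) smooth no-prime size
          where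
          smooth : ∀ p u → Prime p → a₁ ℕ.< u → u ℕ.≤ n₁ → p ∣ u → p ℕ.≤ m
          smooth p u P a<u u≤n p∣u = case in-unmatched p u P a<u u≤n p∣u of λ where
            (i , ¬m , p≤aᵢ) → max p (ℕP.≤-trans p≤aᵢ (a≤n₁ i)) (ℤP.≤-trans (S-mono-len p≤aᵢ (λ j _ _ → L≥0 j)) (unmatched-bound i ¬m))
          -- n₁ is replaced by a variable so that the equation with a₁ + k can be matched by `refl`.
          go : ∀ n′ → a₁ ℕ.+ k ≡ n′ → m ℕ.≤ n′ → 4 ℕ.* n′ ℕ.≤ X → (∀ u → suc u ℕ.≤ n′ → rad (u ℕ.* suc u) ℕ.^ 7 ℕ.≤ X) →
            (∀ p u → Prime p → a₁ ℕ.< u → u ℕ.≤ n′ → p ∣ u → p ℕ.≤ m) → (∀ p → Prime p → a₁ ℕ.< p → ¬ (p ℕ.≤ n′)) → S L m ≤ + T * (+ k * L n′) → ⊥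
          go _ refl h₁ h₂ h₃ h₄ h₅ h₆ = impossible A₀≤a₁ k h₅ 2≤k m X lg h₂ h₁ 1≤T abc h₃ h₄ h₆

        large-impossible : ⊥
        large-impossible = absurd (greatest (λ m → S L m ℤP.≤? + T * (+ k * L n₁)) (0≤+ T ⊠ (0≤+ k ⊠ L≥0 n₁)) n₁)

    -- If a₁ < A₀, a prime in (A₀ , A₀ + A₀/2] would lie in (a₁ , n₁] as soon as n₁ exceeds 2 A₀.
    bounded : n₁ ℕ.≤ A₀ ℕ.+ A₀
    bounded = ℕP.≮⇒≥ λ 2A₀<n₁ → case A₀ ℕP.≤? a₁ of λ where
      (yes A₀≤a₁) → large-impossible A₀≤a₁
      (no A₀≰a₁) → case PrimeGap.prime-in-interval 2 ℕP.≤-refl A₀ gap₂≤A₀ of λ where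
        (p , A₀<p , p≤ , P) → no-prime p P (ℕP.<-trans (ℕP.≰⇒> A₀≰a₁) A₀<p) (ℕP.≤-trans p≤ (ℕP.≤-trans (ℕP.+-monoʳ-≤ A₀ (÷-≤ A₀ 2)) (ℕP.<⇒≤ 2A₀<n₁)))

  B : ℕ
  B = A₀ ℕ.+ A₀

  candidates : List (Vec ℕ t × Vec ℕ s)
  candidates = cartesianProduct (vectors B t) (vectors B s)

  complete : ∀ (σ : IndexChoice t s) (v : Vec ℕ t × Vec ℕ s) → InNc t s c σ (proj₁ v) (proj₂ v) → v ∈ candidates
  complete σ (a , n) sol = ∈P.∈-cartesianProduct⁺
    (∈-vectors B a (λ i → ℕP.≤-trans (a≤n₁ σ a n sol i) (bounded σ a n sol)))
    (∈-vectors B n (λ j → ℕP.≤-trans (n≤n₁ σ a n sol j) (bounded σ a n sol)))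

theorem1p2 : ExplicitABC → (s t c : ℕ) → 2 ℕ.< s → s ℕ.< t → 0 ℕ.< c →
    ((σ : IndexChoice t s) →
    FiniteSet {Vec ℕ t × Vec ℕ s} (λ p → InNc t s c σ (proj₁ p) (proj₂ p)))
    × FiniteSet {Vec ℕ t × Vec ℕ s}
    (λ p → Σ (IndexChoice t s) λ σ → InNc t s c σ (proj₁ p) (proj₂ p))
theorem1p2 abc (suc s′) t c _ _ 1≤c =
    (λ σ → candidates , complete σ)
  -- The list does not depend on σ, so it also covers the union over all index choices.
  , candidates , λ v solution → complete (proj₁ solution) v (proj₂ solution)
  where open Solutions abc t s′ c 1≤c
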